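{- Suppose $\mathcal{K}$ is a quasiminimal class, $\mathbb{M}$ is a monster model for $\mathcal{K}$, $A\subset\mathbb{M}$ is a finite set, $(a,b,c,x,y,z)\in\mathbb{M}$ is a strict bounded partial quadrangle over $A$, and the type $t(a,b,c,x,y,z/A)$ is stationary. Then there is a group $G$ in $(\mathbb{M}^{eq})^{eq}$, Galois definable over some finite set $A'\subset\mathbb{M}$. Moreover, a generic element of $G$ has $U$-rank $1$.
   Context: QUASIMINIMAL CLASSES. Let $L$ be a countable language; $\mathrm{tp}$ denotes quantifier-free type. An $L$-structure $M$ with a pregeometry $\mathrm{cl}$ is a quasiminimal pregeometry structure if: (QM1) if $a,a'$ are singletons and $\mathrm{tp}(a,b)=\mathrm{tp}(a',b')$, then $a\in\mathrm{cl}(b)$ iff $a'\in\mathrm{cl}(b')$; (QM2) $M$ is infinite-dimensional; (QM3) $\mathrm{cl}(A)$ is countable for finite $A\subseteq M$; (QM4) if $H,H'\subseteq M$ are countable closed sets enumerated so that $\mathrm{tp}(H)=\mathrm{tp}(H')$ and $a\in M\setminus H$, $a'\in M\setminus H'$ are singletons, then $\mathrm{tp}(H,a)=\mathrm{tp}(H',a')$; (QM5) if $H,H'\subseteq M$ are countable closed sets or empty, enumerated so that $\mathrm{tp}(H)=\mathrm{tp}(H')$, $b,b'$ are finite tuples with $\mathrm{tp}(H,b)=\mathrm{tp}(H',b')$ and $a\in\mathrm{cl}(H,b)$ is a singleton, then there is a singleton $a'\in M$ with $\mathrm{tp}(H,b,a)=\mathrm{tp}(H',b',a')$. Weakly quasiminimal: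 all of these except possibly (QM2). A closed embedding $\theta:M_1\to M_2$ of weakly quasiminimal structures is an isomorphism onto a substructure that is $\mathrm{cl}_{M_2}$-closed, with $\mathrm{cl}_{M_1}$ the restriction of $\mathrm{cl}_{M_2}$. For a quasiminimal pregeometry structure $M$, $\mathcal{K}^-(M)$ is the smallest class of $L$-structures containing $M$ and all its closed substructures and closed under isomorphism; $\mathcal{K}(M)$ is the smallest class containing $\mathcal{K}^-(M)$ and closed also under unions of chains of closed embeddings. A quasiminimal class is $\mathcal{K}=\mathcal{K}(M)$ with all finite-dimensional structures discarded, with $\mathcal{A}\preccurlyeq\mathcal{B}$ iff $\mathcal{A}$ is a closed submodel of $\mathcal{B}$; it is an abstract elementary class (AEC) with Löwenheim–Skolem number $\omega$. The monster model $\mathbb{M}$ is a $\delta$-model homogeneous, $\delta$-universal member of $\mathcal{K}$ for a large cardinal $\delta$; "bounded" means of size $<\delta$. TYPES AND RANK (for a monster model $\mathbb{M}$ of an AEC; also applied with $\mathbb{M}^{eq}$, $(\mathbb{M}^{eq})^{eq}$ in place of $\mathbb{M}$). Models are $\mathcal{A}\preccurlyeq\mathbb{M}$; models and parameter sets are bounded; $a\in X$ may be a finite tuple; juxtaposition denotes union or concatenation. $a,b$ have the same Galois type over $A$ if some $f\in\mathrm{Aut}(\mathbb{M}/A)$ (automorphisms fixing $A$ pointwise) maps $a$ to $b$; they have the same weak type, $t(a/A)=t(b/A)$, if they have the same Galois type over every finite subset of $A$. For finite $A\subseteq B$, or $A$ finite and $B$ arbitrary, $t(a/B)$ splits over $A$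 if there are $b,c\in B$ with $t(b/A)=t(c/A)$ but $t(ab/A)\ne t(ac/A)$. $a\downarrow^{ns}_B C$ means that $t(a/B\cup C)$ does not split over some finite $A\subseteq B$. For a model $\mathcal{A}$: $U(a/\mathcal{A})\ge0$ always; $U(a/\mathcal{A})\ge n+1$ if there is a model $\mathcal{B}\supseteq\mathcal{A}$ with $a\not\downarrow^{ns}_{\mathcal{A}}\mathcal{B}$ and $U(a/\mathcal{B})\ge n$; $U(a/\mathcal A)$ is the largest $n$ with $U(a/\mathcal{A})\ge n$. For finite $A$, $U(a/A)=\max\{U(a/\mathcal{A}) : \mathcal{A}\supset A\text{ a model}\}$; for arbitrary $A$, $U(a/A)=\min\{U(a/B):B\subseteq A\text{ finite}\}$. INDEPENDENCE. For finite $A$, $E(A)$ is the set of $\mathrm{Aut}(\mathbb{M}/A)$-invariant equivalence relations on powers $\mathbb{M}^n$ with boundedly many classes; $Lt(a/B)=Lt(b/B)$ means $(a,b)\in E$ for all finite $A\subseteq B$ and $E\in E(A)$. For $A\subseteq B$ with $A$ finite, $t(a/B)$ Lascar splits over $A$ if there are $b,c\in B$ with $Lt(b/A)=Lt(c/A)$ and $t(ab/A)\neq t(ac/A)$. $a\downarrow_B C$ means: there is a finite $A\subseteq B$ such that for all $D\supseteq B\cup C$ there is $b$ with $t(b/B\cup C)=t(a/B\cup C)$ and $t(b/D)$ not Lascar splitting over $A$. A set $X$ is independent over $B$ if $a\downarrow_B (X\setminus\{a\})$ for each $a\in X$. A type $t(d/B)$ is stationary if for every $C\supset B$ there is a unique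 type $t(d'/C)$ with $t(d'/B)=t(d/B)$ and $d'\downarrow_B C$. IMAGINARIES. Let $\mathcal{E}$ be a countable collection of $\emptyset$-invariant equivalence relations $E\subseteq\mathbb{M}^n\times\mathbb{M}^n$ (various $n$), containing equality, each given by a countable set $G_E$ of Galois types over $\emptyset$ via $(a,b)\in E$ iff $t^g(ab/\emptyset)\in G_E$. For $\mathcal{A}\in\mathcal{K}$, $\mathcal{A}^{eq}=\{a/E: a\in\mathcal{A},E\in\mathcal{E}\}$, with $a$ identified with $a/{=}$, the structure of $\mathcal{A}$ on the copy of $\mathcal{A}$, and additional predicates $P_E$ for $\{a/E:a\in\mathcal{A}\}$ and functions $F_E(a)=a/E$. $\mathcal{K}^{eq}=\{\mathcal{A}^{eq}:\mathcal{A}\in\mathcal{K}\}$, with $\mathcal{A}^{eq}\preccurlyeq^{eq}\mathcal{B}^{eq}$ iff $\mathcal{A}^{eq}$ is a submodel of $\mathcal{B}^{eq}$ and $\mathcal{A}\preccurlyeq\mathcal{B}$; its monster model is $\mathbb{M}^{eq}$. $(\mathbb{M}^{eq})^{eq}$ is formed from $\mathbb{M}^{eq}$ in the same way. The countable collections $\mathcal{E}$ at both stages are assumed chosen to contain the relations needed (e.g. those providing canonical bases, and the relations "$\mathrm{bcl}(x)=\mathrm{bcl}(y)$" on tuples), so the assertion is for a suitable such choice. QUADRANGLE. A strict bounded partial quadrangle over a finite set $A$ is a $6$-tuple $(a,b,c,x,y,z)$ of elements of $\mathbb{M}^{eq}$, each of $U$-rank $1$ over $A$, such that, with lines $\{a,b,c\}$,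 $\{a,x,y\}$, $\{b,y,z\}$, $\{c,x,z\}$: (i) any triple of non-collinear points is independent over $A$, i.e. has $U$-rank $3$ over $A$; (ii) every line has $U$-rank $2$ over $A$. DEFINABILITY. A set $B$ is Galois definable over $A$ if every automorphism fixing $A$ pointwise fixes $B$ setwise. A group is Galois definable over $A$ if both its underlying set and its operation are. An element of a set $B$ Galois definable over $A'$ is generic if its $U$-rank over $A'$ is maximal among elements of $B$; here the $U$-rank of a generic element of $G$ is taken over $A'$. -}

module Defs where

open import Level using (Level; 0ℓ) renaming (suc to lsuc; _⊔_ to _⊔ˡ_)
open import Algebra.Structures using (IsGroup)
open import Data.Fin.Base using (Fin)
open import Data.Fin.Patterns using (0F; 1F; 2F; 3F; 4F; 5F)
open import Data.List.Base as List using (List; []; _∷_)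
import Data.List.Membership.Setoid as ListMembership
import Data.List.Relation.Unary.All as ListAll
import Data.List.Relation.Unary.Any as ListAny
open import Data.Maybe.Base using (Maybe; just; nothing)
open import Data.Nat.Base using (ℕ; zero; suc; _+_; _≤_)
open import Data.Product.Base using (Σ; Σ-syntax; _×_; _,_; proj₁; proj₂)
open import Data.Sum.Base using (_⊎_; inj₁; inj₂; [_,_])
open import Data.Unit.Polymorphic.Base using (⊤)
open import Data.Empty using (⊥)
open import Data.Vec.Base as Vec using (Vec; []; _∷_; _∷ʳ_; _++_; lookup)
import Data.Vec.Membership.Propositional as VecMembershipₚ
open import Data.Vec.Relation.Binary.Pointwise.Inductive as Pointwise using (Pointwise; []; _∷_)
open import Data.Vec.Relation.Unary.All as VecAll using (All; []; _∷_)
open import Function.Bundles using (Injection; _↣_; _⇔_)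
open import Relation.Binary.Bundles using (Setoid; TotalOrder)
open import Relation.Binary.Core using (Rel)
open import Relation.Binary.Structures using (IsEquivalence)
open import Relation.Binary.PropositionalEquality.Core using (_≡_; _≢_)
import Relation.Binary.PropositionalEquality.Properties as ≡ₚ
import Relation.Binary.Construct.On as On
open import Relation.Nullary.Negation.Core using (¬_)
open import Relation.Unary using (Pred; ∅; _⊆_; _∪_; _≐_)

-- The axiom of choice in the form "every equivalence relation has a
-- system of representatives"; type-theoretic choice alone does not
-- produce functions respecting a setoid equality.
ExtensionalChoice : (a ℓ : Level) → Set (lsuc (a ⊔ˡ ℓ))
ExtensionalChoice a ℓ =
  (S : Setoid a ℓ) → let open Setoid S in
  Σ[ r ∈ (Carrier → Carrier) ]
    (∀ x → r x ≈ x) × (∀ {x y} → x ≈ y → r x ≡ r y)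

-- A cardinal is represented by any set δ of that cardinality.

infix 4 _<ᶜ_

_<ᶜ_ : Setoid 0ℓ 0ℓ → Set → Set
S <ᶜ δ = Injection S (≡ₚ.setoid δ) × ¬ Injection (≡ₚ.setoid δ) S

Countable : Setoid 0ℓ 0ℓ → Set
Countable S = Injection S (≡ₚ.setoid ℕ)

subsetoid : (S : Setoid 0ℓ 0ℓ) → Pred (Setoid.Carrier S) 0ℓ → Setoid 0ℓ 0ℓ
subsetoid S X = On.setoid S (proj₁ {B = X})

record Language : Set₁ where
  field
    FunSym : ℕ → Set
    RelSym : ℕ → Set

open Language

CountableLanguage : Language → Set
CountableLanguage L = (Σ ℕ (FunSym L) ↣ ℕ) × (Σ ℕ (RelSym L) ↣ ℕ)

-- Equality in a structure is a setoid equality, so that quotients (the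
-- sorts of imaginaries) are again structures.
record Structure (L : Language) : Set₁ where
  field
    setoid : Setoid 0ℓ 0ℓ

  open Setoid setoid public using (Carrier; _≈_)
  open ListMembership setoid public using (_∈_)

  infix 4 _≋_
  _≋_ : ∀ {n} → Rel (Vec Carrier n) 0ℓ
  _≋_ = Pointwise _≈_

  field
    fun      : ∀ {n} → FunSym L n → Vec Carrier n → Carrier
    rel      : ∀ {n} → RelSym L n → Vec Carrier n → Set
    fun-cong : ∀ {n} (f : FunSym L n) {xs ys} → xs ≋ ys → fun f xs ≈ fun f ys
    rel-resp : ∀ {n} (R : RelSym L n) {xs ys} → xs ≋ ys → rel R xs → rel R ys

  Image : {V : Set} → (V → Carrier) → Pred V 0ℓ → Pred Carrier 0ℓ
  Image f X m = Σ[ v ∈ _ ] X v × m ≈ f v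

  Range : {V : Set} → (V → Carrier) → Pred Carrier 0ℓ
  Range f m = Σ[ v ∈ _ ] m ≈ f v

  ⟪_⟫ : List Carrier → Pred Carrier 0ℓ
  ⟪ xs ⟫ m = m ∈ xs

  _∖_ : Pred Carrier 0ℓ → Carrier → Pred Carrier 0ℓ
  (X ∖ a) m = X m × ¬ m ≈ a

  _⊆ᶠ_ : List Carrier → Pred Carrier 0ℓ → Set
  xs ⊆ᶠ X = ListAll.All X xs

data Term (L : Language) (V : Set) : Set where
  var : V → Term L V
  app : ∀ {n} → FunSym L n → Vec (Term L V) n → Term L V

data QFFormula (L : Language) (V : Set) : Set where
  _≐ᶠ_      : Term L V → Term L V → QFFormula L V
  atom      : ∀ {n} → RelSym L n → Vec (Term L V) n → QFFormula L V
  ⊥ᶠ        : QFFormula L V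
  ¬ᶠ_       : QFFormula L V → QFFormula L V
  _∧ᶠ_ _∨ᶠ_ : QFFormula L V → QFFormula L V → QFFormula L V

module _ {L : Language} (M : Structure L) {V : Set} where
  open Structure M

  mutual
    eval : (V → Carrier) → Term L V → Carrier
    eval v (var x)    = v x
    eval v (app f ts) = fun f (evals v ts)

    evals : ∀ {n} → (V → Carrier) → Vec (Term L V) n → Vec Carrier n
    evals v []       = []
    evals v (t ∷ ts) = eval v t ∷ evals v ts

  Satisfies : (V → Carrier) → QFFormula L V → Set
  Satisfies v (s ≐ᶠ t)    = eval v s ≈ eval v t
  Satisfies v (atom R ts) = rel R (evals v ts)
  Satisfies v ⊥ᶠ          = ⊥
  Satisfies v (¬ᶠ φ)      = ¬ Satisfies v φ
  Satisfies v (φ ∧ᶠ ψ)    = Satisfies v φ × Satisfies v ψ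
  Satisfies v (φ ∨ᶠ ψ)    = Satisfies v φ ⊎ Satisfies v ψ

  -- tp(v) = tp(v′) for families v, v′ of elements indexed by V
  SameType : (V → Carrier) → (V → Carrier) → Set
  SameType v v′ = ∀ φ → Satisfies v φ ⇔ Satisfies v′ φ

record Embedding {L : Language} (M N : Structure L) : Set where
  private
    module M = Structure M
    module N = Structure N
  field
    to        : M.Carrier → N.Carrier
    cong      : ∀ {x y} → x M.≈ y → to x N.≈ to y
    injective : ∀ {x y} → to x N.≈ to y → x M.≈ y
    fun-hom   : ∀ {n} (f : FunSym L n) xs → to (M.fun f xs) N.≈ N.fun f (Vec.map to xs)
    rel-hom   : ∀ {n} (R : RelSym L n) xs → M.rel R xs ⇔ N.rel R (Vec.map to xs)

record Isomorphism {L : Language} (M N : Structure L) : Set where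
  field
    embedding  : Embedding M N
  open Embedding embedding public
  field
    surjective : ∀ y → Structure.Range N to y

Automorphism : {L : Language} → Structure L → Set
Automorphism M = Isomorphism M M

record IsPregeometry (S : Setoid 0ℓ 0ℓ)
                     (cl : Pred (Setoid.Carrier S) 0ℓ → Pred (Setoid.Carrier S) 0ℓ) : Set₁ where
  open Setoid S using (_≈_)
  open ListMembership S using (_∈_)
  field
    respects   : ∀ X {a b} → a ≈ b → cl X a → cl X b
    extensive  : ∀ X → X ⊆ cl X
    monotone   : ∀ X Y → X ⊆ Y → cl X ⊆ cl Y
    idempotent : ∀ X → cl (cl X) ⊆ cl X
    finitary   : ∀ X {a} → cl X a → Σ[ F ∈ List _ ] ListAll.All X F × cl (_∈ F) a
    exchange   : ∀ X {a b} → cl (X ∪ (_≈ b)) a → ¬ cl X a → cl (X ∪ (_≈ a)) b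

record PregeometryStructure (L : Language) : Set₁ where
  field
    structure : Structure L
  open Structure structure public
  field
    cl            : Pred Carrier 0ℓ → Pred Carrier 0ℓ
    isPregeometry : IsPregeometry setoid cl
  open IsPregeometry isPregeometry public

  Closed : Pred Carrier 0ℓ → Set
  Closed X = cl X ⊆ X

  Independent : Pred Carrier 0ℓ → Set
  Independent X = ∀ {a} → X a → ¬ cl (X ∖ a) a

  IsBasis : Pred Carrier 0ℓ → Set
  IsBasis X = Independent X × (∀ m → cl X m)

  FiniteDimensional : Set
  FiniteDimensional = Σ[ F ∈ List Carrier ] IsBasis ⟪ F ⟫

open PregeometryStructure using (FiniteDimensional)

-- In (QM4) and (QM5) the countable sets H, H′ are the ranges of families
-- h, h′ indexed by the same countable set V, and V is empty iff H is.
record IsWeaklyQuasiminimal {L : Language} (M : PregeometryStructure L) : Set₁ where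
  open PregeometryStructure M
  private
    _~_ : {V : Set} → (V → Carrier) → (V → Carrier) → Set
    _~_ = SameType structure
  field
    qm1 : ∀ {n} (a a′ : Carrier) (b b′ : Vec Carrier n) →
          lookup (a ∷ b) ~ lookup (a′ ∷ b′) →
          cl (Range (lookup b)) a ⇔ cl (Range (lookup b′)) a′
    qm3 : (F : List Carrier) → Countable (subsetoid setoid (cl ⟪ F ⟫))
    qm4 : (V : Set) → V ↣ ℕ → (h h′ : V → Carrier) →
          Closed (Range h) → Closed (Range h′) → h ~ h′ →
          (a a′ : Carrier) → ¬ Range h a → ¬ Range h′ a′ →
          [ h , lookup (a ∷ []) ] ~ [ h′ , lookup (a′ ∷ []) ]
    qm5 : (V : Set) → V ↣ ℕ → (h h′ : V → Carrier) →
          Closed (Range h) ⊎ ¬ V → Closed (Range h′) ⊎ ¬ V → h ~ h′ →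
          ∀ {n} (b b′ : Vec Carrier n) →
          [ h , lookup b ] ~ [ h′ , lookup b′ ] →
          (a : Carrier) → cl (Range [ h , lookup b ]) a →
          Σ[ a′ ∈ Carrier ] [ h , lookup (b ∷ʳ a) ] ~ [ h′ , lookup (b′ ∷ʳ a′) ]

record IsQuasiminimal {L : Language} (M : PregeometryStructure L) : Set₁ where
  field
    isWeaklyQuasiminimal : IsWeaklyQuasiminimal M
    qm2                  : ¬ FiniteDimensional M

record ClosedEmbedding {L : Language} (M N : PregeometryStructure L) : Set₁ where
  private
    module M = PregeometryStructure M
    module N = PregeometryStructure N
  field
    embedding : Embedding M.structure N.structure
  open Embedding embedding public
  field
    closed-range : N.Closed (N.Range to)
    cl-restricts : ∀ X a → M.cl X a ⇔ N.cl (N.Image to X) (to a)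

record PregeometryIsomorphism {L : Language} (M N : PregeometryStructure L) : Set₁ where
  field
    closedEmbedding : ClosedEmbedding M N
  open ClosedEmbedding closedEmbedding public
  field
    surjective : ∀ y → PregeometryStructure.Range N to y

-- A closed substructure is presented by its inclusion map; as the class
-- is closed under isomorphism, any closed embedding may be taken.
data 𝒦⁻ {L : Language} (M : PregeometryStructure L) : PregeometryStructure L → Set₁ where
  itself    : 𝒦⁻ M M
  closedSub : ∀ {A} → ClosedEmbedding A M → 𝒦⁻ M A
  iso       : ∀ {A B} → PregeometryIsomorphism A B → 𝒦⁻ M A → 𝒦⁻ M B

record Chain (L : Language) : Set₁ where
  field
    index    : TotalOrder 0ℓ 0ℓ 0ℓ
  open TotalOrder index public using () renaming (Carrier to I; _≤_ to _≤ᴵ_)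
  field
    start    : I
    obj      : I → PregeometryStructure L
    step     : ∀ {i j} → i ≤ᴵ j → ClosedEmbedding (obj i) (obj j)
  map : ∀ {i j} → i ≤ᴵ j → PregeometryStructure.Carrier (obj i) → PregeometryStructure.Carrier (obj j)
  map p = ClosedEmbedding.to (step p)
  field
    coherent : ∀ {i j k} (p : i ≤ᴵ j) (q : j ≤ᴵ k) (r : i ≤ᴵ k) x →
               PregeometryStructure._≈_ (obj k) (map q (map p x)) (map r x)

-- The pregeometry of a union is determined by those of the members of
-- the chain, because it is finitary and restricts to them.
record IsUnion {L : Language} (𝒞 : Chain L) (A : PregeometryStructure L) : Set₁ where
  open Chain 𝒞
  open PregeometryStructure A using (Carrier; _≈_)
  field
    inclusion : ∀ i → ClosedEmbedding (obj i) A
  incl : ∀ i → PregeometryStructure.Carrier (obj i) → Carrier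
  incl i = ClosedEmbedding.to (inclusion i)
  field
    commutes  : ∀ {i j} (p : i ≤ᴵ j) x → incl j (map p x) ≈ incl i x
    covers    : ∀ a → Σ[ i ∈ I ] Σ[ x ∈ _ ] a ≈ incl i x

data 𝒦 {L : Language} (M : PregeometryStructure L) : PregeometryStructure L → Set₁ where
  base  : ∀ {A} → 𝒦⁻ M A → 𝒦 M A
  iso   : ∀ {A B} → PregeometryIsomorphism A B → 𝒦 M A → 𝒦 M B
  union : ∀ (𝒞 : Chain L) {A} → (∀ i → 𝒦 M (Chain.obj 𝒞 i)) → IsUnion 𝒞 A → 𝒦 M A

QuasiminimalClass : {L : Language} → PregeometryStructure L → PregeometryStructure L → Set₁
QuasiminimalClass M A = 𝒦 M A × ¬ FiniteDimensional A

-- IsModel M 𝕄 X : the subset X of 𝕄 carries a member of the class which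
-- is a closed submodel of 𝕄.
record IsModel {L : Language} (M 𝕄 : PregeometryStructure L)
               (X : Pred (PregeometryStructure.Carrier 𝕄) 0ℓ) : Set₁ where
  field
    model     : PregeometryStructure L
    inClass   : QuasiminimalClass M model
    inclusion : ClosedEmbedding model 𝕄
    range     : X ≐ PregeometryStructure.Range 𝕄 (ClosedEmbedding.to inclusion)

-- Submodels A, B ≼ 𝕄 are given by their inclusion maps i, j.
record IsMonster {L : Language} (M : PregeometryStructure L) (δ : Set)
                 (𝕄 : PregeometryStructure L) : Set₁ where
  open PregeometryStructure using (setoid; structure)
  open PregeometryStructure 𝕄 using (_≈_)
  field
    member      : QuasiminimalClass M 𝕄
    homogeneous :
      ∀ A B → QuasiminimalClass M A → QuasiminimalClass M B →
      (i : ClosedEmbedding A 𝕄) (j : ClosedEmbedding B 𝕄) →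
      setoid A <ᶜ δ → setoid B <ᶜ δ →
      (f : Isomorphism (structure A) (structure B)) →
      Σ[ g ∈ Automorphism (structure 𝕄) ] (∀ x →
        Isomorphism.to g (ClosedEmbedding.to i x) ≈
        ClosedEmbedding.to j (Isomorphism.to f x))
    universal   :
      ∀ A → QuasiminimalClass M A → setoid A <ᶜ δ → ClosedEmbedding A 𝕄

-- The data on which types, U-rank and independence depend; it has the
-- three instances 𝕄, 𝕄^eq and (𝕄^eq)^eq.
record Ambient : Set₂ where
  field
    δ         : Set
    language  : Language
    structure : Structure language
  open Structure structure public
  field
    Submodel  : Pred Carrier 0ℓ → Set₁

monsterAmbient : {L : Language} → PregeometryStructure L → Set → PregeometryStructure L → Ambient
monsterAmbient {L} M δ 𝕄 = record
  { δ         = δ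
  ; language  = L
  ; structure = PregeometryStructure.structure 𝕄
  ; Submodel  = IsModel M 𝕄
  }

module Types (𝕄 : Ambient) where
  open Ambient 𝕄

  Subset : Set₁
  Subset = Pred Carrier 0ℓ

  Bounded : Subset → Set
  Bounded X = subsetoid setoid X <ᶜ δ

  Model : Subset → Set₁
  Model X = Submodel X × Bounded X

  Aut : Set
  Aut = Automorphism structure

  _·_ : Aut → Carrier → Carrier
  f · m = Isomorphism.to f m

  _·*_ : ∀ {n} → Aut → Vec Carrier n → Vec Carrier n
  f ·* a = Vec.map (f ·_) a

  Fixes : Subset → Aut → Set
  Fixes A f = ∀ {m} → A m → (f · m) ≈ m

  SameGaloisType : ∀ {n} → Subset → Rel (Vec Carrier n) 0ℓ
  SameGaloisType A a b = Σ[ f ∈ Aut ] Fixes A f × (f ·* a) ≋ b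

  SameWeakType : ∀ {n} → Subset → Rel (Vec Carrier n) 0ℓ
  SameWeakType A a b = ∀ F → F ⊆ᶠ A → SameGaloisType ⟪ F ⟫ a b

  Splits : ∀ {n} → Vec Carrier n → Subset → List Carrier → Set
  Splits a B A =
    Σ[ k ∈ ℕ ] Σ[ b ∈ Vec Carrier k ] Σ[ c ∈ Vec Carrier k ]
      All B b × All B c × SameWeakType ⟪ A ⟫ b c × ¬ SameWeakType ⟪ A ⟫ (a ++ b) (a ++ c)

  -- a ↓ⁿˢ_B C, with the finite set A ⊆ B as witness
  NsIndependent : ∀ {n} → Vec Carrier n → Subset → Subset → Set
  NsIndependent a B C = Σ[ A ∈ List Carrier ] A ⊆ᶠ B × ¬ Splits a (B ∪ C) A

  U≥ : ℕ → ∀ {k} → Vec Carrier k → Subset → Set₁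
  U≥ zero    a 𝒜 = ⊤
  U≥ (suc n) a 𝒜 =
    Σ[ ℬ ∈ Subset ] Model ℬ × 𝒜 ⊆ ℬ × ¬ NsIndependent a 𝒜 ℬ × U≥ n a ℬ

  URankModel : ∀ {k} → Vec Carrier k → Subset → ℕ → Set₁
  URankModel a 𝒜 n = U≥ n a 𝒜 × (∀ m → U≥ m a 𝒜 → m ≤ n)

  -- For finite A, U(a/A) is the maximum of U(a/𝒜) over models 𝒜 ⊇ A.
  -- Bounding every m with U(a/𝒜) ≥ m also excludes infinite U(a/𝒜).
  URank≤ : ∀ {k} → Vec Carrier k → List Carrier → ℕ → Set₁
  URank≤ a A n = ∀ 𝒜 → Model 𝒜 → A ⊆ᶠ 𝒜 → ∀ m → U≥ m a 𝒜 → m ≤ n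

  URank : ∀ {k} → Vec Carrier k → List Carrier → ℕ → Set₁
  URank a A n =
    (Σ[ 𝒜 ∈ Subset ] Model 𝒜 × A ⊆ᶠ 𝒜 × URankModel a 𝒜 n) × URank≤ a A n

  -- The relations on n-tuples belonging to E(A).  ≋⇒E makes E a relation
  -- on tuples up to the equality of the structure.
  record BoundedInvariantEquivalence (A : List Carrier) (n : ℕ) : Set₁ where
    field
      E             : Rel (Vec Carrier n) 0ℓ
      isEquivalence : IsEquivalence E
      ≋⇒E           : ∀ {x y} → x ≋ y → E x y
      invariant     : ∀ f → Fixes ⟪ A ⟫ f → ∀ x y → E x y ⇔ E (f ·* x) (f ·* y)
      bounded       : record { isEquivalence = isEquivalence } <ᶜ δ

  SameLascarType : ∀ {n} → Subset → Vec Carrier n → Vec Carrier n → Set₁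
  SameLascarType {n} B a b =
    ∀ A → A ⊆ᶠ B → (R : BoundedInvariantEquivalence A n) → BoundedInvariantEquivalence.E R a b

  LascarSplits : ∀ {n} → Vec Carrier n → Subset → List Carrier → Set₁
  LascarSplits a B A =
    Σ[ k ∈ ℕ ] Σ[ b ∈ Vec Carrier k ] Σ[ c ∈ Vec Carrier k ]
      All B b × All B c × SameLascarType ⟪ A ⟫ b c × ¬ SameWeakType ⟪ A ⟫ (a ++ b) (a ++ c)

  -- a ↓_B C
  Independent : ∀ {n} → Vec Carrier n → Subset → Subset → Set₁
  Independent {n} a B C =
    Σ[ A ∈ List Carrier ] A ⊆ᶠ B ×
      (∀ D → Bounded D → (B ∪ C) ⊆ D →
        Σ[ b ∈ Vec Carrier n ] SameWeakType (B ∪ C) b a × ¬ LascarSplits b D A)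

  Stationary : ∀ {n} → Vec Carrier n → Subset → Set₁
  Stationary {n} d B = ∀ C → Bounded C → B ⊆ C →
    Σ[ d′ ∈ Vec Carrier n ] FreeExtension C d′ ×
      (∀ d″ → FreeExtension C d″ → SameWeakType C d′ d″)
    where
    FreeExtension : Subset → Vec Carrier n → Set₁
    FreeExtension C d′ = SameWeakType B d′ d × Independent d′ B C

  GaloisDefinable : ∀ {n} → Pred (Vec Carrier n) 0ℓ → Subset → Set
  GaloisDefinable X A = ∀ f → Fixes A f → ∀ x → X x ⇔ X (f ·* x)

-- A countable collection of ∅-invariant equivalence relations containing
-- equality.  Equality of elements is the sort `nothing`, the other
-- relations of the collection are the sorts `just j`.
record Imaginaries (𝕄 : Ambient) : Set₁ where
  open Ambient 𝕄
  open Types 𝕄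
  field
    J             : Set
    countable     : J ↣ ℕ
    arityᴶ        : J → ℕ
    Eᴶ            : ∀ j → Rel (Vec Carrier (arityᴶ j)) 0ℓ
    isEquivalence : ∀ j → IsEquivalence (Eᴶ j)
    -- representatives of the Galois types in G_E
    galoisTypes   : ∀ j → ℕ → Vec Carrier (arityᴶ j + arityᴶ j)
    given         : ∀ j a b →
                    Eᴶ j a b ⇔ (Σ[ k ∈ ℕ ] SameGaloisType ∅ (a ++ b) (galoisTypes j k))

  Sort : Set
  Sort = Maybe J

  arity : Sort → ℕ
  arity nothing  = 1
  arity (just j) = arityᴶ j

  E : ∀ s → Rel (Vec Carrier (arity s)) 0ℓ
  E nothing  = _≋_
  E (just j) = Eᴶ j

  E-isEquivalence : ∀ s → IsEquivalence (E s)
  E-isEquivalence nothing  = Pointwise.isEquivalence (Setoid.isEquivalence setoid) 1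
  E-isEquivalence (just j) = isEquivalence j

  module E s = IsEquivalence (E-isEquivalence s)

  -- (s , a) stands for the class a/E of the relation E of sort s.
  Imaginary : Set
  Imaginary = Σ[ s ∈ Sort ] Vec Carrier (arity s)

  data _≈ᵉ_ : Rel Imaginary 0ℓ where
    class : ∀ {s a b} → E s a b → (s , a) ≈ᵉ (s , b)

  imaginarySetoid : Setoid 0ℓ 0ℓ
  imaginarySetoid = record
    { Carrier       = Imaginary
    ; _≈_           = _≈ᵉ_
    ; isEquivalence = record
      { refl  = λ { {s , _} → class (E.refl s) }
      ; sym   = λ { (class {s} p) → class (E.sym s p) }
      ; trans = λ { (class {s} p) (class q) → class (E.trans s p q) }
      }
    }

  ι : Carrier → Imaginary
  ι m = nothing , m ∷ []

  -- Function symbols become graphs, as they are interpreted on the copy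
  -- of 𝕄 only.
  data RelSymᵉ : ℕ → Set where
    old   : ∀ {n} → RelSym language n → RelSymᵉ n
    graph : ∀ {n} → FunSym language n → RelSymᵉ (suc n)
    P     : Sort → RelSymᵉ 1
    F     : (s : Sort) → RelSymᵉ (suc (arity s))

  languageᵉ : Language
  languageᵉ = record { FunSym = λ _ → ⊥ ; RelSym = RelSymᵉ }

  _≋ᵉ_ : ∀ {n} → Rel (Vec Imaginary n) 0ℓ
  _≋ᵉ_ = Pointwise _≈ᵉ_

  relᵉ : ∀ {n} → RelSymᵉ n → Vec Imaginary n → Set
  relᵉ (old R)   us       = Σ[ a ∈ Vec Carrier _ ] us ≋ᵉ Vec.map ι a × rel R a
  relᵉ (graph f) (v ∷ us) = Σ[ a ∈ Vec Carrier _ ] us ≋ᵉ Vec.map ι a × v ≈ᵉ ι (fun f a)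
  relᵉ (P s)     (v ∷ []) = Σ[ a ∈ Vec Carrier _ ] v ≈ᵉ (s , a)
  relᵉ (F s)     (v ∷ us) = Σ[ a ∈ Vec Carrier _ ] us ≋ᵉ Vec.map ι a × v ≈ᵉ (s , a)

  private
    open Setoid imaginarySetoid using () renaming (sym to ≈ᵉ-sym; trans to ≈ᵉ-trans)

    back : ∀ {n} {us vs ws : Vec Imaginary n} → us ≋ᵉ vs → us ≋ᵉ ws → vs ≋ᵉ ws
    back p q = Pointwise.trans ≈ᵉ-trans (Pointwise.sym ≈ᵉ-sym p) q

    relᵉ-resp : ∀ {n} (R : RelSymᵉ n) {us vs} → us ≋ᵉ vs → relᵉ R us → relᵉ R vs
    relᵉ-resp (old R)   ps       (a , q , r) = a , back ps q , r
    relᵉ-resp (graph f) (p ∷ ps) (a , q , r) = a , back ps q , ≈ᵉ-trans (≈ᵉ-sym p) r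
    relᵉ-resp (P s)     (p ∷ []) (a , r)     = a , ≈ᵉ-trans (≈ᵉ-sym p) r
    relᵉ-resp (F s)     (p ∷ ps) (a , q , r) = a , back ps q , ≈ᵉ-trans (≈ᵉ-sym p) r

  structureᵉ : Structure languageᵉ
  structureᵉ = record
    { setoid   = imaginarySetoid
    ; fun      = λ ()
    ; rel      = relᵉ
    ; fun-cong = λ ()
    ; rel-resp = relᵉ-resp
    }

  _^eqSubset : Pred Carrier 0ℓ → Pred Imaginary 0ℓ
  (𝒜 ^eqSubset) u = Σ[ s ∈ Sort ] Σ[ a ∈ Vec Carrier (arity s) ] All 𝒜 a × u ≈ᵉ (s , a)

  -- The submodels of 𝕄^eq are the sets 𝒜^eq for submodels 𝒜 of 𝕄.
  eq : Ambient
  eq = record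
    { δ         = δ
    ; language  = languageᵉ
    ; structure = structureᵉ
    ; Submodel  = λ X → Σ[ 𝒜 ∈ Subset ] Submodel 𝒜 × X ≐ (𝒜 ^eqSubset)
    }

-- The points a, b, c, x, y, z are numbered 0, …, 5.
lines : List (Vec (Fin 6) 3)
lines = (0F ∷ 1F ∷ 2F ∷ [])
      ∷ (0F ∷ 3F ∷ 4F ∷ [])
      ∷ (1F ∷ 4F ∷ 5F ∷ [])
      ∷ (2F ∷ 3F ∷ 5F ∷ [])
      ∷ []

Collinear : Fin 6 → Fin 6 → Fin 6 → Set
Collinear i j k = ListAny.Any (λ ℓ → i ∈ ℓ × j ∈ ℓ × k ∈ ℓ) lines
  where open VecMembershipₚ using (_∈_)

module Groups (𝕄 : Ambient) where
  open Ambient 𝕄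
  open Types 𝕄

  record IsStrictBoundedPartialQuadrangle (A : List Carrier) (p : Vec Carrier 6) : Set₁ where
    field
      points       : ∀ i → URank (lookup p i ∷ []) A 1
      nonCollinear : ∀ i j k → i ≢ j → j ≢ k → i ≢ k → ¬ Collinear i j k →
                     URank (lookup p i ∷ lookup p j ∷ lookup p k ∷ []) A 3
      onLine       : ListAll.All (λ ℓ → URank (Vec.map (lookup p) ℓ) A 2) lines

  record GroupIn : Set₁ where
    field
      G        : Subset
      respects : ∀ {x y} → x ≈ y → G x → G y

    open Setoid (subsetoid setoid G) public using () renaming (Carrier to Elt; _≈_ to _≈ᴳ_)

    field
      _∙_     : Elt → Elt → Elt
      ε       : Elt
      _⁻¹     : Elt → Elt
      isGroup : IsGroup _≈ᴳ_ _∙_ ε _⁻¹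

    underlying : Pred (Vec Carrier 1) 0ℓ
    underlying (x ∷ []) = G x

    operation : Pred (Vec Carrier 3) 0ℓ
    operation (x ∷ y ∷ z ∷ []) = Σ[ g ∈ G x ] Σ[ h ∈ G y ] proj₁ ((x , g) ∙ (y , h)) ≈ z

  IsDefinableGroup : GroupIn → List Carrier → Set
  IsDefinableGroup 𝔾 A = GaloisDefinable underlying ⟪ A ⟫ × GaloisDefinable operation ⟪ A ⟫
    where open GroupIn 𝔾

  IsGenericOfRank : Carrier → Subset → List Carrier → ℕ → Set₁
  IsGenericOfRank g B A n = B g × URank (g ∷ []) A n × (∀ {h} → B h → URank≤ (h ∷ []) A n)

  Generic : Carrier → Subset → List Carrier → Set₁
  Generic g B A = Σ[ n ∈ ℕ ] IsGenericOfRank g B A n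

{-# OPTIONS --safe #-}
-- Naming generic points u and v of the quadrangle turns b, z and y into
-- tuples β, ζ and η which determine each other: each point is the
-- intersection of two lines, so that β gives a bijection T β from the ζ to
-- the η up to interalgebraicity.  The quadrangle shows that a germ
-- (T β₁)⁻¹ ∘ T β₂ can be written with any generic β₃ in the place of β₂.
-- Hence the germs are closed under composition and form a group, and they
-- have rank one because β₁ is algebraic over β₂ and the germ.
--
-- Everything takes place over a finite set which isolates the type of the
-- configuration over its two independent points.  Such a set exists:
-- otherwise a binary tree of automorphisms would give uncountably many
-- tuples in a countable closure.  By a back-and-forth argument the monster
-- model is homogeneous for finite tuples, which provides the automorphisms.

module Submission where

open import Defs
open import Axiom.ExcludedMiddle using (ExcludedMiddle)
open import Level using (0ℓ)
open import Data.Bool.Base using (Bool; true; false; not; if_then_else_)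
open import Data.Empty using (⊥; ⊥-elim)
open import Data.Unit.Base using (⊤; tt)
open import Data.Fin.Base as Fin using (Fin; zero; suc)
open import Data.Fin.Patterns using (0F; 1F; 2F; 3F; 4F; 5F)
import Data.Fin.Properties as Finₚ
open import Data.List.Base as List using (List; []; _∷_; length; _++_)
import Data.List.Properties as Listₚ
import Data.List.Relation.Binary.Pointwise as Listᴾ
open import Data.List.Properties using (map-∘; map-++; map-id; length-map)
open import Data.List.Membership.Propositional using (find; lose) renaming (_∈_ to _∈≡_)
open import Data.List.Membership.Propositional.Properties using (∈-lookup; ∈-map⁺; ∈-++⁺ˡ; ∈-++⁺ʳ; ∈-upTo⁺)
import Data.List.Membership.Setoid.Properties as ∈ₚ
open import Data.List.Relation.Unary.All as LAll using (All; []; _∷_)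
import Data.List.Relation.Unary.All.Properties as LAllₚ
open import Data.List.Relation.Unary.Any as LAny using (here; there)
import Data.List.Relation.Unary.Any.Properties as LAnyₚ
open import Data.List.Relation.Unary.Any.Properties using (lookup-index)
open import Data.Maybe.Base using (just; nothing)
open import Data.Nat.Base as ℕ using (ℕ; zero; suc; _+_; _≤_; _<_; z≤n; s≤s; _⊔_)
import Data.Nat.Properties as ℕₚ
open import Data.Product.Base as Prod using (Σ-syntax; _×_; _,_; proj₁; proj₂; swap)
open import Data.Sum.Base as Sum using (_⊎_; inj₁; inj₂; [_,_])
open import Data.Sum.Properties using (inj₁-injective; inj₂-injective)
open import Data.Vec.Base as Vec using (Vec; []; _∷_)
import Data.Vec.Properties as Vecₚ
import Data.Vec.Membership.DecPropositional as DecMembership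
import Data.Vec.Relation.Unary.All as VecAll
import Data.Vec.Relation.Unary.All.Properties as VecAllₚ
open import Data.Vec.Relation.Binary.Pointwise.Inductive as Pointwise using (Pointwise; []; _∷_)
open import Function.Base using (_∘_; id; _$_)
open import Function.Bundles using (Injection; _↣_; _⇔_; mk⇔; Equivalence)
open import Function.Construct.Identity using (↣-id)
open import Relation.Binary.Bundles using (Setoid; TotalOrder)
open import Relation.Binary.Structures using (IsEquivalence)
open import Relation.Binary.PropositionalEquality.Core using (_≡_; refl; sym; trans; cong; cong₂; subst; subst₂)
open import Relation.Binary.PropositionalEquality.Properties as ≡ₚ using ()
open import Relation.Nullary using (Dec; yes; no; ¬_; contradiction; does)
open import Relation.Nullary.Decidable using (False; toWitnessFalse; _×-dec_)
open import Relation.Unary using (Pred; ∅; _∪_; _⊆_; _≐_)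

-- Countable codings

-- (QM4) and (QM5) speak of countable closed sets and do not pass to unions of chains directly, so
-- only their forms for finite partial maps are carried to the monster model. Isolation needs (QM5)
-- over an infinite closed set, to extend a limit of automorphisms to an algebraic tuple; so the
-- tree is built over a countable model inside `M`, and its result is moved elsewhere by an
-- automorphism. U-rank enters through dimension only: what is determined by elements algebraic over
-- a model and n more has rank at most n over it, and chains of countable models on one generic
-- sequence give lower bounds. Imaginaries require countably many relations, invariant under all
-- automorphisms and fixed before any quadrangle is given. Hence a germ is named together with its
-- configuration `o` and base `F`, with one relation for each length of `F` and of its segment `A`.
-- The group then lies in the first stage of imaginaries already, and is viewed in the second. The
-- bound on δ makes `M` and all countable sets strictly smaller than δ, so that universality embeds
-- `M` and homogeneity applies to countable models.

unpairStep : ℕ × ℕ → ℕ × ℕ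
unpairStep (zero  , b) = suc b , zero
unpairStep (suc a , b) = a , suc b

-- The Cantor walk along the antidiagonals. Iterating a step avoids arithmetic: `pair` is read off
-- from the proof of surjectivity and is a section of `unpair` by construction.
unpair : ℕ → ℕ × ℕ
unpair zero    = 0 , 0
unpair (suc n) = unpairStep (unpair n)

private
  antidiagonal : ∀ k b {n a} → unpair n ≡ (b + a , k) → Σ[ m ∈ ℕ ] unpair m ≡ (a , b + k)
  antidiagonal k zero    {n} p = n , p
  antidiagonal k (suc b) {n} {a} p
    with m , q ← antidiagonal k b {n} {suc a} (trans p (cong (_, k) (sym (ℕₚ.+-suc b a))))
    = suc m , cong unpairStep q

  diagonalStart : ∀ a → Σ[ n ∈ ℕ ] unpair n ≡ (a , 0)
  diagonalStart zero = 0 , refl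
  diagonalStart (suc a)
    with n , p ← diagonalStart a
    with m , q ← antidiagonal 0 a {n} {0} (trans p (cong (_, 0) (sym (ℕₚ.+-identityʳ a))))
    = suc m , trans (cong unpairStep q) (cong (λ k → suc k , 0) (ℕₚ.+-identityʳ a))

unpair-surjective : ∀ a b → Σ[ n ∈ ℕ ] unpair n ≡ (a , b)
unpair-surjective a b
  with n , p ← diagonalStart (b + a)
  with m , q ← antidiagonal 0 b {n} {a} p
  = m , trans q (cong (a ,_) (ℕₚ.+-identityʳ b))

pair : ℕ × ℕ → ℕ
pair (a , b) = proj₁ (unpair-surjective a b)

unpair-pair : ∀ p → unpair (pair p) ≡ p
unpair-pair (a , b) = proj₂ (unpair-surjective a b)

pair-injective : ∀ {p q} → pair p ≡ pair q → p ≡ q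
pair-injective {p} {q} e = trans (sym (unpair-pair p)) (trans (cong unpair e) (unpair-pair q))

encode : ∀ {n} → Vec ℕ n → ℕ
encode []       = 0
encode (a ∷ as) = pair (a , encode as)

decode : ∀ n → ℕ → Vec ℕ n
decode zero    k = []
decode (suc n) k = proj₁ (unpair k) ∷ decode n (proj₂ (unpair k))

decode-encode : ∀ {n} (as : Vec ℕ n) → decode n (encode as) ≡ as
decode-encode []       = refl
decode-encode {suc n} (a ∷ as) =
  cong₂ _∷_ (cong proj₁ (unpair-pair (a , encode as)))
    (trans (cong (decode n ∘ proj₂) (unpair-pair (a , encode as))) (decode-encode as))

module Classical {ℓ} (em : ExcludedMiddle ℓ) where

  by-contradiction : {P : Set ℓ} → ¬ ¬ P → P
  by-contradiction {P} nn with em {P}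
  ... | yes p = p
  ... | no ¬p = ⊥-elim (nn ¬p)

module _ (em : ExcludedMiddle 0ℓ) where

  private module Diagonal (X : Set) (f : (X → Bool) → X) where

    Hits : X → Set
    Hits x = Σ[ ξ ∈ (X → Bool) ] f ξ ≡ x × ξ x ≡ true

    diagonal : X → Bool
    diagonal x = not (does (em {Hits x}))

  -- Cantor's theorem, with injectivity read pointwise because functions into `Bool` are not
  -- extensional. The diagonal excludes `x` exactly when `x` is `f ξ` for some `ξ` containing it, so
  -- asking whether it contains its own code is contradictory either way.
  noInjectionFromSubsets : (X : Set) (f : (X → Bool) → X) →
                           ¬ (∀ {ξ η} → f ξ ≡ f η → ∀ x → ξ x ≡ η x)
  noInjectionFromSubsets X f inj with em {Hits (f diagonal)} in eq
    where open Diagonal X f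
  ... | yes (ξ , e , t) with () ← trans (sym t) (trans (inj e _) (cong (not ∘ does) eq))
  ... | no ¬p = ¬p (Diagonal.diagonal X f , refl , cong (not ∘ does) eq)

-- Quantifier-free types

module _ {L : Language} where
  open Language L

  mutual
    renameᵗ : {V W : Set} → (V → W) → Term L V → Term L W
    renameᵗ r (var x)    = var (r x)
    renameᵗ r (app f ts) = app f (renameᵗˢ r ts)

    renameᵗˢ : {V W : Set} → (V → W) → ∀ {n} → Vec (Term L V) n → Vec (Term L W) n
    renameᵗˢ r []       = []
    renameᵗˢ r (t ∷ ts) = renameᵗ r t ∷ renameᵗˢ r ts

  rename : {V W : Set} → (V → W) → QFFormula L V → QFFormula L W
  rename r (s ≐ᶠ t)    = renameᵗ r s ≐ᶠ renameᵗ r t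
  rename r (atom R ts) = atom R (renameᵗˢ r ts)
  rename r ⊥ᶠ          = ⊥ᶠ
  rename r (¬ᶠ φ)      = ¬ᶠ rename r φ
  rename r (φ ∧ᶠ ψ)    = rename r φ ∧ᶠ rename r ψ
  rename r (φ ∨ᶠ ψ)    = rename r φ ∨ᶠ rename r ψ

module QFTypes {L : Language} (N : Structure L) where
  open Structure N
  open Setoid setoid using () renaming (sym to ≈-sym; trans to ≈-trans)

  mutual
    eval-rename : {V W : Set} (r : V → W) (w : W → Carrier) (t : Term L V) →
                  eval N w (renameᵗ r t) ≡ eval N (w ∘ r) t
    eval-rename r w (var x)    = refl
    eval-rename r w (app f ts) = cong (fun f) (evals-rename r w ts)

    evals-rename : {V W : Set} (r : V → W) (w : W → Carrier) → ∀ {n} (ts : Vec (Term L V) n) →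
                   evals N w (renameᵗˢ r ts) ≡ evals N (w ∘ r) ts
    evals-rename r w []       = refl
    evals-rename r w (t ∷ ts) = cong₂ _∷_ (eval-rename r w t) (evals-rename r w ts)

  satisfies-rename : {V W : Set} (r : V → W) (w : W → Carrier) (φ : QFFormula L V) →
                     Satisfies N w (rename r φ) ≡ Satisfies N (w ∘ r) φ
  satisfies-rename r w (s ≐ᶠ t)    = cong₂ _≈_ (eval-rename r w s) (eval-rename r w t)
  satisfies-rename r w (atom R ts) = cong (rel R) (evals-rename r w ts)
  satisfies-rename r w ⊥ᶠ          = refl
  satisfies-rename r w (¬ᶠ φ)      = cong ¬_ (satisfies-rename r w φ)
  satisfies-rename r w (φ ∧ᶠ ψ)    = cong₂ _×_ (satisfies-rename r w φ) (satisfies-rename r w ψ)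
  satisfies-rename r w (φ ∨ᶠ ψ)    = cong₂ _⊎_ (satisfies-rename r w φ) (satisfies-rename r w ψ)

  -- A formula involves only finitely many variables, so those with
  -- codes below some bound.
  module _ {V : Set} (code : V → ℕ) where

    AgreeBelow : ℕ → (V → Carrier) → (V → Carrier) → Set
    AgreeBelow k v w = ∀ x → code x < k → v x ≈ w x

    private
      agreeˡ : ∀ {k v w} l → AgreeBelow (k ⊔ l) v w → AgreeBelow k v w
      agreeˡ {k} l p x lt = p x (ℕₚ.<-≤-trans lt (ℕₚ.m≤m⊔n k l))

      agreeʳ : ∀ {l v w} k → AgreeBelow (k ⊔ l) v w → AgreeBelow l v w
      agreeʳ {l} k p x lt = p x (ℕₚ.<-≤-trans lt (ℕₚ.m≤n⊔m k l))

    mutual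
      boundᵗ : Term L V → ℕ
      boundᵗ (var x)    = suc (code x)
      boundᵗ (app f ts) = boundᵗˢ ts

      boundᵗˢ : ∀ {n} → Vec (Term L V) n → ℕ
      boundᵗˢ []       = 0
      boundᵗˢ (t ∷ ts) = boundᵗ t ⊔ boundᵗˢ ts

    bound : QFFormula L V → ℕ
    bound (s ≐ᶠ t)    = boundᵗ s ⊔ boundᵗ t
    bound (atom R ts) = boundᵗˢ ts
    bound ⊥ᶠ          = 0
    bound (¬ᶠ φ)      = bound φ
    bound (φ ∧ᶠ ψ)    = bound φ ⊔ bound ψ
    bound (φ ∨ᶠ ψ)    = bound φ ⊔ bound ψ

    mutual
      eval-local : ∀ t {v w} → AgreeBelow (boundᵗ t) v w → eval N v t ≈ eval N w t
      eval-local (var x)    p = p x ℕₚ.≤-refl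
      eval-local (app f ts) p = fun-cong f (evals-local ts p)

      evals-local : ∀ {n} (ts : Vec (Term L V) n) {v w} → AgreeBelow (boundᵗˢ ts) v w →
                    evals N v ts ≋ evals N w ts
      evals-local []       p = []
      evals-local (t ∷ ts) p =
        eval-local t (agreeˡ (boundᵗˢ ts) p) ∷ evals-local ts (agreeʳ (boundᵗ t) p)

    satisfies-local : ∀ φ {v w} → AgreeBelow (bound φ) v w → Satisfies N v φ → Satisfies N w φ
    satisfies-local (s ≐ᶠ t) p q =
      ≈-trans (≈-sym (eval-local s (agreeˡ (boundᵗ t) p)))
        (≈-trans q (eval-local t (agreeʳ (boundᵗ s) p)))
    satisfies-local (atom R ts) p q = rel-resp R (evals-local ts p) q
    satisfies-local (¬ᶠ φ)      p q = q ∘ satisfies-local φ (λ x lt → ≈-sym (p x lt))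
    satisfies-local (φ ∧ᶠ ψ)    p (q , r) =
      satisfies-local φ (agreeˡ (bound ψ) p) q , satisfies-local ψ (agreeʳ (bound φ) p) r
    satisfies-local (φ ∨ᶠ ψ)    p (inj₁ q) = inj₁ (satisfies-local φ (agreeˡ (bound ψ) p) q)
    satisfies-local (φ ∨ᶠ ψ)    p (inj₂ q) = inj₂ (satisfies-local ψ (agreeʳ (bound φ) p) q)

  satisfies-cong : {V : Set} {v w : V → Carrier} → (∀ x → v x ≈ w x) →
                   ∀ φ → Satisfies N v φ → Satisfies N w φ
  satisfies-cong p φ = satisfies-local (λ _ → 0) φ (λ x _ → p x)

  -- The bookkeeping with tuples reduces to this: permuting, repeating or forgetting entries and
  -- replacing them by equal ones are given by a map of the variables, along which formulas are
  -- renamed.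
  sameType-reindex : {V W : Set} {v v′ : V → Carrier} {w w′ : W → Carrier} →
                     SameType N v v′ → (∀ y → Σ[ x ∈ V ] w y ≈ v x × w′ y ≈ v′ x) → SameType N w w′
  sameType-reindex {V} {W} {v} {v′} {w} {w′} same p φ = mk⇔
    (λ s → satisfies-cong (≈-sym ∘ proj₂ ∘ proj₂ ∘ p) φ (out v′ (to (same (rename r φ)) (into v
             (satisfies-cong (proj₁ ∘ proj₂ ∘ p) φ s)))))
    (λ s → satisfies-cong (≈-sym ∘ proj₁ ∘ proj₂ ∘ p) φ (out v (from (same (rename r φ)) (into v′
             (satisfies-cong (proj₂ ∘ proj₂ ∘ p) φ s)))))
    where
    open Equivalence
    r : W → V
    r = proj₁ ∘ p
    into : ∀ u → Satisfies N (u ∘ r) φ → Satisfies N u (rename r φ)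
    into u = subst id (sym (satisfies-rename r u φ))
    out : ∀ u → Satisfies N u (rename r φ) → Satisfies N (u ∘ r) φ
    out u = subst id (satisfies-rename r u φ)

  sameType-sym : {V : Set} {v w : V → Carrier} → SameType N v w → SameType N w v
  sameType-sym p φ = mk⇔ (Equivalence.from (p φ)) (Equivalence.to (p φ))

  infix 4 _∈ₚ_
  _∈ₚ_ : Carrier × Carrier → List (Carrier × Carrier) → Set
  (a , b) ∈ₚ ps = LAny.Any (λ p → a ≈ proj₁ p × b ≈ proj₂ p) ps

  dom cod : List (Carrier × Carrier) → List Carrier
  dom = List.map proj₁
  cod = List.map proj₂

  -- A finite partial elementary map in the quantifier-free sense. Listing pairs, rather than two
  -- tuples, keeps domain and image aligned when pairs are added.
  Elem : List (Carrier × Carrier) → Set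
  Elem ps = SameType N {V = Fin (length ps)} (proj₁ ∘ List.lookup ps) (proj₂ ∘ List.lookup ps)

  ∈ₚ-lookup : ∀ {a b} ps → (a , b) ∈ₚ ps →
              Σ[ i ∈ Fin (length ps) ] a ≈ proj₁ (List.lookup ps i) × b ≈ proj₂ (List.lookup ps i)
  ∈ₚ-lookup (p ∷ ps) (here e)  = zero , e
  ∈ₚ-lookup (p ∷ ps) (there q) with i , e ← ∈ₚ-lookup ps q = suc i , e

  elem⇒sameType : ∀ {ps} → Elem ps → {V : Set} {v v′ : V → Carrier} →
                  (∀ x → (v x , v′ x) ∈ₚ ps) → SameType N v v′
  elem⇒sameType {ps} e p = sameType-reindex e (λ x → ∈ₚ-lookup ps (p x))

  sameType⇒elem : {V : Set} {v v′ : V → Carrier} → SameType N v v′ → ∀ {ps} →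
                  LAll.All (λ p → Σ[ x ∈ V ] proj₁ p ≈ v x × proj₂ p ≈ v′ x) ps → Elem ps
  sameType⇒elem same ps∈ = sameType-reindex same (λ i → LAll.lookup ps∈ (∈-lookup i))

  elem-mono : ∀ {ps qs} → Elem ps → LAll.All (_∈ₚ ps) qs → Elem qs
  elem-mono {ps} e qs⊆ = sameType⇒elem e (LAll.map (∈ₚ-lookup ps) qs⊆)

  dom-swap : ∀ ps → dom (List.map swap ps) ≡ cod ps
  dom-swap ps = sym (map-∘ ps)

  cod-swap : ∀ ps → cod (List.map swap ps) ≡ dom ps
  cod-swap ps = sym (map-∘ ps)

  elem-swap : ∀ {ps} → Elem ps → Elem (List.map swap ps)
  elem-swap {ps} e = sameType⇒elem (sameType-sym e) (LAllₚ.map⁺ (LAll.tabulate {xs = ps} λ {p} p∈ →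
    LAny.index p∈ , reflexive (cong proj₂ (lookup-index p∈)) , reflexive (cong proj₁ (lookup-index p∈))))
    where open Setoid setoid using (reflexive)

module _ {L : Language} {M N : Structure L} (e : Embedding M N) where
  private
    module M = Structure M
    module N = Structure N
    module S = Setoid N.setoid
  open Embedding e renaming (cong to to-cong)

  mutual
    eval-embedding : {V : Set} (v : V → M.Carrier) (t : Term L V) →
                     eval N (to ∘ v) t N.≈ to (eval M v t)
    eval-embedding v (var x)    = S.refl
    eval-embedding v (app f ts) =
      S.trans (N.fun-cong f (evals-embedding v ts)) (S.sym (fun-hom f (evals M v ts)))

    evals-embedding : {V : Set} (v : V → M.Carrier) → ∀ {n} (ts : Vec (Term L V) n) →
                      evals N (to ∘ v) ts N.≋ Vec.map to (evals M v ts)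
    evals-embedding v []       = []
    evals-embedding v (t ∷ ts) = eval-embedding v t ∷ evals-embedding v ts

  satisfies-embedding : {V : Set} (v : V → M.Carrier) (φ : QFFormula L V) →
                        Satisfies M v φ ⇔ Satisfies N (to ∘ v) φ
  satisfies-embedding v (s ≐ᶠ t) = mk⇔
    (λ p → S.trans (eval-embedding v s) (S.trans (to-cong p) (S.sym (eval-embedding v t))))
    (λ p → injective (S.trans (S.sym (eval-embedding v s)) (S.trans p (eval-embedding v t))))
  satisfies-embedding v (atom R ts) = mk⇔
    (λ p → N.rel-resp R (Pointwise.sym S.sym (evals-embedding v ts)) (Equivalence.to (rel-hom R _) p))
    (λ p → Equivalence.from (rel-hom R _) (N.rel-resp R (evals-embedding v ts) p))
  satisfies-embedding v ⊥ᶠ       = mk⇔ id id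
  satisfies-embedding v (¬ᶠ φ)   with mk ← satisfies-embedding v φ =
    mk⇔ (_∘ Equivalence.from mk) (_∘ Equivalence.to mk)
  satisfies-embedding v (φ ∧ᶠ ψ) with p ← satisfies-embedding v φ | q ← satisfies-embedding v ψ =
    mk⇔ (Prod.map (Equivalence.to p) (Equivalence.to q)) (Prod.map (Equivalence.from p) (Equivalence.from q))
  satisfies-embedding v (φ ∨ᶠ ψ) with p ← satisfies-embedding v φ | q ← satisfies-embedding v ψ =
    mk⇔ (Sum.map (Equivalence.to p) (Equivalence.to q)) (Sum.map (Equivalence.from p) (Equivalence.from q))

  sameType-embedding : {V : Set} (v w : V → M.Carrier) →
                       SameType M v w ⇔ SameType N (to ∘ v) (to ∘ w)
  sameType-embedding v w = mk⇔
    (λ p φ → mk⇔ (E.to (satisfies-embedding w φ) ∘ E.to (p φ) ∘ E.from (satisfies-embedding v φ))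
                 (E.to (satisfies-embedding v φ) ∘ E.from (p φ) ∘ E.from (satisfies-embedding w φ)))
    (λ p φ → mk⇔ (E.from (satisfies-embedding w φ) ∘ E.to (p φ) ∘ E.to (satisfies-embedding v φ))
                 (E.from (satisfies-embedding v φ) ∘ E.from (p φ) ∘ E.to (satisfies-embedding w φ)))
    where module E = Equivalence

  map² : M.Carrier × M.Carrier → N.Carrier × N.Carrier
  map² (a , b) = to a , to b

  elem-embedding : ∀ ps → QFTypes.Elem M ps ⇔ QFTypes.Elem N (List.map map² ps)
  elem-embedding ps = mk⇔
    (λ p → QFTypes.sameType⇒elem N (Equivalence.to (sameType-embedding _ _) p)
             (LAllₚ.map⁺ (LAll.tabulate {xs = ps} λ {p} p∈ → LAny.index p∈ ,
               S.reflexive (cong (to ∘ proj₁) (lookup-index p∈)) ,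
               S.reflexive (cong (to ∘ proj₂) (lookup-index p∈)))))
    (λ p → Equivalence.from (sameType-embedding _ _)
             (QFTypes.elem⇒sameType N p λ i →
               LAnyₚ.map⁺ (LAny.map (λ { refl → S.refl , S.refl }) (∈-lookup {xs = ps} i))))

-- Pregeometries

module Pregeometry (em : ExcludedMiddle 0ℓ) {L : Language} (N : PregeometryStructure L) where
  open PregeometryStructure N hiding (Independent)
  open Setoid setoid using () renaming (refl to ≈-refl; sym to ≈-sym; trans to ≈-trans)
  open Classical em

  infix 4 _∈cl_
  _∈cl_ : Carrier → List Carrier → Set
  a ∈cl F = cl ⟪ F ⟫ a

  closed-respects : ∀ {P} → Closed P → ∀ {a b} → a ≈ b → P a → P b
  closed-respects {P} closed e p = closed (respects P e (extensive P p))

  closed-list : ∀ {P} → Closed P → ∀ {F} → All P F → ∀ {a} → a ∈cl F → P a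
  closed-list {P} closed {F} P-F = closed ∘ monotone ⟪ F ⟫ P (member P-F)
    where
    member : ∀ {G} → All P G → ⟪ G ⟫ ⊆ P
    member (p ∷ ps) (here e)  = closed-respects closed (≈-sym e) p
    member (p ∷ ps) (there q) = member ps q

  clList-closed : ∀ F → Closed (_∈cl F)
  clList-closed F = idempotent ⟪ F ⟫

  cl-trans : ∀ {F G} → All (_∈cl G) F → ∀ {a} → a ∈cl F → a ∈cl G
  cl-trans {G = G} = closed-list (clList-closed G)

  cl-mono : ∀ {F G} → ⟪ F ⟫ ⊆ ⟪ G ⟫ → ∀ {a} → a ∈cl F → a ∈cl G
  cl-mono = monotone _ _

  cl-∈ : ∀ {F a} → a ∈ F → a ∈cl F
  cl-∈ = extensive _

  cl-resp : ∀ {F a b} → a ≈ b → a ∈cl F → b ∈cl F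
  cl-resp = respects _

  cl-here : ∀ {a F} → a ∈cl a ∷ F
  cl-here = cl-∈ (here ≈-refl)

  cl-there : ∀ {b F a} → a ∈cl F → a ∈cl b ∷ F
  cl-there = cl-mono there

  cl-++ʳ : ∀ E {F a} → a ∈cl F → a ∈cl E ++ F
  cl-++ʳ E = cl-mono (∈ₚ.∈-++⁺ʳ setoid E)

  cl-++ˡ : ∀ {E F a} → a ∈cl E → a ∈cl E ++ F
  cl-++ˡ = cl-mono (∈ₚ.∈-++⁺ˡ setoid)

  cl-self : ∀ F → All (_∈cl F) F
  cl-self []      = []
  cl-self (a ∷ F) = cl-here ∷ LAll.map cl-there (cl-self F)

  cl-selfˡ : ∀ E {F} → All (_∈cl E ++ F) E
  cl-selfˡ E = LAll.map cl-++ˡ (cl-self E)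

  cl-selfʳ : ∀ E {F} → All (_∈cl E ++ F) F
  cl-selfʳ E = LAll.map (cl-++ʳ E) (cl-self _)

  cl-exchange : ∀ {a b F} → a ∈cl b ∷ F → ¬ a ∈cl F → b ∈cl a ∷ F
  cl-exchange {a} {b} {F} p ¬p =
    monotone _ _ (λ { (inj₁ q) → there q ; (inj₂ e) → here e })
      (exchange ⟪ F ⟫ (monotone _ _ (λ { (here e) → inj₂ e ; (there q) → inj₁ q }) p) ¬p)

  private
    separate : ∀ {P : Pred Carrier 0ℓ} D F → All (P ∪ ⟪ D ⟫) F → Σ[ G ∈ List Carrier ] All P G × All (_∈cl D ++ G) F
    separate D []      []      = [] , [] , []
    separate D (a ∷ F) (q ∷ F⊆) with G , P-G , r ← separate D F F⊆ | q
    ... | inj₁ p = a ∷ G , p ∷ P-G ,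
      cl-++ʳ D cl-here ∷ LAll.map (cl-trans (LAllₚ.++⁺ (cl-selfˡ D)
        (LAll.map (cl-++ʳ D ∘ cl-there) (cl-self G)))) r
    ... | inj₂ d = G , P-G , cl-++ˡ (cl-∈ d) ∷ r

  finitary-∪ : ∀ {P} D {a} → cl (P ∪ ⟪ D ⟫) a → Σ[ G ∈ List Carrier ] All P G × a ∈cl D ++ G
  finitary-∪ {P} D p with F , F⊆ , q ← finitary _ p with G , P-G , r ← separate D F F⊆ =
    G , P-G , cl-trans r q

  -- Each entry is tested only against those after it and the base. Exchange makes the order
  -- irrelevant, and this form suits recursion.
  Ind : List Carrier → List Carrier → Set
  Ind F []       = ⊤
  Ind F (d ∷ ds) = ¬ d ∈cl ds ++ F × Ind F ds

  IndOver : Pred Carrier 0ℓ → List Carrier → Set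
  IndOver P D = ∀ G → All P G → Ind G D

  ind-base : ∀ {F G} → All (_∈cl G) F → ∀ {D} → Ind G D → Ind F D
  ind-base F⊆ {[]}     _       = _
  ind-base {F} {G} F⊆ {d ∷ ds} (p , i) =
    p ∘ cl-trans (LAllₚ.++⁺ (cl-selfˡ ds) (LAll.map (cl-++ʳ ds) F⊆)) , ind-base F⊆ i

  ind-extend : ∀ {F e} D → Ind F D → ¬ e ∈cl D ++ F → Ind (e ∷ F) D
  ind-extend []       _       _ = _
  ind-extend {F} {e} (d ∷ ds) (p , i) q =
    (λ r → q (cl-exchange (cl-trans (LAllₚ.++⁺ (LAll.map cl-there (cl-selfˡ ds))
                 (cl-here ∷ LAll.map cl-there (cl-selfʳ ds))) r) p)) ,
    ind-extend ds i (q ∘ cl-there)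

  -- Symmetry of independence, one element of `hs` at a time; exchange enters through `ind-extend`.
  ind-swap : ∀ {F} D hs → Ind F D → Ind (D ++ F) hs → Ind (hs ++ F) D
  ind-swap D []       i _       = i
  ind-swap D (h ∷ hs) i (p , j) = ind-extend D (ind-swap D hs i j)
    (p ∘ cl-trans (LAllₚ.++⁺ (LAll.map (cl-++ʳ hs) (cl-selfˡ D))
      (LAllₚ.++⁺ (cl-selfˡ hs) (LAll.map (cl-++ʳ hs) (cl-selfʳ D)))))

  -- Were `x` outside the closure of `G`, an exchange would make some entry of `D` algebraic over
  -- `x` and the entries after it.
  ind-algebraic : ∀ {x G} D → Ind (x ∷ G) D → x ∈cl D ++ G → x ∈cl G
  ind-algebraic []       _       p = p
  ind-algebraic {x} {G} (d ∷ ds) (q , i) p with em {x ∈cl ds ++ G}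
  ... | yes r = ind-algebraic ds i r
  ... | no ¬r = ⊥-elim (q (cl-trans (cl-++ʳ ds cl-here ∷
    LAllₚ.++⁺ (cl-selfˡ ds) (LAll.map (cl-++ʳ ds ∘ cl-there) (cl-self G))) (cl-exchange p ¬r)))

  private
    exchangeOut : ∀ {d G} es → d ∈cl es ++ G → ¬ d ∈cl G →
      Σ[ es′ ∈ List Carrier ] length es ≡ suc (length es′) × All (_∈cl es′ ++ d ∷ G) es
    exchangeOut []       p q = ⊥-elim (q p)
    exchangeOut {d} {G} (e ∷ es) p q with em {d ∈cl es ++ G}
    ... | yes r with es′ , l , es⊆ ← exchangeOut es r q =
      e ∷ es′ , cong suc l , cl-here ∷ LAll.map cl-there es⊆
    ... | no ¬r = es , refl ,
      cl-trans (cl-++ʳ es cl-here ∷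
        LAllₚ.++⁺ (cl-selfˡ es) (LAll.map (cl-++ʳ es ∘ cl-there) (cl-self G))) (cl-exchange p ¬r) ∷
      cl-selfˡ es

    replace : ∀ {F} ds {es} → Ind F ds → All (_∈cl es ++ F) ds →
      Σ[ es′ ∈ List Carrier ] length ds + length es′ ≡ length es × All (_∈cl es′ ++ ds ++ F) es
    replace []       {es} _       _        = es , refl , cl-selfˡ es
    replace {F} (d ∷ ds) {es} (p , i) (q ∷ qs)
      with es′ , l , es⊆ ← replace ds i qs
      with es″ , l′ , es′⊆ ← exchangeOut es′
             (cl-trans (LAllₚ.++⁺ es⊆ (LAll.map (cl-++ʳ es′) (cl-selfʳ ds))) q) p
      = es″ , trans (sym (ℕₚ.+-suc (length ds) (length es″))) (trans (cong (length ds +_) (sym l′)) l) ,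
        LAll.map (cl-trans (LAllₚ.++⁺ es′⊆ (LAll.map (cl-++ʳ es″ ∘ cl-there) (cl-self (ds ++ F))))) es⊆

  -- Each entry of the independent list displaces one of the spanning list. The counting arguments
  -- about the quadrangle are instances of this inequality.
  steinitz : ∀ {F} ds {es} → Ind F ds → All (_∈cl es ++ F) ds → length ds ≤ length es
  steinitz ds i p with es′ , l , _ ← replace ds i p =
    ℕₚ.≤-trans (ℕₚ.m≤m+n (length ds) (length es′)) (ℕₚ.≤-reflexive l)

  -- The clause polymorphic in `P` says that the basis is selected from `c`, without recording
  -- positions.
  basisOver : ∀ F (c : List Carrier) → Σ[ hs ∈ List Carrier ]
    (∀ {P : Carrier → Set} → All P c → All P hs) × Ind F hs × All (_∈cl hs ++ F) c × length hs ≤ length c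
  basisOver F []      = [] , id , _ , [] , z≤n
  basisOver F (a ∷ c) with hs , sub , i , c⊆ , l ← basisOver F c with em {a ∈cl hs ++ F}
  ... | yes p = hs , sub ∘ LAll.tail , i , p ∷ c⊆ , ℕₚ.m≤n⇒m≤1+n l
  ... | no ¬p = a ∷ hs , (λ { (p ∷ ps) → p ∷ sub ps }) , (¬p , i) , cl-here ∷ LAll.map cl-there c⊆ , s≤s l

  InfDim : Pred Carrier 0ℓ → Set
  InfDim P = ∀ G → Σ[ m ∈ Carrier ] P m × ¬ m ∈cl G

  -- An independent list longer than `G` cannot lie in the closure of `G`, by Steinitz.
  infDim : ∀ {P} → (∀ n → Σ[ ds ∈ List Carrier ] All P ds × Ind [] ds × length ds ≡ n) → InfDim P
  infDim {P} lists G with ds , P-ds , i , l ← lists (suc (length G)) =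
    by-contradiction λ none → ℕₚ.<⇒≱ ℕₚ.≤-refl (ℕₚ.≤-trans (ℕₚ.≤-reflexive (sym l))
      (steinitz ds {G} i (LAll.map (λ {m} p → by-contradiction λ q → none (m , p , q ∘ cl-++ˡ)) P-ds)))

  indList : ∀ {P} → InfDim P → ∀ n → Σ[ ds ∈ List Carrier ] All P ds × Ind [] ds × length ds ≡ n
  indList inf zero    = [] , [] , _ , refl
  indList inf (suc n) with ds , p , i , l ← indList inf n with m , q , r ← inf (ds ++ []) =
    m ∷ ds , q ∷ p , (r , i) , cong suc l

  private
    remove : ∀ a F → a ∈ F → Σ[ G ∈ List Carrier ] length G < length F ×
             (∀ {m} → m ∈ F → ¬ m ≈ a → m ∈ G)
    remove a (b ∷ F) (here e)  = F , ℕₚ.≤-refl ,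
      λ { (here q) ne → ⊥-elim (ne (≈-trans q (≈-sym e))) ; (there q) ne → q }
    remove a (b ∷ F) (there p) with G , l , sub ← remove a F p = b ∷ G , s≤s l ,
      λ { (here q) ne → here q ; (there q) ne → there (sub q ne) }

  -- An entry in the closure of the elements different from it could be deleted, and the shorter
  -- list left over would still span `ds`, against Steinitz.
  ind⇒independent : ∀ ds → Ind [] ds → PregeometryStructure.Independent N ⟪ ds ⟫
  ind⇒independent ds i {a} a∈ p with G , l , sub ← remove a ds a∈ =
    ℕₚ.<⇒≱ l (steinitz ds i (LAll.tabulateₛ setoid λ {m} m∈ → cl-++ˡ (inG m m∈)))
    where
    inG : ∀ m → m ∈ ds → m ∈cl G
    inG m m∈ with em {m ≈ a}
    ... | yes e = cl-resp (≈-sym e) (monotone _ _ (λ (q , ne) → sub q ne) p)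
    ... | no ne = cl-∈ (sub m∈ ne)

  infDimensional : ¬ FiniteDimensional → InfDim (λ _ → ⊤)
  infDimensional ¬fd G = by-contradiction λ none →
    let hs , _ , i , G⊆ , _ = basisOver [] G in
    ¬fd (hs , ind⇒independent hs i , λ m →
      by-contradiction λ q → none (m , _ , q ∘ cl-trans
        (LAll.map (cl-trans (LAllₚ.++⁺ (cl-self hs) [])) G⊆)))

-- Branches through trees of finite partial maps of ℕ

module Branch (Node : Set) (graph : Node → List (ℕ × ℕ)) (start : Node)
              (step : ℕ → Bool → Node → Node)
              (grow : ∀ n b x {p} → p ∈≡ graph x → p ∈≡ graph (step n b x))
              (forth : ∀ n b x → Σ[ m ∈ ℕ ] (n , m) ∈≡ graph (step n b x))
              (back : ∀ n b x → Σ[ m ∈ ℕ ] (m , n) ∈≡ graph (step n b x))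
              (η : ℕ → Bool) where

  node : ℕ → Node
  node zero    = start
  node (suc n) = step n (η n) (node n)

  π : ℕ → ℕ
  π n = proj₁ (forth n (η n) (node n))

  private
    grow* : ∀ n {p} → p ∈≡ graph (node n) → ∀ k → p ∈≡ graph (node (k + n))
    grow* n p∈ zero    = p∈
    grow* n p∈ (suc k) = grow _ _ _ (grow* n p∈ k)

  node-mono : ∀ {m n p} → m ≤ n → p ∈≡ graph (node m) → p ∈≡ graph (node n)
  node-mono {m} {n} m≤n p∈ = subst (λ k → _ ∈≡ graph (node k)) (ℕₚ.m∸n+n≡m m≤n) (grow* m p∈ (n ℕ.∸ m))

  π-graph : ∀ {i n} → i < n → (i , π i) ∈≡ graph (node n)
  π-graph {i} i<n = node-mono i<n (proj₂ (forth i (η i) (node i)))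

  onto : ∀ n → Σ[ m ∈ ℕ ] (m , n) ∈≡ graph (node (suc n))
  onto n = back n (η n) (node n)

-- Back-and-forth between countable families

module FamilyTypes {L : Language} (N : Structure L) where
  open Structure N
  open Setoid setoid using () renaming (refl to ≈-refl; sym to ≈-sym; trans to ≈-trans)
  open QFTypes N

  elem-functional : ∀ {ps} → Elem ps → ∀ {a b a′ b′} → (a , b) ∈ₚ ps → (a′ , b′) ∈ₚ ps → a ≈ a′ → b ≈ b′
  elem-functional {ps} e {a} {b} {a′} {b′} p q = Equivalence.to
    (elem⇒sameType {ps} e {Bool} {λ { true → a ; false → a′ }} {λ { true → b ; false → b′ }}
      (λ { true → p ; false → q }) (var true ≐ᶠ var false))

  ∈⇒∈ₚ : ∀ {p ps} → p ∈≡ ps → p ∈ₚ ps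
  ∈⇒∈ₚ = LAny.map λ { refl → ≈-refl , ≈-refl }

  -- A formula sees finitely many variables. Those beyond its bound are all sent to `x₀`, whose code
  -- 0 is within every bound, so that the clipped families stay inside one finite map.
  locally⇒sameType : {V : Set} (code : V → ℕ) (x₀ : V) → code x₀ ≡ 0 → (v w : V → Carrier) →
    (∀ k → Σ[ ps ∈ List (Carrier × Carrier) ] Elem ps × (∀ x → code x ≤ k → (v x , w x) ∈ₚ ps)) →
    SameType N v w
  locally⇒sameType {V} code x₀ code-x₀ v w local φ
    with ps , e , ps∋ ← local (bound code φ) = mk⇔
      (λ s → satisfies-local code φ (clip-agrees w) (Equivalence.to (same φ)
        (satisfies-local code φ (λ x → ≈-sym ∘ clip-agrees v x) s)))
      (λ s → satisfies-local code φ (clip-agrees v) (Equivalence.from (same φ)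
        (satisfies-local code φ (λ x → ≈-sym ∘ clip-agrees w x) s)))
    where
    k = bound code φ
    clip : (V → Carrier) → V → Carrier
    clip u x with code x ℕₚ.≤? k
    ... | yes _ = u x
    ... | no  _ = u x₀
    clip-agrees : ∀ u → AgreeBelow code k (clip u) u
    clip-agrees u x lt with code x ℕₚ.≤? k
    ... | yes _ = ≈-refl
    ... | no ¬p = contradiction (ℕₚ.<⇒≤ lt) ¬p
    in-ps : ∀ x → (clip v x , clip w x) ∈ₚ ps
    in-ps x with code x ℕₚ.≤? k
    ... | yes p = ps∋ x p
    ... | no  _ = ps∋ x₀ (subst (_≤ k) (sym code-x₀) z≤n)
    same : SameType N (clip v) (clip w)
    same = elem⇒sameType {ps} e in-ps

  module _ (h k : ℕ → Carrier) where
    on : ℕ × ℕ → Carrier × Carrier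
    on (i , j) = h i , k j

    -- The steps are demanded only for maps extending `ps₀`: in the application to closures, the
    -- families are known to be algebraic over the finite map for these only.
    backAndForth : (ps₀ : List (ℕ × ℕ)) → Elem (List.map on ps₀) →
      (∀ ps → (∀ {p} → p ∈≡ ps₀ → p ∈≡ ps) → Elem (List.map on ps) →
        ∀ n → Σ[ m ∈ ℕ ] Elem (List.map on ((n , m) ∷ ps))) →
      (∀ ps → (∀ {p} → p ∈≡ ps₀ → p ∈≡ ps) → Elem (List.map on ps) →
        ∀ n → Σ[ m ∈ ℕ ] Elem (List.map on ((m , n) ∷ ps))) →
      Σ[ π ∈ (ℕ → ℕ) ] SameType N h (k ∘ π) × (∀ n → Σ[ m ∈ ℕ ] k n ≈ k (π m)) ×
        All (λ (i , j) → k j ≈ k (π i)) ps₀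
    backAndForth ps₀ e₀ forth back =
      π ,
      locally⇒sameType id 0 refl h (k ∘ π)
        (λ n → List.map on (proj₁ (node (suc n))) , proj₂ (proj₂ (node (suc n))) ,
               λ i i≤n → ∈⇒∈ₚ (∈-map⁺ on (π-graph (s≤s i≤n)))) ,
      (λ n → let m , p = onto n in m , functional {suc n} p) ,
      LAll.tabulate (λ p∈ → functional {zero} p∈)
      where
      Node = Σ[ ps ∈ List (ℕ × ℕ) ] (∀ {p} → p ∈≡ ps₀ → p ∈≡ ps) × Elem (List.map on ps)
      step : ℕ → Bool → Node → Node
      step n _ (ps , s , e) =
        let m , e₁ = forth ps s e n ; l , e₂ = back ((n , m) ∷ ps) (there ∘ s) e₁ n
        in _ , there ∘ there ∘ s , e₂
      open Branch Node proj₁ (ps₀ , id , e₀) step (λ _ _ _ → there ∘ there)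
             (λ n _ (ps , e) → _ , there (here refl)) (λ n _ (ps , e) → _ , here refl) (λ _ → true)
      -- The index chosen by `π` may differ from one already listed in a node; as elementary maps
      -- preserve equality, both name the same element.
      functional : ∀ {n i j} → (i , j) ∈≡ proj₁ (node n) → k j ≈ k (π i)
      functional {n} {i} p∈ = elem-functional {List.map on (proj₁ (node (n ⊔ suc i)))} (proj₂ (proj₂ (node (n ⊔ suc i))))
        (∈⇒∈ₚ (∈-map⁺ on (node-mono (ℕₚ.m≤m⊔n n (suc i)) p∈)))
        (∈⇒∈ₚ (∈-map⁺ on (π-graph (ℕₚ.m≤n⊔m n (suc i))))) ≈-refl

  pairs-lookup : ∀ ps i → (Vec.lookup (Vec.map proj₁ (Vec.fromList ps)) i ,
                           Vec.lookup (Vec.map proj₂ (Vec.fromList ps)) i) ∈ₚ ps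
  pairs-lookup (p ∷ ps) zero    = here (≈-refl , ≈-refl)
  pairs-lookup (p ∷ ps) (suc i) = there (pairs-lookup ps i)

  pairs-snoc : ∀ ps {a a′} → All (λ p → Σ[ i ∈ Fin (suc (length ps)) ]
    proj₁ p ≈ Vec.lookup (Vec.map proj₁ (Vec.fromList ps) Vec.∷ʳ a) i ×
    proj₂ p ≈ Vec.lookup (Vec.map proj₂ (Vec.fromList ps) Vec.∷ʳ a′) i) ((a , a′) ∷ ps)
  pairs-snoc []       = (zero , ≈-refl , ≈-refl) ∷ []
  pairs-snoc (p ∷ ps) with q ∷ qs ← pairs-snoc ps =
    (suc (proj₁ q) , proj₂ q) ∷ (zero , ≈-refl , ≈-refl) ∷ LAll.map (λ (i , r) → suc i , r) qs

  range-pairs : ∀ {A : Set} (f : A → Carrier) (ps : List A) {m} →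
                Range (Vec.lookup (Vec.map f (Vec.fromList ps))) m ⇔ m ∈ List.map f ps
  range-pairs f ps = mk⇔ (λ (i , e) → to ps i e) (from ps)
    where
    to : ∀ ps i {m} → m ≈ Vec.lookup (Vec.map f (Vec.fromList ps)) i → m ∈ List.map f ps
    to (p ∷ ps) zero    e = here e
    to (p ∷ ps) (suc i) e = there (to ps i e)
    from : ∀ ps {m} → m ∈ List.map f ps → Range (Vec.lookup (Vec.map f (Vec.fromList ps))) m
    from (p ∷ ps) (here e)  = zero , e
    from (p ∷ ps) (there q) = let i , r = from ps q in suc i , r

-- The point `m₀` is the value at numbers which code nothing.
enumerate : ExcludedMiddle 0ℓ → (S : Setoid 0ℓ 0ℓ) (X : Pred (Setoid.Carrier S) 0ℓ) →
            Countable (subsetoid S X) → ∀ {m₀} → X m₀ →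
            Σ[ h ∈ (ℕ → Setoid.Carrier S) ] (∀ n → X (h n)) ×
              (∀ {m} → X m → Σ[ n ∈ ℕ ] Setoid._≈_ S m (h n))
enumerate em S X inj {m₀} X-m₀ = (proj₁ ∘ h) , (proj₂ ∘ h) , onto
  where
  open Injection inj
  open Setoid S using (_≈_)
  open Setoid (subsetoid S X) using (Carrier)
  choose : ∀ n → Dec (Σ[ x ∈ Carrier ] to x ≡ n) → Carrier
  choose n (yes (x , _)) = x
  choose n (no _)        = m₀ , X-m₀
  h : ℕ → Carrier
  h n = choose n em
  onto : ∀ {m} → X m → Σ[ n ∈ ℕ ] m ≈ proj₁ (h n)
  onto {m} X-m = to (m , X-m) , lemma em
    where
    lemma : (d : Dec (Σ[ x ∈ Carrier ] to x ≡ to (m , X-m))) → m ≈ proj₁ (choose (to (m , X-m)) d)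
    lemma (yes (x , e)) = injective (sym e)
    lemma (no ¬p)       = ⊥-elim (¬p ((m , X-m) , refl))

⊥↣ℕ : ⊥ ↣ ℕ
⊥↣ℕ = record { to = λ () ; cong = λ {x} → ⊥-elim x ; injective = λ {x} → ⊥-elim x }

-- The axioms in terms of finite partial maps

module FiniteQuasiminimality (em : ExcludedMiddle 0ℓ) {L : Language} where

  -- (QM1), (QM3), (QM4), (QM5) for finite partial maps; unlike (QM4) and
  -- (QM5) themselves these conditions pass to unions of chains at once.
  record IsFinitelyQuasiminimal (N : PregeometryStructure L) : Set₁ where
    open PregeometryStructure N
    open Pregeometry em N using (_∈cl_)
    open QFTypes structure
    field
      fqm1 : ∀ {a a′} ps → Elem ((a , a′) ∷ ps) → a ∈cl dom ps → a′ ∈cl cod ps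
      fqm3 : ∀ F → Countable (subsetoid setoid (cl ⟪ F ⟫))
      fqm4 : ∀ {a a′} ps → Elem ps → ¬ a ∈cl dom ps → ¬ a′ ∈cl cod ps → Elem ((a , a′) ∷ ps)
      fqm5 : ∀ {a} ps → Elem ps → a ∈cl dom ps → Σ[ a′ ∈ Carrier ] Elem ((a , a′) ∷ ps)

  module _ {M : PregeometryStructure L} (wqm : IsWeaklyQuasiminimal M) where
    open IsWeaklyQuasiminimal wqm
    open PregeometryStructure M
    open Setoid setoid using () renaming (refl to ≈-refl; sym to ≈-sym; trans to ≈-trans)
    open Pregeometry em M
    open QFTypes structure
    open FamilyTypes structure

    private
      fqm1 : ∀ {a a′} ps → Elem ((a , a′) ∷ ps) → a ∈cl dom ps → a′ ∈cl cod ps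
      fqm1 {a} {a′} ps e p = monotone _ _ (to (range-pairs proj₂ ps)) (to
        (qm1 a a′ (Vec.map proj₁ (Vec.fromList ps)) (Vec.map proj₂ (Vec.fromList ps))
          (elem⇒sameType {(a , a′) ∷ ps} e λ
            { zero → here (≈-refl , ≈-refl) ; (suc i) → there (pairs-lookup ps i) }))
        (monotone _ _ (from (range-pairs proj₁ ps)) p))
        where open Equivalence

      fqm5 : ∀ {a} ps → Elem ps → a ∈cl dom ps → Σ[ a′ ∈ Carrier ] Elem ((a , a′) ∷ ps)
      fqm5 {a} ps e p =
        -- (QM5) with empty `H`: the whole finite map is put into the tuples `b` and `b′`.
        let a′ , q = qm5 ⊥ ⊥↣ℕ (λ ()) (λ ()) (inj₂ id) (inj₂ id) (λ φ → mk⇔ (satisfies-cong (λ ()) φ) (satisfies-cong (λ ()) φ))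
              (Vec.map proj₁ (Vec.fromList ps)) (Vec.map proj₂ (Vec.fromList ps))
              (elem⇒sameType {ps} e λ { (inj₂ i) → pairs-lookup ps i }) a
              (monotone _ _ (λ m∈ → let i , r = from (range-pairs proj₁ ps) m∈ in inj₂ i , r) p)
        in a′ , sameType⇒elem q {(a , a′) ∷ ps} (LAll.map (λ (i , r) → inj₂ i , r) (pairs-snoc ps))
        where open Equivalence

    private
      fqm5ʳ : ∀ {b} ps → Elem ps → b ∈cl cod ps → Σ[ a ∈ Carrier ] Elem ((a , b) ∷ ps)
      fqm5ʳ {b} ps e p =
        let a , q = fqm5 (List.map swap ps) (elem-swap {ps} e) (subst (b ∈cl_) (sym (dom-swap ps)) p)
        in a , subst (λ qs → Elem ((a , b) ∷ qs)) (swap² ps) (elem-swap {(b , a) ∷ List.map swap ps} q)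
        where
        swap² : ∀ ps → List.map swap (List.map swap ps) ≡ ps
        swap² []       = refl
        swap² (p ∷ ps) = cong (p ∷_) (swap² ps)

      fqm1ʳ : ∀ {a a′} ps → Elem ((a , a′) ∷ ps) → a′ ∈cl cod ps → a ∈cl dom ps
      fqm1ʳ {a} {a′} ps e p = subst (a ∈cl_) (cod-swap ps)
        (fqm1 (List.map swap ps) (elem-swap {(a , a′) ∷ ps} e) (subst (a′ ∈cl_) (sym (dom-swap ps)) p))

      ∈ₚ-dom : ∀ {p qs} → p ∈ₚ qs → proj₁ p ∈cl dom qs
      ∈ₚ-dom = cl-∈ ∘ LAnyₚ.map⁺ ∘ LAny.map proj₁

      ∈ₚ-cod : ∀ {p qs} → p ∈ₚ qs → proj₂ p ∈cl cod qs
      ∈ₚ-cod = cl-∈ ∘ LAnyₚ.map⁺ ∘ LAny.map proj₂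

      module _ (h k : ℕ → Carrier) where

        indices : ∀ {ps} → All (λ p → Σ[ i ∈ ℕ ] Σ[ j ∈ ℕ ] proj₁ p ≈ h i × proj₂ p ≈ k j) ps →
          Σ[ is ∈ List (ℕ × ℕ) ] All (_∈ₚ List.map (on h k) is) ps × All (_∈ₚ ps) (List.map (on h k) is)
        indices []                     = [] , [] , []
        indices ((i , j , e , f) ∷ ps) with is , q , r ← indices ps =
          (i , j) ∷ is , here (e , f) ∷ LAll.map there q ,
          here (≈-sym e , ≈-sym f) ∷ LAll.map there r

        ∈ₚ-on : ∀ {p} is → p ∈ₚ List.map (on h k) is →
          Σ[ i ∈ ℕ ] Σ[ j ∈ ℕ ] (i , j) ∈≡ is × proj₁ p ≈ h i × proj₂ p ≈ k j
        ∈ₚ-on ((i , j) ∷ is) (here (e , f)) = i , j , here refl , e , f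
        ∈ₚ-on (_ ∷ is)       (there p∈) with i , j , ij∈ , e ← ∈ₚ-on is p∈ = i , j , there ij∈ , e

      module Extension (ps : List (Carrier × Carrier)) (e : Elem ps) (h k : ℕ → Carrier)
          (h∈ : ∀ n → h n ∈cl dom ps) (h-onto : ∀ {m} → m ∈cl dom ps → Σ[ n ∈ ℕ ] m ≈ h n)
          (k∈ : ∀ n → k n ∈cl cod ps) (k-onto : ∀ {m} → m ∈cl cod ps → Σ[ n ∈ ℕ ] m ≈ k n) where

        start : Σ[ is ∈ List (ℕ × ℕ) ] All (_∈ₚ List.map (on h k) is) ps × All (_∈ₚ ps) (List.map (on h k) is)
        start = indices h k (LAll.tabulate λ p∈ →
          let i , q = h-onto (∈ₚ-dom (∈⇒∈ₚ p∈)) ; j , r = k-onto (∈ₚ-cod (∈⇒∈ₚ p∈)) in i , j , q , r)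

        Extends : List (ℕ × ℕ) → Set
        Extends js = ∀ {p} → p ∈≡ proj₁ start → p ∈≡ js

        ps⊆ : ∀ {js} → Extends js → All (_∈ₚ List.map (on h k) js) ps
        ps⊆ ext = LAll.map (LAnyₚ.map⁺ ∘ (λ p → lift p) ∘ LAnyₚ.map⁻) (proj₁ (proj₂ start))
          where
          lift : ∀ {P : ℕ × ℕ → Set} → LAny.Any P (proj₁ start) → LAny.Any P _
          lift p with _ , q , r ← find p = lose (ext q) r

        dom⊆ : ∀ {js} → Extends js → ∀ n → h n ∈cl dom (List.map (on h k) js)
        dom⊆ ext n = cl-trans (LAllₚ.map⁺ (LAll.map ∈ₚ-dom (ps⊆ ext))) (h∈ n)

        cod⊆ : ∀ {js} → Extends js → ∀ n → k n ∈cl cod (List.map (on h k) js)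
        cod⊆ ext n = cl-trans (LAllₚ.map⁺ (LAll.map ∈ₚ-cod (ps⊆ ext))) (k∈ n)

        forth : ∀ js → Extends js → Elem (List.map (on h k) js) →
                ∀ n → Σ[ m ∈ ℕ ] Elem (List.map (on h k) ((n , m) ∷ js))
        forth js ext e n =
          let b , e₁ = fqm5 (List.map (on h k) js) e (dom⊆ ext n)
              m , q = k-onto (cl-trans (LAllₚ.map⁺ (LAllₚ.map⁺ (LAll.tabulate {xs = js} λ {p} _ → k∈ (proj₂ p))))
                        (fqm1 (List.map (on h k) js) e₁ (dom⊆ ext n)))
          in m , elem-mono {(h n , b) ∷ List.map (on h k) js} e₁
                   (here (≈-refl , ≈-sym q) ∷ LAll.tabulate (there ∘ ∈⇒∈ₚ))

        back : ∀ js → Extends js → Elem (List.map (on h k) js) →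
               ∀ n → Σ[ m ∈ ℕ ] Elem (List.map (on h k) ((m , n) ∷ js))
        back js ext e n =
          let b , e₁ = fqm5ʳ (List.map (on h k) js) e (cod⊆ ext n)
              m , q = h-onto (cl-trans (LAllₚ.map⁺ (LAllₚ.map⁺ (LAll.tabulate {xs = js} λ {p} _ → h∈ (proj₁ p))))
                        (fqm1ʳ (List.map (on h k) js) e₁ (cod⊆ ext n)))
          in m , elem-mono {(b , k n) ∷ List.map (on h k) js} e₁
                   (here (≈-sym q , ≈-refl) ∷ LAll.tabulate (there ∘ ∈⇒∈ₚ))

        -- (QM4) asks for closed sets. Back-and-forth by (QM5) enumerates the closures of domain and
        -- image in matching order, after which (QM4) adds the generic elements.
        extension : ∀ {a a′} → ¬ a ∈cl dom ps → ¬ a′ ∈cl cod ps → Elem ((a , a′) ∷ ps)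
        extension {a} {a′} a∉ a′∉ = conclude
          (backAndForth h k (proj₁ start) (elem-mono {ps} e (proj₂ (proj₂ start))) forth back)
          where
          cl⊆ : ∀ {F} {f : ℕ → Carrier} → (∀ n → f n ∈cl F) → cl (Range f) ⊆ (_∈cl F)
          cl⊆ {F} f∈ p = idempotent ⟪ F ⟫ (monotone _ _ (λ (n , q) → cl-resp (≈-sym q) (f∈ n)) p)

          conclude : Σ[ π ∈ (ℕ → ℕ) ] SameType structure h (k ∘ π) × (∀ n → Σ[ m ∈ ℕ ] k n ≈ k (π m)) ×
                       All (λ (i , j) → k j ≈ k (π i)) (proj₁ start) → Elem ((a , a′) ∷ ps)
          conclude (π , same , π-onto , agree) = sameType⇒elem
              (qm4 ℕ (↣-id ℕ) h (k ∘ π)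
                (λ p → h-onto (cl⊆ h∈ p))
                (λ p → let n , q = k-onto (cl⊆ (k∈ ∘ π) p) ; m , r = π-onto n in m , ≈-trans q r)
                same a a′
                (λ (n , q) → a∉ (cl-resp (≈-sym q) (h∈ n)))
                (λ (n , q) → a′∉ (cl-resp (≈-sym q) (k∈ (π n)))))
              {(a , a′) ∷ ps}
              ((inj₂ zero , ≈-refl , ≈-refl) ∷
               LAll.map (λ p∈ → let i , j , ij∈ , q , r = ∈ₚ-on h k (proj₁ start) p∈ in
                 inj₁ i , q , ≈-trans r (LAll.lookup agree ij∈)) (proj₁ (proj₂ start)))

      -- Enumerating a closure by the natural numbers requires a point in it. It can be empty only
      -- for the empty map, and then (QM4) is applied to the empty closed set.
      extendGeneric : ∀ {a a′} ps → Elem ps → ¬ a ∈cl dom ps → ¬ a′ ∈cl cod ps →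
        Dec (Σ[ m ∈ Carrier ] m ∈cl dom ps) → Elem ((a , a′) ∷ ps)
      extendGeneric (p ∷ ps) e a∉ a′∉ (no empty) = ⊥-elim (empty (proj₁ p , cl-here))
      extendGeneric {a} {a′} [] e a∉ a′∉ (no empty) =
        sameType⇒elem (qm4 ⊥ ⊥↣ℕ (λ ()) (λ ()) none none
            (λ φ → mk⇔ (satisfies-cong (λ ()) φ) (satisfies-cong (λ ()) φ))
            a a′ (λ ()) (λ ()))
          {(a , a′) ∷ []} ((inj₂ zero , ≈-refl , ≈-refl) ∷ [])
        where
        none : {f : ⊥ → Carrier} → Closed (Range f)
        none p = ⊥-elim (empty (_ , monotone _ _ (λ ()) p))
      extendGeneric ps e a∉ a′∉ (yes (m , m∈)) =
        let m′ , e′ = fqm5 {m} ps e m∈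
            h , h∈ , h-onto = enumerate em setoid (_∈cl dom ps) (qm3 (dom ps)) m∈
            k , k∈ , k-onto = enumerate em setoid (_∈cl cod ps) (qm3 (cod ps)) {m′} (fqm1 ps e′ m∈)
        in Extension.extension ps e h k h∈ h-onto k∈ k-onto a∉ a′∉

    wqm⇒fqm : IsFinitelyQuasiminimal M
    wqm⇒fqm = record { fqm1 = fqm1 ; fqm3 = qm3 ; fqm4 = λ ps e a∉ a′∉ → extendGeneric ps e a∉ a′∉ em ; fqm5 = fqm5 }

-- Finite quasiminimality passes to all members of the class

module Inheritance (em : ExcludedMiddle 0ℓ) {L : Language} where
  open FiniteQuasiminimality em {L}

  module EmbeddedClosure {A B : PregeometryStructure L} (emb : ClosedEmbedding A B) where
    private
      module A = PregeometryStructure A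
      module B = PregeometryStructure B
      module SB = Setoid B.setoid
      module GA = Pregeometry em A
      module GB = Pregeometry em B
      module TA = QFTypes A.structure
      module TB = QFTypes B.structure
    open ClosedEmbedding emb renaming (cong to to-cong)

    map-pairs : List (A.Carrier × A.Carrier) → List (B.Carrier × B.Carrier)
    map-pairs = List.map (map² embedding)

    image-list : ∀ F {b} → B.Image to A.⟪ F ⟫ b ⇔ (b B.∈ List.map to F)
    image-list F = mk⇔
      (λ (a , a∈ , e) → LAnyₚ.map⁺ (LAny.map (λ q → SB.trans e (to-cong q)) a∈))
      (λ b∈ → let a , a∈ , e = find (LAnyₚ.map⁻ b∈) in a , LAny.map (λ { refl → SA.refl }) a∈ , e)
      where module SA = Setoid A.setoid

    cl⁺ : ∀ {F a} → a GA.∈cl F → to a GB.∈cl List.map to F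
    cl⁺ {F} {a} p = B.monotone _ _ (Equivalence.to (image-list F)) (Equivalence.to (cl-restricts A.⟪ F ⟫ a) p)

    cl⁻ : ∀ {F a} → to a GB.∈cl List.map to F → a GA.∈cl F
    cl⁻ {F} {a} p = Equivalence.from (cl-restricts A.⟪ F ⟫ a) (B.monotone _ _ (Equivalence.from (image-list F)) p)

    ind⁺ : ∀ {F} D → GA.Ind F D → GB.Ind (List.map to F) (List.map to D)
    ind⁺ []          _       = _
    ind⁺ {F} (d ∷ D) (p , i) = (p ∘ cl⁻ ∘ subst (to d GB.∈cl_) (sym (map-++ to D F))) , ind⁺ D i

    dom-map : ∀ ps → TB.dom (map-pairs ps) ≡ List.map to (TA.dom ps)
    dom-map ps = trans (sym (map-∘ ps)) (map-∘ ps)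

    cod-map : ∀ ps → TB.cod (map-pairs ps) ≡ List.map to (TA.cod ps)
    cod-map ps = trans (sym (map-∘ ps)) (map-∘ ps)

    elem⁺ : ∀ {ps} → TA.Elem ps → TB.Elem (map-pairs ps)
    elem⁺ {ps} = Equivalence.to (elem-embedding embedding ps)

    elem⁻ : ∀ {ps} → TB.Elem (map-pairs ps) → TA.Elem ps
    elem⁻ {ps} = Equivalence.from (elem-embedding embedding ps)

    -- Only (QM5) is not immediate: the element found in `B` is algebraic over the image, by (QM1),
    -- so it lies in the closed range and comes from `A`.
    restrict : IsFinitelyQuasiminimal B → IsFinitelyQuasiminimal A
    restrict fqm = record
      { fqm1 = λ {a} {a′} ps e p → cl⁻ (subst (to a′ GB.∈cl_) (cod-map ps)
          (fqm1 (map-pairs ps) (elem⁺ {(a , a′) ∷ ps} e) (subst (to a GB.∈cl_) (sym (dom-map ps)) (cl⁺ p))))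
      ; fqm3 = λ F → let module I = Injection (fqm3 (List.map to F)) in record
          { to        = λ (a , p) → I.to (to a , cl⁺ p)
          ; cong      = λ e → I.cong (to-cong e)
          ; injective = λ e → injective (I.injective e)
          }
      ; fqm4 = λ {a} {a′} ps e p q → elem⁻ {(a , a′) ∷ ps} (fqm4 (map-pairs ps) (elem⁺ {ps} e)
          (λ r → p (cl⁻ (subst (to a GB.∈cl_) (dom-map ps) r)))
          (λ r → q (cl⁻ (subst (to a′ GB.∈cl_) (cod-map ps) r))))
      ; fqm5 = λ {a} ps e p →
          let b , e₁ = fqm5 (map-pairs ps) (elem⁺ {ps} e) (subst (to a GB.∈cl_) (sym (dom-map ps)) (cl⁺ p))
              b∈ = fqm1 (map-pairs ps) e₁ (subst (to a GB.∈cl_) (sym (dom-map ps)) (cl⁺ p))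
              a′ , q = GB.closed-list closed-range
                (LAllₚ.map⁺ (LAll.tabulate {xs = TA.cod ps} λ {c} _ → c , SB.refl))
                (subst (b GB.∈cl_) (cod-map ps) b∈)
          in a′ , elem⁻ {(a , a′) ∷ ps} (TB.elem-mono {(to a , b) ∷ map-pairs ps} e₁
               (here (SB.refl , SB.sym q) ∷ LAll.tabulate (there ∘ FamilyTypes.∈⇒∈ₚ B.structure)))
      }
      where open IsFinitelyQuasiminimal fqm

  module _ {B : PregeometryStructure L} where
    private module B = PregeometryStructure B
    open Pregeometry em B
    open QFTypes B.structure
    open Setoid B.setoid using () renaming (refl to ≈-refl; sym to ≈-sym; trans to ≈-trans)

    Cover : List B.Carrier → Set₁
    Cover xs = Σ[ A ∈ PregeometryStructure L ] IsFinitelyQuasiminimal A ×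
      Σ[ emb ∈ ClosedEmbedding A B ] All (B.Range (ClosedEmbedding.to emb)) xs

    private
      infix 4 _⊆ₚ_
      _⊆ₚ_ : List (B.Carrier × B.Carrier) → List (B.Carrier × B.Carrier) → Set
      qs ⊆ₚ ps = All (_∈ₚ ps) qs

      dom-⊆ : ∀ {qs ps} → qs ⊆ₚ ps → ∀ {a} → a ∈cl dom qs → a ∈cl dom ps
      dom-⊆ s = cl-trans (LAllₚ.map⁺ (LAll.map (cl-∈ ∘ LAnyₚ.map⁺ ∘ LAny.map proj₁) s))

      cod-⊆ : ∀ {qs ps} → qs ⊆ₚ ps → ∀ {a} → a ∈cl cod qs → a ∈cl cod ps
      cod-⊆ s = cl-trans (LAllₚ.map⁺ (LAll.map (cl-∈ ∘ LAnyₚ.map⁺ ∘ LAny.map proj₂) s))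

      module _ {A} (emb : ClosedEmbedding A B) where
        open ClosedEmbedding emb
        open EmbeddedClosure emb using (map-pairs)

        preimages : ∀ {ps} → All (B.Range to) (dom ps ++ cod ps) →
                    Σ[ qs ∈ List _ ] ps ⊆ₚ map-pairs qs × map-pairs qs ⊆ₚ ps
        preimages {ps} r = go ps (LAllₚ.++⁻ˡ (dom ps) r) (LAllₚ.++⁻ʳ (dom ps) r)
          where
          go : ∀ ps → All (B.Range to) (dom ps) → All (B.Range to) (cod ps) →
               Σ[ qs ∈ List _ ] ps ⊆ₚ map-pairs qs × map-pairs qs ⊆ₚ ps
          go []       []             []             = [] , [] , []
          go (p ∷ ps) ((a , e) ∷ as) ((b , f) ∷ bs) with qs , s , t ← go ps as bs =
            (a , b) ∷ qs , here (e , f) ∷ LAll.map there s ,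
            here (≈-sym e , ≈-sym f) ∷ LAll.map there t

        preimage : ∀ {F} → All (B.Range to) F →
                   Σ[ G ∈ List _ ] All (_∈cl List.map to G) F × All (_∈cl F) (List.map to G)
        preimage []             = [] , [] , []
        preimage ((a , e) ∷ as) with G , s , t ← preimage as =
          a ∷ G , cl-∈ (here e) ∷ LAll.map cl-there s , cl-∈ (here (≈-sym e)) ∷ LAll.map cl-there t

    -- Each condition concerns finitely many elements, which lie together in a closed copy of a
    -- finitely quasiminimal structure. A closed range containing `F` also contains its closure,
    -- whence countability.
    covered : (∀ xs → Cover xs) → IsFinitelyQuasiminimal B
    covered cover = record { fqm1 = q1 ; fqm3 = q3 ; fqm4 = q4 ; fqm5 = q5 }
      where
      q1 : ∀ {a a′} ps → Elem ((a , a′) ∷ ps) → a ∈cl dom ps → a′ ∈cl cod ps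
      q1 {a} {a′} ps e p
        with A , fqm , emb , r ← cover (a ∷ a′ ∷ dom ps ++ cod ps)
        with (x , ex) ∷ (y , ey) ∷ rs ← r
        with qs , s , t ← preimages emb {ps} rs =
        cod-⊆ t (cl-resp (≈-sym ey) (subst (to y ∈cl_) (sym (cod-map qs)) (cl⁺ (fqm1 qs
          (elem⁻ {(x , y) ∷ qs} (elem-mono {(a , a′) ∷ ps} e (here (≈-sym ex , ≈-sym ey) ∷ LAll.map there t)))
          (cl⁻ (subst (to x ∈cl_) (dom-map qs) (cl-resp ex (dom-⊆ s p))))))))
        where
        open EmbeddedClosure emb
        open IsFinitelyQuasiminimal fqm
        open ClosedEmbedding emb using (to)

      q3 : ∀ F → Countable (subsetoid B.setoid (_∈cl F))
      q3 F with A , fqm , emb , r ← cover F with G , s , t ← preimage emb r = record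
        { to        = λ (b , p) → I.to (proj₁ (pre p) , cl⁻ (cl-resp (proj₂ (pre p)) (cl-trans s p)))
        ; cong      = λ {(b , p)} {(b′ , p′)} e → I.cong (injective (≈-trans (≈-sym (proj₂ (pre p))) (≈-trans e (proj₂ (pre p′)))))
        ; injective = λ {(b , p)} {(b′ , p′)} e → ≈-trans (proj₂ (pre p)) (≈-trans (to-cong (I.injective e)) (≈-sym (proj₂ (pre p′))))
        }
        where
        open EmbeddedClosure emb
        open IsFinitelyQuasiminimal fqm
        open ClosedEmbedding emb renaming (cong to to-cong)
        module I = Injection (fqm3 G)
        pre : ∀ {b} → b ∈cl F → B.Range to b
        pre = closed-list closed-range r

      q4 : ∀ {a a′} ps → Elem ps → ¬ a ∈cl dom ps → ¬ a′ ∈cl cod ps → Elem ((a , a′) ∷ ps)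
      q4 {a} {a′} ps e p q
        with A , fqm , emb , r ← cover (a ∷ a′ ∷ dom ps ++ cod ps)
        with (x , ex) ∷ (y , ey) ∷ rs ← r
        with qs , s , t ← preimages emb {ps} rs =
        elem-mono {(to x , to y) ∷ map-pairs qs} (elem⁺ {(x , y) ∷ qs} (fqm4 qs (elem⁻ {qs} (elem-mono {ps} e t))
            (λ c → p (dom-⊆ t (cl-resp (≈-sym ex) (subst (to x ∈cl_) (sym (dom-map qs)) (cl⁺ c)))))
            (λ c → q (cod-⊆ t (cl-resp (≈-sym ey) (subst (to y ∈cl_) (sym (cod-map qs)) (cl⁺ c)))))))
          (here (ex , ey) ∷ LAll.map there s)
        where
        open EmbeddedClosure emb
        open IsFinitelyQuasiminimal fqm
        open ClosedEmbedding emb using (to)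

      q5 : ∀ {a} ps → Elem ps → a ∈cl dom ps → Σ[ a′ ∈ B.Carrier ] Elem ((a , a′) ∷ ps)
      q5 {a} ps e p
        with A , fqm , emb , r ← cover (a ∷ dom ps ++ cod ps)
        with (x , ex) ∷ rs ← r
        with qs , s , t ← preimages emb {ps} rs =
        let y , e₁ = fqm5 qs (elem⁻ {qs} (elem-mono {ps} e t))
              (cl⁻ (subst (to x ∈cl_) (dom-map qs) (cl-resp ex (dom-⊆ s p))))
        in to y , elem-mono {(to x , to y) ∷ map-pairs qs} (elem⁺ {(x , y) ∷ qs} e₁)
             (here (ex , ≈-refl) ∷ LAll.map there s)
        where
        open EmbeddedClosure emb
        open IsFinitelyQuasiminimal fqm
        open ClosedEmbedding emb using (to)

  -- Totality of the index order puts finitely many elements into a single member of the chain.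
  coveredByChain : ∀ (𝒞 : Chain L) {B} → IsUnion 𝒞 B →
    (∀ i → IsFinitelyQuasiminimal (Chain.obj 𝒞 i)) → ∀ xs → Cover {B} xs
  coveredByChain 𝒞 {B} u fqm xs = let i , r = index∋ xs in obj i , fqm i , inclusion i , r
    where
    open Chain 𝒞
    open IsUnion u
    open PregeometryStructure B using (Range; setoid)
    open Setoid setoid using () renaming (sym to ≈-sym; trans to ≈-trans)
    move : ∀ {i j} → i ≤ᴵ j → ∀ {b} → Range (incl i) b → Range (incl j) b
    move i≤j (x , e) = map i≤j x , ≈-trans e (≈-sym (commutes i≤j x))
    index∋ : ∀ xs → Σ[ i ∈ I ] All (Range (incl i)) xs
    index∋ [] = start , []
    index∋ (x ∷ xs) with i , rs ← index∋ xs with j , y , e ← covers x with TotalOrder.total index i j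
    ... | inj₁ i≤j = j , (y , e) ∷ LAll.map (move i≤j) rs
    ... | inj₂ j≤i = i , move j≤i (y , e) ∷ rs

  coveredByIsomorphism : ∀ {A B} → PregeometryIsomorphism A B → IsFinitelyQuasiminimal A → ∀ xs → Cover {B} xs
  coveredByIsomorphism {A} φ fqm xs = A , fqm , closedEmbedding , LAll.tabulate (λ {x} _ → surjective x)
    where open PregeometryIsomorphism φ

  module _ {M : PregeometryStructure L} (fqm : IsFinitelyQuasiminimal M) where

    𝒦⁻-fqm : ∀ {A} → 𝒦⁻ M A → IsFinitelyQuasiminimal A
    𝒦⁻-fqm itself        = fqm
    𝒦⁻-fqm (closedSub e) = EmbeddedClosure.restrict e fqm
    𝒦⁻-fqm (iso e k)     = covered (coveredByIsomorphism e (𝒦⁻-fqm k))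

    𝒦-fqm : ∀ {A} → 𝒦 M A → IsFinitelyQuasiminimal A
    𝒦-fqm (base k)      = 𝒦⁻-fqm k
    𝒦-fqm (iso e k)     = covered (coveredByIsomorphism e (𝒦-fqm k))
    𝒦-fqm (union 𝒞 k u) = covered (coveredByChain 𝒞 u (λ i → 𝒦-fqm (k i)))

-- Countable models

module CountableModels (em : ExcludedMiddle 0ℓ) {L : Language} (N : PregeometryStructure L)
    (fqm : FiniteQuasiminimality.IsFinitelyQuasiminimal em N) where
  open PregeometryStructure N hiding (Independent)
  open Setoid setoid using () renaming (refl to ≈-refl; sym to ≈-sym; trans to ≈-trans)
  open Pregeometry em N
  open QFTypes structure
  open FamilyTypes structure
  open FiniteQuasiminimality.IsFinitelyQuasiminimal fqm

  record CountableModel (P : Pred Carrier 0ℓ) : Set₁ where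
    field
      closed : Closed P
      inf    : InfDim P
      enum   : ℕ → Carrier
      enum∈  : ∀ n → P (enum n)
      index  : ∀ {m} → P m → Σ[ n ∈ ℕ ] m ≈ enum n

  identity : List Carrier → List (Carrier × Carrier)
  identity = List.map λ x → x , x

  elem-identity : ∀ F → Elem (identity F)
  elem-identity F = sameType⇒elem {v = id} {id} (λ φ → mk⇔ id id)
    (LAllₚ.map⁺ (LAll.tabulate {xs = F} λ {x} _ → x , ≈-refl , ≈-refl))

  swap-swap : (ps : List (Carrier × Carrier)) → List.map swap (List.map swap ps) ≡ ps
  swap-swap []       = refl
  swap-swap (p ∷ ps) = cong (p ∷_) (swap-swap ps)

  -- An algebraic element has its image in the closure of the image of the map, hence in `P`; a
  -- generic one may go to any generic element, and the infinite-dimensional `P` contains one.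
  elem-forth : ∀ {P} → Closed P → InfDim P → ∀ ps → Elem ps → All P (cod ps) →
               ∀ a → Σ[ b ∈ Carrier ] P b × Elem ((a , b) ∷ ps)
  elem-forth closed inf ps e cod⊆ a with em {a ∈cl dom ps}
  ... | yes p with b , e₁ ← fqm5 ps e p = b , closed-list closed cod⊆ (fqm1 ps e₁ p) , e₁
  ... | no ¬p with b , q , ¬q ← inf (cod ps) = b , q , fqm4 ps e ¬p ¬q

  elem-back : ∀ {P} → Closed P → InfDim P → ∀ ps → Elem ps → All P (dom ps) →
              ∀ b → Σ[ a ∈ Carrier ] P a × Elem ((a , b) ∷ ps)
  elem-back {P} closed inf ps e dom⊆ b
    with a , q , e₁ ← elem-forth closed inf (List.map swap ps) (elem-swap {ps} e)
                        (subst (All P) (sym (cod-swap ps)) dom⊆) b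
    = a , q , subst (λ qs → Elem ((a , b) ∷ qs)) (swap-swap ps) (elem-swap {(b , a) ∷ List.map swap ps} e₁)

  module _ {P Q : Pred Carrier 0ℓ} (mP : CountableModel P) (mQ : CountableModel Q) where
    private
      module P = CountableModel mP
      module Q = CountableModel mQ

    ModelIsomorphism : List (Carrier × Carrier) → Set
    ModelIsomorphism ps =
      Σ[ g ∈ (ℕ → Carrier) ] SameType structure P.enum g × (∀ n → Q (g n)) ×
        (∀ {m} → Q m → Σ[ n ∈ ℕ ] m ≈ g n) ×
        All (λ (a , b) → Σ[ n ∈ ℕ ] a ≈ P.enum n × b ≈ g n) ps

    -- The isomorphism is recorded as an enumeration of `Q` with the same type as that of `P`, so
    -- that both models become images of one structure on the natural numbers.
    modelIsomorphism : ∀ ps → Elem ps → All P (dom ps) → All Q (cod ps) → ModelIsomorphism ps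
    modelIsomorphism ps e dom⊆ cod⊆ = conclude (indices ps dom⊆ cod⊆)
      where
      f = on P.enum Q.enum

      Indexed : List (Carrier × Carrier) → List (ℕ × ℕ) → Set
      Indexed ps is = All (_∈ₚ ps) (List.map f is) ×
        All (λ (a , b) → Σ[ i ∈ ℕ ] Σ[ j ∈ ℕ ] (i , j) ∈≡ is × a ≈ P.enum i × b ≈ Q.enum j) ps

      indices : ∀ ps → All P (dom ps) → All Q (cod ps) → Σ[ is ∈ List (ℕ × ℕ) ] Indexed ps is
      indices []       _        _        = [] , [] , []
      indices (_ ∷ ps) (p ∷ p*) (q ∷ q*)
        with is , s , t ← indices ps p* q* | i , e ← P.index p | j , r ← Q.index q =
        (i , j) ∷ is , here (≈-sym e , ≈-sym r) ∷ LAll.map there s ,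
        (i , j , here refl , e , r) ∷ LAll.map (λ (i , j , k , u) → i , j , there k , u) t

      forth : ∀ is → Elem (List.map f is) → ∀ n → Σ[ m ∈ ℕ ] Elem (List.map f ((n , m) ∷ is))
      forth is e n = indexed (elem-forth Q.closed Q.inf (List.map f is) e
          (LAllₚ.map⁺ (LAllₚ.map⁺ (LAll.tabulate {xs = is} λ {ij} _ → Q.enum∈ (proj₂ ij)))) (P.enum n))
        where
        indexed : Σ[ b ∈ Carrier ] Q b × Elem ((P.enum n , b) ∷ List.map f is) → _
        indexed (b , q , e₁) = let m , r = Q.index q in
          m , elem-mono {(P.enum n , b) ∷ List.map f is} e₁ (here (≈-refl , ≈-sym r) ∷ LAll.tabulate (there ∘ ∈⇒∈ₚ))

      back : ∀ is → Elem (List.map f is) → ∀ n → Σ[ m ∈ ℕ ] Elem (List.map f ((m , n) ∷ is))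
      back is e n = indexed (elem-back P.closed P.inf (List.map f is) e
          (LAllₚ.map⁺ (LAllₚ.map⁺ (LAll.tabulate {xs = is} λ {ij} _ → P.enum∈ (proj₁ ij)))) (Q.enum n))
        where
        indexed : Σ[ a ∈ Carrier ] P a × Elem ((a , Q.enum n) ∷ List.map f is) → _
        indexed (a , q , e₁) = let m , r = P.index q in
          m , elem-mono {(a , Q.enum n) ∷ List.map f is} e₁ (here (≈-sym r , ≈-refl) ∷ LAll.tabulate (there ∘ ∈⇒∈ₚ))

      conclude : Σ[ is ∈ List (ℕ × ℕ) ] Indexed ps is → ModelIsomorphism ps
      conclude (is , s , t) = finish (backAndForth P.enum Q.enum is (elem-mono {ps} e s)
          (λ js _ → forth js) (λ js _ → back js))
        where
        finish : Σ[ π ∈ (ℕ → ℕ) ] SameType structure P.enum (Q.enum ∘ π) ×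
                   (∀ n → Σ[ m ∈ ℕ ] Q.enum n ≈ Q.enum (π m)) ×
                   All (λ (i , j) → Q.enum j ≈ Q.enum (π i)) is → ModelIsomorphism ps
        finish (π , same , onto , agree) = Q.enum ∘ π , same , Q.enum∈ ∘ π ,
          (λ q → let n , r = Q.index q ; m , u = onto n in m , ≈-trans r u) ,
          LAll.map (λ (i , j , ij∈ , p , q) → i , p , ≈-trans q (LAll.lookup agree ij∈)) t

  evals-var : {V : Set} (v : V → Carrier) → ∀ {n} (xs : Vec V n) → evals structure v (Vec.map var xs) ≡ Vec.map v xs
  evals-var v []       = refl
  evals-var v (x ∷ xs) = cong (v x ∷_) (evals-var v xs)

  module _ (inf : InfDim (λ _ → ⊤)) where

    -- A value outside the closure of its arguments would have the same type over them as a further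
    -- generic element `y′`; the formula saying that it is the value would make the two equal.
    fun∈cl : ∀ {n} (f : Language.FunSym L n) (xs : Vec Carrier n) → fun f xs ∈cl Vec.toList xs
    fun∈cl {n} f xs = Classical.by-contradiction em λ f∉ → absurd f∉ (inf (y ∷ F))
      where
      y = fun f xs
      F = Vec.toList xs
      v : Carrier → Fin (suc n) → Carrier
      v a = Vec.lookup (a ∷ xs)
      φ : QFFormula L (Fin (suc n))
      φ = var zero ≐ᶠ app f (Vec.map var (Vec.map suc (Vec.allFin n)))
      vars : ∀ a → evals structure (v a) (Vec.map var (Vec.map suc (Vec.allFin n))) ≡ xs
      vars a = trans (evals-var (v a) (Vec.map suc (Vec.allFin n)))
        (trans (sym (Vecₚ.map-∘ (v a) suc (Vec.allFin n))) (Vecₚ.map-lookup-allFin xs))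
      in-identity : ∀ {n} (xs : Vec Carrier n) i → (Vec.lookup xs i , Vec.lookup xs i) ∈ₚ identity (Vec.toList xs)
      in-identity (x ∷ xs) zero    = here (≈-refl , ≈-refl)
      in-identity (x ∷ xs) (suc i) = there (in-identity xs i)
      absurd : ¬ y ∈cl F → Σ[ m ∈ Carrier ] ⊤ × ¬ m ∈cl y ∷ F → ⊥
      absurd f∉ (y′ , _ , y′∉) = y′∉ (cl-∈ (here (subst (λ us → y′ ≈ fun f us) (vars y′)
          (Equivalence.to (elem⇒sameType {(y , y′) ∷ identity F} e {v = v y} {v y′}
            (λ { zero → here (≈-refl , ≈-refl) ; (suc i) → there (in-identity xs i) }) φ)
            (subst (λ us → y ≈ fun f us) (sym (vars y)) ≈-refl)))))
        where
        e : Elem ((y , y′) ∷ identity F)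
        e = fqm4 (identity F) (elem-identity F)
          (f∉ ∘ subst (y ∈cl_) (trans (sym (map-∘ F)) (map-id F)))
          (y′∉ ∘ cl-there ∘ subst (y′ ∈cl_) (trans (sym (map-∘ F)) (map-id F)))

  -- The models cl(e₀, e₁, …, B) for a fixed sequence eₙ of elements of P independent over Q.
  module Generated {P : Pred Carrier 0ℓ} (P-closed : Closed P) (P-inf : InfDim P) (Q : List Carrier) where

    prefix : ℕ → List Carrier
    prefix zero    = []
    prefix (suc n) = proj₁ (P-inf (prefix n ++ Q)) ∷ prefix n

    prefix-ind : ∀ n → Ind Q (prefix n)
    prefix-ind zero    = _
    prefix-ind (suc n) = proj₂ (proj₂ (P-inf (prefix n ++ Q))) , prefix-ind n

    prefix-length : ∀ n → length (prefix n) ≡ n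
    prefix-length zero    = refl
    prefix-length (suc n) = cong suc (prefix-length n)

    H : List Carrier → Pred Carrier 0ℓ
    H B x = Σ[ n ∈ ℕ ] x ∈cl prefix n ++ B

    stage-mono : ∀ {B m n} → m ≤ n → ∀ {x} → x ∈cl prefix m ++ B → x ∈cl prefix n ++ B
    stage-mono {B} {m} {n} m≤n {x} p = subst (λ k → x ∈cl prefix k ++ B) (ℕₚ.m∸n+n≡m m≤n) (go (n ℕ.∸ m))
      where
      go : ∀ k → x ∈cl prefix (k + m) ++ B
      go zero    = p
      go (suc k) = cl-there (go k)

    sameStage : ∀ {B F} → All (H B) F → Σ[ n ∈ ℕ ] All (_∈cl prefix n ++ B) F
    sameStage []             = 0 , []
    sameStage ((m , p) ∷ ps) with n , qs ← sameStage ps =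
      m ⊔ n , stage-mono (ℕₚ.m≤m⊔n m n) p ∷ LAll.map (stage-mono (ℕₚ.m≤n⊔m m n)) qs

    H-closed : ∀ B → Closed (H B)
    H-closed B p with F , F⊆ , q ← finitary _ p with n , r ← sameStage F⊆ = n , cl-trans r q

    base⊆H : ∀ B → All (H B) B
    base⊆H B = LAll.map (0 ,_) (cl-self B)

    H⊆ : ∀ {B R} → Closed R → (∀ n → All R (prefix n)) → All R B → H B ⊆ R
    H⊆ R-closed pre⊆ B⊆ (n , p) = closed-list R-closed (LAllₚ.++⁺ (pre⊆ n) B⊆) p

    H-mono : ∀ {B C} → All (H C) B → H B ⊆ H C
    H-mono {B} {C} B⊆ = H⊆ (H-closed C) (λ n → LAll.map (n ,_) (cl-selfˡ (prefix n))) B⊆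

    -- The sequence is generic over `Q`, hence over `D` and `B` together; symmetry turns this into
    -- independence of `D` over the sequence and `B`.
    H-indOver : ∀ {B} D → All (_∈cl Q) (D ++ B) → Ind B D → IndOver (H B) D
    H-indOver {B} D s i G G⊆ with n , r ← sameStage G⊆ =
      ind-base r (ind-swap D (prefix n) i (ind-base s (prefix-ind n)))

    H-inf : ∀ B → InfDim (H B)
    H-inf B = infDim λ n → prefix n , LAll.map (n ,_) (cl-selfˡ (prefix n)) ,
      ind-base [] (prefix-ind n) , prefix-length n

    private
      stage : ∀ B n → Σ[ h ∈ (ℕ → Carrier) ] (∀ k → h k ∈cl prefix (suc n) ++ B) ×
                        (∀ {m} → m ∈cl prefix (suc n) ++ B → Σ[ k ∈ ℕ ] m ≈ h k)
      -- With `suc n` the generating list is non-empty, which provides the point that `enumerate`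
      -- asks for.
      stage B n = enumerate em setoid (_∈cl prefix (suc n) ++ B) (fqm3 (prefix (suc n) ++ B)) cl-here

    H-model : ∀ B → CountableModel (H B)
    H-model B = record
      { closed = H-closed B
      ; inf    = H-inf B
      ; enum   = λ k → element (unpair k)
      ; enum∈  = λ k → element∈ (unpair k)
      ; index  = λ (n , p) → code n (proj₂ (proj₂ (stage B n)) (cl-there p))
      }
      where
      element : ℕ × ℕ → Carrier
      element (n , i) = proj₁ (stage B n) i
      element∈ : ∀ p → H B (element p)
      element∈ (n , i) = suc n , proj₁ (proj₂ (stage B n)) i
      code : ∀ n {m} → Σ[ i ∈ ℕ ] m ≈ proj₁ (stage B n) i → Σ[ k ∈ ℕ ] m ≈ element (unpair k)
      code n {m} (i , e) = pair (n , i) , subst (λ p → m ≈ element p) (sym (unpair-pair (n , i))) e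

-- Homogeneity of the monster model

-- If this injects into δ, then `C` and the natural numbers are strictly smaller than δ: the left
-- summand maps them into δ, and by Cantor's theorem the right one forbids an injection back.
bigSet : Set → Set
bigSet C = (C ⊎ ℕ) ⊎ ((C ⊎ ℕ) → Bool)

module _ (em : ExcludedMiddle 0ℓ) where

  <ᶜ-large : ∀ {C δ : Set} {S : Setoid 0ℓ 0ℓ} → bigSet C ↣ δ → Injection S (≡ₚ.setoid (C ⊎ ℕ)) → S <ᶜ δ
  <ᶜ-large {C} {δ} {S} large f = record
    { to        = D.to ∘ inj₁ ∘ F.to
    ; cong      = λ e → cong (D.to ∘ inj₁) (F.cong e)
    ; injective = λ e → F.injective (inj₁-injective (D.injective e))
    } , λ g → let module G = Injection g in
      noInjectionFromSubsets em (C ⊎ ℕ) (F.to ∘ G.to ∘ D.to ∘ inj₂)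
        (λ e x → cong (_$ x) (inj₂-injective (D.injective (G.injective (F.injective e)))))
    where
    module D = Injection large
    module F = Injection f

-- Countable models as structures on the natural numbers

module Substructure (em : ExcludedMiddle 0ℓ) {L : Language} (N : PregeometryStructure L)
    (fqm : FiniteQuasiminimality.IsFinitelyQuasiminimal em N)
    (inf : Pregeometry.InfDim em N (λ _ → ⊤)) {P : Pred (PregeometryStructure.Carrier N) 0ℓ}
    (model : CountableModels.CountableModel em N fqm P) where
  open PregeometryStructure N
  open Setoid setoid using () renaming (refl to ≈-refl; sym to ≈-sym; trans to ≈-trans)
  open Pregeometry em N hiding (Ind)
  open CountableModels em N fqm
  open CountableModel model hiding (inf)

  private
    fun-index : ∀ {n} (f : Language.FunSym L n) (ns : Vec ℕ n) →
                Σ[ m ∈ ℕ ] fun f (Vec.map enum ns) ≈ enum m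
    fun-index f ns = index (closed-list closed (enum-all ns) (fun∈cl inf f (Vec.map enum ns)))
      where
      enum-all : ∀ {n} (ns : Vec ℕ n) → All P (Vec.toList (Vec.map enum ns))
      enum-all []       = []
      enum-all (n ∷ ns) = enum∈ n ∷ enum-all ns

    Image-mono : ∀ {X Y : Pred ℕ 0ℓ} → X ⊆ Y → Image enum X ⊆ Image enum Y
    Image-mono X⊆Y (n , p , e) = n , X⊆Y p , e

  countableStructure : Structure L
  countableStructure = record
    { setoid   = record
        { Carrier       = ℕ
        ; _≈_           = λ m n → enum m ≈ enum n
        ; isEquivalence = record { refl = ≈-refl ; sym = ≈-sym ; trans = ≈-trans }
        }
    ; fun      = λ f ns → proj₁ (fun-index f ns)
    ; rel      = λ R ns → rel R (Vec.map enum ns)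
    ; fun-cong = λ f {xs} {ys} e → ≈-trans (≈-sym (proj₂ (fun-index f xs)))
        (≈-trans (fun-cong f (Pointwise.map⁺ id e)) (proj₂ (fun-index f ys)))
    ; rel-resp = λ R e → rel-resp R (Pointwise.map⁺ id e)
    }

  countableSubstructure : PregeometryStructure L
  countableSubstructure = record
    { structure     = countableStructure
    ; cl            = λ X n → cl (Image enum X) (enum n)
    ; isPregeometry = record
        { respects   = λ X → respects (Image enum X)
        ; extensive  = λ X {n} p → extensive _ (n , p , ≈-refl)
        ; monotone   = λ X Y X⊆Y → monotone _ _ (Image-mono X⊆Y)
        ; idempotent = λ X p → idempotent _ (monotone _ _ (λ (n , q , e) → respects _ (≈-sym e) q) p)
        ; finitary   = λ X p → let F , F⊆ , q = finitary _ p ; ns , s , t = preimages F⊆ in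
            ns , s , closed-list (idempotent _) (LAll.map (λ (n , n∈ , e) → extensive _ (n , n∈ , e)) t) q
        ; exchange   = λ X {a} {b} p ¬p → monotone _ _
            (λ { (inj₁ (n , q , e)) → n , inj₁ q , e ; (inj₂ e) → a , inj₂ ≈-refl , e })
            (exchange _ (monotone _ _ (λ { (n , inj₁ q , e) → inj₁ (n , q , e)
                                         ; (n , inj₂ q , e) → inj₂ (≈-trans e q) }) p) ¬p)
        }
    }
    where
    preimages : ∀ {X F} → All (Image enum X) F → Σ[ ns ∈ List ℕ ] All X ns ×
                All (Image enum (λ n → LAny.Any (λ m → enum n ≈ enum m) ns)) F
    preimages []                   = [] , [] , []
    preimages ((n , x , e) ∷ rest) with ns , s , t ← preimages rest =
      n ∷ ns , x ∷ s , (n , here ≈-refl , e) ∷ LAll.map (λ (m , m∈ , e) → m , there m∈ , e) t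

  inclusionEmbedding : ClosedEmbedding countableSubstructure N
  inclusionEmbedding = record
    { embedding    = record
        { to        = enum
        ; cong      = id
        ; injective = id
        ; fun-hom   = λ f ns → ≈-sym (proj₂ (fun-index f ns))
        ; rel-hom   = λ R ns → mk⇔ id id
        }
    ; closed-range = λ p → index (closed (monotone _ _ (λ (n , e) → closed-respects closed (≈-sym e) (enum∈ n)) p))
    ; cl-restricts = λ X n → mk⇔ id id
    }

  countableInf : ¬ PregeometryStructure.FiniteDimensional countableSubstructure
  countableInf (F , _ , spans) =
    let m , p , m∉ = CountableModel.inf model (List.map enum F)
        n , e = index p
    in m∉ (respects _ (≈-sym e) (monotone _ _
         (λ (k , k∈ , e) → LAnyₚ.map⁺ (LAny.map (≈-trans e) k∈)) (spans n)))

module Monster (em : ExcludedMiddle 0ℓ) (ac : ExtensionalChoice 0ℓ 0ℓ) {L : Language}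
    (M : PregeometryStructure L) (qm : IsQuasiminimal M) {δ : Set}
    (large : bigSet (PregeometryStructure.Carrier M) ↣ δ)
    (𝕄 : PregeometryStructure L) (monster : IsMonster M δ 𝕄) where
  open FiniteQuasiminimality em {L}
  open IsMonster monster
  private
    module M = PregeometryStructure M
    module M-cl = Pregeometry em M

  M-fqm : IsFinitelyQuasiminimal M
  M-fqm = wqm⇒fqm (IsQuasiminimal.isWeaklyQuasiminimal qm)

  𝕄-fqm : IsFinitelyQuasiminimal 𝕄
  𝕄-fqm = Inheritance.𝒦-fqm em M-fqm (proj₁ member)

  open PregeometryStructure 𝕄
  open Setoid setoid using () renaming (refl to ≈-refl; sym to ≈-sym; trans to ≈-trans)
  open Pregeometry em 𝕄
  open QFTypes structure
  open IsFinitelyQuasiminimal 𝕄-fqm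
  open CountableModels em 𝕄 𝕄-fqm

  M-inf : Pregeometry.InfDim em M (λ _ → ⊤)
  M-inf = Pregeometry.infDimensional em M (IsQuasiminimal.qm2 qm)

  𝕄-inf : InfDim (λ _ → ⊤)
  𝕄-inf = infDimensional (proj₂ member)

  -- The index found for an element depends on its presentation; representatives from `ac` make the
  -- choice compatible with equality.
  countable⇒<ᶜ : {S : Setoid 0ℓ 0ℓ} (h : ℕ → Setoid.Carrier S) →
                 (∀ x → Σ[ n ∈ ℕ ] Setoid._≈_ S x (h n)) → S <ᶜ δ
  countable⇒<ᶜ {S} h onto = <ᶜ-large em large record
    { to        = inj₂ ∘ proj₁ ∘ onto ∘ r
    ; cong      = λ e → cong (inj₂ ∘ proj₁ ∘ onto) (proj₂ (proj₂ (ac S)) e)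
    ; injective = λ {x} {y} e → S.trans (S.sym (r≈ x)) (S.trans (proj₂ (onto (r x)))
        (S.trans (S.reflexive (cong h (inj₂-injective e))) (S.trans (S.sym (proj₂ (onto (r y)))) (r≈ y))))
    }
    where
    module S = Setoid S
    r : S.Carrier → S.Carrier
    r = proj₁ (ac S)
    r≈ : ∀ x → r x S.≈ x
    r≈ = proj₁ (proj₂ (ac S))

  -- Universality places `M` in the monster model; the argument requiring (QM5) itself is carried
  -- out for elements of its range.
  j : ClosedEmbedding M 𝕄
  j = universal M (base itself , IsQuasiminimal.qm2 qm) (<ᶜ-large em large record
    { to        = inj₁ ∘ proj₁ (ac M.setoid)
    ; cong      = λ e → cong inj₁ (proj₂ (proj₂ (ac M.setoid)) e)
    ; injective = λ {x} {y} e → SM.trans (SM.sym (proj₁ (proj₂ (ac M.setoid)) x))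
        (SM.trans (SM.reflexive (inj₁-injective e)) (proj₁ (proj₂ (ac M.setoid)) y))
    })
    where module SM = Setoid M.setoid

  module J = ClosedEmbedding j
  module JC = Inheritance.EmbeddedClosure em j

  private module CM = CountableModels em M M-fqm

  image-inf : ∀ {P : Pred M.Carrier 0ℓ} → Pregeometry.InfDim em M P → InfDim (Image J.to P)
  image-inf inf = infDim λ n → let ds , p , i , l = Pregeometry.indList em M inf n in
    List.map J.to ds , LAllₚ.map⁺ (LAll.map (λ {d} q → d , q , ≈-refl) p) , JC.ind⁺ ds i , trans (length-map J.to ds) l

  image-closed : ∀ {P : Pred M.Carrier 0ℓ} → M.Closed P → Closed (Image J.to P)
  image-closed {P} closed {a} p =
    let F , F⊆ , q = finitary _ p
        G , P-G , r = preimages F⊆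
        x , e = closed-list J.closed-range (LAllₚ.map⁺ (LAll.tabulate {xs = G} λ {c} _ → c , ≈-refl)) (cl-trans r q)
    in x , Pregeometry.closed-list em M closed P-G (JC.cl⁻ (cl-resp e (cl-trans r q))) , e
    where
    preimages : ∀ {F} → All (Image J.to P) F → Σ[ G ∈ List M.Carrier ] All P G × All (_∈cl List.map J.to G) F
    preimages []                 = [] , [] , []
    preimages ((x , p , e) ∷ ps) with G , s , t ← preimages ps =
      x ∷ G , p ∷ s , cl-∈ (here e) ∷ LAll.map cl-there t

  image-model : ∀ {P} → CM.CountableModel P → CountableModel (Image J.to P)
  image-model model = record
    { closed = image-closed closed
    ; inf    = image-inf inf
    ; enum   = J.to ∘ enum
    ; enum∈  = λ n → enum n , enum∈ n , ≈-refl
    ; index  = λ (x , p , e) → let n , f = index p in n , ≈-trans e (J.cong f)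
    }
    where open CM.CountableModel model

  Aut : Set
  Aut = Automorphism structure

  infixr 8 _∙_
  _∙_ : Aut → Carrier → Carrier
  σ ∙ a = Isomorphism.to σ a

  module Copies {P₀ : Pred M.Carrier 0ℓ} (H₀-model : CM.CountableModel P₀) where
    private
      module H₀ = CM.CountableModel H₀-model
      module Sub = Substructure em M M-fqm M-inf H₀-model

      h₀ : ℕ → Carrier
      h₀ = J.to ∘ H₀.enum

    private
      module _ {P : Pred Carrier 0ℓ} (model : CountableModel P) (g : ℕ → Carrier)
               (same : SameType structure h₀ g) (g∈ : ∀ n → P (g n))
               (g-onto : ∀ {m} → P m → Σ[ n ∈ ℕ ] m ≈ g n) where

        satisfies : ∀ φ → Satisfies M.structure H₀.enum φ ⇔ Satisfies structure g φ
        satisfies φ = mk⇔ (to (same φ) ∘ to (satisfies-embedding J.embedding H₀.enum φ))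
                          (from (satisfies-embedding J.embedding H₀.enum φ) ∘ from (same φ))
          where open Equivalence

        evals-M : ∀ {n} (ns : Vec ℕ n) → evals M.structure H₀.enum (Vec.map var ns) ≡ Vec.map H₀.enum ns
        evals-M = CM.evals-var H₀.enum

        elem-h₀-g : ∀ ns → Elem (List.map (λ n → h₀ n , g n) ns)
        elem-h₀-g ns = sameType⇒elem same (LAllₚ.map⁺ (LAll.tabulate {xs = ns} λ {n} _ → n , ≈-refl , ≈-refl))

        dom-map : ∀ ns → dom (List.map (λ n → h₀ n , g n) ns) ≡ List.map J.to (List.map H₀.enum ns)
        dom-map ns = trans (sym (map-∘ ns)) (map-∘ ns)

        cod-map : ∀ ns → cod (List.map (λ n → h₀ n , g n) ns) ≡ List.map g ns
        cod-map ns = sym (map-∘ ns)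

        to-g : ∀ ns n → H₀.enum n M-cl.∈cl List.map H₀.enum ns → g n ∈cl List.map g ns
        to-g ns n p = subst (g n ∈cl_) (cod-map ns) (fqm1 (List.map (λ n → h₀ n , g n) ns) (elem-h₀-g (n ∷ ns))
          (subst (h₀ n ∈cl_) (sym (dom-map ns)) (JC.cl⁺ p)))

        from-g : ∀ ns n → g n ∈cl List.map g ns → H₀.enum n M-cl.∈cl List.map H₀.enum ns
        from-g ns n p = JC.cl⁻ (subst (h₀ n ∈cl_) (trans (cod-swap′ ns) (dom-map ns))
          (fqm1 (List.map (λ n → g n , h₀ n) ns) (sameType⇒elem (sameType-sym same)
              {(g n , h₀ n) ∷ List.map (λ n → g n , h₀ n) ns}
              (LAllₚ.map⁺ (LAll.tabulate {xs = n ∷ ns} λ {n} _ → n , ≈-refl , ≈-refl)))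
            (subst (g n ∈cl_) (map-∘ ns) p)))
          where
          cod-swap′ : ∀ ns → cod (List.map (λ n → g n , h₀ n) ns) ≡ dom (List.map (λ n → h₀ n , g n) ns)
          cod-swap′ ns = trans (sym (map-∘ ns)) (map-∘ ns)

        -- Equality of types gives the embedding. That it respects closures comes from (QM1) for
        -- finite sets, applied in both directions.
        copy : ClosedEmbedding Sub.countableSubstructure 𝕄
        copy = record
          { embedding    = record
              { to        = g
              ; cong      = λ {m} {n} → Equivalence.to (satisfies (var m ≐ᶠ var n))
              ; injective = λ {m} {n} → Equivalence.from (satisfies (var m ≐ᶠ var n))
              ; fun-hom   = λ f ns → subst (λ us → g (Structure.fun Sub.countableStructure f ns) ≈ fun f us) (evals-var g ns)
                  (Equivalence.to (satisfies (var (Structure.fun Sub.countableStructure f ns) ≐ᶠ app f (Vec.map var ns)))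
                    (subst (λ us → H₀.enum (Structure.fun Sub.countableStructure f ns) M.≈ M.fun f us) (sym (evals-M ns))
                      (Embedding.fun-hom (ClosedEmbedding.embedding Sub.inclusionEmbedding) f ns)))
              ; rel-hom   = λ R ns → mk⇔
                  (λ r → subst (rel R) (evals-var g ns) (Equivalence.to (satisfies (atom R (Vec.map var ns)))
                    (subst (M.rel R) (sym (evals-M ns)) r)))
                  (λ r → subst (M.rel R) (evals-M ns) (Equivalence.from (satisfies (atom R (Vec.map var ns)))
                    (subst (rel R) (sym (evals-var g ns)) r)))
              }
          ; closed-range = λ p → g-onto (CountableModel.closed model
              (monotone _ _ (λ (n , e) → closed-respects (CountableModel.closed model) (≈-sym e) (g∈ n)) p))
          ; cl-restricts = λ X n → mk⇔
              (λ p → let F , F⊆ , q = M.finitary _ p ; ns , s , t = preimages M.setoid H₀.enum F⊆ in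
                closed-list (idempotent _) (LAllₚ.map⁺ (LAll.map (λ {k} x → extensive _ (k , x , ≈-refl)) s))
                  (to-g ns n (M-cl.cl-trans (LAll.map M-cl.cl-∈ t) q)))
              (λ p → let F , F⊆ , q = finitary _ p ; ns , s , t = preimages setoid g F⊆ in
                M-cl.closed-list (M.idempotent _)
                  (LAllₚ.map⁺ (LAll.map (λ {k} x → M.extensive _ (k , x , Setoid.refl M.setoid)) s))
                  (from-g ns n (cl-trans (LAll.map cl-∈ t) q)))
          }
          where
          preimages : (S : Setoid 0ℓ 0ℓ) (f : ℕ → Setoid.Carrier S) → let open Setoid S using () renaming (_≈_ to _≈ˢ_) in
            ∀ {X : Pred ℕ 0ℓ} {F} → All (λ m → Σ[ n ∈ ℕ ] X n × m ≈ˢ f n) F →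
            Σ[ ns ∈ List ℕ ] All X ns × All (λ m → LAny.Any (m ≈ˢ_) (List.map f ns)) F
          preimages S f []                   = [] , [] , []
          preimages S f ((n , x , e) ∷ rest) with ns , s , t ← preimages S f rest =
            n ∷ ns , x ∷ s , here e ∷ LAll.map there t

    private
      substructureInClass : QuasiminimalClass M Sub.countableSubstructure
      substructureInClass = base (closedSub Sub.inclusionEmbedding) , Sub.countableInf

      image₀ : CountableModel (Image J.to P₀)
      image₀ = image-model H₀-model

    isModel : ∀ {P} → CountableModel P → IsModel M 𝕄 P
    isModel {P} model = conclude (modelIsomorphism image₀ model [] (elem-identity []) [] [])
      where
      conclude : ModelIsomorphism image₀ model [] → IsModel M 𝕄 P
      conclude (g , same , g∈ , g-onto , _) = record
        { model     = Sub.countableSubstructure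
        ; inClass   = substructureInClass
        ; inclusion = copy model g same g∈ g-onto
        ; range     = g-onto , λ (n , e) → closed-respects (CountableModel.closed model) (≈-sym e) (g∈ n)
        }

    -- Domain and image lie in countable models, and back-and-forth extends the map to an
    -- isomorphism of these. Both are copies of the same substructure of `M`, so the homogeneity of
    -- the monster model for models applies.
    extend : ∀ ps → Elem ps → Σ[ σ ∈ Aut ] All (λ (a , b) → σ ∙ a ≈ b) ps
    extend ps e = first (modelIsomorphism image₀ modelP [] (elem-identity []) [] [])
      where
      module Around (F : List Carrier) = Generated {λ _ → ⊤} (λ _ → tt) 𝕄-inf F
      P Q : Pred Carrier 0ℓ
      P = Around.H [] (dom ps)
      Q = Around.H [] (cod ps)
      modelP : CountableModel P
      modelP = Around.H-model [] (dom ps)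
      modelQ : CountableModel Q
      modelQ = Around.H-model [] (cod ps)

      first : ModelIsomorphism image₀ modelP [] → Σ[ σ ∈ Aut ] All (λ (a , b) → σ ∙ a ≈ b) ps
      first (g , same , g∈ , g-onto , _) =
        second (modelIsomorphism modelP′ modelQ ps e (Around.base⊆H [] (dom ps)) (Around.base⊆H [] (cod ps)))
        where
        modelP′ : CountableModel P
        modelP′ = record
          { closed = CountableModel.closed modelP ; inf = CountableModel.inf modelP
          ; enum = g ; enum∈ = g∈ ; index = g-onto }
        second : ModelIsomorphism modelP′ modelQ ps → Σ[ σ ∈ Aut ] All (λ (a , b) → σ ∙ a ≈ b) ps
        second (g′ , same′ , g′∈ , g′-onto , agree) = extendHomogeneous
          -- The isomorphism of the two models is absorbed into the second embedding, so the map to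
          -- be extended is the identity of the common copy.
          (homogeneous Sub.countableSubstructure Sub.countableSubstructure substructureInClass substructureInClass
            (copy modelP g same g∈ g-onto)
            (copy modelQ g′ (λ φ → mk⇔ (to (same′ φ) ∘ to (same φ)) (from (same φ) ∘ from (same′ φ))) g′∈ g′-onto)
            bounded bounded identityIso)
          where
          open Equivalence
          bounded : PregeometryStructure.setoid Sub.countableSubstructure <ᶜ δ
          bounded = countable⇒<ᶜ id (λ n → n , Setoid.refl (PregeometryStructure.setoid Sub.countableSubstructure))
          identityIso : Isomorphism Sub.countableStructure Sub.countableStructure
          identityIso = record
            { embedding = record
                { to = id ; cong = id ; injective = id
                ; fun-hom = λ f ns → Setoid.reflexive M.setoid
                    (cong (λ ms → H₀.enum (Structure.fun Sub.countableStructure f ms)) (sym (Vecₚ.map-id ns)))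
                ; rel-hom = λ R ns → mk⇔ (subst (M.rel R ∘ Vec.map H₀.enum) (sym (Vecₚ.map-id ns)))
                                         (subst (M.rel R ∘ Vec.map H₀.enum) (Vecₚ.map-id ns))
                }
            ; surjective = λ n → n , Setoid.refl M.setoid
            }
          extendHomogeneous : Σ[ σ ∈ Aut ] (∀ n → σ ∙ g n ≈ g′ n) → Σ[ σ ∈ Aut ] All (λ (a , b) → σ ∙ a ≈ b) ps
          extendHomogeneous (σ , σg) = σ , LAll.map (λ (n , p , q) →
            ≈-trans (Isomorphism.cong σ p) (≈-trans (σg n) (≈-sym q))) agree

  private
    module G = CM.Generated {λ _ → ⊤} (λ _ → tt) M-inf []
    module C = Copies (G.H-model [])

  abstract
    galois : ∀ ps → Elem ps → Σ[ σ ∈ Aut ] All (λ (a , b) → σ ∙ a ≈ b) ps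
    galois = C.extend

    countable-isModel : ∀ {P} → CountableModel P → IsModel M 𝕄 P
    countable-isModel = C.isModel

-- Automorphisms

module Automorphisms {L : Language} (S : Structure L) where
  open Structure S
  open Setoid setoid using () renaming (refl to ≈-refl; sym to ≈-sym; trans to ≈-trans)

  identityᵃ : Automorphism S
  identityᵃ = record
    { embedding = record
        { to = id ; cong = id ; injective = id
        ; fun-hom = λ f xs → Setoid.reflexive setoid (cong (fun f) (sym (Vecₚ.map-id xs)))
        ; rel-hom = λ R xs → mk⇔ (subst (rel R) (sym (Vecₚ.map-id xs))) (subst (rel R) (Vecₚ.map-id xs))
        }
    ; surjective = λ y → y , ≈-refl
    }

  infixr 9 _∘ᵃ_
  _∘ᵃ_ : Automorphism S → Automorphism S → Automorphism S
  σ ∘ᵃ τ = record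
    { embedding = record
        { to        = σ.to ∘ τ.to
        ; cong      = σ.cong ∘ τ.cong
        ; injective = τ.injective ∘ σ.injective
        ; fun-hom   = λ f xs → ≈-trans (σ.cong (τ.fun-hom f xs)) (≈-trans (σ.fun-hom f _)
            (Setoid.reflexive setoid (cong (fun f) (sym (Vecₚ.map-∘ σ.to τ.to xs)))))
        ; rel-hom   = λ R xs → mk⇔
            (λ r → subst (rel R) (sym (Vecₚ.map-∘ σ.to τ.to xs)) (to (σ.rel-hom R _) (to (τ.rel-hom R xs) r)))
            (λ r → from (τ.rel-hom R xs) (from (σ.rel-hom R _) (subst (rel R) (Vecₚ.map-∘ σ.to τ.to xs) r)))
        }
    ; surjective = λ y → let z , e = σ.surjective y ; x , f = τ.surjective z in x , ≈-trans e (σ.cong f)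
    }
    where
    module σ = Isomorphism σ
    module τ = Isomorphism τ
    open Equivalence

  inverseᵃ : Automorphism S → Automorphism S
  inverseᵃ σ = record
    { embedding = record
        { to        = inv
        ; cong      = λ {x} {y} e → σ.injective (≈-trans (≈-sym (spec x)) (≈-trans e (spec y)))
        ; injective = λ {x} {y} e → ≈-trans (spec x) (≈-trans (σ.cong e) (≈-sym (spec y)))
        ; fun-hom   = λ f xs → σ.injective (≈-trans (≈-sym (spec _))
            (≈-trans (fun-cong f (specs xs)) (≈-sym (σ.fun-hom f _))))
        ; rel-hom   = λ R xs → mk⇔
            (λ r → from (σ.rel-hom R _) (rel-resp R (specs xs) r))
            (λ r → rel-resp R (Pointwise.sym ≈-sym (specs xs)) (to (σ.rel-hom R _) r))
        }
    ; surjective = λ y → σ.to y , σ.injective (spec (σ.to y))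
    }
    where
    module σ = Isomorphism σ
    open Equivalence
    inv : Carrier → Carrier
    inv y = proj₁ (σ.surjective y)
    spec : ∀ y → y ≈ σ.to (inv y)
    spec y = proj₂ (σ.surjective y)
    specs : ∀ {n} (xs : Vec Carrier n) → xs ≋ Vec.map σ.to (Vec.map inv xs)
    specs []       = []
    specs (x ∷ xs) = spec x ∷ specs xs

  infixr 8 _∙_
  _∙_ : Automorphism S → Carrier → Carrier
  σ ∙ a = Isomorphism.to σ a

  ∙-inverseʳ : ∀ σ {a} → σ ∙ inverseᵃ σ ∙ a ≈ a
  ∙-inverseʳ σ {a} = ≈-sym (proj₂ (Isomorphism.surjective σ a))

  ∙-inverseˡ : ∀ σ {a} → inverseᵃ σ ∙ σ ∙ a ≈ a
  ∙-inverseˡ σ = Isomorphism.injective σ (∙-inverseʳ σ)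

  ∙-cong : ∀ σ {a b} → a ≈ b → σ ∙ a ≈ σ ∙ b
  ∙-cong σ = Isomorphism.cong σ

  ∙-inverse : ∀ σ {a b} → σ ∙ a ≈ b → inverseᵃ σ ∙ b ≈ a
  ∙-inverse σ e = ≈-trans (∙-cong (inverseᵃ σ) (≈-sym e)) (∙-inverseˡ σ)

  Fixes : Automorphism S → List Carrier → Set
  Fixes σ F = All (λ x → σ ∙ x ≈ x) F

-- Automorphisms extending finite partial maps

module Homogeneity (em : ExcludedMiddle 0ℓ) {L : Language} (𝕄 : PregeometryStructure L)
    (fqm : FiniteQuasiminimality.IsFinitelyQuasiminimal em 𝕄)
    (galois : ∀ ps → QFTypes.Elem (PregeometryStructure.structure 𝕄) ps →
      Σ[ σ ∈ Automorphism (PregeometryStructure.structure 𝕄) ]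
        All (λ (a , b) → PregeometryStructure._≈_ 𝕄 (Isomorphism.to σ a) b) ps) where
  open PregeometryStructure 𝕄 hiding (Independent)
  open Setoid setoid using () renaming (refl to ≈-refl; sym to ≈-sym; trans to ≈-trans)
  open Pregeometry em 𝕄
  open QFTypes structure
  open FiniteQuasiminimality.IsFinitelyQuasiminimal fqm
  open CountableModels em 𝕄 fqm
  open Automorphisms structure

  Aut : Set
  Aut = Automorphism structure

  graph : Aut → List Carrier → List (Carrier × Carrier)
  graph σ = List.map λ x → x , σ ∙ x

  elem-graph : ∀ σ {ps} → All (λ (a , b) → σ ∙ a ≈ b) ps → Elem ps
  elem-graph σ {ps} e = sameType⇒elem {v = id} {σ ∙_}
    (satisfies-embedding (Isomorphism.embedding σ) id) (LAll.map (λ {p} q → proj₁ p , ≈-refl , ≈-sym q) e)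

  dom-graph : ∀ σ F → dom (graph σ F) ≡ F
  dom-graph σ F = trans (sym (map-∘ F)) (map-id F)

  cod-graph : ∀ σ F → cod (graph σ F) ≡ List.map (σ ∙_) F
  cod-graph σ F = sym (map-∘ F)

  elem-graph′ : ∀ σ F → Elem (graph σ F)
  elem-graph′ σ F = elem-graph σ (LAllₚ.map⁺ (LAll.tabulate {xs = F} λ _ → ≈-refl))

  -- Automorphisms are those of the bare structure; they respect the closure operator because (QM1)
  -- makes it a matter of types.
  aut-cl : ∀ σ {F a} → a ∈cl F → σ ∙ a ∈cl List.map (σ ∙_) F
  aut-cl σ {F} {a} p = subst (σ ∙ a ∈cl_) (cod-graph σ F)
    (fqm1 (graph σ F) (elem-graph′ σ (a ∷ F)) (subst (a ∈cl_) (sym (dom-graph σ F)) p))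

  aut-closed : ∀ σ {P} → Closed P → ∀ {F} → All (λ x → P (σ ∙ x)) F → ∀ {a} → a ∈cl F → P (σ ∙ a)
  aut-closed σ closed F⊆ p = closed-list closed (LAllₚ.map⁺ F⊆) (aut-cl σ p)

  aut-cl⁻ : ∀ σ {F a} → σ ∙ a ∈cl List.map (σ ∙_) F → a ∈cl F
  aut-cl⁻ σ {F} p = cl-resp (∙-inverseˡ σ) (aut-closed (inverseᵃ σ) (clList-closed F)
    (LAllₚ.map⁺ (LAll.map (cl-resp (≈-sym (∙-inverseˡ σ))) (cl-self F))) p)

  fixes-cl : ∀ σ {F} → Fixes σ F → ∀ {a} → a ∈cl F → σ ∙ a ∈cl F
  fixes-cl σ {F} fix = aut-closed σ (clList-closed F) (LAll.zipWith (λ (e , p) → cl-resp (≈-sym e) p) (fix , cl-self F))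

  fixes-inverse : ∀ σ {F} → Fixes σ F → Fixes (inverseᵃ σ) F
  fixes-inverse σ = LAll.map (∙-inverse σ)

  fixes-∘ : ∀ σ τ {F} → Fixes σ F → Fixes τ F → Fixes (σ ∘ᵃ τ) F
  fixes-∘ σ τ fσ fτ = LAll.zipWith (λ (p , q) → ≈-trans (∙-cong σ q) p) (fσ , fτ)

  map-fixed : ∀ σ {F} → Fixes σ F → All (_∈cl List.map (σ ∙_) F) F
  map-fixed σ []       = []
  map-fixed σ (e ∷ es) = cl-∈ (here (≈-sym e)) ∷ LAll.map cl-there (map-fixed σ es)

  ind-aut : ∀ σ {F} D → Ind F D → Ind (List.map (σ ∙_) F) (List.map (σ ∙_) D)
  ind-aut σ []       _       = _
  ind-aut σ {F} (d ∷ D) (p , i) =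
    p ∘ aut-cl⁻ σ ∘ subst (σ ∙ d ∈cl_) (sym (map-++ (σ ∙_) D F)) , ind-aut σ D i

  private
    split-graph : ∀ {σ : Aut} ps F {τ} → All (λ (a , b) → σ ∙ a ≈ b) (ps ++ graph τ F) →
                  All (λ (a , b) → σ ∙ a ≈ b) ps × All (λ x → σ ∙ x ≈ τ ∙ x) F
    split-graph ps F s = LAllₚ.++⁻ˡ ps s , LAllₚ.map⁻ (LAllₚ.++⁻ʳ ps s)

  -- Generic pairs can be added to the graph of `σ` on `F` one by one, by (QM4), and the enlarged
  -- finite map again extends to an automorphism.
  extendIndependent : ∀ σ F ps → Ind F (dom ps) → Ind (List.map (σ ∙_) F) (cod ps) →
    Σ[ τ ∈ Aut ] All (λ (a , b) → τ ∙ a ≈ b) ps × All (λ x → τ ∙ x ≈ σ ∙ x) F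
  extendIndependent σ F ps i j = let τ , e = galois (ps ++ graph σ F) (elem ps i j) in τ , split-graph {τ} ps F {σ} e
    where
    dom-++ : ∀ ps → dom (ps ++ graph σ F) ≡ dom ps ++ F
    dom-++ ps = trans (map-++ proj₁ ps (graph σ F)) (cong (dom ps ++_) (dom-graph σ F))
    cod-++ : ∀ ps → cod (ps ++ graph σ F) ≡ cod ps ++ List.map (σ ∙_) F
    cod-++ ps = trans (map-++ proj₂ ps (graph σ F)) (cong (cod ps ++_) (cod-graph σ F))
    elem : ∀ ps → Ind F (dom ps) → Ind (List.map (σ ∙_) F) (cod ps) → Elem (ps ++ graph σ F)
    elem []             _       _       = elem-graph′ σ F
    elem ((a , b) ∷ ps) (p , i) (q , j) = fqm4 (ps ++ graph σ F) (elem ps i j)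
      (p ∘ subst (a ∈cl_) (dom-++ ps)) (q ∘ subst (b ∈cl_) (cod-++ ps))

  move : ∀ F {a b} → ¬ a ∈cl F → ¬ b ∈cl F → Σ[ σ ∈ Aut ] Fixes σ F × σ ∙ a ≈ b
  move F {a} {b} p q = let τ , e , fix = extendIndependent identityᵃ F ((a , b) ∷ []) (p , _)
                             (q ∘ subst (b ∈cl_) (map-id F) , _)
                       in τ , fix , LAll.head e

  -- The images of `F` are kept, and every further element is given an image in `P`, algebraic or
  -- generic over those already chosen as the case may be.
  moveInto : ∀ {P} → Closed P → InfDim P → ∀ σ F → All (λ x → P (σ ∙ x)) F → ∀ xs →
    Σ[ τ ∈ Aut ] All (λ x → τ ∙ x ≈ σ ∙ x) F × All (λ x → P (τ ∙ x)) xs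
  moveInto closed inf σ F F⊆ []       = σ , LAll.tabulate {xs = F} (λ _ → ≈-refl) , []
  moveInto {P} closed inf σ F F⊆ (x ∷ xs) = let τ , e , s = moveInto closed inf σ F F⊆ xs in add τ e s
    where
    add : ∀ τ → All (λ x → τ ∙ x ≈ σ ∙ x) F → All (λ x → P (τ ∙ x)) xs →
          Σ[ τ ∈ Aut ] All (λ x → τ ∙ x ≈ σ ∙ x) F × All (λ x → P (τ ∙ x)) (x ∷ xs)
    add τ e s = conclude (elem-forth closed inf (graph τ (xs ++ F)) (elem-graph′ τ (xs ++ F))
        (subst (All P) (sym (cod-graph τ (xs ++ F))) (LAllₚ.map⁺ (LAllₚ.++⁺ s
          (LAll.zipWith (λ (q , p) → closed-respects closed (≈-sym q) p) (e , F⊆))))) x)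
      where
      conclude : Σ[ y ∈ Carrier ] P y × Elem ((x , y) ∷ graph τ (xs ++ F)) → _
      conclude (y , p , el) with ρ , q ∷ r ← galois ((x , y) ∷ graph τ (xs ++ F)) el =
        let r′ = LAllₚ.map⁻ {xs = xs ++ F} r in ρ ,
        LAll.zipWith (λ (u , v) → ≈-trans u v) (LAllₚ.++⁻ʳ xs r′ , e) ,
        closed-respects closed (≈-sym q) p ∷
        LAll.zipWith (λ (u , v) → closed-respects closed (≈-sym u) v) (LAllₚ.++⁻ˡ xs r′ , s)

-- Types over countable models are determined by their restriction to a finite set

module LocalLift (em : ExcludedMiddle 0ℓ) {L : Language} {M : PregeometryStructure L}
    (wqm : IsWeaklyQuasiminimal M) (h h′ : ℕ → PregeometryStructure.Carrier M)
    (closed : PregeometryStructure.Closed M (PregeometryStructure.Range M h))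
    (closed′ : PregeometryStructure.Closed M (PregeometryStructure.Range M h′)) where
  open IsWeaklyQuasiminimal wqm
  open PregeometryStructure M
  open Setoid setoid using () renaming (refl to ≈-refl; sym to ≈-sym; trans to ≈-trans)
  open QFTypes structure
  open FamilyTypes structure

  pairs : List ℕ → List (Carrier × Carrier)
  pairs = List.map λ i → h i , h′ i

  -- Elementarity of the infinite map is kept in terms of finite parts, since it is for these that
  -- automorphisms supply it.
  Locally : List (Carrier × Carrier) → Set
  Locally ps = ∀ is → Elem (pairs is ++ ps)

  private
    ∈-pairs : ∀ {i is ps} → i ∈≡ is → (h i , h′ i) ∈ₚ pairs is ++ ps
    ∈-pairs i∈ = LAnyₚ.++⁺ˡ (∈⇒∈ₚ (∈-map⁺ (λ i → h i , h′ i) i∈))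

  -- This is (QM5) over an infinite closed set. Its hypotheses on types hold because a type is
  -- determined by its finite parts.
  lift : ∀ ps → Locally ps → ∀ {a} → cl (Range h ∪ ⟪ dom ps ⟫) a → Σ[ a′ ∈ Carrier ] Locally ((a , a′) ∷ ps)
  lift ps loc {a} p = conclude (qm5 ℕ (↣-id ℕ) h h′ (inj₁ closed) (inj₁ closed′)
      (locally⇒sameType id 0 refl h h′ λ k → pairs (List.upTo (suc k)) ++ ps , loc _ , λ i i≤k → ∈-pairs (∈-upTo⁺ (s≤s i≤k)))
      b b′
      (locally⇒sameType {ℕ ⊎ Fin (length ps)} [ id , (λ _ → 0) ] (inj₁ 0) refl _ _
        λ k → pairs (List.upTo (suc k)) ++ ps , loc _ ,
          λ { (inj₁ i) i≤k → ∈-pairs (∈-upTo⁺ (s≤s i≤k))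
            ; (inj₂ i) _   → LAnyₚ.++⁺ʳ (pairs (List.upTo (suc k))) (pairs-lookup ps i) })
      a (monotone _ _ (λ { (inj₁ (i , e)) → inj₁ i , e
                         ; (inj₂ m∈) → let i , e = Equivalence.from (range-pairs proj₁ ps) m∈ in inj₂ i , e }) p))
    where
    b b′ : Vec Carrier (length ps)
    b  = Vec.map proj₁ (Vec.fromList ps)
    b′ = Vec.map proj₂ (Vec.fromList ps)
    conclude : Σ[ a′ ∈ Carrier ] SameType structure [ h , Vec.lookup (b Vec.∷ʳ a) ] [ h′ , Vec.lookup (b′ Vec.∷ʳ a′) ] →
               Σ[ a′ ∈ Carrier ] Locally ((a , a′) ∷ ps)
    conclude (a′ , same) = a′ , λ is → sameType⇒elem same
      (LAllₚ.++⁺ (LAllₚ.map⁺ (LAll.tabulate {xs = is} λ {i} _ → inj₁ i , ≈-refl , ≈-refl))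
                 (LAll.map (λ (i , q) → inj₂ i , q) (pairs-snoc ps)))

  zipped : ∀ {n} → Vec Carrier n → Vec Carrier n → List (Carrier × Carrier)
  zipped E E′ = Vec.toList (Vec.zip E E′)

  liftAll : ∀ ps → Locally ps → ∀ {n} {E : Vec Carrier n} → VecAll.All (cl (Range h ∪ ⟪ dom ps ⟫)) E →
            Σ[ E′ ∈ Vec Carrier n ] Locally (zipped E E′ ++ ps)
  liftAll ps loc VecAll.[] = [] , loc
  liftAll ps loc {E = e ∷ E} (p VecAll.∷ qs) = first (liftAll ps loc qs)
    where
    first : Σ[ E′ ∈ Vec Carrier _ ] Locally (zipped E E′ ++ ps) →
            Σ[ E′ ∈ Vec Carrier _ ] Locally (zipped (e ∷ E) E′ ++ ps)
    first (E′ , loc′) = second (lift (zipped E E′ ++ ps) loc′ (monotone _ _ weaken p))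
      where
      weaken : ∀ {m} → (Range h ∪ ⟪ dom ps ⟫) m → (Range h ∪ ⟪ dom (zipped E E′ ++ ps) ⟫) m
      weaken (inj₁ r)  = inj₁ r
      weaken {m} (inj₂ m∈) = inj₂ (subst (m ∈_) (sym (map-++ proj₁ (zipped E E′) ps))
        (LAnyₚ.++⁺ʳ (dom (zipped E E′)) m∈))
      second : Σ[ e′ ∈ Carrier ] Locally ((e , e′) ∷ zipped E E′ ++ ps) → _
      second (e′ , loc″) = e′ ∷ E′ , loc″

-- The tree of splitting automorphisms

module Tree (em : ExcludedMiddle 0ℓ) {L : Language} {M : PregeometryStructure L} (wqm : IsWeaklyQuasiminimal M)
    (𝕄 : PregeometryStructure L) (𝕄-fqm : FiniteQuasiminimality.IsFinitelyQuasiminimal em 𝕄)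
    (galois : ∀ ps → QFTypes.Elem (PregeometryStructure.structure 𝕄) ps →
      Σ[ σ ∈ Automorphism (PregeometryStructure.structure 𝕄) ]
        All (λ (a , b) → PregeometryStructure._≈_ 𝕄 (Isomorphism.to σ a) b) ps)
    (j : ClosedEmbedding M 𝕄) where
  private
    module M = PregeometryStructure M
    module MC = Pregeometry em M
    module J = ClosedEmbedding j
    module JC = Inheritance.EmbeddedClosure em j
    module MT = QFTypes M.structure
    module MF = FamilyTypes M.structure
    module SM = Setoid M.setoid
    M-fqm : FiniteQuasiminimality.IsFinitelyQuasiminimal em M
    M-fqm = FiniteQuasiminimality.wqm⇒fqm em wqm
    module Mq = FiniteQuasiminimality.IsFinitelyQuasiminimal M-fqm
    module CM = CountableModels em M M-fqm
  open PregeometryStructure 𝕄 hiding (Independent)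
  open Setoid setoid using () renaming (refl to ≈-refl; sym to ≈-sym; trans to ≈-trans)
  open Pregeometry em 𝕄
  open QFTypes structure
  open Automorphisms structure
  open Homogeneity em 𝕄 𝕄-fqm galois

  module _ (h : ℕ → M.Carrier) (h-closed : M.Closed (M.Range h))
      (hh-closed : Closed (Range (J.to ∘ h))) (hh-inf : InfDim (Range (J.to ∘ h)))
      (ns₀ : List ℕ) (D : List M.Carrier) (D-ind : MC.IndOver (M.Range h) D)
      {n} (E : Vec M.Carrier n) (E⊆ : VecAll.All (MC._∈cl D ++ List.map h ns₀) E) where

    hh : ℕ → Carrier
    hh = J.to ∘ h

    Maps : Aut → List (ℕ × ℕ) → Set
    Maps σ = All λ (i , k) → σ ∙ hh i ≈ hh k

    Fixed : Aut → List ℕ → Set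
    Fixed σ = All λ i → σ ∙ hh i ≈ hh i

    FixedE : Aut → Set
    FixedE σ = VecAll.All (λ e → σ ∙ J.to e ≈ J.to e) E

    -- Every conjugation within the model over `ns` can be carried out over `E` as well: the type of
    -- `E` over the model does not split over the finite part `ns`.
    Determines : List ℕ → Set
    Determines ns = ∀ is → (Σ[ σ ∈ Aut ] Fixed σ ns × Maps σ is) →
                    Σ[ ρ ∈ Aut ] Fixed ρ ns × Maps ρ is × FixedE ρ

    Split : List ℕ → Set
    Split ns = Σ[ is ∈ List (ℕ × ℕ) ] (Σ[ σ ∈ Aut ] Fixed σ ns × Maps σ is) ×
               ¬ (Σ[ ρ ∈ Aut ] Fixed ρ ns × Maps ρ is × FixedE ρ)

    private
      bounded : ∀ (is : List ℕ) → Σ[ k ∈ ℕ ] All (_< k) is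
      bounded []       = 0 , []
      bounded (i ∷ is) with k , lt ← bounded is =
        suc i ⊔ k , ℕₚ.m≤m⊔n (suc i) k ∷ LAll.map (λ p → ℕₚ.≤-trans p (ℕₚ.m≤n⊔m (suc i) k)) lt

    module Limit (π : ℕ → ℕ) (h′-closed : M.Closed (M.Range (h ∘ π)))
        (local : ∀ is → Σ[ σ ∈ Aut ] All (λ i → σ ∙ hh i ≈ hh (π i)) is)
        (fixed : ∀ {i} → i ∈≡ ns₀ → hh i ≈ hh (π i)) where

      h′ : ℕ → M.Carrier
      h′ = h ∘ π

      open LocalLift em wqm h h′ h-closed h′-closed

      abstract
        -- A finite part of the model is moved within the model, and `D` is independent over the
        -- model; so the automorphism can be altered to fix `D` while its effect on that part is
        -- kept.
        locally-D : Locally (CM.identity D)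
        locally-D is = JC.elem⁻ {pairs is ++ CM.identity D} (conclude (extendIndependent σ (List.map hh is)
            (List.map (map² J.embedding) (CM.identity D))
            (subst (Ind (List.map hh is)) (sym dom-D) (subst (λ F → Ind F (List.map J.to D)) (sym (map-∘ is))
              (JC.ind⁺ D (D-ind (List.map h is) (LAllₚ.map⁺ (LAll.tabulate {xs = is} λ {i} _ → i , SM.refl))))))
            (subst (Ind (List.map (σ ∙_) (List.map hh is))) (sym cod-D) (ind-base image
              (JC.ind⁺ D (D-ind (List.map h′ is) (LAllₚ.map⁺ (LAll.tabulate {xs = is} λ {i} _ → π i , SM.refl))))))))
          where
          σ : Aut
          σ = proj₁ (local is)
          σ-maps : All (λ i → σ ∙ hh i ≈ hh (π i)) is
          σ-maps = proj₂ (local is)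
          dom-D : dom (List.map (map² J.embedding) (CM.identity D)) ≡ List.map J.to D
          dom-D = trans (JC.dom-map (CM.identity D)) (cong (List.map J.to) (trans (sym (map-∘ D)) (map-id D)))
          cod-D : cod (List.map (map² J.embedding) (CM.identity D)) ≡ List.map J.to D
          cod-D = trans (JC.cod-map (CM.identity D)) (cong (List.map J.to) (trans (sym (map-∘ D)) (map-id D)))
          image : All (_∈cl List.map J.to (List.map h′ is)) (List.map (σ ∙_) (List.map hh is))
          image = LAllₚ.map⁺ (LAllₚ.map⁺ (LAll.tabulate {xs = is} λ {i} i∈ →
            cl-∈ (LAnyₚ.map⁺ (LAnyₚ.map⁺ (LAny.map (λ { refl → LAll.lookup σ-maps i∈ }) i∈)))))
          conclude : Σ[ τ ∈ Aut ] All (λ (a , b) → τ ∙ a ≈ b) (List.map (map² J.embedding) (CM.identity D)) ×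
                       All (λ x → τ ∙ x ≈ σ ∙ x) (List.map hh is) →
                     Elem (List.map (map² J.embedding) (pairs is ++ CM.identity D))
          conclude (τ , s , t) = elem-graph τ (LAllₚ.map⁺ (LAllₚ.++⁺
            (LAllₚ.map⁺ (LAll.zipWith (λ (p , q) → ≈-trans p q) (LAllₚ.map⁻ t , σ-maps)))
            (LAllₚ.map⁻ s)))

        lifted : Σ[ E′ ∈ Vec M.Carrier n ] Locally (zipped E E′ ++ CM.identity D)
        lifted = liftAll (CM.identity D) locally-D (VecAll.map (M.monotone _ _ member) E⊆)
          where
          member : ∀ {m} → m M.∈ (D ++ List.map h ns₀) → (M.Range h ∪ M.⟪ MT.dom (CM.identity D) ⟫) m
          member {m} m∈ with LAnyₚ.++⁻ D m∈
          ... | inj₁ p = inj₂ (subst (m M.∈_) (trans (sym (map-id D)) (map-∘ D)) p)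
          ... | inj₂ p = let i , _ , e = find (LAnyₚ.map⁻ p) in inj₁ (i , e)

      E′ : Vec M.Carrier n
      E′ = proj₁ lifted

      abstract
        -- The limit map fixes `D` and `ns₀`, over which `E` is algebraic; by (QM1) the image of `E`
        -- stays in one closure, whatever the branch.
        E′⊆ : VecAll.All (MC._∈cl D ++ List.map h ns₀) E′
        E′⊆ = VecAllₚ.lookup⁻ λ i → MC.cl-trans cod⊆
          (Mq.fqm1 ps (MT.elem-mono {pairs ns₀ ++ zipped E E′ ++ CM.identity D} (proj₂ lifted ns₀)
              (LAnyₚ.++⁺ʳ (pairs ns₀) (LAnyₚ.++⁺ˡ (zip-lookup E E′ i)) ∷
               LAllₚ.++⁺ (LAll.tabulate λ p → LAnyₚ.++⁺ˡ (MF.∈⇒∈ₚ p))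
                         (LAll.tabulate λ p → LAnyₚ.++⁺ʳ (pairs ns₀) (LAnyₚ.++⁺ʳ (zipped E E′) (MF.∈⇒∈ₚ p)))))
            (MC.cl-trans dom⊆ (VecAllₚ.lookup⁺ E⊆ i)))
          where
          ps : List (M.Carrier × M.Carrier)
          ps = pairs ns₀ ++ CM.identity D
          zip-lookup : ∀ {n} (E E′ : Vec M.Carrier n) i → (Vec.lookup E i , Vec.lookup E′ i) MT.∈ₚ zipped E E′
          zip-lookup (_ ∷ _) (_ ∷ _)  zero    = here (SM.refl , SM.refl)
          zip-lookup (_ ∷ E) (_ ∷ E′) (suc i) = there (zip-lookup E E′ i)
          dom⊆ : All (MC._∈cl MT.dom ps) (D ++ List.map h ns₀)
          dom⊆ rewrite map-++ proj₁ (pairs ns₀) (CM.identity D) | sym (map-∘ {g = proj₁} {f = λ i → h i , h′ i} ns₀)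
                     | sym (map-∘ {g = proj₁} {f = λ (x : M.Carrier) → x , x} D) | map-id D =
            LAllₚ.++⁺ (MC.cl-selfʳ (List.map h ns₀)) (MC.cl-selfˡ (List.map h ns₀))
          cod⊆ : All (MC._∈cl D ++ List.map h ns₀) (MT.cod ps)
          cod⊆ rewrite map-++ proj₂ (pairs ns₀) (CM.identity D) | sym (map-∘ {g = proj₂} {f = λ i → h i , h′ i} ns₀)
                     | sym (map-∘ {g = proj₂} {f = λ (x : M.Carrier) → x , x} D) | map-id D =
            LAllₚ.++⁺ (LAllₚ.map⁺ (LAll.tabulate λ {i} i∈ → MC.cl-resp
                  (J.injective (fixed i∈))
                  (MC.cl-++ʳ D (MC.cl-∈ (LAnyₚ.map⁺ (LAny.map (λ { refl → SM.refl }) i∈))))))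
                (MC.cl-selfˡ D)

        realize : ∀ is → Σ[ κ ∈ Aut ] All (λ i → κ ∙ hh i ≈ hh (π i)) is × Pointwise (λ e e′ → κ ∙ J.to e ≈ J.to e′) E E′
        realize is = conclude (galois _ (JC.elem⁺ {pairs is ++ zipped E E′ ++ CM.identity D} (proj₂ lifted is)))
          where
          unzipped : ∀ {n} {κ} (E E′ : Vec M.Carrier n) → All (λ (a , b) → κ ∙ J.to a ≈ J.to b) (zipped E E′) →
                     Pointwise (λ e e′ → κ ∙ J.to e ≈ J.to e′) E E′
          unzipped []      []       []       = []
          unzipped {κ = κ} (_ ∷ E) (_ ∷ E′) (q ∷ qs) = q ∷ unzipped {κ = κ} E E′ qs
          conclude : Σ[ κ ∈ Aut ] All (λ (a , b) → κ ∙ a ≈ b) (List.map (map² J.embedding) (pairs is ++ zipped E E′ ++ CM.identity D)) →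
                     Σ[ κ ∈ Aut ] All (λ i → κ ∙ hh i ≈ hh (π i)) is × Pointwise (λ e e′ → κ ∙ J.to e ≈ J.to e′) E E′
          conclude (κ , s) = κ ,
            LAllₚ.map⁻ {f = λ i → h i , h′ i} (LAllₚ.++⁻ˡ (pairs is) (LAllₚ.map⁻ s)) ,
            unzipped {κ = κ} E E′ (LAllₚ.++⁻ˡ (zipped E E′) (LAllₚ.++⁻ʳ (pairs is) (LAllₚ.map⁻ s)))

    module _ (splits : ∀ ns → All (_∈≡ ns) ns₀ → Split ns) where

      -- The automorphism only witnesses that the finite map is elementary: along a branch the maps
      -- grow, while the automorphisms may be replaced.
      Node : Set
      Node = Σ[ ps ∈ List (ℕ × ℕ) ] All (λ i → (i , i) ∈≡ ps) ns₀ × Σ[ σ ∈ Aut ] Maps σ ps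

      graphᵗ : Node → List (ℕ × ℕ)
      graphᵗ = proj₁

      private
        agree : ∀ {σ τ : Aut} {f g : ℕ × ℕ → ℕ} ps → All (λ x → τ ∙ x ≈ σ ∙ x) (List.map (hh ∘ f) ps) →
                All (λ p → σ ∙ hh (f p) ≈ hh (g p)) ps → All (λ p → τ ∙ hh (f p) ≈ hh (g p)) ps
        agree ps e m = LAll.zipWith (λ (p , q) → ≈-trans p q) (LAllₚ.map⁻ e , m)

      abstract
        forthᵗ : (x : Node) (n : ℕ) → Σ[ m ∈ ℕ ] Σ[ σ ∈ Aut ] Maps σ ((n , m) ∷ graphᵗ x)
        forthᵗ (ps , _ , σ , maps) n = conclude (moveInto hh-closed hh-inf σ (List.map (hh ∘ proj₁) ps)
            (LAllₚ.map⁺ (LAll.map (λ {p} e → proj₂ p , e) maps)) (hh n ∷ []))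
          where
          conclude : Σ[ τ ∈ Aut ] All (λ x → τ ∙ x ≈ σ ∙ x) (List.map (hh ∘ proj₁) ps) ×
                       All (λ x → Range hh (τ ∙ x)) (hh n ∷ []) →
                     Σ[ m ∈ ℕ ] Σ[ σ ∈ Aut ] Maps σ ((n , m) ∷ ps)
          conclude (τ , e , (m , q) ∷ []) = m , τ , q ∷ agree {σ} {τ} ps e maps

        backᵗ : (x : Node) (n : ℕ) → Σ[ m ∈ ℕ ] Σ[ σ ∈ Aut ] Maps σ ((m , n) ∷ graphᵗ x)
        backᵗ (ps , _ , σ , maps) n = conclude (moveInto hh-closed hh-inf (inverseᵃ σ) (List.map (hh ∘ proj₂) ps)
            (LAllₚ.map⁺ (LAll.map (λ {p} e → proj₁ p , ∙-inverse σ e) maps)) (hh n ∷ []))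
          where
          conclude : Σ[ τ ∈ Aut ] All (λ x → τ ∙ x ≈ inverseᵃ σ ∙ x) (List.map (hh ∘ proj₂) ps) ×
                       All (λ x → Range hh (τ ∙ x)) (hh n ∷ []) →
                     Σ[ m ∈ ℕ ] Σ[ σ ∈ Aut ] Maps σ ((m , n) ∷ ps)
          conclude (τ , e , (m , q) ∷ []) = m , inverseᵃ τ , ∙-inverse τ q ∷
            LAll.map (∙-inverse τ) (agree {inverseᵃ σ} {τ} ps e (LAll.map (∙-inverse σ) maps))

      -- Before the splitting at stage `n`, that number is put into the domain and the image, so
      -- that the limit along a branch maps the model onto itself.
      mid : ℕ → Node → Node
      mid n x@(ps , ns₀⊆ , _) =
        let m , σ , maps = forthᵗ x n
            y = (n , m) ∷ ps , LAll.map there ns₀⊆ , σ , maps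
            l , τ , maps′ = backᵗ y n
        in (l , n) ∷ (n , m) ∷ ps , LAll.map (there ∘ there) ns₀⊆ , τ , maps′

      branches : Bool → (is ws : List (ℕ × ℕ)) → List (ℕ × ℕ)
      branches b []             ws             = []
      branches b (_ ∷ _)        []             = []
      branches b ((i , k) ∷ is) ((_ , w) ∷ ws) = ((if b then i else k) , w) ∷ branches b is ws

      -- ws sends the first components of is into the model, compatibly with x; so it also sends the second components there.
      record Splitting (x : Node) : Set where
        field
          is ws  : List (ℕ × ℕ)
          same   : List.map proj₁ is ≡ List.map proj₁ ws
          both   : ∀ b → Σ[ σ ∈ Aut ] Maps σ (branches b is ws ++ graphᵗ x)
          really : ¬ (Σ[ ρ ∈ Aut ] Fixed ρ (List.map proj₁ (graphᵗ x)) × Maps ρ is × FixedE ρ)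

      abstract
        -- Over the domain of the node there is `τ` taking the first components of `is` to the
        -- second, which no automorphism fixing `E` can imitate. If `σ′` sends the first components
        -- to `ws`, then `σ′` after the inverse of `τ` sends the second ones there, and both extend
        -- the node.
        splitting : ∀ x → Splitting x
        splitting x@(ps , ns₀⊆ , σ , maps) = first (splits (List.map proj₁ ps) (LAll.map (∈-map⁺ proj₁) ns₀⊆))
          where
          first : Split (List.map proj₁ ps) → Splitting x
          first (is , (τ , τ-fixes , τ-maps) , really) =
            second (moveInto hh-closed hh-inf σ (List.map (hh ∘ proj₁) ps)
              (LAllₚ.map⁺ (LAll.map (λ {p} e → proj₂ p , e) maps)) (List.map (hh ∘ proj₁) is))
            where
            second : Σ[ τ ∈ Aut ] All (λ x → τ ∙ x ≈ σ ∙ x) (List.map (hh ∘ proj₁) ps) ×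
                       All (λ x → Range hh (τ ∙ x)) (List.map (hh ∘ proj₁) is) → Splitting x
            second (σ′ , e , into) = third (values is (LAllₚ.map⁻ into))
              where
              values : ∀ (is : List (ℕ × ℕ)) → All (λ p → Range hh (σ′ ∙ hh (proj₁ p))) is →
                Σ[ ws ∈ List (ℕ × ℕ) ] List.map proj₁ is ≡ List.map proj₁ ws × Maps σ′ ws
              values []       []             = [] , refl , []
              values (p ∷ is) ((w , q) ∷ qs) with ws , s , m ← values is qs =
                (proj₁ p , w) ∷ ws , cong (proj₁ p ∷_) s , q ∷ m
              third : Σ[ ws ∈ List (ℕ × ℕ) ] List.map proj₁ is ≡ List.map proj₁ ws × Maps σ′ ws → Splitting x
              third (ws , s , m) = record
                { is = is ; ws = ws ; same = s ; really = really
                ; both = λ { true  → σ′ , LAllₚ.++⁺ (left is ws s m) σ′-maps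
                           ; false → σ′ ∘ᵃ inverseᵃ τ , LAllₚ.++⁺ (right is ws s m τ-maps)
                               (LAll.zipWith (λ (p , q) → ≈-trans (∙-cong σ′ (∙-inverse τ p)) q)
                                 (LAllₚ.map⁻ τ-fixes , σ′-maps)) }
                }
                where
                σ′-maps : Maps σ′ ps
                σ′-maps = agree {σ} {σ′} ps e maps
                left : ∀ (is ws : List (ℕ × ℕ)) → List.map proj₁ is ≡ List.map proj₁ ws → Maps σ′ ws → Maps σ′ (branches true is ws)
                left []       []       s m = []
                left (_ ∷ is) (_ ∷ ws) s (q ∷ m) with refl , s′ ← Listₚ.∷-injective s = q ∷ left is ws s′ m
                right : ∀ (is ws : List (ℕ × ℕ)) → List.map proj₁ is ≡ List.map proj₁ ws → Maps σ′ ws → Maps τ is →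
                        Maps (σ′ ∘ᵃ inverseᵃ τ) (branches false is ws)
                right []       []       s m       t = []
                right (_ ∷ is) (_ ∷ ws) s (q ∷ m) (u ∷ t) with refl , s′ ← Listₚ.∷-injective s =
                  ≈-trans (∙-cong σ′ (∙-inverse τ u)) q ∷ right is ws s′ m t

      step : ℕ → Bool → Node → Node
      step n b x = let open Splitting (splitting (mid n x)) in
        branches b is ws ++ graphᵗ (mid n x) , LAll.map (∈-++⁺ʳ (branches b is ws)) (proj₁ (proj₂ (mid n x))) , both b

      module Path (η : ℕ → Bool) where
        open Branch Node graphᵗ ((List.map (λ i → i , i) ns₀) , LAll.tabulate (∈-map⁺ (λ i → i , i)) ,
                      identityᵃ , LAllₚ.map⁺ (LAll.tabulate {xs = ns₀} λ _ → ≈-refl))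
          step
          (λ n b x → ∈-++⁺ʳ (branches b (Splitting.is (splitting (mid n x))) (Splitting.ws (splitting (mid n x)))) ∘ there ∘ there)
          (λ n b x → _ , ∈-++⁺ʳ (branches b (Splitting.is (splitting (mid n x))) (Splitting.ws (splitting (mid n x)))) (there (here refl)))
          (λ n b x → _ , ∈-++⁺ʳ (branches b (Splitting.is (splitting (mid n x))) (Splitting.ws (splitting (mid n x)))) (here refl))
          η public

        h′ : ℕ → M.Carrier
        h′ = h ∘ π

        functional : ∀ {k i m} → (i , m) ∈≡ graphᵗ (node k) → hh m ≈ hh (π i)
        functional {k} {i} p = ≈-trans (≈-sym (LAll.lookup maps (node-mono (ℕₚ.m≤m⊔n k (suc i)) p)))
          (LAll.lookup maps (π-graph (ℕₚ.m≤n⊔m k (suc i))))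
          where
          maps = proj₂ (proj₂ (proj₂ (node (k ⊔ suc i))))

        h′-closed : M.Closed (M.Range h′)
        h′-closed {x} p = let n , e = h-closed (M.monotone _ _ (λ (i , e) → π i , e) p)
                              m , q = onto n
                          in m , SM.trans e (J.injective (functional {suc n} q))

        local : ∀ is → Σ[ σ ∈ Aut ] All (λ i → σ ∙ hh i ≈ hh (π i)) is
        local is = let k , lt = bounded is in proj₁ (proj₂ (proj₂ (node k))) ,
          LAll.map (λ p → LAll.lookup (proj₂ (proj₂ (proj₂ (node k)))) (π-graph p)) lt

        open Limit π h′-closed local
          (λ i∈ → functional {0} (∈-map⁺ (λ i → i , i) i∈))
          public using (E′; E′⊆; realize)

        realizeNode : ∀ k → Σ[ κ ∈ Aut ] Maps κ (graphᵗ (node k)) × Pointwise (λ e e′ → κ ∙ J.to e ≈ J.to e′) E E′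
        realizeNode k = conclude (realize (List.map proj₁ (graphᵗ (node k))))
          where
          conclude : Σ[ κ ∈ Aut ] All (λ i → κ ∙ hh i ≈ hh (π i)) (List.map proj₁ (graphᵗ (node k))) ×
                       Pointwise (λ e e′ → κ ∙ J.to e ≈ J.to e′) E E′ →
                     Σ[ κ ∈ Aut ] Maps κ (graphᵗ (node k)) × Pointwise (λ e e′ → κ ∙ J.to e ≈ J.to e′) E E′
          conclude (κ , s , t) = κ ,
            LAll.tabulate (λ {p} p∈ → ≈-trans (LAll.lookup (LAllₚ.map⁻ {f = proj₁} s) p∈) (≈-sym (functional {k} p∈))) , t

      open Path using (node; E′; E′⊆; realizeNode)

      private
        module I = Injection (Mq.fqm3 (D ++ List.map h ns₀))

        codes : ∀ {n} {E′ : Vec M.Carrier n} → VecAll.All (MC._∈cl D ++ List.map h ns₀) E′ → Vec ℕ n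
        codes VecAll.[]       = []
        codes (p VecAll.∷ ps) = I.to (_ , p) ∷ codes ps

        codes-injective : ∀ {n} {E′ E″ : Vec M.Carrier n} (p : VecAll.All (MC._∈cl D ++ List.map h ns₀) E′)
          (q : VecAll.All (MC._∈cl D ++ List.map h ns₀) E″) → codes p ≡ codes q → E′ M.≋ E″
        codes-injective VecAll.[]       VecAll.[]       e = []
        codes-injective (p VecAll.∷ ps) (q VecAll.∷ qs) e =
          I.injective (proj₁ (Vecₚ.∷-injective e)) ∷ codes-injective ps qs (proj₂ (Vecₚ.∷-injective e))

        code : (ℕ → Bool) → ℕ
        code η = encode (codes (E′⊆ η))

        code-injective : ∀ η ξ → code η ≡ code ξ → E′ η M.≋ E′ ξ
        code-injective η ξ e = codes-injective (E′⊆ η) (E′⊆ ξ)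
          (trans (sym (decode-encode (codes (E′⊆ η)))) (trans (cong (decode n) e) (decode-encode (codes (E′⊆ ξ)))))

        atBranch : ∀ η k {x b} → node η k ≡ x → η k ≡ b → let open Splitting (splitting (mid k x)) in
          Σ[ κ ∈ Aut ] Maps κ (branches b is ws ++ graphᵗ (mid k x)) × Pointwise (λ e e′ → κ ∙ J.to e ≈ J.to e′) E (E′ η)
        atBranch η k refl refl = realizeNode η (suc k)

        -- If `κ` and `μ` realize the two branches with the same image of `E`, then the inverse of
        -- `μ` after `κ` fixes `E` and the domain of the node and takes the first components of `is`
        -- to the second, which `really` excludes.
        clash : ∀ η ξ k → E′ η M.≋ E′ ξ → node η k ≡ node ξ k → η k ≡ true → ξ k ≡ false → ⊥
        clash η ξ k same-E same-node p q = conclude (atBranch η k refl p) (atBranch ξ k (sym same-node) q)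
          where
          open Splitting (splitting (mid k (node η k)))
          conclude : Σ[ κ ∈ Aut ] Maps κ (branches true is ws ++ graphᵗ (mid k (node η k))) ×
                       Pointwise (λ e e′ → κ ∙ J.to e ≈ J.to e′) E (E′ η) →
                     Σ[ κ ∈ Aut ] Maps κ (branches false is ws ++ graphᵗ (mid k (node η k))) ×
                       Pointwise (λ e e′ → κ ∙ J.to e ≈ J.to e′) E (E′ ξ) → ⊥
          conclude (κ , s , t) (μ , u , v) = really (inverseᵃ μ ∘ᵃ κ ,
            LAllₚ.map⁺ (LAll.zipWith (λ (p , q) → back p q)
              (LAllₚ.++⁻ʳ (branches true is ws) s , LAllₚ.++⁻ʳ (branches false is ws) u)) ,
            onIs is ws same (LAllₚ.++⁻ˡ (branches true is ws) s) (LAllₚ.++⁻ˡ (branches false is ws) u) ,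
            onE E (E′ η) (E′ ξ) same-E t v)
            where
            back : ∀ {a b c} → κ ∙ a ≈ c → μ ∙ b ≈ c → inverseᵃ μ ∙ κ ∙ a ≈ b
            back p q = ∙-inverse μ (≈-trans q (≈-sym p))
            onIs : ∀ (is ws : List (ℕ × ℕ)) → List.map proj₁ is ≡ List.map proj₁ ws →
                   Maps κ (branches true is ws) → Maps μ (branches false is ws) → Maps (inverseᵃ μ ∘ᵃ κ) is
            onIs []       []       e []       []       = []
            onIs (_ ∷ is) (_ ∷ ws) e (p ∷ ps) (q ∷ qs) = back p q ∷ onIs is ws (proj₂ (Listₚ.∷-injective e)) ps qs
            onE : ∀ {n} (E E′ E″ : Vec M.Carrier n) → E′ M.≋ E″ → Pointwise (λ e e′ → κ ∙ J.to e ≈ J.to e′) E E′ →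
                  Pointwise (λ e e′ → μ ∙ J.to e ≈ J.to e′) E E″ →
                  VecAll.All (λ e → inverseᵃ μ ∙ κ ∙ J.to e ≈ J.to e) E
            onE []      []       []       []       []       []       = VecAll.[]
            onE (_ ∷ E) (_ ∷ E′) (_ ∷ E″) (e ∷ es) (p ∷ ps) (q ∷ qs) =
              back p (≈-trans q (≈-sym (J.cong e))) VecAll.∷ onE E E′ E″ es ps qs

        module _ (η ξ : ℕ → Bool) (same-E : E′ η M.≋ E′ ξ) where
          mutual
            -- Nodes and bits are compared together: with equal images of `E`, two branches cannot
            -- part at a common node, and so reach a common next node.
            sameNode : ∀ k → node η k ≡ node ξ k
            sameNode zero    = refl
            sameNode (suc k) = cong₂ (step k) (sameBit k) (sameNode k)

            sameBit : ∀ k → η k ≡ ξ k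
            sameBit k = compare (η k) (ξ k) refl refl
              where
              compare : ∀ b c → η k ≡ b → ξ k ≡ c → η k ≡ ξ k
              compare true  true  p q = trans p (sym q)
              compare false false p q = trans p (sym q)
              compare true  false p q = ⊥-elim (clash η ξ k same-E (sameNode k) p q)
              compare false true  p q = ⊥-elim (clash ξ η k (Pointwise.sym SM.sym same-E) (sym (sameNode k)) q p)

      noSplits : ⊥
      noSplits = noInjectionFromSubsets em ℕ code λ {η} {ξ} e → sameBit η ξ (code-injective η ξ e)

    open Classical em

    -- Otherwise the binary tree of splittings has uncountably many
    -- branches, which send E to distinct tuples of a countable set.
    determined : Σ[ ns ∈ List ℕ ] All (_∈≡ ns) ns₀ × Determines ns
    determined = by-contradiction λ none → noSplits λ ns ns₀⊆ → by-contradiction λ unsplit →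
      none (ns , ns₀⊆ , λ is gal → by-contradiction λ ¬ρ → unsplit (is , gal , ¬ρ))

-- Isolation of types by finite sets

module Isolation (em : ExcludedMiddle 0ℓ) {L : Language} (𝕄 : PregeometryStructure L)
    (fqm : FiniteQuasiminimality.IsFinitelyQuasiminimal em 𝕄)
    (galois : ∀ ps → QFTypes.Elem (PregeometryStructure.structure 𝕄) ps →
      Σ[ σ ∈ Automorphism (PregeometryStructure.structure 𝕄) ]
        All (λ (a , b) → PregeometryStructure._≈_ 𝕄 (Isomorphism.to σ a) b) ps) where
  open PregeometryStructure 𝕄 hiding (Independent)
  open Setoid setoid using () renaming (sym to ≈-sym; trans to ≈-trans)
  open Pregeometry em 𝕄
  open QFTypes structure
  open Automorphisms structure
  open CountableModels em 𝕄 fqm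
  open Homogeneity em 𝕄 fqm galois

  Agree : Aut → Aut → List Carrier → Set
  Agree σ τ = All λ x → σ ∙ x ≈ τ ∙ x

  -- tp(E/FD) has a unique extension to any set over which D is independent.
  Isolates : List Carrier → List Carrier → List Carrier → Set
  Isolates F D E = ∀ σ → Fixes σ F → Fixes σ D → ∀ c → Ind (c ++ F) D →
    Σ[ ρ ∈ Aut ] Fixes ρ F × Fixes ρ D × Fixes ρ c × Agree ρ σ E

  identity-dom : ∀ D → dom (identity D) ≡ D
  identity-dom D = trans (sym (map-∘ D)) (map-id D)

  identity-cod : ∀ D → cod (identity D) ≡ D
  identity-cod D = trans (sym (map-∘ D)) (map-id D)

  extendFixing : ∀ σ F D → Ind F D → Ind (List.map (σ ∙_) F) D → Σ[ τ ∈ Aut ] Fixes τ D × Agree τ σ F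
  extendFixing σ F D i j with τ , s , t ← extendIndependent σ F (identity D)
      (subst (Ind F) (sym (identity-dom D)) i) (subst (Ind (List.map (σ ∙_) F)) (sym (identity-cod D)) j)
    = τ , LAllₚ.map⁻ s , t

  agree-fixes : ∀ {σ τ : Aut} {F} → Agree σ τ F → Fixes τ F → Fixes σ F
  agree-fixes s t = LAll.zipWith (λ (p , q) → ≈-trans p q) (s , t)

  map-⊆ : ∀ σ {P : Pred Carrier 0ℓ} {F} → All (λ x → P (σ ∙ x)) F → All P (List.map (σ ∙_) F)
  map-⊆ σ = LAllₚ.map⁺

  private
    moved : ∀ (σ : Aut) {P} → Closed P → ∀ {F} → Fixes σ F → All P F → All (λ x → P (σ ∙ x)) F
    moved σ closed fix p = LAll.zipWith (λ (e , q) → closed-respects closed (≈-sym e) q) (fix , p)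

  module FromDetermined {R : Pred Carrier 0ℓ} (R-closed : Closed R) (R-inf : InfDim R)
      (F D E : List Carrier) (F⊆ : All R F) (D-ind : IndOver R D) (E⊆ : All (_∈cl D ++ F) E)
      (determined : ∀ (ps : List (Carrier × Carrier)) → All R (dom ps) → All R (cod ps) →
        (Σ[ σ ∈ Aut ] Fixes σ F × All (λ (a , b) → σ ∙ a ≈ b) ps) →
        Σ[ ρ ∈ Aut ] Fixes ρ F × All (λ (a , b) → ρ ∙ a ≈ b) ps × Fixes ρ (D ++ E)) where

    private
      -- A basis `hs` of `c` over `F` is independent over `D`, `E` and `F`, so `σ` can be altered to
      -- fix it. Then the preimage of `c` still lies in the model; its conjugation to `c` can be
      -- performed over `D` and `E`, and is divided out.
      isolatesWithin : ∀ σ → Fixes σ F → Fixes σ D → ∀ c → All R c →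
        Σ[ ρ ∈ Aut ] Fixes ρ F × Fixes ρ D × Fixes ρ c × Agree ρ σ E
      isolatesWithin σ fixF fixD c c⊆ = go (basisOver F c)
        where
        σ-DF : Fixes σ (D ++ F)
        σ-DF = LAllₚ.++⁺ fixD fixF
        go : Σ[ hs ∈ List Carrier ] (∀ {P : Carrier → Set} → All P c → All P hs) × Ind F hs ×
               All (_∈cl hs ++ F) c × length hs ≤ length c →
             Σ[ ρ ∈ Aut ] Fixes ρ F × Fixes ρ D × Fixes ρ c × Agree ρ σ E
        go (hs , sub , i , c⊆cl , _) =
          correct (extendFixing σ (E ++ D ++ F) hs (ind-base (LAllₚ.++⁺ E⊆ (cl-self _)) hs-ind)
            (ind-base (map-⊆ σ (LAllₚ.++⁺ (LAll.map (fixes-cl σ σ-DF) E⊆)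
              (moved σ (clList-closed (D ++ F)) σ-DF (cl-self _)))) hs-ind))
          where
          hs⊆ : All R (hs ++ F)
          hs⊆ = LAllₚ.++⁺ (sub c⊆) F⊆
          hs-ind : Ind (D ++ F) hs
          hs-ind = ind-swap hs D i (D-ind (hs ++ F) hs⊆)
          correct : Σ[ σ₁ ∈ Aut ] Fixes σ₁ hs × Agree σ₁ σ (E ++ D ++ F) →
                    Σ[ ρ ∈ Aut ] Fixes ρ F × Fixes ρ D × Fixes ρ c × Agree ρ σ E
          correct (σ₁ , fix-hs , agree) = conclude (determined ps
              (subst (All R) (sym dom-ps) (map-⊆ (inverseᵃ σ₁) (LAll.map back c⊆cl)))
              (subst (All R) (sym cod-ps) c⊆)
              (σ₁ , LAllₚ.++⁻ʳ D σ₁-DF , LAllₚ.map⁺ (LAll.tabulate {xs = c} λ _ → ∙-inverseʳ σ₁)))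
            where
            σ₁-DF : Fixes σ₁ (D ++ F)
            σ₁-DF = agree-fixes {σ₁} {σ} (LAllₚ.++⁻ʳ E agree) σ-DF
            ps : List (Carrier × Carrier)
            ps = List.map (λ x → inverseᵃ σ₁ ∙ x , x) c
            dom-ps : dom ps ≡ List.map (inverseᵃ σ₁ ∙_) c
            dom-ps = sym (map-∘ c)
            cod-ps : cod ps ≡ c
            cod-ps = trans (sym (map-∘ c)) (map-id c)
            back : ∀ {x} → x ∈cl hs ++ F → R (inverseᵃ σ₁ ∙ x)
            back = aut-closed (inverseᵃ σ₁) R-closed (moved (inverseᵃ σ₁) R-closed
              (fixes-inverse σ₁ (LAllₚ.++⁺ fix-hs (LAllₚ.++⁻ʳ D σ₁-DF))) hs⊆)
            conclude : Σ[ ρ ∈ Aut ] Fixes ρ F × All (λ (a , b) → ρ ∙ a ≈ b) ps × Fixes ρ (D ++ E) →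
                       Σ[ ρ ∈ Aut ] Fixes ρ F × Fixes ρ D × Fixes ρ c × Agree ρ σ E
            conclude (ρ , ρF , ρps , ρDE) = σ₁ ∘ᵃ inverseᵃ ρ ,
              fixes-∘ σ₁ (inverseᵃ ρ) (LAllₚ.++⁻ʳ D σ₁-DF) (fixes-inverse ρ ρF) ,
              fixes-∘ σ₁ (inverseᵃ ρ) (LAllₚ.++⁻ˡ D σ₁-DF) (fixes-inverse ρ (LAllₚ.++⁻ˡ D ρDE)) ,
              LAll.map (λ q → ≈-trans (∙-cong σ₁ (∙-inverse ρ q)) (∙-inverseʳ σ₁)) (LAllₚ.map⁻ {f = λ x → inverseᵃ σ₁ ∙ x , x} ρps) ,
              LAll.zipWith (λ (p , q) → ≈-trans (∙-cong σ₁ p) q) (fixes-inverse ρ (LAllₚ.++⁻ʳ D ρDE) , LAllₚ.++⁻ˡ E agree)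

    -- A general `c` is moved into the model by `τ₁`. As this may move `E`, the previous case is
    -- applied both to `τ₁` and to `τ₁` after `σ`; the quotient of the results, conjugated back,
    -- fixes `c` and acts on `E` as `σ`.
    isolates : Isolates F D E
    isolates σ σF σD c c-ind = into (moveInto R-closed R-inf identityᵃ F F⊆ c)
      where
      into : Σ[ τ ∈ Aut ] Fixes τ F × All (λ x → R (τ ∙ x)) c →
             Σ[ ρ ∈ Aut ] Fixes ρ F × Fixes ρ D × Fixes ρ c × Agree ρ σ E
      into (τ , τF , τc) = fixing (extendFixing τ (c ++ F) D c-ind
          (D-ind _ (map-⊆ τ (LAllₚ.++⁺ τc (moved τ R-closed τF F⊆)))))
        where
        fixing : Σ[ τ₁ ∈ Aut ] Fixes τ₁ D × Agree τ₁ τ (c ++ F) →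
                 Σ[ ρ ∈ Aut ] Fixes ρ F × Fixes ρ D × Fixes ρ c × Agree ρ σ E
        fixing (τ₁ , τ₁D , agree) = conclude (isolatesWithin τ₁ τ₁F τ₁D c* c*⊆)
            (isolatesWithin (τ₁ ∘ᵃ σ) (fixes-∘ τ₁ σ τ₁F σF) (fixes-∘ τ₁ σ τ₁D σD) c* c*⊆)
          where
          c* : List Carrier
          c* = List.map (τ₁ ∙_) c
          c*⊆ : All R c*
          c*⊆ = map-⊆ τ₁ (LAll.zipWith (λ (e , p) → closed-respects R-closed (≈-sym e) p) (LAllₚ.++⁻ˡ c agree , τc))
          τ₁F : Fixes τ₁ F
          τ₁F = agree-fixes {τ₁} {τ} (LAllₚ.++⁻ʳ c agree) τF
          conclude : Σ[ ρ ∈ Aut ] Fixes ρ F × Fixes ρ D × Fixes ρ c* × Agree ρ τ₁ E →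
                     Σ[ ρ ∈ Aut ] Fixes ρ F × Fixes ρ D × Fixes ρ c* × Agree ρ (τ₁ ∘ᵃ σ) E →
                     Σ[ ρ ∈ Aut ] Fixes ρ F × Fixes ρ D × Fixes ρ c × Agree ρ σ E
          conclude (κ , κF , κD , κc , κE) (μ , μF , μD , μc , μE) = inverseᵃ τ₁ ∘ᵃ μ ∘ᵃ inverseᵃ κ ∘ᵃ τ₁ ,
            LAll.zipWith (λ (p , q , r) → fix p q r) (τ₁F , LAll.zip (κF , μF)) ,
            LAll.zipWith (λ (p , q , r) → fix p q r) (τ₁D , LAll.zip (κD , μD)) ,
            LAll.zipWith (λ (q , r) → ≈-trans (∙-cong (inverseᵃ τ₁) (≈-trans (∙-cong μ (∙-inverse κ q)) r)) (∙-inverseˡ τ₁))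
              (LAllₚ.map⁻ κc , LAllₚ.map⁻ μc) ,
            LAll.zipWith (λ (q , r) → ≈-trans (∙-cong (inverseᵃ τ₁) (≈-trans (∙-cong μ (∙-inverse κ q)) r)) (∙-inverseˡ τ₁))
              (κE , μE)
            where
            fix : ∀ {x} → τ₁ ∙ x ≈ x → κ ∙ x ≈ x → μ ∙ x ≈ x → inverseᵃ τ₁ ∙ μ ∙ inverseᵃ κ ∙ τ₁ ∙ x ≈ x
            fix p q r = ≈-trans (∙-cong (inverseᵃ τ₁) (≈-trans (∙-cong μ
              (≈-trans (∙-cong (inverseᵃ κ) p) (∙-inverse κ q))) r)) (∙-inverse τ₁ p)

  isolates-conjugate : ∀ α {F D E} → Isolates (List.map (α ∙_) F) (List.map (α ∙_) D) (List.map (α ∙_) E) → Isolates F D E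
  isolates-conjugate α {F} {D} {E} isol σ σF σD c i = conclude
      (isol (α ∘ᵃ σ ∘ᵃ inverseᵃ α) (conj σF) (conj σD) (List.map (α ∙_) c)
        (subst (λ G → Ind G (List.map (α ∙_) D)) (map-++ (α ∙_) c F) (ind-aut α D i)))
    where
    conj : ∀ {G} → Fixes σ G → Fixes (α ∘ᵃ σ ∘ᵃ inverseᵃ α) (List.map (α ∙_) G)
    conj fix = LAllₚ.map⁺ (LAll.map (λ e → ∙-cong α (≈-trans (∙-cong σ (∙-inverseˡ α)) e)) fix)
    conclude : Σ[ ρ ∈ Aut ] Fixes ρ (List.map (α ∙_) F) × Fixes ρ (List.map (α ∙_) D) × Fixes ρ (List.map (α ∙_) c) ×
                 Agree ρ (α ∘ᵃ σ ∘ᵃ inverseᵃ α) (List.map (α ∙_) E) →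
               Σ[ ρ ∈ Aut ] Fixes ρ F × Fixes ρ D × Fixes ρ c × Agree ρ σ E
    conclude (ρ , ρF , ρD , ρc , ρE) = inverseᵃ α ∘ᵃ ρ ∘ᵃ α , unconj ρF , unconj ρD , unconj ρc ,
      LAll.map (λ e → ≈-trans (∙-cong (inverseᵃ α) e) (≈-trans (∙-inverseˡ α) (∙-cong σ (∙-inverseˡ α)))) (LAllₚ.map⁻ ρE)
      where
      unconj : ∀ {G} → Fixes ρ (List.map (α ∙_) G) → Fixes (inverseᵃ α ∘ᵃ ρ ∘ᵃ α) G
      unconj fix = LAll.map (λ e → ≈-trans (∙-cong (inverseᵃ α) e) (∙-inverseˡ α)) (LAllₚ.map⁻ fix)

  -- The additional parameters are absorbed into the arbitrary set `c` of the definition.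
  isolates-mono : ∀ {F G D E} → All (_∈ G) F → Isolates F D E → Isolates G D E
  isolates-mono {F} {G} {D} F⊆ isol σ σG σD c i = conclude
      (isol σ (sub σ F⊆ σG) σD (c ++ G) (ind-base (LAllₚ.++⁺ (cl-self _) (LAll.map (cl-++ʳ c ∘ cl-∈) F⊆)) i))
    where
    sub : ∀ σ {F} → All (_∈ G) F → Fixes σ G → Fixes σ F
    sub σ F⊆ fix = LAll.map (λ x∈ → let y , y∈ , e = find x∈ in
      ≈-trans (∙-cong σ e) (≈-trans (LAll.lookup fix y∈) (≈-sym e))) F⊆
    conclude : Σ[ ρ ∈ Aut ] Fixes ρ F × Fixes ρ D × Fixes ρ (c ++ G) × Agree ρ σ _ →
               Σ[ ρ ∈ Aut ] Fixes ρ G × Fixes ρ D × Fixes ρ c × Agree ρ σ _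
    conclude (ρ , ρF , ρD , ρcG , ρE) = ρ , LAllₚ.++⁻ʳ c ρcG , ρD , LAllₚ.++⁻ˡ c ρcG , ρE

-- Isolating sets obtained inside the quasiminimal structure

module IsolatingSets (em : ExcludedMiddle 0ℓ) {L : Language} {M : PregeometryStructure L}
    (wqm : IsWeaklyQuasiminimal M) (M-inf : Pregeometry.InfDim em M (λ _ → ⊤))
    (𝕄 : PregeometryStructure L) (fqm : FiniteQuasiminimality.IsFinitelyQuasiminimal em 𝕄)
    (galois : ∀ ps → QFTypes.Elem (PregeometryStructure.structure 𝕄) ps →
      Σ[ σ ∈ Automorphism (PregeometryStructure.structure 𝕄) ]
        All (λ (a , b) → PregeometryStructure._≈_ 𝕄 (Isomorphism.to σ a) b) ps)
    (j : ClosedEmbedding M 𝕄)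
    (image-closed : ∀ {P} → PregeometryStructure.Closed M P →
      PregeometryStructure.Closed 𝕄 (PregeometryStructure.Image 𝕄 (ClosedEmbedding.to j) P))
    (image-inf : ∀ {P} → Pregeometry.InfDim em M P →
      Pregeometry.InfDim em 𝕄 (PregeometryStructure.Image 𝕄 (ClosedEmbedding.to j) P)) where
  private
    module M = PregeometryStructure M
    module MC = Pregeometry em M
    module SM = Setoid M.setoid
    module J = ClosedEmbedding j
    module JC = Inheritance.EmbeddedClosure em j
    module CM = CountableModels em M (FiniteQuasiminimality.wqm⇒fqm em wqm)
  open PregeometryStructure 𝕄 hiding (Independent)
  open Setoid setoid using () renaming (refl to ≈-refl; sym to ≈-sym; trans to ≈-trans)
  open Pregeometry em 𝕄
  open QFTypes structure
  open Automorphisms structure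
  open Homogeneity em 𝕄 fqm galois
  open Isolation em 𝕄 fqm galois

  private module Transfer (α : Aut) where

    infix 4 _~_
    _~_ : List Carrier → List M.Carrier → Set
    _~_ = Listᴾ.Pointwise λ x m → α ∙ x ≈ J.to m

    preimages : ∀ {X} → All (λ x → Range J.to (α ∙ x)) X → Σ[ X* ∈ List M.Carrier ] X ~ X*
    preimages []             = [] , Listᴾ.[]
    preimages ((m , e) ∷ ps) with X* , q ← preimages ps = m ∷ X* , e Listᴾ.∷ q

    ~⇒ : ∀ {X X*} → X ~ X* → All (_∈cl List.map J.to X*) (List.map (α ∙_) X)
    ~⇒ Listᴾ.[]       = []
    ~⇒ (e Listᴾ.∷ es) = cl-∈ (here e) ∷ LAll.map cl-there (~⇒ es)

    ~⇐ : ∀ {X X*} → X ~ X* → All (_∈cl List.map (α ∙_) X) (List.map J.to X*)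
    ~⇐ Listᴾ.[]       = []
    ~⇐ (e Listᴾ.∷ es) = cl-∈ (here (≈-sym e)) ∷ LAll.map cl-there (~⇐ es)

    cl* : ∀ {X X* x m} → X ~ X* → α ∙ x ≈ J.to m → x ∈cl X → m MC.∈cl X*
    cl* X~ e p = JC.cl⁻ (cl-resp e (cl-trans (~⇒ X~) (aut-cl α p)))

    ind* : ∀ {F F*} → F ~ F* → ∀ {D D*} → D ~ D* → Ind F D → MC.Ind F* D*
    ind* F~ Listᴾ.[]       _       = _
    ind* F~ (e Listᴾ.∷ es) (p , i) =
      (λ q → p (aut-cl⁻ α (cl-resp (≈-sym e) (cl-trans (~⇐ (Listᴾ.++⁺ es F~)) (JC.cl⁺ q))))) , ind* F~ es i

    ind-~ : ∀ {F D D*} → D ~ D* → Ind F (List.map J.to D*) → Ind F (List.map (α ∙_) D)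
    ind-~ Listᴾ.[]       _       = _
    ind-~ {F} {_ ∷ D} (e Listᴾ.∷ es) (p , i) =
      (λ q → p (cl-resp e (cl-trans (LAllₚ.++⁺ (LAll.map cl-++ˡ (~⇒ es)) (cl-selfʳ _)) q))) , ind-~ es i

  module _ {F₀ D E : List Carrier} (D-ind : Ind F₀ D) (E⊆ : All (_∈cl D ++ F₀) E) where

    private
      IsolatingSet : Set
      IsolatingSet = Σ[ F ∈ List Carrier ] Ind (F ++ F₀) D × Isolates (F ++ F₀) D E

      module _ (α : Aut) where
        open Transfer α

        module _ {F* D* E*} (F~ : F₀ ~ F*) (D~ : D ~ D*) (E~ : E ~ E*)
                 {P : Pred M.Carrier 0ℓ} (model : CM.CountableModel P) (F*⊆ : All P F*) (D*-ind : MC.IndOver P D*) where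
          open CM.CountableModel model renaming (enum to h)

          hh : ℕ → Carrier
          hh = J.to ∘ h

          range⇒ : M.Range h ⊆ P
          range⇒ (n , e) = MC.closed-respects closed (SM.sym e) (enum∈ n)

          range-hh : ∀ {x} → Image J.to P x → Range hh x
          range-hh (m , p , e) = let n , q = index p in n , ≈-trans e (J.cong q)

          hh-range : ∀ {x} → Range hh x → Image J.to P x
          hh-range (n , e) = h n , enum∈ n , e

          h-closed : M.Closed (M.Range h)
          h-closed p = index (closed (M.monotone _ _ range⇒ p))

          h-ind : MC.IndOver (M.Range h) D*
          h-ind G G⊆ = D*-ind G (LAll.map range⇒ G⊆)

          R-closed : Closed (Range hh)
          R-closed p = range-hh (image-closed closed (monotone _ _ hh-range p))

          R-inf : InfDim (Range hh)
          R-inf G = let m , p , q = image-inf inf G in m , range-hh p , q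

          indexes : ∀ {X} → All P X → Σ[ ns ∈ List ℕ ] Listᴾ.Pointwise (λ x n → x M.≈ h n) X ns
          indexes []       = [] , Listᴾ.[]
          indexes (p ∷ ps) with n , e ← index p | ns , es ← indexes ps = n ∷ ns , e Listᴾ.∷ es

          indexesʳ : ∀ {X} → All (Range hh) X → Σ[ ns ∈ List ℕ ] Listᴾ.Pointwise (λ x n → x ≈ hh n) X ns
          indexesʳ []             = [] , Listᴾ.[]
          indexesʳ ((n , e) ∷ ps) with ns , es ← indexesʳ ps = n ∷ ns , e Listᴾ.∷ es

          R-ind : IndOver (Range hh) (List.map (α ∙_) D)
          R-ind G G⊆ = let ns , es = indexesʳ G⊆ in
            ind-base (contained es) (ind-~ D~ (JC.ind⁺ D* (D*-ind (List.map h ns)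
              (LAllₚ.map⁺ (LAll.tabulate {xs = ns} λ {n} _ → enum∈ n)))))
            where
            contained : ∀ {G ns} → Listᴾ.Pointwise (λ x n → x ≈ hh n) G ns → All (_∈cl List.map J.to (List.map h ns)) G
            contained Listᴾ.[]       = []
            contained (e Listᴾ.∷ es) = cl-∈ (here e) ∷ LAll.map cl-there (contained es)

          module _ (ns₀ : List ℕ) (F*≈ : Listᴾ.Pointwise (λ x n → x M.≈ h n) F* ns₀) where
            open Tree em wqm 𝕄 fqm galois j using (Determines; determined)

            F*⊆cl : All (MC._∈cl List.map h ns₀) F*
            F*⊆cl = go F*≈
              where
              go : ∀ {X ns} → Listᴾ.Pointwise (λ x n → x M.≈ h n) X ns → All (MC._∈cl List.map h ns) X
              go Listᴾ.[]       = []
              go (e Listᴾ.∷ es) = MC.cl-∈ (here e) ∷ LAll.map MC.cl-there (go es)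

            -- `D*` is joined to `E*` so that the automorphisms given by `determined` fix `D*` too.
            DE*⊆ : VecAll.All (MC._∈cl D* ++ List.map h ns₀) (Vec.fromList (D* ++ E*))
            DE*⊆ = VecAllₚ.fromList⁺ (LAllₚ.++⁺ (MC.cl-selfˡ D*) (E*⊆ E~ E⊆))
              where
              E*⊆ : ∀ {E E*} → E ~ E* → All (_∈cl D ++ F₀) E → All (MC._∈cl D* ++ List.map h ns₀) E*
              E*⊆ Listᴾ.[]       []       = []
              E*⊆ (e Listᴾ.∷ es) (p ∷ ps) =
                MC.cl-trans (LAllₚ.++⁺ (MC.cl-selfˡ D*) (LAll.map (MC.cl-++ʳ D*) F*⊆cl)) (cl* (Listᴾ.++⁺ D~ F~) e p) ∷ E*⊆ es ps

            conclude : (Σ[ ns ∈ List ℕ ] All (_∈≡ ns) ns₀ ×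
                         Determines h h-closed R-closed R-inf ns₀ D*
                           h-ind (Vec.fromList (D* ++ E*)) DE*⊆ ns) → IsolatingSet
            conclude (ns , ns₀⊆ , det) = List.map (inverseᵃ α ∙_) F′ ,
                ind-conj , isolates-mono F⊆F′F₀ (isolates-conjugate α (isolates-mono αα (isolates)))
              where
              F′ : List Carrier
              F′ = List.map hh ns
              F′⊆ : All (Range hh) F′
              F′⊆ = LAllₚ.map⁺ (LAll.tabulate {xs = ns} λ {n} _ → n , ≈-refl)
              αα : All (_∈ List.map (α ∙_) (List.map (inverseᵃ α ∙_) F′)) F′
              αα = go F′
                where
                go : ∀ X → All (_∈ List.map (α ∙_) (List.map (inverseᵃ α ∙_) X)) X
                go []      = []
                go (x ∷ X) = here (≈-sym (∙-inverseʳ α)) ∷ LAll.map there (go X)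
              F⊆F′F₀ : All (_∈ List.map (inverseᵃ α ∙_) F′ ++ F₀) (List.map (inverseᵃ α ∙_) F′)
              F⊆F′F₀ = LAll.tabulateₛ setoid LAnyₚ.++⁺ˡ
              αF₀⊆ : All (_∈ F′) (List.map (α ∙_) F₀)
              αF₀⊆ = go F~ F*≈ ns₀⊆
                where
                go : ∀ {X X* ms} → X ~ X* → Listᴾ.Pointwise (λ x n → x M.≈ h n) X* ms → All (_∈≡ ns) ms → All (_∈ F′) (List.map (α ∙_) X)
                go Listᴾ.[]       Listᴾ.[]       []       = []
                go (e Listᴾ.∷ es) (f Listᴾ.∷ fs) (p ∷ ps) =
                  LAnyₚ.map⁺ (LAny.map (λ { refl → ≈-trans e (J.cong f) }) p) ∷ go es fs ps
              αF₀⊆R : All (Range hh) (List.map (α ∙_) F₀)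
              αF₀⊆R = LAll.map (λ x∈ → let n , _ , e = find (LAnyₚ.map⁻ x∈) in n , e) αF₀⊆
              ind-conj : Ind (List.map (inverseᵃ α ∙_) F′ ++ F₀) D
              ind-conj = ind-base (LAllₚ.++⁺ (cl-selfˡ _) (LAll.map (cl-++ʳ (List.map (inverseᵃ α ∙_) F′)) (back F₀)))
                  (subst′ (ind-aut (inverseᵃ α) (List.map (α ∙_) D)
                    (R-ind (F′ ++ List.map (α ∙_) F₀) (LAllₚ.++⁺ F′⊆ αF₀⊆R))))
                where
                back : ∀ X → All (_∈cl List.map (inverseᵃ α ∙_) (List.map (α ∙_) X)) X
                back []      = []
                back (x ∷ X) = cl-∈ (here (≈-sym (∙-inverseˡ α))) ∷ LAll.map cl-there (back X)
                unmap : ∀ {G} X → Ind G (List.map (inverseᵃ α ∙_) (List.map (α ∙_) X)) → Ind G X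
                unmap []      _       = _
                unmap {G} (x ∷ X) (p , i) = (λ q → p (cl-resp (≈-sym (∙-inverseˡ α))
                  (cl-trans (LAllₚ.++⁺ (LAll.map cl-++ˡ (back X)) (cl-selfʳ _)) q))) , unmap X i
                subst′ : Ind (List.map (inverseᵃ α ∙_) (F′ ++ List.map (α ∙_) F₀)) (List.map (inverseᵃ α ∙_) (List.map (α ∙_) D)) →
                         Ind (List.map (inverseᵃ α ∙_) F′ ++ List.map (inverseᵃ α ∙_) (List.map (α ∙_) F₀)) D
                subst′ i = unmap D (subst (λ G → Ind G _) (map-++ (inverseᵃ α ∙_) F′ (List.map (α ∙_) F₀)) i)
              FixedDE : ∀ ρ {X X*} → X ~ X* → VecAll.All (λ e → ρ ∙ J.to e ≈ J.to e) (Vec.fromList X*) → Fixes ρ (List.map (α ∙_) X)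
              FixedDE ρ Listᴾ.[]       VecAll.[]       = []
              FixedDE ρ (e Listᴾ.∷ es) (p VecAll.∷ ps) = ≈-trans (∙-cong ρ e) (≈-trans p (≈-sym e)) ∷ FixedDE ρ es ps
              pairIndices : ∀ ps → All (Range hh) (dom ps) → All (Range hh) (cod ps) →
                Σ[ is ∈ List (ℕ × ℕ) ] Listᴾ.Pointwise (λ (a , b) (i , k) → a ≈ hh i × b ≈ hh k) ps is
              pairIndices []       []             []             = [] , Listᴾ.[]
              pairIndices (_ ∷ ps) ((i , e) ∷ es) ((k , f) ∷ fs) with is , g ← pairIndices ps es fs =
                (i , k) ∷ is , (e , f) Listᴾ.∷ g
              maps⇒ : ∀ {σ : Aut} {ps is} → Listᴾ.Pointwise (λ (a , b) (i , k) → a ≈ hh i × b ≈ hh k) ps is →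
                      All (λ (a , b) → σ ∙ a ≈ b) ps → All (λ (i , k) → σ ∙ hh i ≈ hh k) is
              maps⇒ Listᴾ.[] [] = []
              maps⇒ {σ} ((e , f) Listᴾ.∷ es) (p ∷ ps) = ≈-trans (∙-cong σ (≈-sym e)) (≈-trans p f) ∷ maps⇒ {σ} es ps
              maps⇐ : ∀ {σ : Aut} {ps is} → Listᴾ.Pointwise (λ (a , b) (i , k) → a ≈ hh i × b ≈ hh k) ps is →
                      All (λ (i , k) → σ ∙ hh i ≈ hh k) is → All (λ (a , b) → σ ∙ a ≈ b) ps
              maps⇐ Listᴾ.[] [] = []
              maps⇐ {σ} ((e , f) Listᴾ.∷ es) (p ∷ ps) = ≈-trans (∙-cong σ e) (≈-trans p (≈-sym f)) ∷ maps⇐ {σ} es ps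
              determined′ : ∀ (ps : List (Carrier × Carrier)) → All (Range hh) (dom ps) → All (Range hh) (cod ps) →
                (Σ[ σ ∈ Aut ] Fixes σ F′ × All (λ (a , b) → σ ∙ a ≈ b) ps) →
                Σ[ ρ ∈ Aut ] Fixes ρ F′ × All (λ (a , b) → ρ ∙ a ≈ b) ps × Fixes ρ (List.map (α ∙_) D ++ List.map (α ∙_) E)
              determined′ ps d c (σ , σF , σps) =
                let is , ps~is = pairIndices ps d c
                    ρ , ρns , ρis , ρE = det is (σ , LAllₚ.map⁻ σF , maps⇒ {σ} ps~is σps)
                in ρ , LAllₚ.map⁺ ρns , maps⇐ {ρ} ps~is ρis ,
                   subst (Fixes ρ) (map-++ (α ∙_) D E) (FixedDE ρ (Listᴾ.++⁺ D~ E~) ρE)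
              open FromDetermined R-closed R-inf F′ (List.map (α ∙_) D) (List.map (α ∙_) E) F′⊆ R-ind
                (LAllₚ.map⁺ (LAll.map (λ p → cl-trans (subst (All (_∈cl List.map (α ∙_) D ++ F′)) (sym (map-++ (α ∙_) D F₀))
                  (LAllₚ.++⁺ (cl-selfˡ (List.map (α ∙_) D)) (LAll.map (cl-++ʳ (List.map (α ∙_) D) ∘ cl-∈) αF₀⊆))) (aut-cl α p)) E⊆))
                determined′ using (isolates)

            isolating : IsolatingSet
            isolating = conclude (determined h h-closed R-closed R-inf ns₀ D* h-ind (Vec.fromList (D* ++ E*)) DE*⊆)

          isolatingSet′ : IsolatingSet
          isolatingSet′ = let ns₀ , es = indexes F*⊆ in isolating ns₀ es

    abstract
      -- All elements are moved into the range of `M`, where the tree argument is available. The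
      -- model used there is built on a sequence generic over `D*` and `F*`, so that `D*` is
      -- independent over it.
      isolatingSet : IsolatingSet
      isolatingSet = go (moveInto J.closed-range inf-range identityᵃ [] [] (F₀ ++ D ++ E))
        where
        inf-range : InfDim (Range J.to)
        inf-range G = let m , (x , _ , e) , q = image-inf M-inf G in m , (x , e) , q
        go : Σ[ α ∈ Aut ] Fixes α [] × All (λ x → Range J.to (α ∙ x)) (F₀ ++ D ++ E) → IsolatingSet
        go (α , _ , into) = build (preimages (LAllₚ.++⁻ˡ F₀ into)) (preimages (LAllₚ.++⁻ˡ D (LAllₚ.++⁻ʳ F₀ into)))
            (preimages (LAllₚ.++⁻ʳ D (LAllₚ.++⁻ʳ F₀ into)))
          where
          open Transfer α
          build : Σ[ X* ∈ List M.Carrier ] F₀ ~ X* → Σ[ X* ∈ List M.Carrier ] D ~ X* → Σ[ X* ∈ List M.Carrier ] E ~ X* → IsolatingSet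
          build (F* , F~) (D* , D~) (E* , E~) = isolatingSet′ α F~ D~ E~ (G.H-model F*) (G.base⊆H F*)
              (G.H-indOver D* (MC.cl-self _) (ind* F~ D~ D-ind))
            where module G = CM.Generated {λ _ → ⊤} (λ _ → tt) M-inf (D* ++ F*)

record HomogeneousPregeometry (em : ExcludedMiddle 0ℓ) {L : Language} (𝕄 : PregeometryStructure L) : Set₁ where
  private module 𝕄 = PregeometryStructure 𝕄
  field
    fqm       : FiniteQuasiminimality.IsFinitelyQuasiminimal em 𝕄
    inf       : Pregeometry.InfDim em 𝕄 (λ _ → ⊤)
    galois    : ∀ ps → QFTypes.Elem 𝕄.structure ps →
                Σ[ σ ∈ Automorphism 𝕄.structure ] All (λ (a , b) → Isomorphism.to σ a 𝕄.≈ b) ps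
  open Pregeometry em 𝕄
  open Isolation em 𝕄 fqm galois
  field
    isolating : ∀ {F₀ D E} → Ind F₀ D → All (_∈cl D ++ F₀) E →
                Σ[ F ∈ List 𝕄.Carrier ] Ind (F ++ F₀) D × Isolates (F ++ F₀) D E

-- Non-splitting over models

module Nonsplitting (em : ExcludedMiddle 0ℓ) {L : Language} {𝕄 : PregeometryStructure L}
    (hom : HomogeneousPregeometry em 𝕄) where
  open HomogeneousPregeometry hom
  open PregeometryStructure 𝕄 hiding (Independent)
  open Setoid setoid using () renaming (refl to ≈-refl; sym to ≈-sym; trans to ≈-trans)
  open Pregeometry em 𝕄
  open QFTypes structure
  open Automorphisms structure
  open Homogeneity em 𝕄 fqm galois
  open Isolation em 𝕄 fqm galois

  -- Conjugation by `α`, combined with an enlargement of the base; it carries an isolating set into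
  -- a model while `D` and `E` stay in place.
  isolates-transport : ∀ α {F D E F′} → Fixes α D → Fixes α E → All (λ x → (α ∙ x) ∈ F′) F →
                       Isolates F D E → Isolates F′ D E
  isolates-transport α {F} {D} {E} {F′} αD αE αF isol σ σF′ σD c i = conclude
      (isol (inverseᵃ α ∘ᵃ σ ∘ᵃ α) (LAll.map (λ x∈ → ∙-inverse α (≈-sym (fixed x∈))) αF)
        (LAll.zipWith (λ (p , q) → ∙-inverse α (≈-trans p (≈-sym (≈-trans (∙-cong σ p) q)))) (αD , σD))
        (List.map (inverseᵃ α ∙_) (c ++ F′))
        (ind-base (LAllₚ.++⁺ (cl-self _) (LAll.map pull αF)) (unmap D αD (ind-aut (inverseᵃ α) D i))))
    where
    fixed : ∀ {x} → (α ∙ x) ∈ F′ → σ ∙ α ∙ x ≈ α ∙ x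
    fixed x∈ = let y , y∈ , e = find x∈ in ≈-trans (∙-cong σ e) (≈-trans (LAll.lookup σF′ y∈) (≈-sym e))
    pull : ∀ {x} → (α ∙ x) ∈ F′ → x ∈cl List.map (inverseᵃ α ∙_) (c ++ F′)
    pull x∈ = cl-resp (∙-inverseˡ α) (aut-cl (inverseᵃ α) (cl-++ʳ c (cl-∈ x∈)))
    unmap : ∀ {G} X → Fixes α X → Ind G (List.map (inverseᵃ α ∙_) X) → Ind G X
    unmap []      _        _       = _
    unmap {G} (x ∷ X) (e ∷ es) (p , j) = (λ q → p (cl-resp (≈-sym (∙-inverse α e))
      (cl-trans (LAllₚ.++⁺ (LAll.map cl-++ˡ (map-fixed (inverseᵃ α) (fixes-inverse α es))) (cl-selfʳ _)) q))) , unmap X es j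
    conclude : Σ[ ρ ∈ Aut ] Fixes ρ F × Fixes ρ D × Fixes ρ (List.map (inverseᵃ α ∙_) (c ++ F′)) × Agree ρ (inverseᵃ α ∘ᵃ σ ∘ᵃ α) E →
               Σ[ ρ ∈ Aut ] Fixes ρ F′ × Fixes ρ D × Fixes ρ c × Agree ρ σ E
    conclude (ρ , _ , ρD , ρcF′ , ρE) = α ∘ᵃ ρ ∘ᵃ inverseᵃ α ,
        LAllₚ.++⁻ʳ c cF′ , LAll.zipWith (λ (p , q) → ≈-trans (∙-cong α (≈-trans (∙-cong ρ (∙-inverse α p)) q)) p) (αD , ρD) ,
        LAllₚ.++⁻ˡ c cF′ ,
        LAll.zipWith (λ (p , q) → ≈-trans (∙-cong α (≈-trans (∙-cong ρ (∙-inverse α p)) q)) (≈-trans (∙-inverseʳ α) (∙-cong σ p))) (αE , ρE)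
      where
      cF′ : Fixes (α ∘ᵃ ρ ∘ᵃ inverseᵃ α) (c ++ F′)
      cF′ = LAll.map (λ q → ≈-trans (∙-cong α q) (∙-inverseʳ α)) (LAllₚ.map⁻ ρcF′)

  module _ {𝒜 ℬ : Pred Carrier 0ℓ} (𝒜-closed : Closed 𝒜) (𝒜-inf : InfDim 𝒜) (𝒜⊆ℬ : 𝒜 ⊆ ℬ) (ℬ-closed : Closed ℬ)
      (D E : List Carrier) (D-ind : IndOver ℬ D) (E⊆ : All (cl (𝒜 ∪ ⟪ D ⟫)) E) where

    private
      NonSplitting : Set
      NonSplitting = Σ[ F ∈ List Carrier ] All 𝒜 F ×
        (∀ ps → All ℬ (dom ps) → All ℬ (cod ps) → (σ : Aut) → Fixes σ F → All (λ (a , b) → σ ∙ a ≈ b) ps →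
         Σ[ ρ ∈ Aut ] Fixes ρ F × All (λ (a , b) → ρ ∙ a ≈ b) ps × Fixes ρ E)

      finiteBase : ∀ {E} → All (cl (𝒜 ∪ ⟪ D ⟫)) E → Σ[ F₀ ∈ List Carrier ] All 𝒜 F₀ × All (_∈cl D ++ F₀) E
      finiteBase []       = [] , [] , []
      finiteBase (p ∷ ps) with F , F⊆ , q ← finitary-∪ D p | G , G⊆ , r ← finiteBase ps =
        F ++ G , LAllₚ.++⁺ F⊆ G⊆ ,
        cl-trans (LAllₚ.++⁺ (cl-selfˡ D) (LAll.map (cl-++ʳ D) (cl-selfˡ F))) q ∷
        LAll.map (cl-trans (LAllₚ.++⁺ (cl-selfˡ D) (LAll.map (cl-++ʳ D) (cl-selfʳ F)))) r

      module _ {F₀} (F₀⊆ : All 𝒜 F₀) (E⊆F₀ : All (_∈cl D ++ F₀) E) where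

        -- An isolating set is found somewhere in the monster model, but a base for non-splitting
        -- must lie in the model. An element algebraic over the others and `F₀` follows them; any
        -- other is generic over `E` and `D` as well, since `D` is independent over it, and can be
        -- sent to a generic element of the model.
        intoModel : ∀ X → Ind (X ++ F₀) D → Σ[ α ∈ Aut ] Fixes α (E ++ D ++ F₀) × All (λ x → 𝒜 (α ∙ x)) X
        intoModel []      i = identityᵃ , LAll.tabulate {xs = E ++ D ++ F₀} (λ _ → ≈-refl) , []
        intoModel (x ∷ X) i = add (intoModel X (ind-base (LAll.map cl-there (cl-self _)) i))
          where
          add : Σ[ α ∈ Aut ] Fixes α (E ++ D ++ F₀) × All (λ x → 𝒜 (α ∙ x)) X →
                Σ[ α ∈ Aut ] Fixes α (E ++ D ++ F₀) × All (λ x → 𝒜 (α ∙ x)) (x ∷ X)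
          add (α , fix , into) with em {x ∈cl X ++ F₀}
          ... | yes p = α , fix , aut-closed α 𝒜-closed (LAllₚ.++⁺ into
                  (LAll.zipWith (λ (e , q) → closed-respects 𝒜-closed (≈-sym e) q)
                    (LAllₚ.++⁻ʳ D (LAllₚ.++⁻ʳ E fix) , F₀⊆))) p ∷ into
          ... | no ¬p = change (𝒜-inf (List.map (α ∙_) Q))
            where
            Q : List Carrier
            Q = X ++ E ++ D ++ F₀
            x∉ : ¬ x ∈cl Q
            x∉ p = ¬p (ind-algebraic D i (cl-trans (LAllₚ.++⁺ (LAll.map (cl-++ʳ D) (cl-selfˡ X))
              (LAllₚ.++⁺ (LAll.map (cl-trans DF₀⊆) E⊆F₀) (LAll.map (cl-trans DF₀⊆) (cl-self (D ++ F₀))))) p))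
              where
              DF₀⊆ : All (_∈cl D ++ X ++ F₀) (D ++ F₀)
              DF₀⊆ = LAllₚ.++⁺ (cl-selfˡ D) (LAll.map (cl-++ʳ D) (cl-selfʳ X))
            change : Σ[ m ∈ Carrier ] 𝒜 m × ¬ m ∈cl List.map (α ∙_) Q →
                     Σ[ α ∈ Aut ] Fixes α (E ++ D ++ F₀) × All (λ x → 𝒜 (α ∙ x)) (x ∷ X)
            change (m , m∈ , m∉) with τ , q ∷ [] , agree ← extendIndependent α Q ((x , m) ∷ []) (x∉ , _) (m∉ , _) =
              τ , agree-fixes {τ} {α} (LAllₚ.++⁻ʳ X agree) fix , closed-respects 𝒜-closed (≈-sym q) m∈ ∷
              LAll.zipWith (λ (e , r) → closed-respects 𝒜-closed (≈-sym e) r) (LAllₚ.++⁻ˡ X agree , into)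

        conclude : Σ[ F ∈ List Carrier ] Ind (F ++ F₀) D × Isolates (F ++ F₀) D E → NonSplitting
        conclude (F , i , isol) = moved (intoModel F i)
          where
          moved : Σ[ α ∈ Aut ] Fixes α (E ++ D ++ F₀) × All (λ x → 𝒜 (α ∙ x)) F → NonSplitting
          moved (α , fix , into) = F′ , F′⊆ , λ ps d c σ σF′ σps →
              extended ps d c σ σF′ σps (extendFixing σ (dom ps ++ F′) D
                (D-ind _ (LAllₚ.++⁺ d (LAll.map 𝒜⊆ℬ F′⊆)))
                (D-ind _ (LAllₚ.map⁺ (LAllₚ.++⁺ (LAllₚ.map⁺ (image {σ} ps σps (LAllₚ.map⁻ c)))
                  (LAll.zipWith (λ (e , p) → closed-respects ℬ-closed (≈-sym e) (𝒜⊆ℬ p)) (σF′ , F′⊆))))))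
            where
            F′ : List Carrier
            F′ = List.map (α ∙_) F ++ F₀
            F′⊆ : All 𝒜 F′
            F′⊆ = LAllₚ.++⁺ (LAllₚ.map⁺ into) F₀⊆
            isol′ : Isolates F′ D E
            isol′ = isolates-transport α (LAllₚ.++⁻ˡ D (LAllₚ.++⁻ʳ E fix)) (LAllₚ.++⁻ˡ E fix)
              (LAllₚ.++⁺ (LAll.map LAnyₚ.++⁺ˡ (LAll.tabulateₛ setoid (λ {x} x∈ → LAnyₚ.map⁺ (LAny.map (∙-cong α) x∈))))
                (LAll.map (LAnyₚ.++⁺ʳ (List.map (α ∙_) F))
                  (LAll.zipWith (λ (e , x∈) → ∈ₚ.∈-resp-≈ setoid (≈-sym e) x∈)
                    (LAllₚ.++⁻ʳ D (LAllₚ.++⁻ʳ E fix) , LAll.tabulateₛ setoid id)))) isol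
            image : ∀ {σ : Aut} ps → All (λ (a , b) → σ ∙ a ≈ b) ps → All (λ p → ℬ (proj₂ p)) ps → All (λ p → ℬ (σ ∙ proj₁ p)) ps
            image ps s t = LAll.zipWith (λ (e , q) → closed-respects ℬ-closed (≈-sym e) q) (s , t)
            -- As `D` is independent over `ℬ`, the map can be realized by some `τ` fixing `D`. By
            -- isolation some `ρ` fixes the targets of `ps` and acts on `E` as `τ`; dividing by it
            -- fixes `E`.
            extended : ∀ ps → All ℬ (dom ps) → All ℬ (cod ps) → (σ : Aut) → Fixes σ F′ → All (λ (a , b) → σ ∙ a ≈ b) ps →
              Σ[ τ ∈ Aut ] Fixes τ D × Agree τ σ (dom ps ++ F′) →
              Σ[ ρ ∈ Aut ] Fixes ρ F′ × All (λ (a , b) → ρ ∙ a ≈ b) ps × Fixes ρ E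
            extended ps d c σ σF′ σps (τ , τD , agree) = finish (isol′ τ τF′ τD (cod ps)
                (D-ind _ (LAllₚ.++⁺ c (LAll.map 𝒜⊆ℬ F′⊆))))
              where
              τF′ : Fixes τ F′
              τF′ = agree-fixes {τ} {σ} (LAllₚ.++⁻ʳ (dom ps) agree) σF′
              finish : Σ[ ρ ∈ Aut ] Fixes ρ F′ × Fixes ρ D × Fixes ρ (cod ps) × Agree ρ τ E →
                       Σ[ ρ ∈ Aut ] Fixes ρ F′ × All (λ (a , b) → ρ ∙ a ≈ b) ps × Fixes ρ E
              finish (ρ , ρF′ , _ , ρc , ρE) = inverseᵃ ρ ∘ᵃ τ ,
                fixes-∘ (inverseᵃ ρ) τ (fixes-inverse ρ ρF′) τF′ ,
                LAll.zipWith (λ (p , q , r) → ∙-inverse ρ (≈-trans r (≈-sym (≈-trans p q))))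
                  (LAllₚ.map⁻ (LAllₚ.++⁻ˡ (dom ps) agree) , LAll.zip (σps , LAllₚ.map⁻ ρc)) ,
                LAll.map (∙-inverse ρ) ρE

    abstract
      nonsplitting : NonSplitting
      nonsplitting = let F₀ , F₀⊆ , E⊆F₀ = finiteBase E⊆ in
        conclude F₀⊆ E⊆F₀ (isolating (D-ind F₀ (LAll.map 𝒜⊆ℬ F₀⊆)) E⊆F₀)

-- Automorphisms of the structures of imaginaries

module ImaginaryAutomorphisms {X : Ambient} (ℰ : Imaginaries X) where
  open Ambient X
  open Imaginaries ℰ
  open Types X using (Aut; _·*_)
  open Automorphisms structure
  open Setoid setoid using () renaming (refl to ≈-refl; sym to ≈-sym; trans to ≈-trans)
  open Setoid imaginarySetoid using () renaming (refl to ≈ᵉ-refl; sym to ≈ᵉ-sym; trans to ≈ᵉ-trans)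
  private
    module Sᵉ = Structure structureᵉ

    ≋-refl : ∀ {n} {a : Vec Carrier n} → a ≋ a
    ≋-refl = Pointwise.refl ≈-refl

    ≋-trans : ∀ {n} {a b c : Vec Carrier n} → a ≋ b → b ≋ c → a ≋ c
    ≋-trans = Pointwise.trans ≈-trans

    ≋-sym : ∀ {n} {a b : Vec Carrier n} → a ≋ b → b ≋ a
    ≋-sym = Pointwise.sym ≈-sym

    ≋ᵉ-trans : ∀ {n} {a b c : Vec Imaginary n} → a ≋ᵉ b → b ≋ᵉ c → a ≋ᵉ c
    ≋ᵉ-trans = Pointwise.trans ≈ᵉ-trans

    ≋ᵉ-reflexive : ∀ {n} {a b : Vec Imaginary n} → a ≡ b → a ≋ᵉ b
    ≋ᵉ-reflexive refl = Pointwise.refl ≈ᵉ-refl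

  -- Compatibility with equality follows from `given`, because Galois types do not distinguish equal
  -- tuples.
  E-resp : ∀ s {a b} → a ≋ b → E s a b
  E-resp nothing  e = e
  E-resp (just i) {a} {b} e with k , f , _ , q ← Equivalence.to (given i a a) (E.refl (just i)) =
    Equivalence.from (given i a b) (k , f , (λ ()) , ≋-trans (Pointwise.map⁺ (Isomorphism.cong f)
      (Pointwise.++⁺ ≋-refl (≋-sym e))) q)

  E-invariant : ∀ s (f : Aut) {a b} → E s a b → E s (f ·* a) (f ·* b)
  E-invariant nothing  f e = Pointwise.map⁺ (Isomorphism.cong f) e
  E-invariant (just i) f {a} {b} e with k , g , _ , q ← Equivalence.to (given i a b) e =
    Equivalence.from (given i _ _) (k , g ∘ᵃ inverseᵃ f , (λ ()) ,
      subst (λ v → Vec.map ((g ∘ᵃ inverseᵃ f) ∙_) v ≋ galoisTypes i k) (Vecₚ.map-++ (f ∙_) a b)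
        (≋-trans (back (a Vec.++ b)) q))
    where
    back : ∀ {n} (v : Vec Carrier n) → Vec.map ((g ∘ᵃ inverseᵃ f) ∙_) (Vec.map (f ∙_) v) ≋ Vec.map (g ∙_) v
    back []      = []
    back (x ∷ v) = ∙-cong g (∙-inverseˡ f) ∷ back v

  private
    apply : Aut → Imaginary → Imaginary
    apply f (s , a) = s , f ·* a

    apply-cong : ∀ f {u v} → u ≈ᵉ v → apply f u ≈ᵉ apply f v
    apply-cong f (class {s} e) = class (E-invariant s f e)

    apply-cancel : ∀ {f g : Aut} → (∀ {a} → (f ∙ g ∙ a) ≈ a) → ∀ u → apply f (apply g u) ≈ᵉ u
    apply-cancel {f} {g} inv (s , a) = class (E-resp s (cancel a))
      where
      cancel : ∀ {n} (v : Vec Carrier n) → Vec.map (f ∙_) (Vec.map (g ∙_) v) ≋ v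
      cancel []      = []
      cancel (x ∷ v) = inv ∷ cancel v

    apply-ι : ∀ f {n} (a : Vec Carrier n) → Vec.map (apply f) (Vec.map ι a) ≡ Vec.map ι (f ·* a)
    apply-ι f []      = refl
    apply-ι f (x ∷ a) = cong (ι (f ∙ x) ∷_) (apply-ι f a)

    apply-ι-≋ : ∀ f {n} {us : Vec Imaginary n} {a} → us ≋ᵉ Vec.map ι a → Vec.map (apply f) us ≋ᵉ Vec.map ι (f ·* a)
    apply-ι-≋ f {a = a} e = ≋ᵉ-trans (Pointwise.map⁺ (apply-cong f) e) (≋ᵉ-reflexive (apply-ι f a))

    apply-rel : ∀ f {n} (R : RelSymᵉ n) us → relᵉ R us → relᵉ R (Vec.map (apply f) us)
    apply-rel f (old R)   us       (a , e , r) = f ·* a , apply-ι-≋ f e , Equivalence.to (Isomorphism.rel-hom f R a) r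
    apply-rel f (graph φ) (v ∷ us) (a , e , q) = f ·* a , apply-ι-≋ f e ,
      ≈ᵉ-trans (apply-cong f q) (class (Isomorphism.fun-hom f φ a ∷ []))
    apply-rel f (P s)     (v ∷ []) (a , q)     = f ·* a , apply-cong f q
    apply-rel f (F s)     (v ∷ us) (a , e , q) = f ·* a , apply-ι-≋ f e , apply-cong f q

  lift : Aut → Automorphism structureᵉ
  lift f = record
    { embedding  = record
        { to        = apply f
        ; cong      = apply-cong f
        ; injective = λ {u} {v} e → ≈ᵉ-trans (≈ᵉ-sym (back u)) (≈ᵉ-trans (apply-cong (inverseᵃ f) e) (back v))
        ; fun-hom   = λ ()
        ; rel-hom   = λ R us → mk⇔ (apply-rel f R us)
            (λ r → Sᵉ.rel-resp R (backs us) (apply-rel (inverseᵃ f) R (Vec.map (apply f) us) r))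
        }
    ; surjective = λ u → apply (inverseᵃ f) u , ≈ᵉ-sym (apply-cancel {f} {inverseᵃ f} (∙-inverseʳ f) u)
    }
    where
    back : ∀ u → apply (inverseᵃ f) (apply f u) ≈ᵉ u
    back = apply-cancel {inverseᵃ f} {f} (∙-inverseˡ f)
    backs : ∀ {n} (us : Vec Imaginary n) → Vec.map (apply (inverseᵃ f)) (Vec.map (apply f) us) ≋ᵉ us
    backs []       = []
    backs (u ∷ us) = back u ∷ backs us

  ι-injective : ∀ {a b} → ι a ≈ᵉ ι b → a ≈ b
  ι-injective (class (e ∷ [])) = e

  private
    ι-injective* : ∀ {n} {a b : Vec Carrier n} → Vec.map ι a ≋ᵉ Vec.map ι b → a ≋ b
    ι-injective* {a = []}    {[]}    []       = []
    ι-injective* {a = _ ∷ _} {_ ∷ _} (e ∷ es) = ι-injective e ∷ ι-injective* es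

    ≋ᵉ-refl : ∀ {n} {a : Vec Imaginary n} → a ≋ᵉ a
    ≋ᵉ-refl = Pointwise.refl ≈ᵉ-refl

    ≋ᵉ-sym : ∀ {n} {a b : Vec Imaginary n} → a ≋ᵉ b → b ≋ᵉ a
    ≋ᵉ-sym = Pointwise.sym ≈ᵉ-sym

  module Restrict (g : Automorphism structureᵉ) where
    private
      module g = Isomorphism g

      onι : ∀ m → Σ[ m′ ∈ Carrier ] g.to (ι m) ≈ᵉ ι m′
      onι m with m′ ∷ [] , e ← Equivalence.to (g.rel-hom (P nothing) (ι m ∷ [])) (m ∷ [] , ≈ᵉ-refl) = m′ , e

      f : Carrier → Carrier
      f m = proj₁ (onι m)

      spec : ∀ m → g.to (ι m) ≈ᵉ ι (f m)
      spec m = proj₂ (onι m)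

      specs : ∀ {n} (a : Vec Carrier n) → Vec.map g.to (Vec.map ι a) ≋ᵉ Vec.map ι (Vec.map f a)
      specs []      = []
      specs (x ∷ a) = spec x ∷ specs a

      identify : ∀ {n} (xs : Vec Carrier n) {a} → Vec.map g.to (Vec.map ι xs) ≋ᵉ Vec.map ι a → a ≋ Vec.map f xs
      identify xs e = ι-injective* (≋ᵉ-trans (≋ᵉ-sym e) (specs xs))

    restrict : Aut
    restrict = record
      { embedding  = record
          { to        = f
          ; cong      = λ {x} {y} e → ι-injective (≈ᵉ-trans (≈ᵉ-sym (spec x)) (≈ᵉ-trans (g.cong (class (e ∷ []))) (spec y)))
          ; injective = λ {x} {y} e → ι-injective (g.injective (≈ᵉ-trans (spec x) (≈ᵉ-trans (class (e ∷ [])) (≈ᵉ-sym (spec y)))))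
          ; fun-hom   = λ φ xs → let a , e , q = Equivalence.to (g.rel-hom (graph φ) (ι (fun φ xs) ∷ Vec.map ι xs)) (xs , ≋ᵉ-refl , ≈ᵉ-refl) in
              ι-injective (≈ᵉ-trans (≈ᵉ-sym (spec _)) (≈ᵉ-trans q (class (fun-cong φ (identify xs e) ∷ []))))
          ; rel-hom   = λ R xs → mk⇔
              (λ r → let a , e , q = Equivalence.to (g.rel-hom (old R) (Vec.map ι xs)) (xs , ≋ᵉ-refl , r) in rel-resp R (identify xs e) q)
              (λ r → let a , e , q = Equivalence.from (g.rel-hom (old R) (Vec.map ι xs)) (Vec.map f xs , specs xs , r) in
                rel-resp R (≋-sym (ι-injective* e)) q)
          }
      ; surjective = λ y → onto y (g.surjective (ι y))
      }
      where
      onto : ∀ y → Σ[ u ∈ Imaginary ] ι y ≈ᵉ g.to u → Σ[ x ∈ Carrier ] y ≈ f x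
      onto y (u , e) with m ∷ [] , q ← Equivalence.from (g.rel-hom (P nothing) (u ∷ [])) (y ∷ [] , ≈ᵉ-sym e) =
        m , ι-injective (≈ᵉ-trans e (≈ᵉ-trans (g.cong q) (spec m)))

    -- The relation `F s` ties a class to the tuples representing it, so an automorphism is
    -- determined by its action on the copy of the original structure.
    lift-restrict : ∀ u → Isomorphism.to (lift restrict) u ≈ᵉ g.to u
    lift-restrict (s , a) =
      let a′ , e , q = Equivalence.to (g.rel-hom (F s) ((s , a) ∷ Vec.map ι a)) (a , ≋ᵉ-refl , ≈ᵉ-refl) in
      ≈ᵉ-trans (class (E-resp s (≋-sym (identify a e)))) (≈ᵉ-sym q)

-- X arises from the structure S by adding imaginaries; every element of
-- X is determined by a finite support in S.
record Above {L : Language} (S : Structure L) (IsMod : Pred (Structure.Carrier S) 0ℓ → Set₁) (X : Ambient) : Set₁ where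
  private
    module S = Structure S
    module X = Ambient X
  open Automorphisms S using (_∘ᵃ_; identityᵃ)
  field
    act          : Automorphism S → Automorphism X.structure
    restrict     : Automorphism X.structure → Automorphism S
    act-restrict : ∀ g x → Isomorphism.to (act (restrict g)) x X.≈ Isomorphism.to g x
    act-∘        : ∀ σ τ x → Isomorphism.to (act (σ ∘ᵃ τ)) x X.≈ Isomorphism.to (act σ) (Isomorphism.to (act τ) x)
    supp         : X.Carrier → List S.Carrier
    act-agree    : ∀ σ τ x → All (λ m → Isomorphism.to σ m S.≈ Isomorphism.to τ m) (supp x) →
                   Isomorphism.to (act σ) x X.≈ Isomorphism.to (act τ) x
    act-identity : ∀ x → Isomorphism.to (act identityᵃ) x X.≈ x
    supp-act     : ∀ σ x → supp (Isomorphism.to (act σ) x) ≡ List.map (Isomorphism.to σ) (supp x)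
    emb          : S.Carrier → X.Carrier
    emb-cong     : ∀ {a b} → a S.≈ b → emb a X.≈ emb b
    emb-injective : ∀ {a b} → emb a X.≈ emb b → a S.≈ b
    act-emb      : ∀ σ a → Isomorphism.to (act σ) (emb a) X.≈ emb (Isomorphism.to σ a)
    supp-emb     : ∀ a → supp (emb a) ≡ a ∷ []

  Points : Pred S.Carrier 0ℓ → Pred X.Carrier 0ℓ
  Points 𝒜 x = Σ[ y ∈ X.Carrier ] x X.≈ y × All 𝒜 (supp y)

  field
    emb-points   : ∀ {𝒜 : Pred S.Carrier 0ℓ} → (∀ {a b} → a S.≈ b → 𝒜 a → 𝒜 b) → ∀ {a} → Points 𝒜 (emb a) → 𝒜 a

  Enumerable : ∀ {A : Set} → (A → A → Set) → Pred A 0ℓ → Set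
  Enumerable {A} _≈_ P = Σ[ h ∈ (ℕ → A) ] (∀ n → P (h n)) × (∀ {x} → P x → Σ[ n ∈ ℕ ] x ≈ h n)

  field
    submodel⇒    : ∀ {P} → X.Submodel P → Σ[ 𝒜 ∈ Pred S.Carrier 0ℓ ] IsMod 𝒜 × P ≐ Points 𝒜
    submodel⇐    : ∀ {𝒜} → IsMod 𝒜 → X.Submodel (Points 𝒜)
    enumerable   : ∀ {𝒜} → Enumerable S._≈_ 𝒜 → Enumerable X._≈_ (Points 𝒜)

module AboveVectors {L : Language} {S : Structure L} {IsMod : Pred (Structure.Carrier S) 0ℓ → Set₁} {X : Ambient}
    (A : Above S IsMod X) where
  private
    module S = Structure S
    module A = Above A
  open Ambient X using (Carrier; _≈_; _≋_; setoid)
  open Setoid setoid using () renaming (refl to ≈-refl)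

  supp* : ∀ {n} → Vec Carrier n → List S.Carrier
  supp* []      = []
  supp* (x ∷ a) = A.supp x ++ supp* a

  act-agree* : ∀ σ τ {n} (a : Vec Carrier n) → All (λ m → Isomorphism.to σ m S.≈ Isomorphism.to τ m) (supp* a) →
               Vec.map (Isomorphism.to (A.act σ)) a ≋ Vec.map (Isomorphism.to (A.act τ)) a
  act-agree* σ τ []      fix = []
  act-agree* σ τ (x ∷ a) fix = A.act-agree σ τ x (LAllₚ.++⁻ˡ (A.supp x) fix) ∷ act-agree* σ τ a (LAllₚ.++⁻ʳ (A.supp x) fix)

  supp*-act : ∀ σ {n} (a : Vec Carrier n) → supp* (Vec.map (Isomorphism.to (A.act σ)) a) ≡ List.map (Isomorphism.to σ) (supp* a)
  supp*-act σ []      = refl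
  supp*-act σ (x ∷ a) = trans (cong₂ _++_ (A.supp-act σ x) (supp*-act σ a)) (sym (map-++ (Isomorphism.to σ) (A.supp x) (supp* a)))

  represent : ∀ {𝒜 n} {a : Vec Carrier n} → VecAll.All (A.Points 𝒜) a → Σ[ b ∈ Vec Carrier n ] a ≋ b × All 𝒜 (supp* b)
  represent VecAll.[] = [] , [] , []
  represent ((y , e , y∈) VecAll.∷ ps) with b , f , b∈ ← represent ps = y ∷ b , e ∷ f , LAllₚ.++⁺ y∈ b∈

  points : ∀ {𝒜 n} (b : Vec Carrier n) → All 𝒜 (supp* b) → VecAll.All (A.Points 𝒜) b
  points []      b∈ = VecAll.[]
  points (x ∷ b) b∈ = (x , ≈-refl , LAllₚ.++⁻ˡ (A.supp x) b∈) VecAll.∷ points b (LAllₚ.++⁻ʳ (A.supp x) b∈)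

module _ (em : ExcludedMiddle 0ℓ) {L : Language} {S : Structure L} {IsMod : Pred (Structure.Carrier S) 0ℓ → Set₁} where

  -- The support of a class is that of the tuple presenting it. It depends on the presentation,
  -- which is why `Points` passes to an equal element. The construction iterates and so serves both
  -- stages of imaginaries.
  above-eq : ∀ {X} (ℰ : Imaginaries X) → Above S IsMod X → Above S IsMod (Imaginaries.eq ℰ)
  above-eq {X} ℰ A = record
    { act           = lift ∘ A.act
    ; restrict      = λ g → A.restrict (Restrict.restrict g)
    ; act-restrict  = λ g (s , a) → ≈ᵉ-trans (class (E-resp s (pointwise (A.act-restrict (Restrict.restrict g)) a)))
                                     (Restrict.lift-restrict g (s , a))
    ; act-∘         = λ σ τ (s , a) → class (E-resp s (≋-trans (pointwise (A.act-∘ σ τ) a)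
                        (≋-reflexive (Vecₚ.map-∘ _ _ a))))
    ; supp          = supp
    ; act-agree     = λ σ τ (s , a) fix → class (E-resp s (act-agree* σ τ a fix))
    ; act-identity  = λ (s , a) → class (E-resp s (≋-trans (pointwise A.act-identity a) (≋-reflexive (Vecₚ.map-id a))))
    ; emb-points    = λ { resp ((nothing , b ∷ []) , class (e ∷ []) , b∈) → A.emb-points resp (b , e , LAllₚ.++⁻ˡ (A.supp b) b∈) }
    ; supp-act      = λ σ (s , a) → supp*-act σ a
    ; emb           = ι ∘ A.emb
    ; emb-cong      = λ e → class (A.emb-cong e ∷ [])
    ; emb-injective = A.emb-injective ∘ ι-injective
    ; act-emb       = λ σ a → class (A.act-emb σ a ∷ [])
    ; supp-emb      = λ a → cong (_++ []) (A.supp-emb a)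
    ; submodel⇒     = λ (Q , Q-sub , P≐) → let 𝒜 , mod , Q≐ = A.submodel⇒ Q-sub in 𝒜 , mod ,
        (λ p → let s , a , a∈ , e = proj₁ P≐ p ; b , f , b∈ = represent (VecAll.map (proj₁ Q≐) a∈) in
               (s , b) , ≈ᵉ-trans e (class (E-resp s f)) , b∈) ,
        (λ ((s , b) , e , b∈) → proj₂ P≐ (s , b , VecAll.map (proj₂ Q≐) (points b b∈) , e))
    ; submodel⇐     = λ {𝒜} mod → A.Points 𝒜 , A.submodel⇐ mod ,
        (λ ((s , b) , e , b∈) → s , b , points b b∈ , e) ,
        (λ (s , a , a∈ , e) → let b , f , b∈ = represent a∈ in (s , b) , ≈ᵉ-trans e (class (E-resp s f)) , b∈)
    ; enumerable    = λ {𝒜} enum → enumerated (A.enumerable enum)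
    }
    where
    module A = Above A
    module X = Ambient X
    module SS = Structure S
    open AboveVectors A
    open Imaginaries ℰ
    open ImaginaryAutomorphisms ℰ
    open X using (Carrier; _≈_; _≋_)
    open Setoid X.setoid using () renaming (refl to ≈-refl; sym to ≈-sym; trans to ≈-trans)
    open Setoid imaginarySetoid using () renaming (refl to ≈ᵉ-refl; sym to ≈ᵉ-sym; trans to ≈ᵉ-trans)

    ≋-trans : ∀ {n} {a b c : Vec Carrier n} → a ≋ b → b ≋ c → a ≋ c
    ≋-trans = Pointwise.trans ≈-trans

    ≋-reflexive : ∀ {n} {a b : Vec Carrier n} → a ≡ b → a ≋ b
    ≋-reflexive refl = Pointwise.refl ≈-refl

    pointwise : ∀ {f g : Carrier → Carrier} → (∀ x → f x ≈ g x) → ∀ {n} (a : Vec Carrier n) → Vec.map f a ≋ Vec.map g a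
    pointwise e []      = []
    pointwise e (x ∷ a) = e x ∷ pointwise e a

    supp : Imaginary → List SS.Carrier
    supp (s , a) = supp* a

    module J = Injection countable

    sort : ℕ → Sort
    sort zero    = nothing
    sort (suc m) = choose em
      where
      choose : Dec (Σ[ i ∈ J ] J.to i ≡ m) → Sort
      choose (yes (i , _)) = just i
      choose (no _)        = nothing

    sort-onto : ∀ s → Σ[ m ∈ ℕ ] sort m ≡ s
    sort-onto nothing  = 0 , refl
    sort-onto (just i) = suc (J.to i) , onto
      where
      onto : sort (suc (J.to i)) ≡ just i
      onto with em {Σ[ i′ ∈ J ] J.to i′ ≡ J.to i}
      ... | yes (i′ , e) = cong just (J.injective e)
      ... | no ¬p        = ⊥-elim (¬p (i , refl))

    enumerated : ∀ {𝒜} → Σ[ h ∈ (ℕ → Carrier) ] (∀ n → A.Points 𝒜 (h n)) × (∀ {x} → A.Points 𝒜 x → Σ[ n ∈ ℕ ] x ≈ h n) →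
      Σ[ h ∈ (ℕ → Imaginary) ] (∀ n → Σ[ y ∈ Imaginary ] h n ≈ᵉ y × All 𝒜 (supp y)) ×
        (∀ {x} → Σ[ y ∈ Imaginary ] x ≈ᵉ y × All 𝒜 (supp y) → Σ[ n ∈ ℕ ] x ≈ᵉ h n)
    enumerated {𝒜} (e , e∈ , index) = h ∘ unpair ,
      (λ n → let s = sort (proj₁ (unpair n)) ; b , f , b∈ = represent (all (decode (arity s) (proj₂ (unpair n)))) in
             (s , b) , class (E-resp s f) , b∈) ,
      λ { {x} ((s , b) , q , b∈) → let n , r = locate s b b∈ in n , ≈ᵉ-trans q r }
      where
      h : ℕ × ℕ → Imaginary
      h (m , k) = sort m , Vec.map e (decode (arity (sort m)) k)
      all : ∀ {n} (ks : Vec ℕ n) → VecAll.All (A.Points 𝒜) (Vec.map e ks)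
      all []       = VecAll.[]
      all (k ∷ ks) = e∈ k VecAll.∷ all ks
      indices : ∀ {n} {b : Vec Carrier n} → VecAll.All (A.Points 𝒜) b → Σ[ ks ∈ Vec ℕ n ] b ≋ Vec.map e ks
      indices VecAll.[] = [] , []
      indices (p VecAll.∷ ps) with k , q ← index p | ks , qs ← indices ps = k ∷ ks , q ∷ qs
      locate : ∀ s b → All 𝒜 (supp* b) → Σ[ n ∈ ℕ ] (s , b) ≈ᵉ h (unpair n)
      locate s b b∈ with m , refl ← sort-onto s | ks , f ← indices (points b b∈) =
        pair (m , encode ks) , subst (λ p → (sort m , b) ≈ᵉ h p) (sym (unpair-pair (m , encode ks)))
          (class (E-resp (sort m) (subst (λ v → b ≋ Vec.map e v) (sym (decode-encode ks)) f)))

-- U-rank and dimension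

module Rank (em : ExcludedMiddle 0ℓ) {L : Language} {𝕄 : PregeometryStructure L} (hom : HomogeneousPregeometry em 𝕄)
    {IsMod : Pred (PregeometryStructure.Carrier 𝕄) 0ℓ → Set₁}
    (mod-closed : ∀ {P} → IsMod P → PregeometryStructure.Closed 𝕄 P)
    (mod-inf : ∀ {P} → IsMod P → Pregeometry.InfDim em 𝕄 P)
    {X : Ambient} (A : Above (PregeometryStructure.structure 𝕄) IsMod X) where
  open HomogeneousPregeometry hom
  open PregeometryStructure 𝕄 using (structure; cl; Closed; ⟪_⟫)
  private
    module S = PregeometryStructure 𝕄
    module SS = Setoid S.setoid
  open Pregeometry em 𝕄
  open QFTypes structure using (dom; cod)
  open Automorphisms structure
  open Homogeneity em 𝕄 fqm galois using (moveInto; fixes-∘)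
  open Nonsplitting em hom
  open Ambient X using (Carrier; _≈_; _≋_; setoid)
  open Setoid setoid using () renaming (refl to ≈-refl; sym to ≈-sym; trans to ≈-trans)
  open Types X using (Subset; SameGaloisType; Splits; NsIndependent; U≥)
  open Above A
  open AboveVectors A

  infixr 8 _·_
  _·_ : Automorphism structure → Carrier → Carrier
  σ · x = Isomorphism.to (act σ) x

  _·*_ : ∀ {n} → Automorphism structure → Vec Carrier n → Vec Carrier n
  σ ·* a = Vec.map (σ ·_) a

  private
    ≋-trans : ∀ {n} {a b c : Vec Carrier n} → a ≋ b → b ≋ c → a ≋ c
    ≋-trans = Pointwise.trans ≈-trans

    ≋-sym : ∀ {n} {a b : Vec Carrier n} → a ≋ b → b ≋ a
    ≋-sym = Pointwise.sym ≈-sym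

    ≋-reflexive : ∀ {n} {a b : Vec Carrier n} → a ≡ b → a ≋ b
    ≋-reflexive refl = Pointwise.refl ≈-refl

  act-cong : ∀ σ {x y} → x ≈ y → σ · x ≈ σ · y
  act-cong σ = Isomorphism.cong (act σ)

  act-cong* : ∀ σ {n} {a b : Vec Carrier n} → a ≋ b → σ ·* a ≋ σ ·* b
  act-cong* σ = Pointwise.map⁺ (act-cong σ)

  act-fixes : ∀ σ x → Fixes σ (supp x) → σ · x ≈ x
  act-fixes σ x fix = ≈-trans (act-agree σ identityᵃ x fix) (act-identity x)

  act-fixes* : ∀ σ {n} (a : Vec Carrier n) → Fixes σ (supp* a) → σ ·* a ≋ a
  act-fixes* σ a fix = ≋-trans (act-agree* σ identityᵃ a fix) (identities a)
    where
    identities : ∀ {n} (a : Vec Carrier n) → identityᵃ ·* a ≋ a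
    identities []      = []
    identities (x ∷ a) = act-identity x ∷ identities a

  act-∘* : ∀ σ τ {n} (a : Vec Carrier n) → (σ ∘ᵃ τ) ·* a ≋ σ ·* (τ ·* a)
  act-∘* σ τ []      = []
  act-∘* σ τ (x ∷ a) = act-∘ σ τ x ∷ act-∘* σ τ a

  restrict* : ∀ g {n} (a : Vec Carrier n) → restrict g ·* a ≋ Vec.map (Isomorphism.to g) a
  restrict* g []      = []
  restrict* g (x ∷ a) = act-restrict g x ∷ restrict* g a

  restrict-fixes : ∀ g {a} → Isomorphism.to g (emb a) ≈ emb a → restrict g ∙ a S.≈ a
  restrict-fixes g {a} e = emb-injective (≈-trans (≈-sym (act-emb (restrict g) a)) (≈-trans (act-restrict g (emb a)) e))

  act-fixes-emb : ∀ σ {F} → Fixes σ F → ∀ {m} → Ambient.⟪_⟫ X (List.map emb F) m → σ · m ≈ m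
  act-fixes-emb σ {f ∷ F} (e ∷ es) (here q)  =
    ≈-trans (act-cong σ q) (≈-trans (act-emb σ f) (≈-trans (emb-cong e) (≈-sym q)))
  act-fixes-emb σ {f ∷ F} (e ∷ es) (there p) = act-fixes-emb σ es p

  emb∈ : ∀ {𝒜 a} → 𝒜 a → Points 𝒜 (emb a)
  emb∈ {𝒜} {a} p = emb a , ≈-refl , subst (All 𝒜) (sym (supp-emb a)) (p ∷ [])

  embs∈ : ∀ {𝒜 F} → All 𝒜 F → All (Points 𝒜) (List.map emb F)
  embs∈ p = LAllₚ.map⁺ (LAll.map emb∈ p)

  -- Membership in the definable closure of `E`. It lets imaginaries be treated through the closure
  -- operator, which lives on `𝕄`.
  DeterminedBy : ∀ {n} → Vec Carrier n → List S.Carrier → Set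
  DeterminedBy u E = ∀ σ → Fixes σ E → σ ·* u ≋ u

  module _ {P Q : Subset} {𝒜 ℬ : Pred S.Carrier 0ℓ} (P≐ : P ≐ Points 𝒜) (Q≐ : Q ≐ Points ℬ)
           (𝒜-mod : IsMod 𝒜) (ℬ-mod : IsMod ℬ) (P⊆Q : P ⊆ Q) where

    model-mono : 𝒜 ⊆ ℬ
    model-mono p = emb-points (closed-respects (mod-closed ℬ-mod)) (proj₁ Q≐ (P⊆Q (proj₂ P≐ (emb∈ p))))

    -- Non-splitting is known for `E` and passes to what `E` determines; what remains is to replace
    -- imaginary parameters by tuples of the models representing them.
    nsIndependent : ∀ {n} {u : Vec Carrier n} {D E} → DeterminedBy u E → IndOver ℬ D → All (cl (𝒜 ∪ ⟪ D ⟫)) E →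
                    NsIndependent u P Q
    nsIndependent {n} {u} {D} {E} det D-ind E⊆ = conclude
        (nonsplitting (mod-closed 𝒜-mod) (mod-inf 𝒜-mod) model-mono (mod-closed ℬ-mod) D E D-ind E⊆)
      where
      conclude : Σ[ F ∈ List S.Carrier ] All 𝒜 F ×
                   (∀ ps → All ℬ (dom ps) → All ℬ (cod ps) → (σ : Automorphism structure) → Fixes σ F →
                     All (λ (a , b) → σ ∙ a S.≈ b) ps →
                     Σ[ ρ ∈ Automorphism structure ] Fixes ρ F × All (λ (a , b) → ρ ∙ a S.≈ b) ps × Fixes ρ E) →
                 NsIndependent u P Q
      conclude (F , F⊆ , ns) = List.map emb F , LAll.map (proj₂ P≐) (embs∈ F⊆) , notSplits
        where
        inQ : ∀ {x} → (P ∪ Q) x → Points ℬ x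
        inQ (inj₁ p) = proj₁ Q≐ (P⊆Q p)
        inQ (inj₂ q) = proj₁ Q≐ q

        notSplits : ¬ Splits u (P ∪ Q) (List.map emb F)
        notSplits (k , b , c , b∈ , c∈ , same , diff)
          with g , g-fixes , gb ← same (List.map emb F) (LAll.tabulateₛ setoid id)
          with b′ , bb′ , b′⊆ ← represent (VecAll.map inQ b∈)
          with c′ , cc′ , c′⊆ ← represent (VecAll.map inQ c∈)
          -- `g` sends `b` to `c`, but may send the support of `b` out of the model; `τ` brings it
          -- back while fixing `F` and the support of `c`.
          = step₁ (moveInto (mod-closed ℬ-mod) (mod-inf ℬ-mod) identityᵃ (F ++ supp* c′)
              (LAllₚ.++⁺ (LAll.map model-mono F⊆) c′⊆) (List.map (σ ∙_) (supp* b′)))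
          where
          σ : Automorphism structure
          σ = restrict g

          σF : Fixes σ F
          σF = LAll.map (restrict-fixes g) (LAllₚ.map⁻ (LAll.tabulateₛ setoid g-fixes))

          step₁ : Σ[ τ ∈ Automorphism structure ] Fixes τ (F ++ supp* c′) ×
                    All (λ x → ℬ (τ ∙ x)) (List.map (σ ∙_) (supp* b′)) → ⊥
          step₁ (τ , fix , into) = step₂ (ns ps (subst (All ℬ) (sym dom-ps) b′⊆)
              (subst (All ℬ) (map-∘ (supp* b′)) (LAllₚ.map⁺ (LAllₚ.map⁻ into)))
              (τ ∘ᵃ σ) (fixes-∘ τ σ (LAllₚ.++⁻ˡ F fix) σF) (LAllₚ.map⁺ (LAll.tabulate {xs = supp* b′} λ _ → SS.refl)))
            where
            ps : List (S.Carrier × S.Carrier)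
            ps = List.map (λ x → x , τ ∙ σ ∙ x) (supp* b′)
            dom-ps : dom ps ≡ supp* b′
            dom-ps = trans (sym (map-∘ (supp* b′))) (map-id (supp* b′))

            step₂ : Σ[ ρ ∈ Automorphism structure ] Fixes ρ F × All (λ (a , b) → ρ ∙ a S.≈ b) ps × Fixes ρ E → ⊥
            step₂ (ρ , ρF , ρps , ρE) = diff λ F′ F′⊆ → act ρ ,
                (λ m∈ → act-fixes-emb ρ ρF (LAll.lookupₛ setoid (λ e q → ∈ₚ.∈-resp-≈ setoid e q) F′⊆ m∈)) ,
                ≋-trans (≋-reflexive (Vecₚ.map-++ (ρ ·_) u b)) (Pointwise.++⁺ (det ρ ρE) ρb)
              where
              ρb : ρ ·* b ≋ c
              ρb = ≋-trans (act-cong* ρ bb′)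
                (≋-trans (act-agree* ρ (τ ∘ᵃ σ) b′ (LAllₚ.map⁻ ρps))
                (≋-trans (act-∘* τ σ b′)
                (≋-trans (act-cong* τ (≋-trans (act-cong* σ (≋-sym bb′)) (≋-trans (restrict* g b) (≋-trans gb cc′))))
                (≋-trans (act-fixes* τ c′ (LAllₚ.++⁻ʳ F fix)) (≋-sym cc′)))))

  drop : ∀ {G} D → ¬ Ind G D → Σ[ D′ ∈ List S.Carrier ] length D ≡ suc (length D′) × All (_∈cl D′ ++ G) D
  drop []       ¬i = ⊥-elim (¬i _)
  drop {G} (d ∷ D) ¬i with em {Ind G D}
  ... | no ¬j with D′ , l , D⊆ ← drop D ¬j = d ∷ D′ , cong suc l , cl-here ∷ LAll.map cl-there D⊆
  ... | yes i = D , refl , Classical.by-contradiction em (λ d∉ → ¬i (d∉ , i)) ∷ cl-selfˡ D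

  private
    dependent : ∀ {P D} → ¬ IndOver P D → Σ[ G ∈ List S.Carrier ] All P G × ¬ Ind G D
    dependent ¬i = Classical.by-contradiction em λ none → ¬i λ G G⊆ →
      Classical.by-contradiction em λ ¬j → none (G , G⊆ , ¬j)

  U≤dimension : ∀ n {k} {u : Vec Carrier k} {E} → DeterminedBy u E → ∀ {P 𝒜} → IsMod 𝒜 → P ≐ Points 𝒜 →
                ∀ {D} → All (cl (𝒜 ∪ ⟪ D ⟫)) E → U≥ n u P → n ≤ length D
  U≤dimension zero    det 𝒜-mod P≐ E⊆ _ = z≤n
  U≤dimension (suc n) {u = u} {E} det {P} {𝒜} 𝒜-mod P≐ {D} E⊆ (Q , (Q-sub , _) , P⊆Q , ¬ns , U) =
    compare (submodel⇒ Q-sub)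
    where
    compare : Σ[ ℬ ∈ Pred S.Carrier 0ℓ ] IsMod ℬ × Q ≐ Points ℬ → suc n ≤ length D
    compare (ℬ , ℬ-mod , Q≐) with em {IndOver ℬ D}
    ... | yes i = ⊥-elim (¬ns (nsIndependent P≐ Q≐ 𝒜-mod ℬ-mod P⊆Q det i E⊆))
    ... | no ¬i with G , G⊆ , ¬j ← dependent ¬i with D′ , l , D⊆ ← drop D ¬j =
      subst (suc n ≤_) (sym l) (s≤s (U≤dimension n det ℬ-mod Q≐ {D′}
        (LAll.map (λ p → S.idempotent _ (S.monotone _ _ inℬD′ p)) E⊆) U))
      where
      D′G⊆ : All (cl (ℬ ∪ ⟪ D′ ⟫)) (D′ ++ G)
      D′G⊆ = LAllₚ.++⁺ (LAll.tabulateₛ S.setoid (λ p → S.extensive _ (inj₂ p)))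
                       (LAll.map (λ p → S.extensive _ (inj₁ p)) G⊆)
      inℬD′ : ∀ {x} → (𝒜 ∪ ⟪ D ⟫) x → cl (ℬ ∪ ⟪ D′ ⟫) x
      inℬD′ (inj₁ p) = S.extensive _ (inj₁ (model-mono P≐ Q≐ 𝒜-mod ℬ-mod P⊆Q p))
      inℬD′ (inj₂ p) = closed-list (S.idempotent _) D′G⊆ (cl-trans D⊆ (cl-∈ p))

  -- The entry `v` of `u` and its image under `τ` have the same type over the finite set, but only
  -- `v` equals that entry, so joining them to `u` distinguishes them already over the empty set.
  ¬nsIndependent : ∀ {P Q : Subset} {𝒜} → P ≐ Points 𝒜 → ∀ {n} (u : Vec Carrier n) i →
    Q (Vec.lookup u i) →
    (∀ G → All 𝒜 G → Σ[ τ ∈ Automorphism structure ] Fixes τ G × Q (τ · Vec.lookup u i) × ¬ τ · Vec.lookup u i ≈ Vec.lookup u i) →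
    ¬ NsIndependent u P Q
  ¬nsIndependent {P} {Q} {𝒜} P≐ u i q moves (F , F⊆ , ¬splits) = conclude (finite F⊆)
    where
    v = Vec.lookup u i
    finite : ∀ {F} → All P F → Σ[ G ∈ List S.Carrier ] All 𝒜 G × (∀ τ → Fixes τ G → All (λ x → τ · x ≈ x) F)
    finite []       = [] , [] , λ _ _ → []
    finite (p ∷ ps) with y , e , y∈ ← proj₁ P≐ p | G , G⊆ , fix ← finite ps =
      supp y ++ G , LAllₚ.++⁺ y∈ G⊆ , λ τ τG →
        ≈-trans (act-cong τ e) (≈-trans (act-fixes τ y (LAllₚ.++⁻ˡ (supp y) τG)) (≈-sym e)) ∷ fix τ (LAllₚ.++⁻ʳ (supp y) τG)
    fixed : ∀ {g : Automorphism (Ambient.structure X)} {n} (u : Vec Carrier n) i → Vec.map (Isomorphism.to g) u ≋ u →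
            Isomorphism.to g (Vec.lookup u i) ≈ Vec.lookup u i
    fixed (x ∷ u) zero    (e ∷ es) = e
    fixed {g} (x ∷ u) (suc i) (e ∷ es) = fixed {g} u i es
    conclude : Σ[ G ∈ List S.Carrier ] All 𝒜 G × (∀ τ → Fixes τ G → All (λ x → τ · x ≈ x) F) → ⊥
    conclude (G , G⊆ , fix) with τ , τG , τv∈ , moved ← moves G G⊆ =
      ¬splits (1 , v ∷ [] , τ · v ∷ [] , inj₂ q VecAll.∷ VecAll.[] , inj₂ τv∈ VecAll.∷ VecAll.[] ,
        (λ F′ F′⊆ → act τ , (λ m∈ → fixesF (LAll.lookupₛ setoid (λ e q → ∈ₚ.∈-resp-≈ setoid e q) F′⊆ m∈)) , ≈-refl ∷ []) ,
        λ same → clash (same [] []))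
      where
      fixesF : ∀ {m} → Ambient.⟪_⟫ X F m → τ · m ≈ m
      fixesF m∈ with y , y∈ , e ← find m∈ = ≈-trans (act-cong τ e) (≈-trans (LAll.lookup (fix τ τG) y∈) (≈-sym e))
      clash : SameGaloisType (Ambient.⟪_⟫ X []) (u Vec.++ v ∷ []) (u Vec.++ τ · v ∷ []) → ⊥
      clash (g , _ , e) with eᵤ , eᵥ ∷ [] ← Pointwise.++⁻ (Vec.map (Isomorphism.to g) u) u
          (subst (_≋ u Vec.++ τ · v ∷ []) (Vecₚ.map-++ (Isomorphism.to g) u (v ∷ [])) e)
        = moved (≈-trans (≈-sym eᵥ) (fixed {g} u i eᵤ))

-- Ranks of triples in the monster model

module MonsterAbove (em : ExcludedMiddle 0ℓ) {L : Language} {M 𝕄 : PregeometryStructure L} {δ : Set}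
    (mod-closed : ∀ {P} → IsModel M 𝕄 P → PregeometryStructure.Closed 𝕄 P) where
  open PregeometryStructure 𝕄 hiding (Independent)
  open Setoid setoid using () renaming (refl to ≈-refl; sym to ≈-sym; trans to ≈-trans)
  open Pregeometry em 𝕄

  aboveMonster : Above structure (IsModel M 𝕄) (monsterAmbient M δ 𝕄)
  aboveMonster = record
    { act           = id
    ; restrict      = id
    ; act-restrict  = λ _ _ → ≈-refl
    ; act-∘         = λ _ _ _ → ≈-refl
    ; supp          = _∷ []
    ; act-agree     = λ _ _ _ → LAll.head
    ; act-identity  = λ _ → ≈-refl
    ; supp-act      = λ _ _ → refl
    ; emb           = id
    ; emb-cong      = id
    ; emb-injective = id
    ; act-emb       = λ _ _ → ≈-refl
    ; supp-emb      = λ _ → refl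
    ; emb-points    = λ { resp (y , e , p ∷ []) → resp (≈-sym e) p }
    ; submodel⇒     = λ {P} mod → P , mod , (λ {x} p → x , ≈-refl , p ∷ []) ,
                        λ { (y , e , p ∷ []) → closed-respects (mod-closed mod) (≈-sym e) p }
    ; submodel⇐     = λ mod → record
        { model = IsModel.model mod ; inClass = IsModel.inClass mod ; inclusion = IsModel.inclusion mod
        ; range = (λ { (y , e , p ∷ []) → let v , q = proj₁ (IsModel.range mod) p in v , ≈-trans e q }) ,
                  (λ {x} r → x , ≈-refl , proj₂ (IsModel.range mod) r ∷ []) }
    ; enumerable    = λ (h , h∈ , index) → h , (λ n → h n , ≈-refl , h∈ n ∷ []) ,
                        λ { (y , e , p ∷ []) → let n , q = index p in n , ≈-trans e q }
    }

module MonsterRank (em : ExcludedMiddle 0ℓ) (ac : ExtensionalChoice 0ℓ 0ℓ) {L : Language}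
    (M : PregeometryStructure L) (qm : IsQuasiminimal M) {δ : Set}
    (large : bigSet (PregeometryStructure.Carrier M) ↣ δ)
    (𝕄 : PregeometryStructure L) (monster : IsMonster M δ 𝕄) where
  open Monster em ac M qm large 𝕄 monster using (M-inf; 𝕄-fqm; 𝕄-inf; galois; j; image-closed; image-inf; countable-isModel; countable⇒<ᶜ)
  open PregeometryStructure 𝕄 hiding (Independent)
  open Setoid setoid using () renaming (refl to ≈-refl; sym to ≈-sym; trans to ≈-trans)
  open Pregeometry em 𝕄
  open CountableModels em 𝕄 𝕄-fqm

  homogeneousPregeometry : HomogeneousPregeometry em 𝕄
  homogeneousPregeometry = record
    { fqm       = 𝕄-fqm
    ; inf       = 𝕄-inf
    ; galois    = galois
    ; isolating = IsolatingSets.isolatingSet em (IsQuasiminimal.isWeaklyQuasiminimal qm) M-inf 𝕄 𝕄-fqm galois j image-closed image-inf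
    }

  model-closed : ∀ {P} → IsModel M 𝕄 P → Closed P
  model-closed mod p = proj₂ range (ClosedEmbedding.closed-range inclusion (monotone _ _ (proj₁ range) p))
    where open IsModel mod

  model-inf : ∀ {P} → IsModel M 𝕄 P → InfDim P
  model-inf {P} mod = infDim λ n →
      let ds , _ , i , l = Pregeometry.indList em model (Pregeometry.infDimensional em model (proj₂ inClass)) n in
      List.map to ds , LAllₚ.map⁺ (LAll.tabulate {xs = ds} λ {d} _ → proj₂ range (d , ≈-refl)) ,
      Inheritance.EmbeddedClosure.ind⁺ em inclusion ds i , trans (length-map to ds) l
    where
    open IsModel mod
    open ClosedEmbedding inclusion

  open MonsterAbove em {M = M} {𝕄} {δ} model-closed public

  module Over {X : Ambient} (A : Above structure (IsModel M 𝕄) X) (δ≡ : Ambient.δ X ≡ δ) where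
    open Above A
    open Automorphisms structure
    open Homogeneity em 𝕄 𝕄-fqm galois using (move)
    open Rank em homogeneousPregeometry model-closed model-inf A
    open Types X using (Subset; Bounded; Model; NsIndependent; URank; URank≤)
    private module X = Setoid (Ambient.setoid X)

    countable⇒model : ∀ {𝒜} → CountableModel 𝒜 → Model (Points 𝒜)
    countable⇒model {𝒜} model = submodel⇐ (countable-isModel model) ,
        bounded (enumerable (enum , enum∈ , index))
      where
      open CountableModel model
      bounded : Σ[ h ∈ (ℕ → X.Carrier) ] (∀ n → Points 𝒜 (h n)) × (∀ {x} → Points 𝒜 x → Σ[ n ∈ ℕ ] x X.≈ h n) → Bounded (Points 𝒜)
      bounded (h , h∈ , onto) = subst (subsetoid (Ambient.setoid X) (Points 𝒜) <ᶜ_) (sym δ≡)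
        (countable⇒<ᶜ {subsetoid (Ambient.setoid X) (Points 𝒜)} (λ n → h n , h∈ n) (λ (x , p) → onto p))

    module _ (Q : List Carrier) where
      open Generated {λ _ → ⊤} (λ _ → tt) 𝕄-inf Q

      H-Model : ∀ B → Model (Points (H B))
      H-Model B = countable⇒model (H-model B)

      PointsH-mono : ∀ {B C} → All (H C) B → Points (H B) ⊆ Points (H C)
      PointsH-mono s (y , e , y∈) = y , e , LAll.map (H-mono s) y∈

      H-cons : ∀ x B → All (H (x ∷ B)) B
      H-cons x B = LAll.tail (base⊆H (x ∷ B))

      -- `x` belongs to the larger model while it is generic over the smaller one, so it can be
      -- moved within the larger over any finite part of the smaller.
      dependsOn : ∀ {k} (u : Vec X.Carrier k) i x B → Vec.lookup u i X.≈ emb x → All (_∈cl Q) (x ∷ B) → ¬ x ∈cl B →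
                  ¬ NsIndependent u (Points (H B)) (Points (H (x ∷ B)))
      dependsOn u i x B e s x∉ = ¬nsIndependent (id , id) u i
          (emb x , e , subst (All (H (x ∷ B))) (sym (supp-emb x)) (LAll.head (base⊆H (x ∷ B)) ∷ [])) moves
        where
        moves : ∀ G → All (H B) G → Σ[ τ ∈ Automorphism structure ] Fixes τ G ×
                Points (H (x ∷ B)) (τ · Vec.lookup u i) × ¬ τ · Vec.lookup u i X.≈ Vec.lookup u i
        moves G G⊆ = result (H-inf (x ∷ B) (x ∷ G))
          where
          result : Σ[ m ∈ Carrier ] H (x ∷ B) m × ¬ m ∈cl x ∷ G → _
          result (m , m∈ , m∉) = moved (move G (proj₁ (H-indOver (x ∷ []) s (x∉ , _) G G⊆)) (m∉ ∘ cl-there))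
            where
            moved : Σ[ τ ∈ Automorphism structure ] Fixes τ G × τ ∙ x ≈ m → _
            moved (τ , τG , q) = τ , τG ,
              (emb m , τe , subst (All (H (x ∷ B))) (sym (supp-emb m)) (m∈ ∷ [])) ,
              λ r → m∉ (cl-∈ (here (emb-injective (X.trans (X.sym τe) (X.trans r e)))))
              where
              τe : τ · Vec.lookup u i X.≈ emb m
              τe = X.trans (act-cong τ e) (X.trans (act-emb τ x) (emb-cong q))

    module _ (A : List Carrier) (x₀ x₁ x₂ : Carrier) where

      triple : Vec X.Carrier 3
      triple = emb x₀ ∷ emb x₁ ∷ emb x₂ ∷ []

      determinedTriple : DeterminedBy triple (x₀ ∷ x₁ ∷ x₂ ∷ [])
      determinedTriple σ (e₀ ∷ e₁ ∷ e₂ ∷ []) = q e₀ ∷ q e₁ ∷ q e₂ ∷ []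
        where
        q : ∀ {a} → σ ∙ a ≈ a → σ · emb a X.≈ emb a
        q {a} e = X.trans (act-emb σ a) (emb-cong e)

      -- Dependent points would be algebraic over `A` and two of them, and dimension would bound the
      -- rank by 2 over every model containing `A`.
      rank3⇒independent : URank triple (List.map emb A) 3 → Ind A (x₀ ∷ x₁ ∷ x₂ ∷ [])
      rank3⇒independent ((P , (P-sub , _) , A⊆ , (U , _)) , _) = Classical.by-contradiction em (contra (submodel⇒ P-sub))
        where
        contra : Σ[ 𝒜 ∈ Pred Carrier 0ℓ ] IsModel M 𝕄 𝒜 × P ≐ Points 𝒜 → ¬ ¬ Ind A (x₀ ∷ x₁ ∷ x₂ ∷ [])
        contra (𝒜 , mod , P≐) ¬i = dropped (drop (x₀ ∷ x₁ ∷ x₂ ∷ []) ¬i)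
          where
          dropped : Σ[ D′ ∈ List Carrier ] 3 ≡ suc (length D′) × All (_∈cl D′ ++ A) (x₀ ∷ x₁ ∷ x₂ ∷ []) → ⊥
          dropped (D′ , l , D⊆) = ℕₚ.<-irrefl (ℕₚ.suc-injective l)
              (U≤dimension 3 {u = triple} {E = x₀ ∷ x₁ ∷ x₂ ∷ []} determinedTriple mod P≐ {D′}
                (LAll.map (λ p → closed-list (idempotent _) A⊆𝒜D′ p) D⊆) U)
            where
            A⊆𝒜D′ : All (cl (𝒜 ∪ ⟪ D′ ⟫)) (D′ ++ A)
            A⊆𝒜D′ = LAllₚ.++⁺ (LAll.tabulateₛ setoid (λ p → extensive _ (inj₂ p)))
              (LAll.map (λ p → extensive _ (inj₁ (emb-points (closed-respects (model-closed mod)) (proj₁ P≐ p)))) (LAllₚ.map⁻ A⊆))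

      -- Independent points would give a chain of four models, each obtained by adding one point to
      -- the base, and with it three steps of U-rank.
      rank2⇒dependent : URank≤ triple (List.map emb A) 2 → ¬ Ind A (x₀ ∷ x₁ ∷ x₂ ∷ [])
      rank2⇒dependent bound (p₀ , p₁ , p₂ , _) = ℕₚ.<-irrefl refl (bound (P A) (H-Model Q A) (embs∈ (G.base⊆H A)) 3
          (P (x₂ ∷ A) , H-Model Q (x₂ ∷ A) , mono x₂ A , dependsOn Q triple (Fin.suc (Fin.suc Fin.zero)) x₂ A X.refl s₂ p₂ ,
           P (x₁ ∷ x₂ ∷ A) , H-Model Q _ , mono x₁ _ , dependsOn Q triple (Fin.suc Fin.zero) x₁ _ X.refl s₁ p₁ ,
           P Q , H-Model Q _ , mono x₀ _ , dependsOn Q triple Fin.zero x₀ _ X.refl (cl-self Q) p₀ , _))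
        where
        Q : List Carrier
        Q = x₀ ∷ x₁ ∷ x₂ ∷ A
        module G = Generated {λ _ → ⊤} (λ _ → tt) 𝕄-inf Q
        P : List Carrier → Subset
        P B = Points (G.H B)
        mono : ∀ x B → P B ⊆ P (x ∷ B)
        mono x B = PointsH-mono Q (H-cons Q x B)
        s₁ : All (_∈cl Q) (x₁ ∷ x₂ ∷ A)
        s₁ = LAll.tail (cl-self Q)
        s₂ : All (_∈cl Q) (x₂ ∷ A)
        s₂ = LAll.tail s₁

-- Germs of generic bijections

module Correspond (em : ExcludedMiddle 0ℓ) {L : Language} {𝕄 : PregeometryStructure L} (hom : HomogeneousPregeometry em 𝕄)
    (σ : Automorphism (PregeometryStructure.structure 𝕄)) where
  open HomogeneousPregeometry hom
  open PregeometryStructure 𝕄 hiding (Independent)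
  open Setoid setoid using () renaming (refl to ≈-refl; sym to ≈-sym; trans to ≈-trans)
  open Pregeometry em 𝕄
  open Automorphisms structure
  open Homogeneity em 𝕄 fqm galois

  infix 4 _↦_ _↦*_
  _↦_ : ∀ {n} → Vec Carrier n → Vec Carrier n → Set
  a ↦ b = Vec.map (σ ∙_) a ≋ b

  _↦*_ : List Carrier → List Carrier → Set
  _↦*_ = Listᴾ.Pointwise λ a b → σ ∙ a ≈ b

  fixes⇒↦* : ∀ {F} → Fixes σ F → F ↦* F
  fixes⇒↦* []       = Listᴾ.[]
  fixes⇒↦* (e ∷ es) = e Listᴾ.∷ fixes⇒↦* es

  cl-transport : ∀ {G G′} → G ↦* G′ → ∀ {a b} → σ ∙ a ≈ b → a ∈cl G → b ∈cl G′
  cl-transport {G} {G′} G↦ e p = cl-resp e (aut-closed σ (clList-closed G′) (images G↦) p)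
    where
    images : ∀ {G G′} → G ↦* G′ → All (λ x → σ ∙ x ∈cl G′) G
    images Listᴾ.[]       = []
    images (e Listᴾ.∷ es) = cl-∈ (here e) ∷ LAll.map cl-there (images es)

  cl-reflect : ∀ {G G′} → G ↦* G′ → ∀ {a b} → σ ∙ a ≈ b → b ∈cl G′ → a ∈cl G
  cl-reflect {G} {G′} G↦ e p = cl-resp (∙-inverse σ e) (aut-closed (inverseᵃ σ) (clList-closed G) (images G↦) p)
    where
    images : ∀ {G G′} → G ↦* G′ → All (λ x → inverseᵃ σ ∙ x ∈cl G) G′
    images Listᴾ.[]       = []
    images (e Listᴾ.∷ es) = cl-∈ (here (∙-inverse σ e)) ∷ LAll.map cl-there (images es)

  fixes⇒↦ : ∀ {n} {a : Vec Carrier n} → Fixes σ (Vec.toList a) → a ↦ a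
  fixes⇒↦ {a = []}    []       = []
  fixes⇒↦ {a = _ ∷ _} (e ∷ es) = e ∷ fixes⇒↦ es

-- o lists three elements b, p, q, then z, r, and then y, s.  For each β
-- the relation T β is to be the graph of a bijection between the pairs
-- ζ and η up to interalgebraicity over A.
module Germs (em : ExcludedMiddle 0ℓ) {L : Language} {𝕄 : PregeometryStructure L} (hom : HomogeneousPregeometry em 𝕄)
    (F A : List (PregeometryStructure.Carrier 𝕄)) (o : Vec (PregeometryStructure.Carrier 𝕄) 7) where
  open PregeometryStructure 𝕄 hiding (Independent)
  open Pregeometry em 𝕄
  open Automorphisms structure

  -- The orbit of `o` over `F`, that is, its Galois type; the relations on germs are built from it
  -- and the closure operator.
  record T (β : Vec Carrier 3) (ζ η : Vec Carrier 2) : Set where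
    constructor orbit
    field
      aut   : Automorphism structure
      fixes : Fixes aut F
      maps  : Vec.map (aut ∙_) o ≋ β Vec.++ (ζ Vec.++ η)

  P : Vec Carrier 3 → Set
  P β = Σ[ ζ ∈ _ ] Σ[ η ∈ _ ] T β ζ η

  Q : Vec Carrier 2 → Set
  Q ζ = Σ[ β ∈ _ ] Σ[ η ∈ _ ] T β ζ η

  R : Vec Carrier 2 → Set
  R η = Σ[ β ∈ _ ] Σ[ ζ ∈ _ ] T β ζ η

  infix 4 _∼_ _≃_
  -- Entry by entry and over `A`, since two lines of a quadrangle determine their common point up to
  -- closure over `A`.
  _∼_ : ∀ {n} → Vec Carrier n → Vec Carrier n → Set
  _∼_ = Pointwise λ x y → x ∈cl y ∷ A × y ∈cl x ∷ A

  -- (β₁ , β₂) stands for the germ of (T β₁)⁻¹ ∘ T β₂, as a map on the ζ.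
  Germ : Set
  Germ = Vec Carrier 3 × Vec Carrier 3

  Valid : Germ → Set
  Valid (β₁ , β₂) = P β₁ × P β₂

  Ev : Germ → Vec Carrier 2 → Vec Carrier 2 → Set
  Ev (β₁ , β₂) ζ ζ′ = Σ[ η ∈ _ ] T β₂ ζ η × T β₁ ζ′ η

  EvW : List Germ → Vec Carrier 2 → Vec Carrier 2 → Set
  EvW []       ζ ζ′ = ζ ≋ ζ′
  EvW (g ∷ ws) ζ ζ′ = Σ[ ξ ∈ _ ] EvW ws ζ ξ × Ev g ξ ζ′

  bases : List Germ → List Carrier
  bases []               = []
  bases ((β₁ , β₂) ∷ ws) = Vec.head β₁ ∷ Vec.head β₂ ∷ bases ws

  -- Equality of composite germs: agreement at a generic ζ.
  _≃_ : List Germ → List Germ → Set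
  ws ≃ vs = All Valid ws × All Valid vs × Σ[ ζ ∈ _ ] Σ[ ζ₁ ∈ _ ] Σ[ ζ₂ ∈ _ ]
    Q ζ × ¬ Vec.head ζ ∈cl bases ws ++ bases vs ++ F × EvW ws ζ ζ₁ × EvW vs ζ ζ₂ × ζ₁ ∼ ζ₂

module Transport (em : ExcludedMiddle 0ℓ) {L : Language} {𝕄 : PregeometryStructure L} (hom : HomogeneousPregeometry em 𝕄)
    (σ : Automorphism (PregeometryStructure.structure 𝕄))
    {F F′ A A′ : List (PregeometryStructure.Carrier 𝕄)} {o o′ : Vec (PregeometryStructure.Carrier 𝕄) 7}
    (F↦ : Correspond._↦*_ em hom σ F F′) (A↦ : Correspond._↦*_ em hom σ A A′)
    (T↦ : ∀ {β β′ ζ ζ′ η η′} → Correspond._↦_ em hom σ β β′ → Correspond._↦_ em hom σ ζ ζ′ →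
      Correspond._↦_ em hom σ η η′ → Germs.T em hom F A o β ζ η → Germs.T em hom F′ A′ o′ β′ ζ′ η′) where
  open PregeometryStructure 𝕄 hiding (Independent)
  open Setoid setoid using () renaming (refl to ≈-refl; sym to ≈-sym; trans to ≈-trans)
  open Automorphisms structure
  open Correspond em hom σ
  private
    module G  = Germs em hom F A o
    module G′ = Germs em hom F′ A′ o′
    image : ∀ {n} (a : Vec Carrier n) → a ↦ Vec.map (σ ∙_) a
    image a = Pointwise.refl ≈-refl

  P↦ : ∀ {β β′} → β ↦ β′ → G.P β → G′.P β′
  P↦ e (ζ , η , t) = Vec.map (σ ∙_) ζ , Vec.map (σ ∙_) η , T↦ e (image ζ) (image η) t

  Q↦ : ∀ {ζ ζ′} → ζ ↦ ζ′ → G.Q ζ → G′.Q ζ′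
  Q↦ e (β , η , t) = Vec.map (σ ∙_) β , Vec.map (σ ∙_) η , T↦ (image β) e (image η) t

  ∼↦ : ∀ {n} {a a′ b b′ : Vec Carrier n} → a ↦ a′ → b ↦ b′ → a G.∼ b → a′ G′.∼ b′
  ∼↦ {a = []}    {[]}    {[]}    {[]}    []       []       []             = []
  ∼↦ {a = _ ∷ _} {_ ∷ _} {_ ∷ _} {_ ∷ _} (e ∷ es) (f ∷ fs) ((p , q) ∷ ps) =
    (cl-transport (f Listᴾ.∷ A↦) e p , cl-transport (e Listᴾ.∷ A↦) f q) ∷ ∼↦ es fs ps

  GermMap : G.Germ → G′.Germ → Set
  GermMap (β₁ , β₂) (β₁′ , β₂′) = β₁ ↦ β₁′ × β₂ ↦ β₂′

  valid↦ : ∀ {ws ws′} → Listᴾ.Pointwise GermMap ws ws′ → All G.Valid ws → All G′.Valid ws′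
  valid↦ Listᴾ.[]             []             = []
  valid↦ ((e , f) Listᴾ.∷ es) ((p , q) ∷ ps) = (P↦ e p , P↦ f q) ∷ valid↦ es ps

  bases↦ : ∀ {ws ws′} → Listᴾ.Pointwise GermMap ws ws′ → G.bases ws ↦* G′.bases ws′
  bases↦ Listᴾ.[] = Listᴾ.[]
  bases↦ {(_ ∷ _ , _ ∷ _) ∷ _} {(_ ∷ _ , _ ∷ _) ∷ _} ((e ∷ _ , f ∷ _) Listᴾ.∷ es) = e Listᴾ.∷ f Listᴾ.∷ bases↦ es

  Ev↦ : ∀ {g g′} → GermMap g g′ → ∀ {ζ ζ′ ξ ξ′} → ζ ↦ ζ′ → ξ ↦ ξ′ → G.Ev g ζ ξ → G′.Ev g′ ζ′ ξ′
  Ev↦ (e , f) u v (η , s , t) = Vec.map (σ ∙_) η , T↦ f u (image η) s , T↦ e v (image η) t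

  EvW↦ : ∀ {ws ws′} → Listᴾ.Pointwise GermMap ws ws′ → ∀ {ζ ζ′ ξ ξ′} → ζ ↦ ζ′ → ξ ↦ ξ′ → G.EvW ws ζ ξ → G′.EvW ws′ ζ′ ξ′
  EvW↦ Listᴾ.[]       u v e           = Pointwise.trans ≈-trans (Pointwise.sym ≈-sym u)
    (Pointwise.trans ≈-trans (Pointwise.map⁺ (∙-cong σ) e) v)
  EvW↦ (e Listᴾ.∷ es) u v (ξ , s , t) = Vec.map (σ ∙_) ξ , EvW↦ es u (image ξ) s , Ev↦ e (image ξ) v t

  -- With base and configuration fixed this is invariance over the base; with both moved along, it
  -- makes the relation on tuples that include them invariant under all automorphisms.
  ≃↦ : ∀ {ws ws′ vs vs′} → Listᴾ.Pointwise GermMap ws ws′ → Listᴾ.Pointwise GermMap vs vs′ → ws G.≃ vs → ws′ G′.≃ vs′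
  ≃↦ w v (p , q , ζ@(_ ∷ _) , ζ₁ , ζ₂ , Qζ , fresh , e₁ , e₂ , r) = valid↦ w p , valid↦ v q ,
    Vec.map (σ ∙_) ζ , Vec.map (σ ∙_) ζ₁ , Vec.map (σ ∙_) ζ₂ , Q↦ (image ζ) Qζ ,
    (λ c → fresh (cl-reflect (Listᴾ.++⁺ (bases↦ w) (Listᴾ.++⁺ (bases↦ v) F↦)) ≈-refl c)) ,
    EvW↦ w (image ζ) (image ζ₁) e₁ , EvW↦ v (image ζ) (image ζ₂) e₂ , ∼↦ (image ζ₁) (image ζ₂) r

module TransportOrbit (em : ExcludedMiddle 0ℓ) {L : Language} {𝕄 : PregeometryStructure L} (hom : HomogeneousPregeometry em 𝕄)
    (σ : Automorphism (PregeometryStructure.structure 𝕄)) where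
  open HomogeneousPregeometry hom
  open PregeometryStructure 𝕄 hiding (Independent)
  open Setoid setoid using () renaming (refl to ≈-refl; sym to ≈-sym; trans to ≈-trans)
  open Automorphisms structure
  open Homogeneity em 𝕄 fqm galois using (fixes-∘)
  open Correspond em hom σ
  private
    ↦-++ : ∀ {m n} {a a′ : Vec Carrier m} {b b′ : Vec Carrier n} → a ↦ a′ → b ↦ b′ → (a Vec.++ b) ↦ (a′ Vec.++ b′)
    ↦-++ {a = a} {b = b} e f = subst (_≋ _) (sym (Vecₚ.map-++ (σ ∙_) a b)) (Pointwise.++⁺ e f)

    ↦-trans : ∀ (κ : Automorphism structure) {n} {a b c : Vec Carrier n} → Vec.map (κ ∙_) a ≋ b → b ↦ c → Vec.map ((σ ∘ᵃ κ) ∙_) a ≋ c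
    ↦-trans κ {a = []}    []       []       = []
    ↦-trans κ {a = _ ∷ _} (e ∷ es) (f ∷ fs) = ≈-trans (∙-cong σ e) f ∷ ↦-trans κ es fs

  T-fixes : ∀ {F A o β β′ ζ ζ′ η η′} → Fixes σ F → β ↦ β′ → ζ ↦ ζ′ → η ↦ η′ →
            Germs.T em hom F A o β ζ η → Germs.T em hom F A o β′ ζ′ η′
  T-fixes fix e f g (Germs.orbit κ κF q) = Germs.orbit (σ ∘ᵃ κ) (fixes-∘ σ κ fix κF) (↦-trans κ q (↦-++ e (↦-++ f g)))

  T-moves : ∀ {F F′ A A′ o o′ β β′ ζ ζ′ η η′} → F ↦* F′ → o ↦ o′ → β ↦ β′ → ζ ↦ ζ′ → η ↦ η′ →
            Germs.T em hom F A o β ζ η → Germs.T em hom F′ A′ o′ β′ ζ′ η′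
  T-moves F↦ o↦ e f g (Germs.orbit κ κF q) = Germs.orbit (σ ∘ᵃ κ ∘ᵃ inverseᵃ σ) (conj F↦ κF)
    (Pointwise.trans ≈-trans (back o↦) (↦-trans κ q (↦-++ e (↦-++ f g))))
    where
    conj : ∀ {F F′} → F ↦* F′ → Fixes κ F → Fixes (σ ∘ᵃ κ ∘ᵃ inverseᵃ σ) F′
    conj Listᴾ.[]       []       = []
    conj (e Listᴾ.∷ es) (p ∷ ps) = ≈-trans (∙-cong σ (≈-trans (∙-cong κ (∙-inverse σ e)) p)) e ∷ conj es ps
    back : ∀ {n} {a b : Vec Carrier n} → a ↦ b → Vec.map ((σ ∘ᵃ κ ∘ᵃ inverseᵃ σ) ∙_) b ≋ Vec.map ((σ ∘ᵃ κ) ∙_) a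
    back {a = []}    {[]}    []       = []
    back {a = _ ∷ _} {_ ∷ _} (e ∷ es) = ∙-cong σ (∙-cong κ (∙-inverse σ e)) ∷ back es

-- The group configuration

module Lines (em : ExcludedMiddle 0ℓ) {L : Language} {𝕄 : PregeometryStructure L} (hom : HomogeneousPregeometry em 𝕄)
    (A : List (PregeometryStructure.Carrier 𝕄)) where
  open HomogeneousPregeometry hom
  open PregeometryStructure 𝕄 hiding (Independent)
  open Setoid setoid using () renaming (refl to ≈-refl; sym to ≈-sym; trans to ≈-trans)
  open Pregeometry em 𝕄
  open Automorphisms structure
  open Homogeneity em 𝕄 fqm galois

  Collin : Carrier → Carrier → Carrier → Set
  Collin p q r = p ∈cl q ∷ r ∷ A × q ∈cl p ∷ r ∷ A × r ∈cl p ∷ q ∷ A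

  collin : ∀ {p q r} → ¬ Ind A (p ∷ q ∷ r ∷ []) → Ind A (q ∷ r ∷ []) → ¬ p ∈cl r ∷ A → ¬ p ∈cl q ∷ A → Collin p q r
  collin {p} {q} {r} ¬i i p∉r p∉q = p∈ , cl-exchange p∈ p∉r ,
      cl-exchange (cl-trans (cl-there cl-here ∷ cl-here ∷ LAll.map (cl-there ∘ cl-there) (cl-self A)) p∈) p∉q
    where
    p∈ : p ∈cl q ∷ r ∷ A
    p∈ = Classical.by-contradiction em λ p∉ → ¬i (p∉ , i)

  record Quad (a b c x y z : Carrier) : Set where
    field
      abc : Collin a b c
      axy : Collin a x y
      byz : Collin b y z
      cxz : Collin c x z
      bay : Ind A (b ∷ a ∷ y ∷ [])
      acx : Ind A (a ∷ c ∷ x ∷ [])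
      bcz : Ind A (b ∷ c ∷ z ∷ [])
      cax : Ind A (c ∷ a ∷ x ∷ [])

  module _ (σ : Automorphism structure) (fix : Fixes σ A) where
    open Correspond em hom σ
    private
      A↦ : A ↦* A
      A↦ = fixes⇒↦* fix

    collin-aut : ∀ {p p′ q q′ r r′} → σ ∙ p ≈ p′ → σ ∙ q ≈ q′ → σ ∙ r ≈ r′ → Collin p q r → Collin p′ q′ r′
    collin-aut e f g (s , t , u) = cl-transport (f Listᴾ.∷ g Listᴾ.∷ A↦) e s ,
      cl-transport (e Listᴾ.∷ g Listᴾ.∷ A↦) f t , cl-transport (e Listᴾ.∷ f Listᴾ.∷ A↦) g u

    ind-aut₃ : ∀ {p p′ q q′ r r′} → σ ∙ p ≈ p′ → σ ∙ q ≈ q′ → σ ∙ r ≈ r′ → Ind A (p ∷ q ∷ r ∷ []) → Ind A (p′ ∷ q′ ∷ r′ ∷ [])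
    ind-aut₃ e f g (s , t , u , _) = s ∘ cl-reflect (f Listᴾ.∷ g Listᴾ.∷ A↦) e ,
      t ∘ cl-reflect (g Listᴾ.∷ A↦) f , u ∘ cl-reflect A↦ g , _

    quad-aut : ∀ {a b c x y z a′ b′ c′ x′ y′ z′} → σ ∙ a ≈ a′ → σ ∙ b ≈ b′ → σ ∙ c ≈ c′ → σ ∙ x ≈ x′ → σ ∙ y ≈ y′ → σ ∙ z ≈ z′ →
               Quad a b c x y z → Quad a′ b′ c′ x′ y′ z′
    quad-aut ea eb ec ex ey ez q = record
      { abc = collin-aut ea eb ec abc ; axy = collin-aut ea ex ey axy ; byz = collin-aut eb ey ez byz ; cxz = collin-aut ec ex ez cxz
      ; bay = ind-aut₃ eb ea ey bay ; acx = ind-aut₃ ea ec ex acx ; bcz = ind-aut₃ eb ec ez bcz ; cax = ind-aut₃ ec ea ex cax }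
      where open Quad q

  module _ {C : Pred Carrier 0ℓ} (C-closed : Closed C) (A⊆ : All C A) where

    third : ∀ {p q r} → Collin p q r → C p → C q → C r
    third (_ , _ , s) p q = closed-list C-closed (p ∷ q ∷ A⊆) s

    second : ∀ {p q r} → Collin p q r → C p → C r → C q
    second (_ , s , _) p r = closed-list C-closed (p ∷ r ∷ A⊆) s

    first : ∀ {p q r} → Collin p q r → C q → C r → C p
    first (s , _ , _) q r = closed-list C-closed (q ∷ r ∷ A⊆) s

  -- Two lines through t, containing m and k respectively, meet in cl t only.
  meet : ∀ {m k t w} → Ind A (m ∷ k ∷ t ∷ []) → w ∈cl t ∷ m ∷ A → w ∈cl t ∷ k ∷ A → w ∈cl t ∷ A
  meet {m} {k} {t} {w} i p q = Classical.by-contradiction em λ w∉ →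
    ℕₚ.<-irrefl refl (steinitz (m ∷ k ∷ t ∷ []) {w ∷ t ∷ []} i
      (cl-exchange (reorder p) w∉ ∷ cl-exchange (reorder q) w∉ ∷ cl-there cl-here ∷ []))
    where
    reorder : ∀ {m} → w ∈cl t ∷ m ∷ A → w ∈cl m ∷ t ∷ A
    reorder = cl-trans (cl-there cl-here ∷ cl-here ∷ LAll.map (cl-there ∘ cl-there) (cl-self A))

  module _ {a b c x y z} (q : Quad a b c x y z) where
    open Quad q
    private
      C : Pred Carrier 0ℓ
      C = _∈cl b ∷ y ∷ A
      A⊆C : All C A
      A⊆C = LAll.map (cl-there ∘ cl-there) (cl-self A)
      byzA⊆C : All C (b ∷ y ∷ z ∷ A)
      byzA⊆C = cl-here ∷ cl-there cl-here ∷ third (clList-closed _) A⊆C byz cl-here (cl-there cl-here) ∷ A⊆C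

    -- The line of `b`, `y`, `z` is spanned by `b` and `y`, which are independent from `a`. Hence
    -- the quadrangle can be moved generically around this line, which yields the named points.
    a∉byz : ¬ a ∈cl b ∷ y ∷ z ∷ A
    a∉byz p = ℕₚ.<-irrefl refl (steinitz (b ∷ a ∷ y ∷ []) {b ∷ y ∷ []} bay
      (cl-here ∷ closed-list (clList-closed _) byzA⊆C p ∷ cl-there cl-here ∷ []))

    c∉byz : ¬ c ∈cl b ∷ y ∷ z ∷ A
    c∉byz p = a∉byz (first (clList-closed _) (LAll.map (cl-there ∘ cl-there ∘ cl-there) (cl-self A)) abc cl-here p)

  moveGeneric : ∀ {t B} → ¬ t ∈cl B → ∀ G → Σ[ τ ∈ Automorphism structure ] Fixes τ B × ¬ τ ∙ t ∈cl G
  moveGeneric {t} {B} t∉ G = go (inf (G ++ B))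
    where
    go : Σ[ m ∈ Carrier ] ⊤ × ¬ m ∈cl G ++ B → Σ[ τ ∈ Automorphism structure ] Fixes τ B × ¬ τ ∙ t ∈cl G
    go (m , _ , m∉) = found (move B t∉ (m∉ ∘ cl-++ʳ G))
      where
      found : Σ[ τ ∈ Automorphism structure ] Fixes τ B × τ ∙ t ≈ m → Σ[ τ ∈ Automorphism structure ] Fixes τ B × ¬ τ ∙ t ∈cl G
      found (τ , fix , e) = τ , fix , λ p → m∉ (cl-++ˡ (cl-resp e p))

-- Over F the elements b₀, z₀ are independent and determine the type of
-- the other five; u and v are the named points of two quadrangles which
-- share b₀, y₀, z₀.
record ConfigurationData (em : ExcludedMiddle 0ℓ) {L : Language} {𝕄 : PregeometryStructure L}
    (hom : HomogeneousPregeometry em 𝕄) : Set where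
  private C = PregeometryStructure.Carrier 𝕄
  field
    F A                        : List C
    A⊆F                        : All (_∈≡ F) A
    {u v b₀ p₀ q₀ z₀ r₀ y₀ s₀} : C
    u∈F                        : u ∈≡ F
    v∈F                        : v ∈≡ F
    quad-u                     : Lines.Quad em hom A p₀ b₀ u r₀ y₀ z₀
    quad-v                     : Lines.Quad em hom A v b₀ q₀ s₀ y₀ z₀
    bz-ind                     : Pregeometry.Ind em 𝕄 F (b₀ ∷ z₀ ∷ [])
    isolates                   : Isolation.Isolates em 𝕄 (HomogeneousPregeometry.fqm hom) (HomogeneousPregeometry.galois hom)
                                   F (b₀ ∷ z₀ ∷ []) (p₀ ∷ q₀ ∷ r₀ ∷ y₀ ∷ s₀ ∷ [])

  o : Vec C 7
  o = b₀ ∷ p₀ ∷ q₀ ∷ z₀ ∷ r₀ ∷ y₀ ∷ s₀ ∷ []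

module Configuration (em : ExcludedMiddle 0ℓ) {L : Language} {𝕄 : PregeometryStructure L} (hom : HomogeneousPregeometry em 𝕄)
    (cfg : ConfigurationData em hom) where
  open ConfigurationData cfg
  open HomogeneousPregeometry hom
  open PregeometryStructure 𝕄 hiding (Independent)
  open Setoid setoid using () renaming (refl to ≈-refl; sym to ≈-sym; trans to ≈-trans)
  open Pregeometry em 𝕄
  open Automorphisms structure
  open Homogeneity em 𝕄 fqm galois
  open Lines em hom A
  open Correspond em hom
  open Germs em hom F A o

  fixesA : ∀ σ → Fixes σ F → Fixes σ A
  fixesA σ fix = LAll.map (LAll.lookup fix) A⊆F

  module Facts {b p q z r y s} (t : T (b ∷ p ∷ q ∷ []) (z ∷ r ∷ []) (y ∷ s ∷ [])) where

    quad₁ : Quad p b u r y z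
    quad₁ = fact t
      where
      fact : T (b ∷ p ∷ q ∷ []) (z ∷ r ∷ []) (y ∷ s ∷ []) → Quad p b u r y z
      fact (orbit κ κF (eb ∷ ep ∷ eq ∷ ez ∷ er ∷ ey ∷ es ∷ [])) = quad-aut κ (fixesA κ κF) ep eb (LAll.lookup κF u∈F) er ey ez quad-u

    quad₂ : Quad v b q s y z
    quad₂ = fact t
      where
      fact : T (b ∷ p ∷ q ∷ []) (z ∷ r ∷ []) (y ∷ s ∷ []) → Quad v b q s y z
      fact (orbit κ κF (eb ∷ ep ∷ eq ∷ ez ∷ er ∷ ey ∷ es ∷ [])) = quad-aut κ (fixesA κ κF) (LAll.lookup κF v∈F) eb eq es ey ez quad-v

    b∉zF : ¬ b ∈cl z ∷ F
    b∉zF = fact t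
      where
      fact : T (b ∷ p ∷ q ∷ []) (z ∷ r ∷ []) (y ∷ s ∷ []) → ¬ b ∈cl z ∷ F
      fact (orbit κ κF (eb ∷ ep ∷ eq ∷ ez ∷ er ∷ ey ∷ es ∷ [])) = proj₁ bz-ind ∘ cl-reflect κ (ez Listᴾ.∷ fixes⇒↦* κ κF) eb

    z∉F : ¬ z ∈cl F
    z∉F = fact t
      where
      fact : T (b ∷ p ∷ q ∷ []) (z ∷ r ∷ []) (y ∷ s ∷ []) → ¬ z ∈cl F
      fact (orbit κ κF (eb ∷ ep ∷ eq ∷ ez ∷ er ∷ ey ∷ es ∷ [])) = proj₁ (proj₂ bz-ind) ∘ cl-reflect κ (fixes⇒↦* κ κF) ez

    b∉F : ¬ b ∈cl F
    b∉F = b∉zF ∘ cl-there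

    z∉bF : ¬ z ∈cl b ∷ F
    z∉bF c = b∉zF (cl-exchange c z∉F)

    module _ {C : Pred Carrier 0ℓ} (C-closed : Closed C) (F⊆ : All C F) where
      A⊆C : All C A
      A⊆C = LAll.map (LAll.lookup F⊆) A⊆F

      p∈ : C b → C p
      p∈ cb = first C-closed A⊆C (Quad.abc quad₁) cb (LAll.lookup F⊆ u∈F)

      q∈ : C b → C q
      q∈ cb = third C-closed A⊆C (Quad.abc quad₂) (LAll.lookup F⊆ v∈F) cb

      r∈ : C z → C r
      r∈ cz = second C-closed A⊆C (Quad.cxz quad₁) (LAll.lookup F⊆ u∈F) cz

      s∈ : C y → C s
      s∈ cy = second C-closed A⊆C (Quad.axy quad₂) (LAll.lookup F⊆ v∈F) cy

      y∈ : C b → C z → C y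
      y∈ = second C-closed A⊆C (Quad.byz quad₁)

      z∈ : C b → C y → C z
      z∈ = third C-closed A⊆C (Quad.byz quad₁)

      b∈ : C y → C z → C b
      b∈ = first C-closed A⊆C (Quad.byz quad₁)

      β∈ : C b → All C (b ∷ p ∷ q ∷ [])
      β∈ cb = cb ∷ p∈ cb ∷ q∈ cb ∷ []

      ζ∈ : C z → All C (z ∷ r ∷ [])
      ζ∈ cz = cz ∷ r∈ cz ∷ []

      η∈ : C y → All C (y ∷ s ∷ [])
      η∈ cy = cy ∷ s∈ cy ∷ []

  private
    A-in : ∀ {a b} → All (_∈cl a ∷ b ∷ A) A
    A-in = LAll.map (cl-there ∘ cl-there) (cl-self A)

    sub₁ : ∀ {x y G} → y ∈cl x ∷ A → x ∈cl G → All (_∈cl G) A → y ∈cl G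
    sub₁ p q A⊆ = cl-trans (q ∷ A⊆) p

  ∼-refl : ∀ {n} {a : Vec Carrier n} → a ∼ a
  ∼-refl = Pointwise.refl (cl-here , cl-here)

  ∼-reflexive : ∀ {n} {a b : Vec Carrier n} → a ≋ b → a ∼ b
  ∼-reflexive []       = []
  ∼-reflexive (e ∷ es) = (cl-∈ (here e) , cl-∈ (here (≈-sym e))) ∷ ∼-reflexive es

  ∼-sym : ∀ {n} {a b : Vec Carrier n} → a ∼ b → b ∼ a
  ∼-sym = Pointwise.sym swap

  ∼-trans : ∀ {n} {a b c : Vec Carrier n} → a ∼ b → b ∼ c → a ∼ c
  ∼-trans = Pointwise.trans λ (p , q) (p′ , q′) →
    cl-trans (p′ ∷ LAll.map cl-there (cl-self A)) p , cl-trans (q ∷ LAll.map cl-there (cl-self A)) q′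

  private
    -- The points y, s lie on two lines determined by β and ζ, and dually.
    function₁ : ∀ {b p q z r z′ r′ y s y′ s′} → T (b ∷ p ∷ q ∷ []) (z ∷ r ∷ []) (y ∷ s ∷ []) →
      T (b ∷ p ∷ q ∷ []) (z′ ∷ r′ ∷ []) (y′ ∷ s′ ∷ []) → z′ ∈cl z ∷ A → r′ ∈cl r ∷ A → y′ ∈cl y ∷ A × s′ ∈cl s ∷ A
    function₁ {b} {p} {q} {z} {r} {z′} {r′} {y} {s} {y′} {s′} t t′ z′∈ r′∈ = y′∈ ,
        meet (Quad.acx t₂)
          (second (clList-closed _) A-in (Quad.axy t₂′) (cl-there cl-here)
            (sub₁ y′∈ (third (clList-closed _) A-in (Quad.axy t₂) (cl-there cl-here) cl-here) A-in))
          (second (clList-closed _) A-in (Quad.cxz t₂′) (cl-there cl-here)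
            (sub₁ z′∈ (third (clList-closed _) A-in (Quad.cxz t₂) (cl-there cl-here) cl-here) A-in))
      where
      t₁ = Facts.quad₁ t
      t₂ = Facts.quad₂ t
      t₁′ = Facts.quad₁ t′
      t₂′ = Facts.quad₂ t′
      -- `y` is on the line of `b` and `z` and on that of `p` and `r`. As `s` is on the line of `v`
      -- and `y` and on that of `q` and `z`, this has to come before the statement about `s`.
      y′∈ : y′ ∈cl y ∷ A
      y′∈ = meet (Quad.bay t₁)
        (second (clList-closed _) A-in (Quad.byz t₁′) (cl-there cl-here)
          (sub₁ z′∈ (third (clList-closed _) A-in (Quad.byz t₁) (cl-there cl-here) cl-here) A-in))
        (third (clList-closed _) A-in (Quad.axy t₁′) (cl-there cl-here)
          (sub₁ r′∈ (second (clList-closed _) A-in (Quad.axy t₁) (cl-there cl-here) cl-here) A-in))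

    injection₁ : ∀ {b p q z r z′ r′ y s y′ s′} → T (b ∷ p ∷ q ∷ []) (z ∷ r ∷ []) (y ∷ s ∷ []) →
      T (b ∷ p ∷ q ∷ []) (z′ ∷ r′ ∷ []) (y′ ∷ s′ ∷ []) → y′ ∈cl y ∷ A → s′ ∈cl s ∷ A → z′ ∈cl z ∷ A × r′ ∈cl r ∷ A
    injection₁ {b} {p} {q} {z} {r} {z′} {r′} {y} {s} {y′} {s′} t t′ y′∈ s′∈ = z′∈ ,
        meet (Quad.cax t₁)
          (second (clList-closed _) A-in (Quad.cxz t₁′) (cl-there cl-here)
            (sub₁ z′∈ (third (clList-closed _) A-in (Quad.cxz t₁) (cl-there cl-here) cl-here) A-in))
          (second (clList-closed _) A-in (Quad.axy t₁′) (cl-there cl-here)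
            (sub₁ y′∈ (third (clList-closed _) A-in (Quad.axy t₁) (cl-there cl-here) cl-here) A-in))
      where
      t₁ = Facts.quad₁ t
      t₂ = Facts.quad₂ t
      t₁′ = Facts.quad₁ t′
      t₂′ = Facts.quad₂ t′
      z′∈ : z′ ∈cl z ∷ A
      z′∈ = meet (Quad.bcz t₂)
        (third (clList-closed _) A-in (Quad.byz t₂′) (cl-there cl-here)
          (sub₁ y′∈ (second (clList-closed _) A-in (Quad.byz t₂) (cl-there cl-here) cl-here) A-in))
        (third (clList-closed _) A-in (Quad.cxz t₂′) (cl-there cl-here)
          (sub₁ s′∈ (second (clList-closed _) A-in (Quad.cxz t₂) (cl-there cl-here) cl-here) A-in))

  T-function : ∀ {β ζ ζ′ η η′} → T β ζ η → T β ζ′ η′ → ζ ∼ ζ′ → η ∼ η′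
  T-function {_ ∷ _ ∷ _ ∷ []} {_ ∷ _ ∷ []} {_ ∷ _ ∷ []} {_ ∷ _ ∷ []} {_ ∷ _ ∷ []} t t′ ((zl , zr) ∷ (rl , rr) ∷ []) =
    let y , s = function₁ t t′ zr rr ; y′ , s′ = function₁ t′ t zl rl in (y′ , y) ∷ (s′ , s) ∷ []

  T-injective : ∀ {β ζ ζ′ η η′} → T β ζ η → T β ζ′ η′ → η ∼ η′ → ζ ∼ ζ′
  T-injective {_ ∷ _ ∷ _ ∷ []} {_ ∷ _ ∷ []} {_ ∷ _ ∷ []} {_ ∷ _ ∷ []} {_ ∷ _ ∷ []} t t′ ((yl , yr) ∷ (sl , sr) ∷ []) =
    let z , r = injection₁ t t′ yr sr ; z′ , r′ = injection₁ t′ t yl sl in (z′ , z) ∷ (r′ , r) ∷ []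

  inverse-↦* : ∀ κ c → _↦*_ κ (List.map (inverseᵃ κ ∙_) c) c
  inverse-↦* κ []      = Listᴾ.[]
  inverse-↦* κ (x ∷ c) = ∙-inverseʳ κ Listᴾ.∷ inverse-↦* κ c

  -- Independence moves `b₁`, `z₁` to `b₂`, `z₂` over `c` and `F`. Pulled back to `o`, this is an
  -- automorphism fixing `b₀` and `z₀`, and isolation corrects its effect on the other five points.
  stationary : ∀ {b₁ p₁ q₁ z₁ r₁ y₁ s₁ b₂ p₂ q₂ z₂ r₂ y₂ s₂} →
    T (b₁ ∷ p₁ ∷ q₁ ∷ []) (z₁ ∷ r₁ ∷ []) (y₁ ∷ s₁ ∷ []) → T (b₂ ∷ p₂ ∷ q₂ ∷ []) (z₂ ∷ r₂ ∷ []) (y₂ ∷ s₂ ∷ []) →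
    ∀ c → Ind (c ++ F) (b₁ ∷ z₁ ∷ []) → Ind (c ++ F) (b₂ ∷ z₂ ∷ []) →
    Σ[ ρ ∈ Aut ] Fixes ρ (c ++ F) × Vec.map (ρ ∙_) (b₁ ∷ p₁ ∷ q₁ ∷ z₁ ∷ r₁ ∷ y₁ ∷ s₁ ∷ []) ≋ (b₂ ∷ p₂ ∷ q₂ ∷ z₂ ∷ r₂ ∷ y₂ ∷ s₂ ∷ [])
  stationary {b₁} {z₁ = z₁} {b₂ = b₂} {p₂} {q₂} {z₂} {r₂} {y₂} {s₂}
      (orbit κ₁ κ₁F (b₁e ∷ p₁e ∷ q₁e ∷ z₁e ∷ r₁e ∷ y₁e ∷ s₁e ∷ [])) (orbit κ₂ κ₂F (b₂e ∷ p₂e ∷ q₂e ∷ z₂e ∷ r₂e ∷ y₂e ∷ s₂e ∷ [])) c i₁ i₂@(j₁ , j₂ , _) =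
    align (extendIndependent identityᵃ (c ++ F) ((b₁ , b₂) ∷ (z₁ , z₂) ∷ []) i₁
      (subst (λ G → Ind G (b₂ ∷ z₂ ∷ [])) (sym (map-id (c ++ F))) i₂))
    where
    Result : Set
    Result = Σ[ ρ ∈ Aut ] Fixes ρ (c ++ F) × Vec.map (ρ ∙_) _ ≋ (b₂ ∷ p₂ ∷ q₂ ∷ z₂ ∷ r₂ ∷ y₂ ∷ s₂ ∷ [])
    align : Σ[ κ ∈ Aut ] All (λ (a , b) → κ ∙ a ≈ b) ((b₁ , b₂) ∷ (z₁ , z₂) ∷ []) × Fixes κ (c ++ F) → Result
    align (κ , κb ∷ κz ∷ [] , fix) = correct (isolates σ
          (LAll.zipWith (λ (e , f , g) → ∙-inverse κ₂ (≈-trans g (≈-sym (≈-trans (∙-cong κ e) f)))) (κ₁F , LAll.zip (LAllₚ.++⁻ʳ c fix , κ₂F)))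
          (back b₁e κb b₂e ∷ back z₁e κz z₂e ∷ [])
          (List.map (inverseᵃ κ₂ ∙_) c)
          (j₁ ∘ cl-transport κ₂ (z₂e Listᴾ.∷ c′F↦) b₂e , j₂ ∘ cl-transport κ₂ c′F↦ z₂e , _))
      where
      σ : Aut
      σ = inverseᵃ κ₂ ∘ᵃ κ ∘ᵃ κ₁
      c′F↦ : _↦*_ κ₂ (List.map (inverseᵃ κ₂ ∙_) c ++ F) (c ++ F)
      c′F↦ = Listᴾ.++⁺ (inverse-↦* κ₂ c) (fixes⇒↦* κ₂ κ₂F)
      back : ∀ {e e₁ e₂} → κ₁ ∙ e ≈ e₁ → κ ∙ e₁ ≈ e₂ → κ₂ ∙ e ≈ e₂ → σ ∙ e ≈ e
      back p q r = ∙-inverse κ₂ (≈-trans r (≈-sym (≈-trans (∙-cong κ p) q)))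
      correct : Σ[ ρ ∈ Aut ] Fixes ρ F × Fixes ρ (b₀ ∷ z₀ ∷ []) × Fixes ρ (List.map (inverseᵃ κ₂ ∙_) c) ×
                  All (λ x → ρ ∙ x ≈ σ ∙ x) (p₀ ∷ q₀ ∷ r₀ ∷ y₀ ∷ s₀ ∷ []) → Result
      correct (ρ , ρF , ρb ∷ ρz ∷ [] , ρc , pe ∷ qe ∷ re ∷ ye ∷ se ∷ []) = κ₂ ∘ᵃ inverseᵃ ρ ∘ᵃ inverseᵃ κ₂ ∘ᵃ κ ,
          LAllₚ.++⁺
            (LAll.zipWith (λ (e , f) → ≈-trans (∙-cong κ₂ (≈-trans (∙-cong (inverseᵃ ρ) (∙-cong (inverseᵃ κ₂) e)) (∙-inverse ρ f))) (∙-inverseʳ κ₂))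
              (LAllₚ.++⁻ˡ c fix , LAllₚ.map⁻ ρc))
            (LAll.zipWith (λ (e , f , g) → ≈-trans (∙-cong κ₂ (≈-trans (∙-cong (inverseᵃ ρ) (≈-trans (∙-cong (inverseᵃ κ₂) e) (∙-inverse κ₂ g))) (∙-inverse ρ f))) g)
              (LAllₚ.++⁻ʳ c fix , LAll.zip (ρF , κ₂F))) ,
          follow b₁e (≈-trans ρb (≈-sym (back b₁e κb b₂e))) b₂e ∷ follow p₁e pe p₂e ∷ follow q₁e qe q₂e ∷
          follow z₁e (≈-trans ρz (≈-sym (back z₁e κz z₂e))) z₂e ∷ follow r₁e re r₂e ∷ follow y₁e ye y₂e ∷ follow s₁e se s₂e ∷ []
        where
        follow : ∀ {e e₁ e₂} → κ₁ ∙ e ≈ e₁ → ρ ∙ e ≈ σ ∙ e → κ₂ ∙ e ≈ e₂ → κ₂ ∙ inverseᵃ ρ ∙ inverseᵃ κ₂ ∙ κ ∙ e₁ ≈ e₂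
        follow p q r = ≈-trans (∙-cong κ₂ (≈-trans (∙-cong (inverseᵃ ρ)
          (∙-cong (inverseᵃ κ₂) (∙-cong κ (≈-sym p)))) (∙-inverse ρ q))) r

  T-fixes : ∀ σ → Fixes σ F → ∀ {β β′ ζ ζ′ η η′} → _↦_ σ β β′ → _↦_ σ ζ ζ′ → _↦_ σ η η′ → T β ζ η → T β′ ζ′ η′
  T-fixes σ fix e f g = TransportOrbit.T-fixes em hom σ {F} {A} {o} fix e f g

  module Moving (σ : Aut) (fix : Fixes σ F) =
    Transport em hom σ {F} {F} {A} {A} {o} {o} (fixes⇒↦* σ fix) (fixes⇒↦* σ (fixesA σ fix)) (λ e f g → T-fixes σ fix e f g)

  image : ∀ σ {n} (a : Vec Carrier n) → _↦_ σ a (Vec.map (σ ∙_) a)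
  image σ a = Pointwise.refl ≈-refl

  pairInd : ∀ {G b z} → ¬ b ∈cl G → ¬ z ∈cl b ∷ G → Ind G (b ∷ z ∷ [])
  pairInd b∉ z∉ = (λ p → z∉ (cl-exchange p b∉)) , z∉ ∘ cl-there , _

  head-↦ : ∀ σ {n} {a a′ : Vec Carrier (suc n)} → _↦_ σ a a′ → σ ∙ Vec.head a ≈ Vec.head a′
  head-↦ σ {a = _ ∷ _} {_ ∷ _} (e ∷ _) = e

  -- The other entries are algebraic over the head and `F`, so the genericity of a tuple is a
  -- condition on its head.
  P⇒ : ∀ {β} → P β → ∀ {C} → Closed C → All C F → C (Vec.head β) → All C (Vec.toList β)
  P⇒ {b ∷ p ∷ q ∷ []} (z ∷ r ∷ [] , y ∷ s ∷ [] , t) = Facts.β∈ t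

  Q⇒ : ∀ {ζ} → Q ζ → ∀ {C} → Closed C → All C F → C (Vec.head ζ) → All C (Vec.toList ζ)
  Q⇒ {z ∷ r ∷ []} (b ∷ p ∷ q ∷ [] , y ∷ s ∷ [] , t) = Facts.ζ∈ t

  R⇒ : ∀ {η} → R η → ∀ {C} → Closed C → All C F → C (Vec.head η) → All C (Vec.toList η)
  R⇒ {y ∷ s ∷ []} (b ∷ p ∷ q ∷ [] , z ∷ r ∷ [] , t) = Facts.η∈ t

  genericζ : ∀ {β} → P β → ∀ c → Σ[ ζ ∈ _ ] Σ[ η ∈ _ ] T β ζ η × ¬ Vec.head ζ ∈cl Vec.head β ∷ c ++ F
  genericζ {β@(b ∷ p ∷ q ∷ [])} Pβ@(ζ@(z ∷ r ∷ []) , η@(y ∷ s ∷ []) , t) c =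
    conclude (moveGeneric {z} {(b ∷ p ∷ q ∷ []) ++ F} z∉ (b ∷ c ++ F))
    where
    z∉ : ¬ z ∈cl (b ∷ p ∷ q ∷ []) ++ F
    z∉ = Facts.z∉bF t ∘ cl-trans (LAllₚ.++⁺ (P⇒ Pβ (clList-closed _) (LAll.tail (cl-self (b ∷ F))) cl-here) (LAll.tail (cl-self (b ∷ F))))
    conclude : Σ[ τ ∈ Aut ] Fixes τ ((b ∷ p ∷ q ∷ []) ++ F) × ¬ τ ∙ z ∈cl b ∷ c ++ F →
               Σ[ ζ ∈ _ ] Σ[ η ∈ _ ] T β ζ η × ¬ Vec.head ζ ∈cl b ∷ c ++ F
    conclude (τ , fix , z∉) = Vec.map (τ ∙_) ζ , Vec.map (τ ∙_) η ,
      T-fixes τ (LAllₚ.++⁻ʳ (b ∷ p ∷ q ∷ []) fix) (fixes⇒↦ τ (LAllₚ.++⁻ˡ (b ∷ p ∷ q ∷ []) fix)) (image τ ζ) (image τ η) t , z∉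

  genericβ : ∀ {ζ} → Q ζ → ∀ c → Σ[ β ∈ _ ] Σ[ η ∈ _ ] T β ζ η × ¬ Vec.head β ∈cl Vec.head ζ ∷ c ++ F
  genericβ {ζ@(z ∷ r ∷ [])} Qζ@(β@(b ∷ p ∷ q ∷ []) , η@(y ∷ s ∷ []) , t) c =
    conclude (moveGeneric {b} {(z ∷ r ∷ []) ++ F} b∉ (z ∷ c ++ F))
    where
    b∉ : ¬ b ∈cl (z ∷ r ∷ []) ++ F
    b∉ = Facts.b∉zF t ∘ cl-trans (LAllₚ.++⁺ (Q⇒ Qζ (clList-closed _) (LAll.tail (cl-self (z ∷ F))) cl-here) (LAll.tail (cl-self (z ∷ F))))
    conclude : Σ[ τ ∈ Aut ] Fixes τ ((z ∷ r ∷ []) ++ F) × ¬ τ ∙ b ∈cl z ∷ c ++ F →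
               Σ[ β ∈ _ ] Σ[ η ∈ _ ] T β ζ η × ¬ Vec.head β ∈cl z ∷ c ++ F
    conclude (τ , fix , b∉) = Vec.map (τ ∙_) β , Vec.map (τ ∙_) η ,
      T-fixes τ (LAllₚ.++⁻ʳ (z ∷ r ∷ []) fix) (image τ β) (fixes⇒↦ τ (LAllₚ.++⁻ˡ (z ∷ r ∷ []) fix)) (image τ η) t , b∉

  genericβη : ∀ {η} → R η → ∀ c → Σ[ β ∈ _ ] Σ[ ζ ∈ _ ] T β ζ η × ¬ Vec.head β ∈cl Vec.head η ∷ c ++ F
  genericβη {η@(y ∷ s ∷ [])} Rη@(β@(b ∷ p ∷ q ∷ []) , ζ@(z ∷ r ∷ []) , t) c =
    conclude (moveGeneric {b} {(y ∷ s ∷ []) ++ F} b∉ (y ∷ c ++ F))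
    where
    F⊆ : All (_∈cl y ∷ F) F
    F⊆ = LAll.tail (cl-self (y ∷ F))
    b∉y : ¬ b ∈cl y ∷ F
    b∉y c = ℕₚ.<-irrefl refl (steinitz (b ∷ z ∷ []) {y ∷ []} (Facts.b∉zF t , Facts.z∉F t , _)
      (c ∷ Facts.z∈ t (clList-closed (y ∷ F)) F⊆ c cl-here ∷ []))
    b∉ : ¬ b ∈cl (y ∷ s ∷ []) ++ F
    b∉ = b∉y ∘ cl-trans (LAllₚ.++⁺ (R⇒ Rη (clList-closed _) F⊆ cl-here) F⊆)
    conclude : Σ[ τ ∈ Aut ] Fixes τ ((y ∷ s ∷ []) ++ F) × ¬ τ ∙ b ∈cl y ∷ c ++ F →
               Σ[ β ∈ _ ] Σ[ ζ ∈ _ ] T β ζ η × ¬ Vec.head β ∈cl y ∷ c ++ F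
    conclude (τ , fix , b∉) = Vec.map (τ ∙_) β , Vec.map (τ ∙_) ζ ,
      T-fixes τ (LAllₚ.++⁻ʳ (y ∷ s ∷ []) fix) (image τ β) (image τ ζ) (fixes⇒↦ τ (LAllₚ.++⁻ˡ (y ∷ s ∷ []) fix)) t , b∉

-- The calculus of germs

module GermWords (em : ExcludedMiddle 0ℓ) {L : Language} {𝕄 : PregeometryStructure L} (hom : HomogeneousPregeometry em 𝕄)
    (cfg : ConfigurationData em hom) where
  open ConfigurationData cfg
  open HomogeneousPregeometry hom
  open PregeometryStructure 𝕄 hiding (Independent)
  open Setoid setoid using () renaming (refl to ≈-refl)
  open Pregeometry em 𝕄
  open Automorphisms structure
  open Homogeneity em 𝕄 fqm galois
  open Correspond em hom
  open Germs em hom F A o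
  open Configuration em hom cfg

  -- Each of the two is completed by a generic `ζ`, after which the completed tuples are conjugate
  -- by `stationary`.
  conj-β : ∀ {β₁ β₂} → P β₁ → P β₂ → ∀ c → ¬ Vec.head β₁ ∈cl c ++ F → ¬ Vec.head β₂ ∈cl c ++ F →
           Σ[ ρ ∈ Aut ] Fixes ρ (c ++ F) × _↦_ ρ β₁ β₂
  conj-β {_ ∷ _ ∷ _ ∷ []} {_ ∷ _ ∷ _ ∷ []} P₁ P₂ c b₁∉ b₂∉ = go (genericζ P₁ c) (genericζ P₂ c)
    where
    go : _ → _ → _
    go (_ ∷ _ ∷ [] , _ ∷ _ ∷ [] , t₁ , z₁∉) (_ ∷ _ ∷ [] , _ ∷ _ ∷ [] , t₂ , z₂∉) =
      Prod.map₂ (Prod.map₂ λ { (e ∷ f ∷ g ∷ _) → e ∷ f ∷ g ∷ [] }) (stationary t₁ t₂ c (pairInd b₁∉ z₁∉) (pairInd b₂∉ z₂∉))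

  conj-ζ : ∀ {ζ₁ ζ₂} → Q ζ₁ → Q ζ₂ → ∀ c → ¬ Vec.head ζ₁ ∈cl c ++ F → ¬ Vec.head ζ₂ ∈cl c ++ F →
           Σ[ ρ ∈ Aut ] Fixes ρ (c ++ F) × _↦_ ρ ζ₁ ζ₂
  conj-ζ {_ ∷ _ ∷ []} {_ ∷ _ ∷ []} Q₁ Q₂ c z₁∉ z₂∉ = go (genericβ Q₁ c) (genericβ Q₂ c)
    where
    go : _ → _ → _
    go (_ ∷ _ ∷ _ ∷ [] , _ ∷ _ ∷ [] , t₁ , b₁∉) (_ ∷ _ ∷ _ ∷ [] , _ ∷ _ ∷ [] , t₂ , b₂∉) =
      Prod.map₂ (Prod.map₂ λ { (_ ∷ _ ∷ _ ∷ e ∷ f ∷ _) → e ∷ f ∷ [] }) (stationary t₁ t₂ c (b₁∉ , z₁∉ , _) (b₂∉ , z₂∉ , _))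

  conj-η : ∀ {η₁ η₂} → R η₁ → R η₂ → ∀ c → ¬ Vec.head η₁ ∈cl c ++ F → ¬ Vec.head η₂ ∈cl c ++ F →
           Σ[ ρ ∈ Aut ] Fixes ρ (c ++ F) × _↦_ ρ η₁ η₂
  conj-η {_ ∷ _ ∷ []} {_ ∷ _ ∷ []} R₁ R₂ c y₁∉ y₂∉ = go (genericβη R₁ c) (genericβη R₂ c)
    where
    ind : ∀ {b p q z r y s} → T (b ∷ p ∷ q ∷ []) (z ∷ r ∷ []) (y ∷ s ∷ []) → ¬ y ∈cl c ++ F → ¬ b ∈cl y ∷ c ++ F → Ind (c ++ F) (b ∷ z ∷ [])
    ind {b} t y∉ b∉ = pairInd (b∉ ∘ cl-there) λ z∈ → b∉ (cl-exchange
      (Facts.y∈ t (clList-closed (b ∷ c ++ F)) (cl-selfʳ (b ∷ c)) cl-here z∈) y∉)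
    go : _ → _ → _
    go (_ ∷ _ ∷ _ ∷ [] , _ ∷ _ ∷ [] , t₁ , b₁∉) (_ ∷ _ ∷ _ ∷ [] , _ ∷ _ ∷ [] , t₂ , b₂∉) =
      Prod.map₂ (Prod.map₂ λ { (_ ∷ _ ∷ _ ∷ _ ∷ _ ∷ e ∷ f ∷ []) → e ∷ f ∷ [] }) (stationary t₁ t₂ c (ind t₁ y₁∉ b₁∉) (ind t₂ y₂∉ b₂∉))

  F⊆₁ : ∀ {b} → All (_∈cl b ∷ F) F
  F⊆₁ = cl-selfʳ (_ ∷ [])

  β⊆ : ∀ {β} → P β → All (_∈cl Vec.head β ∷ F) (Vec.toList β ++ F)
  β⊆ Pβ = LAllₚ.++⁺ (P⇒ Pβ (clList-closed _) F⊆₁ cl-here) F⊆₁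

  total-η : ∀ {β ζ} → P β → Q ζ → ¬ Vec.head ζ ∈cl Vec.head β ∷ F → Σ[ η ∈ _ ] T β ζ η
  total-η {β} {ζ} Pβ Qζ z∉ = go (genericζ Pβ [])
    where
    go : Σ[ ζ ∈ _ ] Σ[ η ∈ _ ] T β ζ η × ¬ Vec.head ζ ∈cl Vec.head β ∷ F → Σ[ η ∈ _ ] T β ζ η
    go (ζ′ , η′ , t , z′∉) with ρ , fix , e ← conj-ζ (β , η′ , t) Qζ (Vec.toList β) (z′∉ ∘ cl-trans (β⊆ Pβ)) (z∉ ∘ cl-trans (β⊆ Pβ)) =
      Vec.map (ρ ∙_) η′ , T-fixes ρ (LAllₚ.++⁻ʳ (Vec.toList β) fix) (fixes⇒↦ ρ (LAllₚ.++⁻ˡ (Vec.toList β) fix)) e (image ρ η′) t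

  total-ζ : ∀ {β η} → P β → R η → ¬ Vec.head η ∈cl Vec.head β ∷ F → Σ[ ζ ∈ _ ] T β ζ η
  total-ζ {β@(b ∷ _ ∷ _ ∷ [])} {η} Pβ Rη y∉ = go (genericζ Pβ [])
    where
    go : Σ[ ζ ∈ _ ] Σ[ η ∈ _ ] T β ζ η × ¬ Vec.head ζ ∈cl Vec.head β ∷ F → Σ[ ζ ∈ _ ] T β ζ η
    go (ζ′@(z′ ∷ _ ∷ []) , η′@(y′ ∷ _ ∷ []) , t , z′∉)
      with ρ , fix , e ← conj-η (β , ζ′ , t) Rη (Vec.toList β)
             (λ c → z′∉ (Facts.z∈ t (clList-closed _) F⊆₁ cl-here (cl-trans (β⊆ Pβ) c))) (y∉ ∘ cl-trans (β⊆ Pβ)) =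
      Vec.map (ρ ∙_) ζ′ , T-fixes ρ (LAllₚ.++⁻ʳ (Vec.toList β) fix) (fixes⇒↦ ρ (LAllₚ.++⁻ˡ (Vec.toList β) fix)) (image ρ ζ′) e t

  Fresh : Vec Carrier 2 → List Carrier → Set
  Fresh ζ G = ¬ Vec.head ζ ∈cl G

  fresh-sub : ∀ {ζ G G′} → All (_∈cl G) G′ → Fresh ζ G → Fresh ζ G′
  fresh-sub s f = f ∘ cl-trans s

  module _ {G : List Carrier} (F⊆ : All (_∈cl G) F) where

    -- Argument, intermediate point and value are interalgebraic over the germ and `F`; so a generic
    -- argument has a generic value, and words can be evaluated letter by letter.
    ev-total : ∀ {g} → Valid g → All (_∈cl G) (bases (g ∷ [])) → ∀ {ζ} → Q ζ → Fresh ζ G →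
               Σ[ ζ′ ∈ _ ] Ev g ζ ζ′ × Q ζ′ × Fresh ζ′ G
    ev-total {β₁@(_ ∷ _ ∷ _ ∷ []) , β₂@(_ ∷ _ ∷ _ ∷ [])} (P₁ , P₂) (b₁∈ ∷ b₂∈ ∷ []) {ζ@(_ ∷ _ ∷ [])} Qζ z∉ =
      first′ (total-η P₂ Qζ (z∉ ∘ cl-trans (b₂∈ ∷ F⊆)))
      where
      Goal : Set
      Goal = Σ[ ζ′ ∈ _ ] Ev (β₁ , β₂) ζ ζ′ × Q ζ′ × Fresh ζ′ G
      first′ : Σ[ η ∈ _ ] T β₂ ζ η → Goal
      first′ (η@(y ∷ _ ∷ []) , t) = second′ (total-ζ P₁ (β₂ , ζ , t) (y∉ ∘ cl-trans (b₁∈ ∷ F⊆)))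
        where
        y∉ : ¬ y ∈cl G
        y∉ = z∉ ∘ Facts.z∈ t (clList-closed G) F⊆ b₂∈
        second′ : Σ[ ζ′ ∈ _ ] T β₁ ζ′ η → Goal
        second′ (ζ′@(_ ∷ _ ∷ []) , t′) = ζ′ , (η , t , t′) , (β₁ , η , t′) , y∉ ∘ Facts.y∈ t′ (clList-closed G) F⊆ b₁∈

    evW-total : ∀ {ws} → All Valid ws → All (_∈cl G) (bases ws) → ∀ {ζ} → Q ζ → Fresh ζ G →
                Σ[ ζ′ ∈ _ ] EvW ws ζ ζ′ × Q ζ′ × Fresh ζ′ G
    evW-total []       _            {ζ} Qζ z∉ = ζ , Pointwise.refl ≈-refl , Qζ , z∉
    evW-total (v ∷ vs) (b ∷ b′ ∷ bs) Qζ z∉ =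
      let ξ , e , Qξ , ξ∉ = evW-total vs bs Qζ z∉ ; ζ′ , e′ , Qζ′ , ζ′∉ = ev-total v (b ∷ b′ ∷ []) Qξ ξ∉ in
      ζ′ , (ξ , e , e′) , Qζ′ , ζ′∉

  ev-function : ∀ {g ζ ζ₁ ξ ξ₁} → Ev g ζ ζ₁ → Ev g ξ ξ₁ → ζ ∼ ξ → ζ₁ ∼ ξ₁
  ev-function (η , t , s) (η′ , t′ , s′) e = T-injective s s′ (T-function t t′ e)

  evW-function : ∀ ws {ζ ζ₁ ξ ξ₁} → EvW ws ζ ζ₁ → EvW ws ξ ξ₁ → ζ ∼ ξ → ζ₁ ∼ ξ₁
  evW-function []       p q e = ∼-trans (∼-sym (∼-reflexive p)) (∼-trans e (∼-reflexive q))
  evW-function (g ∷ ws) (_ , p , q) (_ , p′ , q′) e = ev-function q q′ (evW-function ws p p′ e)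

  P₀ : P (b₀ ∷ p₀ ∷ q₀ ∷ [])
  P₀ = z₀ ∷ r₀ ∷ [] , y₀ ∷ s₀ ∷ [] , orbit identityᵃ (LAll.tabulate {xs = F} (λ _ → ≈-refl)) (Pointwise.refl ≈-refl)

  fresh-exists : ∀ G → Σ[ ζ ∈ _ ] Q ζ × Fresh ζ (G ++ F)
  fresh-exists G = go (genericζ P₀ G)
    where
    go : Σ[ ζ ∈ _ ] Σ[ η ∈ _ ] T (b₀ ∷ p₀ ∷ q₀ ∷ []) ζ η × ¬ Vec.head ζ ∈cl b₀ ∷ G ++ F → Σ[ ζ ∈ _ ] Q ζ × Fresh ζ (G ++ F)
    go (ζ , η , t , z∉) = ζ , (_ , η , t) , z∉ ∘ cl-there

  -- All entries of a word, which automorphisms have to fix; genericity is measured against the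
  -- heads in `bases`.
  letters : List Germ → List Carrier
  letters []               = []
  letters ((β₁ , β₂) ∷ ws) = Vec.toList β₁ ++ Vec.toList β₂ ++ letters ws

  letters⊆ : ∀ {ws} → All Valid ws → ∀ {C} → Closed C → All C F → All C (bases ws) → All C (letters ws)
  letters⊆ []             _  _  _            = []
  letters⊆ ((p , q) ∷ vs) cC F⊆ (b ∷ b′ ∷ bs) = LAllₚ.++⁺ (P⇒ p cC F⊆ b) (LAllₚ.++⁺ (P⇒ q cC F⊆ b′) (letters⊆ vs cC F⊆ bs))

  letters-fixed : ∀ σ (fixF : Fixes σ F) ws → Fixes σ (letters ws) → Listᴾ.Pointwise (Moving.GermMap σ fixF) ws ws
  letters-fixed σ fixF []               _   = Listᴾ.[]
  letters-fixed σ fixF ((β₁ , β₂) ∷ ws) fix =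
    (fixes⇒↦ σ (LAllₚ.++⁻ˡ (Vec.toList β₁) fix) , fixes⇒↦ σ (LAllₚ.++⁻ˡ (Vec.toList β₂) (LAllₚ.++⁻ʳ (Vec.toList β₁) fix)))
      Listᴾ.∷ letters-fixed σ fixF ws (LAllₚ.++⁻ʳ (Vec.toList β₂) (LAllₚ.++⁻ʳ (Vec.toList β₁) fix))

  Over : List Carrier → List Germ → Set
  Over G ws = All (_∈cl G) (bases ws)

  over : ∀ {all} ws → All (_∈≡ all) ws → Over (bases all ++ F) ws
  over []       []       = []
  over ((β₁ , β₂) ∷ ws) (g∈ ∷ s) = LAllₚ.++⁺ (entry g∈) (over ws s)
    where
    entry : ∀ {g all} → g ∈≡ all → All (_∈cl bases all ++ F) (bases (g ∷ []))
    entry (here refl)           = cl-here ∷ cl-there cl-here ∷ []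
    entry {all = _ ∷ _} (there g∈) = LAll.map (cl-there ∘ cl-there) (entry g∈)

  -- The list `all` may contain auxiliary words: `ζ` is generic over these too, so that they can be
  -- evaluated in the course of the argument.
  ≃-intro : ∀ {ws vs} all → All (_∈≡ all) ws → All (_∈≡ all) vs → All Valid ws → All Valid vs →
    (∀ {ζ ζ₁ ζ₂} → Q ζ → Fresh ζ (bases all ++ F) → EvW ws ζ ζ₁ → EvW vs ζ ζ₂ → ζ₁ ∼ ζ₂) → ws ≃ vs
  ≃-intro {ws} {vs} all w⊆ v⊆ Vw Vv agree = go (fresh-exists (bases all))
    where
    F⊆ : All (_∈cl bases all ++ F) F
    F⊆ = cl-selfʳ (bases all)
    go : Σ[ ζ ∈ _ ] Q ζ × Fresh ζ (bases all ++ F) → ws ≃ vs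
    go (ζ , Qζ , fr) =
      let ζ₁ , e₁ , _ = evW-total F⊆ Vw (over ws w⊆) Qζ fr ; ζ₂ , e₂ , _ = evW-total F⊆ Vv (over vs v⊆) Qζ fr in
      Vw , Vv , ζ , ζ₁ , ζ₂ , Qζ , fresh-sub {ζ} (LAllₚ.++⁺ (over ws w⊆) (LAllₚ.++⁺ (over vs v⊆) F⊆)) fr , e₁ , e₂ , agree Qζ fr e₁ e₂

  -- Agreement at one generic argument is agreement at all, since arguments generic over the letters
  -- are conjugate over them. Transitivity and compatibility with composition rest on this.
  ≃-elim : ∀ {ws vs} → ws ≃ vs → ∀ {G} → All (_∈cl G) F → Over G ws → Over G vs → ∀ {ζ ζ₁ ζ₂} →
           Q ζ → Fresh ζ G → EvW ws ζ ζ₁ → EvW vs ζ ζ₂ → ζ₁ ∼ ζ₂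
  ≃-elim {ws} {vs} (Vw , Vv , ξ , ξ₁ , ξ₂ , Qξ , ξ∉ , f₁ , f₂ , r) F⊆ oW oV {ζ} {ζ₁} {ζ₂} Qζ ζ∉ e₁ e₂ =
    go (conj-ζ Qξ Qζ c (ξ∉ ∘ cl-trans (lettersF⊆ (cl-selfˡ (bases ws)) (LAll.map (cl-++ʳ (bases ws)) (cl-selfˡ (bases vs)))
          (LAll.map (cl-++ʳ (bases ws)) (cl-selfʳ (bases vs)))))
        (ζ∉ ∘ cl-trans (lettersF⊆ oW oV F⊆)))
    where
    c : List Carrier
    c = letters ws ++ letters vs
    lettersF⊆ : ∀ {G} → Over G ws → Over G vs → All (_∈cl G) F → All (_∈cl G) (c ++ F)
    lettersF⊆ w v f = LAllₚ.++⁺ (LAllₚ.++⁺ (letters⊆ Vw (clList-closed _) f w) (letters⊆ Vv (clList-closed _) f v)) f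
    go : Σ[ ρ ∈ Aut ] Fixes ρ (c ++ F) × _↦_ ρ ξ ζ → ζ₁ ∼ ζ₂
    go (ρ , fix , e) = ∼-trans (evW-function ws e₁ (EvW↦ (letters-fixed ρ fixF ws (LAllₚ.++⁻ˡ (letters ws) fixc)) e (image ρ ξ₁) f₁) ∼-refl)
        (∼-trans (∼↦ (image ρ ξ₁) (image ρ ξ₂) r)
          (evW-function vs (EvW↦ (letters-fixed ρ fixF vs (LAllₚ.++⁻ʳ (letters ws) fixc)) e (image ρ ξ₂) f₂) e₂ ∼-refl))
      where
      fixF : Fixes ρ F
      fixF = LAllₚ.++⁻ʳ c fix
      fixc : Fixes ρ c
      fixc = LAllₚ.++⁻ˡ c fix
      open Moving ρ fixF

  validˡ : ∀ {ws vs} → ws ≃ vs → All Valid ws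
  validˡ = proj₁

  validʳ : ∀ {ws vs} → ws ≃ vs → All Valid vs
  validʳ = proj₁ ∘ proj₂

  private
    inˡ : ∀ (ws : List Germ) {vs} → All (_∈≡ ws ++ vs) ws
    inˡ ws = LAll.tabulate ∈-++⁺ˡ

    inʳ : ∀ (ws : List Germ) {vs us} → All (_∈≡ vs) us → All (_∈≡ ws ++ vs) us
    inʳ ws = LAll.map (∈-++⁺ʳ ws)

    self : ∀ (ws : List Germ) → All (_∈≡ ws) ws
    self ws = LAll.tabulate id

  ≃-refl : ∀ {ws} → All Valid ws → ws ≃ ws
  ≃-refl {ws} V = ≃-intro ws (self ws) (self ws) V V λ _ _ e e′ → evW-function ws e e′ ∼-refl

  ≃-sym : ∀ {ws vs} → ws ≃ vs → vs ≃ ws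
  ≃-sym {ws} {vs} p = ≃-intro (ws ++ vs) (inʳ ws (self vs)) (inˡ ws) (validʳ p) (validˡ p) λ Qζ fr e e′ →
    ∼-sym (≃-elim p (cl-selfʳ (bases (ws ++ vs))) (over ws (inˡ ws)) (over vs (inʳ ws (self vs))) Qζ fr e′ e)

  ≃-trans : ∀ {ws vs us} → ws ≃ vs → vs ≃ us → ws ≃ us
  ≃-trans {ws} {vs} {us} p q = ≃-intro all (inˡ ws) u⊆ (validˡ p) (validʳ q) λ Qζ fr e e′ →
      let ζ , e″ , _ = evW-total F⊆ (validʳ p) (over vs v⊆) Qζ fr in
      ∼-trans (≃-elim p F⊆ (over ws (inˡ ws)) (over vs v⊆) Qζ fr e e″) (≃-elim q F⊆ (over vs v⊆) (over us u⊆) Qζ fr e″ e′)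
    where
    all : List Germ
    all = ws ++ vs ++ us
    v⊆ : All (_∈≡ all) vs
    v⊆ = inʳ ws (inˡ vs)
    u⊆ : All (_∈≡ all) us
    u⊆ = inʳ ws (inʳ vs (self us))
    F⊆ : All (_∈cl bases all ++ F) F
    F⊆ = cl-selfʳ (bases all)

  evW-++ : ∀ ws {vs ζ ζ₂} → EvW (ws ++ vs) ζ ζ₂ → Σ[ ζ₁ ∈ _ ] EvW vs ζ ζ₁ × EvW ws ζ₁ ζ₂
  evW-++ []       {ζ₂ = ζ₂} e = ζ₂ , e , Pointwise.refl ≈-refl
  evW-++ (g ∷ ws) (ξ , e , e′) with ζ₁ , f , f′ ← evW-++ ws e = ζ₁ , f , ξ , f′ , e′

  ≃-++ : ∀ {ws ws′ vs vs′} → ws ≃ ws′ → vs ≃ vs′ → (ws ++ vs) ≃ (ws′ ++ vs′)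
  ≃-++ {ws} {ws′} {vs} {vs′} p q = ≃-intro all (LAllₚ.++⁺ w⊆ v⊆) (LAllₚ.++⁺ w′⊆ v′⊆)
      (LAllₚ.++⁺ (validˡ p) (validˡ q)) (LAllₚ.++⁺ (validʳ p) (validʳ q)) λ Qζ fr e e′ →
        let ζ₁ , f , g = evW-++ ws e ; ζ₁′ , f′ , g′ = evW-++ ws′ e′
            ξ , h , Qξ , ξ∉ = evW-total F⊆ (validˡ q) (over vs v⊆) Qζ fr
            a , k , _ = evW-total F⊆ (validˡ p) (over ws w⊆) Qξ ξ∉
            b , l , _ = evW-total F⊆ (validʳ p) (over ws′ w′⊆) Qξ ξ∉
        in ∼-trans (evW-function ws g k (evW-function vs f h ∼-refl))
          (∼-trans (≃-elim p F⊆ (over ws w⊆) (over ws′ w′⊆) Qξ ξ∉ k l)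
            (evW-function ws′ l g′ (≃-elim q F⊆ (over vs v⊆) (over vs′ v′⊆) Qζ fr h f′)))
    where
    all : List Germ
    all = ws ++ ws′ ++ vs ++ vs′
    w⊆ : All (_∈≡ all) ws
    w⊆ = inˡ ws
    w′⊆ : All (_∈≡ all) ws′
    w′⊆ = inʳ ws (inˡ ws′)
    v⊆ : All (_∈≡ all) vs
    v⊆ = inʳ ws (inʳ ws′ (inˡ vs))
    v′⊆ : All (_∈≡ all) vs′
    v′⊆ = inʳ ws (inʳ ws′ (inʳ vs (self vs′)))
    F⊆ : All (_∈cl bases all ++ F) F
    F⊆ = cl-selfʳ (bases all)

  -- The middle maps cancel: `T β₂` and `T β₃` are functions and `T β₁` is injective, up to
  -- interalgebraicity.
  compose : ∀ {β₁ β₂ β₃} → P β₁ → P β₂ → P β₃ → ((β₁ , β₂) ∷ (β₂ , β₃) ∷ []) ≃ ((β₁ , β₃) ∷ [])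
  compose {β₁} {β₂} {β₃} p₁ p₂ p₃ = ≃-intro all (here refl ∷ there (here refl) ∷ []) (there (there (here refl)) ∷ [])
      ((p₁ , p₂) ∷ (p₂ , p₃) ∷ []) ((p₁ , p₃) ∷ [])
      λ { _ _ (_ , (_ , e , (η , s , t)) , (η′ , s′ , t′)) (_ , e″ , (η″ , s″ , t″)) →
        T-injective t′ t″ (∼-trans (∼-sym (T-function t s′ ∼-refl))
          (T-function s s″ (∼-trans (∼-sym (∼-reflexive e)) (∼-reflexive e″)))) }
    where
    all : List Germ
    all = (β₁ , β₂) ∷ (β₂ , β₃) ∷ (β₁ , β₃) ∷ []

  unit : ∀ {β} → P β → ((β , β) ∷ []) ≃ []
  unit {β} p = ≃-intro ((β , β) ∷ []) (here refl ∷ []) [] ((p , p) ∷ []) []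
    λ { _ _ (_ , e , (η , s , t)) e′ → ∼-trans (T-injective t s ∼-refl) (∼-trans (∼-sym (∼-reflexive e)) (∼-reflexive e′)) }

-- The group of germs

module GermGroup (em : ExcludedMiddle 0ℓ) {L : Language} {𝕄 : PregeometryStructure L} (hom : HomogeneousPregeometry em 𝕄)
    (cfg : ConfigurationData em hom) where
  open ConfigurationData cfg
  open HomogeneousPregeometry hom
  open PregeometryStructure 𝕄 hiding (Independent)
  open Setoid setoid using () renaming (refl to ≈-refl; sym to ≈-sym)
  open Pregeometry em 𝕄
  open Automorphisms structure
  open Homogeneity em 𝕄 fqm galois
  open Lines em hom A
  open Correspond em hom
  open Germs em hom F A o
  open Configuration em hom cfg
  open GermWords em hom cfg

  tooMany : ∀ {G} ds {es} → Ind G ds → All (_∈cl es ++ G) ds → length es < length ds → ⊥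
  tooMany ds i s lt = ℕₚ.<⇒≱ lt (steinitz ds i s)

  -- The germ and `w` determine the value of `T β₃` at a generic `ζ`, and `ζ` with this value
  -- determines `b₃`. So `b₃` is algebraic over `ζ` and the rest, and for generic `ζ` exchange makes
  -- it algebraic over the rest alone.
  canonical : ∀ {β₁ β₂ w β₃} → ((β₁ , β₂) ∷ []) ≃ ((w , β₃) ∷ []) →
              Vec.head β₃ ∈cl Vec.head β₁ ∷ Vec.head β₂ ∷ Vec.head w ∷ F
  canonical {β₁@(b₁ ∷ _ ∷ _ ∷ [])} {β₂@(b₂ ∷ _ ∷ _ ∷ [])} {w@(m ∷ _ ∷ _ ∷ [])} {β₃@(b₃ ∷ _ ∷ _ ∷ [])} e =
    Classical.by-contradiction em λ b₃∉ → go b₃∉ (fresh-exists (b₃ ∷ b₁ ∷ b₂ ∷ m ∷ []))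
    where
    G : List Carrier
    G = b₁ ∷ b₂ ∷ m ∷ F
    F⊆ : ∀ {x} → All (_∈cl x ∷ G) F
    F⊆ = cl-selfʳ (_ ∷ b₁ ∷ b₂ ∷ m ∷ [])
    oW : Over (b₃ ∷ G) ((β₁ , β₂) ∷ [])
    oW = cl-there cl-here ∷ cl-there (cl-there cl-here) ∷ []
    oV : Over (b₃ ∷ G) ((w , β₃) ∷ [])
    oV = cl-there (cl-there (cl-there cl-here)) ∷ cl-here ∷ []
    go : ¬ b₃ ∈cl G → Σ[ ζ ∈ _ ] Q ζ × Fresh ζ (b₃ ∷ G) → ⊥
    go b₃∉ (ζ@(z ∷ _ ∷ []) , Qζ , fr) = clash (evW-total F⊆ (validˡ e) oW Qζ fr) (evW-total F⊆ (validʳ e) oV Qζ fr)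
      where
      C : Pred Carrier 0ℓ
      C = _∈cl z ∷ G
      cC : Closed C
      cC = clList-closed (z ∷ G)
      clash : Σ[ ζ′ ∈ _ ] EvW ((β₁ , β₂) ∷ []) ζ ζ′ × Q ζ′ × Fresh ζ′ (b₃ ∷ G) →
              Σ[ ζ′ ∈ _ ] EvW ((w , β₃) ∷ []) ζ ζ′ × Q ζ′ × Fresh ζ′ (b₃ ∷ G) → ⊥
      clash (ζ₁@(z₁ ∷ _ ∷ []) , e₁@(x@(_ ∷ _ ∷ []) , x≈@(ex ∷ _) , η@(_ ∷ _ ∷ []) , t , t′) , _)
            (ζ₂@(z₂ ∷ _ ∷ []) , e₂@(x′@(_ ∷ _ ∷ []) , x′≈@(ex′ ∷ _) , η′@(_ ∷ _ ∷ []) , s , s′) , _) =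
        agree (≃-elim e F⊆ oW oV Qζ fr e₁ e₂)
        where
        z₁∈ : C z₁
        z₁∈ = Facts.z∈ t′ cC F⊆ (cl-there cl-here)
          (Facts.y∈ t cC F⊆ (cl-there (cl-there cl-here)) (cl-resp ex cl-here))
        agree : ζ₁ ∼ ζ₂ → ⊥
        agree ((_ , z₂∈) ∷ _) = fr (cl-exchange b₃∈ b₃∉)
          where
          b₃∈ : C b₃
          b₃∈ = Facts.b∈ s cC F⊆
            (Facts.y∈ s′ cC F⊆ (cl-there (cl-there (cl-there cl-here)))
              (cl-trans (z₁∈ ∷ LAll.map (LAll.lookup F⊆) A⊆F) z₂∈))
            (cl-resp ex′ cl-here)

  -- For a generic ζ₂ with value η under T β₂, the points η and a generic
  -- point a on the line b₂, c₂ have a conjugate quadrangle through b₁.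
  -- Moving the plane over c₁, c₂ by τ preserves the germ, as ζ₁ and ζ₂ are
  -- fixed, and yields the pair (μ₁ , μ₂) independent from both b₂ and b₃;
  -- then β₂ is conjugate to β₃ over it.
  module Independent {b₁ p₁ q₁ b₂ p₂ q₂ b₃ p₃ q₃}
      (P₁ : P (b₁ ∷ p₁ ∷ q₁ ∷ [])) (P₂ : P (b₂ ∷ p₂ ∷ q₂ ∷ [])) (P₃ : P (b₃ ∷ p₃ ∷ q₃ ∷ []))
      (b₁∉ : ¬ b₁ ∈cl b₂ ∷ F) (b₃∉ : ¬ b₃ ∈cl b₁ ∷ b₂ ∷ F) where

    private
      β₁ β₂ β₃ : Vec Carrier 3
      β₁ = b₁ ∷ p₁ ∷ q₁ ∷ []
      β₂ = b₂ ∷ p₂ ∷ q₂ ∷ []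
      β₃ = b₃ ∷ p₃ ∷ q₃ ∷ []

      Goal : Set
      Goal = Σ[ w ∈ _ ] P w × ((w , β₃) ∷ []) ≃ ((β₁ , β₂) ∷ [])

      b₂∉ : ¬ b₂ ∈cl F
      b₂∉ = go P₂
        where
        go : P β₂ → ¬ b₂ ∈cl F
        go (_ ∷ _ ∷ [] , _ ∷ _ ∷ [] , t) = Facts.b∉F t

      module Step₁ {z₂ r₂ y s} (t₂ : T β₂ (z₂ ∷ r₂ ∷ []) (y ∷ s ∷ [])) (z₂∉ : ¬ z₂ ∈cl b₃ ∷ b₁ ∷ b₂ ∷ F)
          {a c₂ x} (quad₂ : Quad a b₂ c₂ x y z₂) (a∉ : ¬ a ∈cl z₂ ∷ b₃ ∷ b₁ ∷ b₂ ∷ F) where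

        ζ₂ η : Vec Carrier 2
        ζ₂ = z₂ ∷ r₂ ∷ []
        η = y ∷ s ∷ []

        I : Ind F (a ∷ z₂ ∷ b₃ ∷ b₁ ∷ b₂ ∷ [])
        I = a∉ , z₂∉ , b₃∉ , b₁∉ , b₂∉ , _

        I₃ : Ind F (a ∷ z₂ ∷ b₂ ∷ [])
        I₃ = a∉ ∘ cl-trans (cl-here ∷ cl-there (cl-there (cl-there cl-here)) ∷ cl-selfʳ (z₂ ∷ b₃ ∷ b₁ ∷ b₂ ∷ [])) ,
             z₂∉ ∘ cl-trans (cl-there (cl-there cl-here) ∷ cl-selfʳ (b₃ ∷ b₁ ∷ b₂ ∷ [])) , b₂∉ , _

        I₄ : Ind F (a ∷ z₂ ∷ b₁ ∷ b₂ ∷ [])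
        I₄ = a∉ ∘ cl-trans (cl-here ∷ cl-selfʳ (z₂ ∷ b₃ ∷ [])) , z₂∉ ∘ cl-there , b₁∉ , b₂∉ , _

        A⊆ : ∀ {G} → All (_∈cl G) F → All (_∈cl G) A
        A⊆ f = LAll.map (LAll.lookup f) A⊆F

        ηax : List Carrier
        ηax = y ∷ s ∷ a ∷ x ∷ []

        ηax⊆ : All (_∈cl y ∷ a ∷ F) (ηax ++ F)
        ηax⊆ = LAllₚ.++⁺ (cl-here ∷ Facts.s∈ t₂ (clList-closed _) f cl-here ∷ cl-there cl-here ∷
            second (clList-closed _) (A⊆ f) (Quad.axy quad₂) (cl-there cl-here) cl-here ∷ []) f
          where
          f : All (_∈cl y ∷ a ∷ F) F
          f = cl-selfʳ (y ∷ a ∷ [])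

        b₂∉ηax : ¬ b₂ ∈cl ηax ++ F
        b₂∉ηax p = tooMany (a ∷ z₂ ∷ b₂ ∷ []) {y ∷ a ∷ []} I₃
            (cl-there cl-here ∷ Facts.z∈ t₂ (clList-closed _) (cl-selfʳ (y ∷ a ∷ [])) p′ cl-here ∷ p′ ∷ []) ℕₚ.≤-refl
          where
          p′ : b₂ ∈cl y ∷ a ∷ F
          p′ = cl-trans ηax⊆ p

        b₁∉ηax : ¬ b₁ ∈cl ηax ++ F
        b₁∉ηax p = tooMany (a ∷ z₂ ∷ b₁ ∷ b₂ ∷ []) {a ∷ z₂ ∷ b₂ ∷ []} I₄
            (cl-here ∷ cl-there cl-here ∷
             cl-trans (Facts.y∈ t₂ (clList-closed _) f (cl-there (cl-there cl-here)) (cl-there cl-here) ∷ cl-here ∷ f) (cl-trans ηax⊆ p) ∷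
             cl-there (cl-there cl-here) ∷ []) ℕₚ.≤-refl
          where
          f : All (_∈cl a ∷ z₂ ∷ b₂ ∷ F) F
          f = cl-selfʳ (a ∷ z₂ ∷ b₂ ∷ [])

        module Step₂ {z₁ r₁ c₁} (t₁ : T β₁ (z₁ ∷ r₁ ∷ []) η) (quad₁ : Quad a b₁ c₁ x y z₁) where

          ζ₁ : Vec Carrier 2
          ζ₁ = z₁ ∷ r₁ ∷ []

          B : List Carrier
          B = c₁ ∷ c₂ ∷ z₁ ∷ r₁ ∷ z₂ ∷ r₂ ∷ []

          B⊆ : All (_∈cl c₁ ∷ c₂ ∷ z₂ ∷ F) (B ++ F)
          B⊆ = cl-here ∷ cl-there cl-here ∷ z₁∈ ∷ Facts.r∈ t₁ (clList-closed _) f z₁∈ ∷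
               cl-there (cl-there cl-here) ∷ Facts.r∈ t₂ (clList-closed _) f (cl-there (cl-there cl-here)) ∷ f
            where
            f : All (_∈cl c₁ ∷ c₂ ∷ z₂ ∷ F) F
            f = cl-selfʳ (c₁ ∷ c₂ ∷ z₂ ∷ [])
            -- `x` is on the line of `c₂` and `z₂`, and `z₁` on that of `c₁` and `x`. So `B` has
            -- dimension at most three over `F`, which leaves `b₁` free to move.
            z₁∈ : z₁ ∈cl c₁ ∷ c₂ ∷ z₂ ∷ F
            z₁∈ = third (clList-closed _) (A⊆ f) (Quad.cxz quad₁) cl-here
              (second (clList-closed _) (A⊆ f) (Quad.cxz quad₂) (cl-there cl-here) (cl-there (cl-there cl-here)))

          module Plane {C : Pred Carrier 0ℓ} (cC : Closed C) (f : All C F) (c₁∈ : C c₁) (c₂∈ : C c₂) where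
            A⊆C : All C A
            A⊆C = LAll.map (LAll.lookup f) A⊆F
            a-from-b₁ : C b₁ → C a
            a-from-b₁ p = first cC A⊆C (Quad.abc quad₁) p c₁∈
            a-from-b₂ : C b₂ → C a
            a-from-b₂ p = first cC A⊆C (Quad.abc quad₂) p c₂∈
            b₁-from-a : C a → C b₁
            b₁-from-a p = second cC A⊆C (Quad.abc quad₁) p c₁∈
            b₂-from-a : C a → C b₂
            b₂-from-a p = second cC A⊆C (Quad.abc quad₂) p c₂∈

          b₁∉B : ¬ b₁ ∈cl B ++ F
          b₁∉B p = tooMany (a ∷ z₂ ∷ b₁ ∷ b₂ ∷ []) {c₁ ∷ c₂ ∷ z₂ ∷ []} I₄
              (Pl.a-from-b₁ p′ ∷ cl-there (cl-there cl-here) ∷ p′ ∷ Pl.b₂-from-a (Pl.a-from-b₁ p′) ∷ []) ℕₚ.≤-refl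
            where
            p′ : b₁ ∈cl c₁ ∷ c₂ ∷ z₂ ∷ F
            p′ = cl-trans B⊆ p
            module Pl = Plane (clList-closed (c₁ ∷ c₂ ∷ z₂ ∷ F)) (cl-selfʳ (c₁ ∷ c₂ ∷ z₂ ∷ [])) cl-here (cl-there cl-here)

          module Step₃ (τ : Aut) (fixB : Fixes τ (B ++ F)) (m₁∉ : ¬ τ ∙ b₁ ∈cl a ∷ z₂ ∷ b₃ ∷ b₁ ∷ b₂ ∷ F) where

            fixF : Fixes τ F
            fixF = LAllₚ.++⁻ʳ B fixB

            m₁ m₂ : Carrier
            m₁ = τ ∙ b₁
            m₂ = τ ∙ b₂

            μ₁ μ₂ : Vec Carrier 3
            μ₁ = Vec.map (τ ∙_) β₁
            μ₂ = Vec.map (τ ∙_) β₂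

            J : Ind F (m₁ ∷ a ∷ z₂ ∷ b₃ ∷ b₁ ∷ b₂ ∷ [])
            J = m₁∉ , I

            module MovedPlane {C : Pred Carrier 0ℓ} (cC : Closed C) (f : All C F) (c₁∈ : C c₁) (c₂∈ : C c₂) (m₁∈ : C m₁) where
              m₂∈ : C m₂
              m₂∈ =
                aut-closed τ cC (closed-respects cC (≈-sym (LAll.head fixB)) c₁∈ ∷
                    closed-respects cC (≈-sym (LAll.head (LAll.tail fixB))) c₂∈ ∷ m₁∈ ∷
                    LAll.zipWith (λ (e , p) → closed-respects cC (≈-sym e) p) (fixF , f))
                  (Pl.b₂-from-a (Pl.a-from-b₁ (cl-there (cl-there cl-here))))
                where
                module Pl = Plane (clList-closed (c₁ ∷ c₂ ∷ b₁ ∷ F)) (cl-selfʳ (c₁ ∷ c₂ ∷ b₁ ∷ [])) cl-here (cl-there cl-here)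

            J₅ : Ind F (m₁ ∷ a ∷ z₂ ∷ b₁ ∷ b₂ ∷ [])
            J₅ = m₁∉ ∘ cl-trans (cl-here ∷ cl-there cl-here ∷ cl-selfʳ (a ∷ z₂ ∷ b₃ ∷ [])) , I₄

            J₅′ : Ind F (m₁ ∷ a ∷ b₃ ∷ b₁ ∷ b₂ ∷ [])
            J₅′ = m₁∉ ∘ cl-trans (cl-here ∷ cl-selfʳ (a ∷ z₂ ∷ [])) , a∉ ∘ cl-there , b₃∉ , b₁∉ , b₂∉ , _

            J₄ : Ind F (m₁ ∷ a ∷ b₁ ∷ b₂ ∷ [])
            J₄ = proj₁ J₅ ∘ cl-trans (cl-here ∷ cl-selfʳ (a ∷ z₂ ∷ [])) , proj₁ I₄ ∘ cl-there , b₁∉ , b₂∉ , _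

            -- `c₁`, `c₂` and `b₁` give `a` and `b₂`, and with `m₁` also `m₂`; if `z₂` were
            -- algebraic over these, four elements would span five independent ones.
            z₂-fresh : ¬ z₂ ∈cl m₁ ∷ m₂ ∷ b₁ ∷ b₂ ∷ F
            z₂-fresh p = tooMany (m₁ ∷ a ∷ z₂ ∷ b₁ ∷ b₂ ∷ []) {es} J₅
                (m₁∈ ∷ a∈ ∷ cl-trans (m₁∈ ∷ Mv.m₂∈ ∷ b₁∈ ∷ b₂∈ ∷ f) p ∷ b₁∈ ∷ b₂∈ ∷ []) ℕₚ.≤-refl
              where
              es : List Carrier
              es = c₁ ∷ c₂ ∷ b₁ ∷ m₁ ∷ []
              f : All (_∈cl es ++ F) F
              f = cl-selfʳ es
              m₁∈ : m₁ ∈cl es ++ F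
              m₁∈ = cl-there (cl-there (cl-there cl-here))
              b₁∈ : b₁ ∈cl es ++ F
              b₁∈ = cl-there (cl-there cl-here)
              module Pl = Plane (clList-closed (es ++ F)) f cl-here (cl-there cl-here)
              module Mv = MovedPlane (clList-closed (es ++ F)) f cl-here (cl-there cl-here) m₁∈
              a∈ : a ∈cl es ++ F
              a∈ = Pl.a-from-b₁ b₁∈
              b₂∈ : b₂ ∈cl es ++ F
              b₂∈ = Pl.b₂-from-a a∈

            μ⊆ : All (_∈cl c₁ ∷ c₂ ∷ m₁ ∷ F) (m₁ ∷ m₂ ∷ F)
            μ⊆ = cl-there (cl-there cl-here) ∷
              MovedPlane.m₂∈ (clList-closed _) (cl-selfʳ (c₁ ∷ c₂ ∷ m₁ ∷ [])) cl-here (cl-there cl-here) (cl-there (cl-there cl-here)) ∷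
              cl-selfʳ (c₁ ∷ c₂ ∷ m₁ ∷ [])

            b₂∉μ : ¬ b₂ ∈cl m₁ ∷ m₂ ∷ F
            b₂∉μ p = tooMany (m₁ ∷ a ∷ b₁ ∷ b₂ ∷ []) {c₁ ∷ c₂ ∷ m₁ ∷ []} J₄
                (cl-there (cl-there cl-here) ∷ Pl.a-from-b₂ p′ ∷ Pl.b₁-from-a (Pl.a-from-b₂ p′) ∷ p′ ∷ []) ℕₚ.≤-refl
              where
              p′ : b₂ ∈cl c₁ ∷ c₂ ∷ m₁ ∷ F
              p′ = cl-trans μ⊆ p
              module Pl = Plane (clList-closed (c₁ ∷ c₂ ∷ m₁ ∷ F)) (cl-selfʳ (c₁ ∷ c₂ ∷ m₁ ∷ [])) cl-here (cl-there cl-here)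

            b₃∉μ : ¬ b₃ ∈cl m₁ ∷ m₂ ∷ F
            b₃∉μ p = tooMany (m₁ ∷ a ∷ b₃ ∷ b₁ ∷ b₂ ∷ []) {es} J₅′
                (cl-here ∷ cl-there cl-here ∷
                 cl-trans (third (clList-closed _) (A⊆ f) (Quad.abc quad₁) (cl-there cl-here) (cl-there (cl-there cl-here)) ∷
                           third (clList-closed _) (A⊆ f) (Quad.abc quad₂) (cl-there cl-here) (cl-there (cl-there (cl-there cl-here))) ∷
                           cl-here ∷ f) (cl-trans μ⊆ p) ∷
                 cl-there (cl-there cl-here) ∷ cl-there (cl-there (cl-there cl-here)) ∷ []) ℕₚ.≤-refl
              where
              es : List Carrier
              es = m₁ ∷ a ∷ b₁ ∷ b₂ ∷ []
              f : All (_∈cl es ++ F) F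
              f = cl-selfʳ es

            ζ-fixed : _↦_ τ ζ₁ ζ₁ × _↦_ τ ζ₂ ζ₂
            ζ-fixed = go fixB
              where
              go : Fixes τ (B ++ F) → _↦_ τ ζ₁ ζ₁ × _↦_ τ ζ₂ ζ₂
              go (_ ∷ _ ∷ e₁ ∷ f₁ ∷ e₂ ∷ f₂ ∷ _) = (e₁ ∷ f₁ ∷ []) , (e₂ ∷ f₂ ∷ [])

            sameGerm : ((β₁ , β₂) ∷ []) ≃ ((μ₁ , μ₂) ∷ [])
            sameGerm = ((P₁ , P₂) ∷ []) , ((P↦ (image τ β₁) P₁ , P↦ (image τ β₂) P₂) ∷ []) , ζ₂ , ζ₁ , ζ₁ , (β₂ , η , t₂) ,
                z₂-fresh ∘ cl-trans (cl-there (cl-there cl-here) ∷ cl-there (cl-there (cl-there cl-here)) ∷ cl-here ∷ cl-there cl-here ∷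
                  cl-selfʳ (m₁ ∷ m₂ ∷ b₁ ∷ b₂ ∷ [])) ,
                (ζ₂ , Pointwise.refl ≈-refl , η , t₂ , t₁) ,
                (ζ₂ , Pointwise.refl ≈-refl , Vec.map (τ ∙_) η , T-fixes τ fixF (image τ β₂) (proj₂ ζ-fixed) (image τ η) t₂ ,
                  T-fixes τ fixF (image τ β₁) (proj₁ ζ-fixed) (image τ η) t₁) ,
                ∼-refl
              where open Moving τ fixF

            conclude : Σ[ σ ∈ Aut ] Fixes σ ((Vec.toList μ₁ ++ Vec.toList μ₂) ++ F) × _↦_ σ β₂ β₃ → Goal
            conclude (σ , fix , e) = Vec.map (σ ∙_) β₁ , Moving.P↦ σ σF (image σ β₁) P₁ ,
              ≃-trans (Moving.≃↦ σ σF ((image σ β₁ , e) Listᴾ.∷ Listᴾ.[])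
                  ((fixes⇒↦ σ (LAllₚ.++⁻ˡ (Vec.toList μ₁) σμ) , fixes⇒↦ σ (LAllₚ.++⁻ʳ (Vec.toList μ₁) σμ)) Listᴾ.∷ Listᴾ.[]) sameGerm)
                (≃-sym sameGerm)
              where
              σF : Fixes σ F
              σF = LAllₚ.++⁻ʳ (Vec.toList μ₁ ++ Vec.toList μ₂) fix
              σμ : Fixes σ (Vec.toList μ₁ ++ Vec.toList μ₂)
              σμ = LAllₚ.++⁻ˡ (Vec.toList μ₁ ++ Vec.toList μ₂) fix

            goal : Goal
            goal = conclude (conj-β P₂ P₃ (Vec.toList μ₁ ++ Vec.toList μ₂) (b₂∉μ ∘ cl-trans μμF⊆) (b₃∉μ ∘ cl-trans μμF⊆))
              where
              open Moving τ fixF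
              f : All (_∈cl m₁ ∷ m₂ ∷ F) F
              f = cl-selfʳ (m₁ ∷ m₂ ∷ [])
              μμF⊆ : All (_∈cl m₁ ∷ m₂ ∷ F) ((Vec.toList μ₁ ++ Vec.toList μ₂) ++ F)
              μμF⊆ = LAllₚ.++⁺ (LAllₚ.++⁺ (P⇒ (P↦ (image τ β₁) P₁) (clList-closed _) f cl-here)
                (P⇒ (P↦ (image τ β₂) P₂) (clList-closed _) f (cl-there cl-here))) f

          goal : Goal
          goal = go (moveGeneric b₁∉B (a ∷ z₂ ∷ b₃ ∷ b₁ ∷ b₂ ∷ F))
            where
            go : Σ[ τ ∈ Aut ] Fixes τ (B ++ F) × ¬ τ ∙ b₁ ∈cl a ∷ z₂ ∷ b₃ ∷ b₁ ∷ b₂ ∷ F → Goal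
            go (τ , fix , m∉) = Step₃.goal τ fix m∉

        goal : Goal
        -- The automorphism carries `β₂` to `β₁` and fixes `η`, `a` and `x`. So the conjugate
        -- quadrangle shares the line of `a`, `x`, `y`, and `x` lies on the lines of `c₁`, `z₁` and
        -- of `c₂`, `z₂`.
        goal = go (conj-β P₂ P₁ ηax b₂∉ηax b₁∉ηax)
          where
          go : Σ[ ρ ∈ Aut ] Fixes ρ (ηax ++ F) × _↦_ ρ β₂ β₁ → Goal
          go (ρ , ey ∷ es ∷ ea ∷ ex ∷ ρF , e@(eb ∷ _)) =
            Step₂.goal (T-fixes ρ ρF e (image ρ ζ₂) (ey ∷ es ∷ []) t₂) (quad-aut ρ (fixesA ρ ρF) ea eb ≈-refl ex ey ≈-refl quad₂)

    goal : Goal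
    goal = go (genericζ P₂ (b₃ ∷ b₁ ∷ []))
      where
      go : Σ[ ζ ∈ _ ] Σ[ η ∈ _ ] T β₂ ζ η × ¬ Vec.head ζ ∈cl b₂ ∷ b₃ ∷ b₁ ∷ F → Goal
      go (ζ₂@(z₂ ∷ r₂ ∷ []) , η@(y ∷ s ∷ []) , t₂ , z₂∉) = step (moveGeneric (a∉byz (Facts.quad₁ t₂)) (z₂ ∷ b₃ ∷ b₁ ∷ b₂ ∷ F))
        where
        step : Σ[ τ ∈ Aut ] Fixes τ (b₂ ∷ y ∷ z₂ ∷ A) × ¬ τ ∙ p₂ ∈cl z₂ ∷ b₃ ∷ b₁ ∷ b₂ ∷ F → Goal
        step (τ , eb ∷ ey ∷ ez ∷ τA , a∉) = Step₁.goal t₂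
          (z₂∉ ∘ cl-trans (cl-there cl-here ∷ cl-there (cl-there cl-here) ∷ cl-here ∷ cl-selfʳ (b₂ ∷ b₃ ∷ b₁ ∷ [])))
          (quad-aut τ τA ≈-refl eb ≈-refl ≈-refl ey ez (Facts.quad₁ t₂)) a∉

  generic-β : ∀ G → Σ[ β ∈ _ ] P β × ¬ Vec.head β ∈cl G ++ F
  generic-β G = go (genericβ {z₀ ∷ r₀ ∷ []} (_ , _ , proj₂ (proj₂ P₀)) G)
    where
    go : Σ[ β ∈ _ ] Σ[ η ∈ _ ] T β (z₀ ∷ r₀ ∷ []) η × ¬ Vec.head β ∈cl z₀ ∷ G ++ F → Σ[ β ∈ _ ] P β × ¬ Vec.head β ∈cl G ++ F
    go (β , η , t , b∉) = β , (_ , η , t) , b∉ ∘ cl-there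

  P⇒∉F : ∀ {β} → P β → ¬ Vec.head β ∈cl F
  P⇒∉F {_ ∷ _ ∷ _ ∷ []} (_ ∷ _ ∷ [] , _ ∷ _ ∷ [] , t) = Facts.b∉F t

  -- If `b₁` is algebraic over `b₂`, a generic `β₄` is interposed: the germ is the composite of
  -- (`β₁` , `β₄`) and (`β₄` , `β₂`). Once the latter is written as (`w` , `β₃`), the former can be
  -- written as (`u` , `w`).
  represent : ∀ {β₁ β₂ β₃} → P β₁ → P β₂ → P β₃ → ¬ Vec.head β₃ ∈cl Vec.head β₁ ∷ Vec.head β₂ ∷ F →
              Σ[ w ∈ _ ] P w × ((w , β₃) ∷ []) ≃ ((β₁ , β₂) ∷ [])
  represent {β₁@(b₁ ∷ _ ∷ _ ∷ [])} {β₂@(b₂ ∷ _ ∷ _ ∷ [])} {β₃@(b₃ ∷ _ ∷ _ ∷ [])} P₁ P₂ P₃ b₃∉ = cases em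
    where
    Goal : Set
    Goal = Σ[ w ∈ _ ] P w × ((w , β₃) ∷ []) ≃ ((β₁ , β₂) ∷ [])
    cases : Dec (b₁ ∈cl b₂ ∷ F) → Goal
    cases (no b₁∉)  = Independent.goal P₁ P₂ P₃ b₁∉ b₃∉
    cases (yes b₁∈) = first′ (generic-β (b₁ ∷ b₃ ∷ b₂ ∷ []))
      where
      first′ : Σ[ β ∈ _ ] P β × ¬ Vec.head β ∈cl b₁ ∷ b₃ ∷ b₂ ∷ F → Goal
      first′ (β₄@(b₄ ∷ _ ∷ _ ∷ []) , P₄ , b₄∉) = second′ (Independent.goal P₄ P₂ P₃
          (b₄∉ ∘ cl-there ∘ cl-there) b₃∉₄₂)
        where
        b₃∉₄₂ : ¬ b₃ ∈cl b₄ ∷ b₂ ∷ F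
        b₃∉₄₂ p = b₄∉ (cl-there (cl-exchange p (b₃∉ ∘ cl-there)))
        second′ : Σ[ w ∈ _ ] P w × ((w , β₃) ∷ []) ≃ ((β₄ , β₂) ∷ []) → Goal
        second′ (w@(m ∷ _ ∷ _ ∷ []) , Pw , e) = third′ (Independent.goal P₁ P₄ Pw
            (λ p → b₄∉ (cl-trans (cl-here ∷ cl-selfʳ (b₁ ∷ b₃ ∷ b₂ ∷ [])) (cl-exchange p (P⇒∉F P₁))))
            -- By `canonical`, `w` is independent enough for the second rewriting: otherwise `b₃`
            -- would be algebraic over `b₄` and `b₂`.
            (λ p → b₃∉₄₂ (cl-trans (cl-here ∷ cl-there cl-here ∷
               cl-trans (cl-trans (cl-there cl-here ∷ cl-selfʳ (b₄ ∷ b₂ ∷ [])) b₁∈ ∷ cl-here ∷ cl-selfʳ (b₄ ∷ b₂ ∷ [])) p ∷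
               cl-selfʳ (b₄ ∷ b₂ ∷ [])) (canonical (≃-sym e)))))
          where
          third′ : Σ[ u ∈ _ ] P u × ((u , w) ∷ []) ≃ ((β₁ , β₄) ∷ []) → Goal
          third′ (u , Pu , e′) = u , Pu ,
            ≃-trans (≃-sym (compose Pu Pw P₃)) (≃-trans (≃-++ e′ e) (compose P₁ P₄ P₂))

  inverse : Germ → Germ
  inverse = swap

  inverseˡ : ∀ {g} → Valid g → (inverse g ∷ g ∷ []) ≃ []
  inverseˡ (p , q) = ≃-trans (compose q p q) (unit q)

  inverseʳ : ∀ {g} → Valid g → (g ∷ inverse g ∷ []) ≃ []
  inverseʳ (p , q) = ≃-trans (compose p q p) (unit p)

  inverse-cong : ∀ {g h} → (g ∷ []) ≃ (h ∷ []) → (inverse g ∷ []) ≃ (inverse h ∷ [])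
  inverse-cong {g} {h} e = ≃-trans (≃-sym (≃-++ Vg⁻ (inverseʳ Vh)))
      (≃-trans (≃-++ Vg⁻ (≃-++ (≃-sym e) (≃-refl (swap Vh ∷ [])))) (≃-++ (inverseˡ Vg) (≃-refl (swap Vh ∷ []))))
    where
    Vg : Valid g
    Vg = LAll.head (validˡ e)
    Vh : Valid h
    Vh = LAll.head (validʳ e)
    Vg⁻ : (inverse g ∷ []) ≃ (inverse g ∷ [])
    Vg⁻ = ≃-refl (swap Vg ∷ [])

  abstract
    -- The first germ and the inverse of the second are written with one generic `β` in second
    -- place, and then the middle maps of the product cancel.
    multiply : ∀ {g h} → Valid g → Valid h → Σ[ k ∈ Germ ] (g ∷ h ∷ []) ≃ (k ∷ [])
    multiply {β₁@(b₁ ∷ _ ∷ _ ∷ []) , β₂@(b₂ ∷ _ ∷ _ ∷ [])} {β₃@(b₃ ∷ _ ∷ _ ∷ []) , β₄@(b₄ ∷ _ ∷ _ ∷ [])} (P₁ , P₂) (P₃ , P₄) =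
      go (generic-β (b₁ ∷ b₂ ∷ b₄ ∷ b₃ ∷ []))
      where
      Goal : Set
      Goal = Σ[ k ∈ Germ ] ((β₁ , β₂) ∷ (β₃ , β₄) ∷ []) ≃ (k ∷ [])
      go : Σ[ β ∈ _ ] P β × ¬ Vec.head β ∈cl b₁ ∷ b₂ ∷ b₄ ∷ b₃ ∷ F → Goal
      go (β , Pβ , b∉) = both
          (represent P₁ P₂ Pβ (b∉ ∘ cl-trans (cl-here ∷ cl-there cl-here ∷ cl-selfʳ (b₁ ∷ b₂ ∷ b₄ ∷ b₃ ∷ []))))
          (represent P₄ P₃ Pβ (b∉ ∘ cl-there ∘ cl-there))
        where
        both : Σ[ w ∈ _ ] P w × ((w , β) ∷ []) ≃ ((β₁ , β₂) ∷ []) → Σ[ v ∈ _ ] P v × ((v , β) ∷ []) ≃ ((β₄ , β₃) ∷ []) → Goal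
        both (w , Pw , e) (v , Pv , e′) = (w , v) , ≃-trans (≃-++ (≃-sym e) (≃-sym (inverse-cong e′))) (compose Pw Pβ Pv)

-- Imaginaries given by invariant equivalence relations

module CountableImaginaries (em : ExcludedMiddle 0ℓ) {L : Language} {M 𝕄 : PregeometryStructure L} {δ : Set}
    (hom : HomogeneousPregeometry em 𝕄)
    (J : Set) (countable : J ↣ ℕ) (arity : J → ℕ)
    (E : ∀ i → Vec (PregeometryStructure.Carrier 𝕄) (arity i) → Vec (PregeometryStructure.Carrier 𝕄) (arity i) → Set)
    (isEquivalence : ∀ i → IsEquivalence (E i))
    (≋⇒E : ∀ i {a b} → PregeometryStructure._≋_ 𝕄 a b → E i a b)
    (E-invariant : ∀ i σ {a b} → E i a b →
      E i (Vec.map (Isomorphism.to {M = PregeometryStructure.structure 𝕄} {N = PregeometryStructure.structure 𝕄} σ) a)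
          (Vec.map (Isomorphism.to σ) b)) where
  open HomogeneousPregeometry hom
  open PregeometryStructure 𝕄 hiding (Independent)
  open Setoid setoid using () renaming (refl to ≈-refl; sym to ≈-sym; trans to ≈-trans)
  open CountableModels em 𝕄 fqm
  open Automorphisms structure
  open Homogeneity em 𝕄 fqm galois

  private
    module Gen = Generated {λ _ → ⊤} (λ _ → tt) inf []
    module H = CountableModel (Gen.H-model [])
    module E i = IsEquivalence (isEquivalence i)

    Related : J → Set
    Related i = Σ[ a ∈ Vec Carrier (arity i) ] Σ[ b ∈ Vec Carrier (arity i) ] E i a b

    at : ∀ {n} → ℕ → Vec Carrier n
    at {n} k = Vec.map H.enum (decode n k)

    choose : ∀ i k₁ k₂ → Dec (E i (at k₁) (at k₂)) → Related i
    choose i k₁ k₂ (yes e) = at k₁ , at k₂ , e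
    -- Codes of unrelated pairs default to a reflexive pair, so that every type listed belongs to
    -- the relation.
    choose i k₁ k₂ (no _)  = at 0 , at 0 , E.refl i

    related : ∀ i → ℕ → Related i
    related i k = choose i (proj₁ (unpair k)) (proj₂ (unpair k)) em

    indices : ∀ {n} {a : Vec Carrier n} → VecAll.All (Gen.H []) a → Σ[ k ∈ ℕ ] a ≋ at k
    indices {n} all = let ks , e = go all in encode ks , subst (λ js → _ ≋ Vec.map H.enum js) (sym (decode-encode ks)) e
      where
      go : ∀ {n} {a : Vec Carrier n} → VecAll.All (Gen.H []) a → Σ[ ks ∈ Vec ℕ n ] a ≋ Vec.map H.enum ks
      go VecAll.[]       = [] , []
      go (p VecAll.∷ ps) with k , e ← H.index p | ks , es ← go ps = k ∷ ks , e ∷ es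

    intoH : ∀ {n} (a b : Vec Carrier n) → Σ[ σ ∈ Aut ]
      VecAll.All (Gen.H []) (Vec.map (σ ∙_) a) × VecAll.All (Gen.H []) (Vec.map (σ ∙_) b)
    intoH a b = conclude (moveInto H.closed H.inf identityᵃ [] [] (Vec.toList a ++ Vec.toList b))
      where
      all : ∀ {n} (σ : Aut) (a : Vec Carrier n) → All (λ x → Gen.H [] (σ ∙ x)) (Vec.toList a) → VecAll.All (Gen.H []) (Vec.map (σ ∙_) a)
      all σ []      []       = VecAll.[]
      all σ (x ∷ a) (p ∷ ps) = p VecAll.∷ all σ a ps
      conclude : Σ[ σ ∈ Aut ] Fixes σ [] × All (λ x → Gen.H [] (σ ∙ x)) (Vec.toList a ++ Vec.toList b) → _
      conclude (σ , _ , ps) = σ , all σ a (LAllₚ.++⁻ˡ (Vec.toList a) ps) , all σ b (LAllₚ.++⁻ʳ (Vec.toList a) ps)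

    abstract
      type : ∀ i → ℕ → Vec Carrier (arity i + arity i)
      type i k = let a , b , _ = related i k in a Vec.++ b

      type-onto : ∀ i a b → E i a b → Σ[ k ∈ ℕ ] Types.SameGaloisType (monsterAmbient M δ 𝕄) ∅ (a Vec.++ b) (type i k)
      type-onto i a b e = go (intoH a b)
        where
        go : Σ[ σ ∈ Aut ] VecAll.All (Gen.H []) (Vec.map (σ ∙_) a) × VecAll.All (Gen.H []) (Vec.map (σ ∙_) b) →
             Σ[ k ∈ ℕ ] Types.SameGaloisType (monsterAmbient M δ 𝕄) ∅ (a Vec.++ b) (type i k)
        go (σ , pa , pb) with k₁ , e₁ ← indices pa | k₂ , e₂ ← indices pb = pair (k₁ , k₂) , σ , (λ ()) ,
            subst (λ p → Vec.map (σ ∙_) (a Vec.++ b) ≋ proj₁ (choose i (proj₁ p) (proj₂ p) em) Vec.++ proj₁ (proj₂ (choose i (proj₁ p) (proj₂ p) em)))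
              (sym (unpair-pair (k₁ , k₂)))
              (subst (_≋ _) (sym (Vecₚ.map-++ (σ ∙_) a b)) (chosen em))
          where
          holds : E i (at k₁) (at k₂)
          holds = E.trans i (E.sym i (≋⇒E i e₁)) (E.trans i (E-invariant i σ e) (≋⇒E i e₂))
          chosen : (d : Dec (E i (at k₁) (at k₂))) → Vec.map (σ ∙_) a Vec.++ Vec.map (σ ∙_) b ≋ proj₁ (choose i k₁ k₂ d) Vec.++ proj₁ (proj₂ (choose i k₁ k₂ d))
          chosen (yes _) = Pointwise.++⁺ e₁ e₂
          chosen (no ¬e) = ⊥-elim (¬e holds)

      type-sound : ∀ i a b → Σ[ k ∈ ℕ ] Types.SameGaloisType (monsterAmbient M δ 𝕄) ∅ (a Vec.++ b) (type i k) → E i a b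
      type-sound i a b (k , σ , _ , q) = go (related i k) q
        where
        cancel : ∀ {n} (a : Vec Carrier n) → Vec.map (inverseᵃ σ ∙_) (Vec.map (σ ∙_) a) ≋ a
        cancel []      = []
        cancel (x ∷ a) = ∙-inverseˡ σ ∷ cancel a
        go : (r : Related i) → Vec.map (σ ∙_) (a Vec.++ b) ≋ proj₁ r Vec.++ proj₁ (proj₂ r) → E i a b
        go (c , d , e) q with qa , qb ← Pointwise.++⁻ (Vec.map (σ ∙_) a) c (subst (_≋ c Vec.++ d) (Vecₚ.map-++ (σ ∙_) a b) q) =
          E.trans i (E.sym i (≋⇒E i (cancel a))) (E.trans i (E-invariant i (inverseᵃ σ)
            (E.trans i (≋⇒E i qa) (E.trans i e (E.sym i (≋⇒E i qb))))) (≋⇒E i (cancel b)))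

  -- An invariant relation is a union of Galois types over the empty set. Every pair of tuples has a
  -- conjugate in one fixed countable model, so the related pairs in that model list these types.
  imaginaries : Imaginaries (monsterAmbient M δ 𝕄)
  imaginaries = record
    { J             = J
    ; countable     = countable
    ; arityᴶ        = arity
    ; Eᴶ            = E
    ; isEquivalence = isEquivalence
    ; galoisTypes   = type
    ; given         = λ i a b → mk⇔ (type-onto i a b) (type-sound i a b)
    }

noImaginaries : ∀ {X} → Imaginaries X
noImaginaries = record
  { J             = ⊥
  ; countable     = ⊥↣ℕ
  ; arityᴶ        = λ ()
  ; Eᴶ            = λ ()
  ; isEquivalence = λ ()
  ; galoisTypes   = λ ()
  ; given         = λ ()
  }

-- The germs (β₁ , β₂) for given o and F, as classes of an invariant
-- relation on the tuples β₁ β₂ o F.  Without knowing that o and F come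
-- from a configuration, equality of germs need not be symmetric and
-- transitive; if it is not, it is replaced by equality of tuples.
module GermImaginaries (em : ExcludedMiddle 0ℓ) {L : Language} {M 𝕄 : PregeometryStructure L} {δ : Set}
    (hom : HomogeneousPregeometry em 𝕄) where
  open PregeometryStructure 𝕄 hiding (Independent)
  open Setoid setoid using () renaming (refl to ≈-refl; sym to ≈-sym; trans to ≈-trans)
  open Automorphisms structure

  -- 13 counts the two triples of a germ and the seven points of `o`; `n` is the length of `F`.
  arity : ℕ × ℕ → ℕ
  arity (n , l) = 13 + n

  germ : ∀ {n} → Vec Carrier (13 + n) → Vec Carrier 3 × Vec Carrier 3
  germ (b₁ ∷ p₁ ∷ q₁ ∷ b₂ ∷ p₂ ∷ q₂ ∷ _) = b₁ ∷ p₁ ∷ q₁ ∷ [] , b₂ ∷ p₂ ∷ q₂ ∷ []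

  parameters : ∀ {n} → Vec Carrier (13 + n) → Vec Carrier (7 + n)
  parameters (_ ∷ _ ∷ _ ∷ _ ∷ _ ∷ _ ∷ v) = v

  abstract
    -- The set A consists of the first l elements of F.
    SameGerm : ∀ {n} → ℕ → Vec Carrier (7 + n) → (g h : Vec Carrier 3 × Vec Carrier 3) → Set
    SameGerm l (b ∷ p ∷ q ∷ z ∷ r ∷ y ∷ s ∷ F) g h =
      Germs._≃_ em hom (Vec.toList F) (List.take l (Vec.toList F)) (b ∷ p ∷ q ∷ z ∷ r ∷ y ∷ s ∷ []) (g ∷ []) (h ∷ [])

    sameGerm⇔ : ∀ {n l b p q z r y s} {F : Vec Carrier n} {g h} → SameGerm l (b ∷ p ∷ q ∷ z ∷ r ∷ y ∷ s ∷ F) g h ⇔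
      Germs._≃_ em hom (Vec.toList F) (List.take l (Vec.toList F)) (b ∷ p ∷ q ∷ z ∷ r ∷ y ∷ s ∷ []) (g ∷ []) (h ∷ [])
    sameGerm⇔ = mk⇔ id id

  private
    module _ (σ : Automorphism structure) where
      open Correspond em hom σ

      Sends : Vec Carrier 3 × Vec Carrier 3 → Vec Carrier 3 × Vec Carrier 3 → Set
      Sends (β₁ , β₂) (β₁′ , β₂′) = β₁ ↦ β₁′ × β₂ ↦ β₂′

      ↦*-toList : ∀ {n} {a b : Vec Carrier n} → a ↦ b → Vec.toList a ↦* Vec.toList b
      ↦*-toList {a = []}    {[]}    []       = Listᴾ.[]
      ↦*-toList {a = _ ∷ _} {_ ∷ _} (e ∷ es) = e Listᴾ.∷ ↦*-toList es

      ↦*-take : ∀ l {F F′} → F ↦* F′ → List.take l F ↦* List.take l F′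
      ↦*-take zero    es              = Listᴾ.[]
      ↦*-take (suc l) Listᴾ.[]        = Listᴾ.[]
      ↦*-take (suc l) (e Listᴾ.∷ es)  = e Listᴾ.∷ ↦*-take l es

      abstract
        sameGerm↦ : ∀ {n} l {v v′ : Vec Carrier (7 + n)} {g g′ h h′} → v ↦ v′ → Sends g g′ → Sends h h′ → SameGerm l v g h → SameGerm l v′ g′ h′
        sameGerm↦ l {_ ∷ _ ∷ _ ∷ _ ∷ _ ∷ _ ∷ _ ∷ F} {_ ∷ _ ∷ _ ∷ _ ∷ _ ∷ _ ∷ _ ∷ F′} (e₁ ∷ e₂ ∷ e₃ ∷ e₄ ∷ e₅ ∷ e₆ ∷ e₇ ∷ es) eg eh =
          Transport.≃↦ em hom σ F↦ (↦*-take l F↦)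
            (λ e f g → TransportOrbit.T-moves em hom σ F↦ (e₁ ∷ e₂ ∷ e₃ ∷ e₄ ∷ e₅ ∷ e₆ ∷ e₇ ∷ []) e f g)
            (eg Listᴾ.∷ Listᴾ.[]) (eh Listᴾ.∷ Listᴾ.[])
          where
          F↦ : Vec.toList F ↦* Vec.toList F′
          F↦ = ↦*-toList es

  PER : ∀ {n} → ℕ → Vec Carrier (7 + n) → Set
  PER l v = (∀ {g h} → SameGerm l v g h → SameGerm l v h g) × (∀ {g h k} → SameGerm l v g h → SameGerm l v h k → SameGerm l v g k)

  private
    map-id≋ : ∀ {n} {a b : Vec Carrier n} → a ≋ b → Correspond._↦_ em hom identityᵃ a b
    map-id≋ []       = []
    map-id≋ (e ∷ es) = e ∷ map-id≋ es

    inverse-↦ : ∀ σ {n} {a b : Vec Carrier n} → Correspond._↦_ em hom σ a b → Correspond._↦_ em hom (inverseᵃ σ) b a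
    inverse-↦ σ {a = []}    {[]}    []       = []
    inverse-↦ σ {a = _ ∷ _} {_ ∷ _} (e ∷ es) = ∙-inverse σ e ∷ inverse-↦ σ es

    PER↦ : ∀ σ {n} l {v v′ : Vec Carrier (7 + n)} → Correspond._↦_ em hom σ v v′ → PER l v → PER l v′
    PER↦ σ l e (symm , tran) = (λ r → forth (symm (back r))) , λ r s → forth (tran (back r) (back s))
      where
      pull : Vec Carrier 3 × Vec Carrier 3 → Vec Carrier 3 × Vec Carrier 3
      pull (β₁ , β₂) = Vec.map (inverseᵃ σ ∙_) β₁ , Vec.map (inverseᵃ σ ∙_) β₂
      ≋-refl : ∀ {n} {a : Vec Carrier n} → a ≋ a
      ≋-refl = Pointwise.refl ≈-refl
      push : ∀ {n} {a : Vec Carrier n} → Correspond._↦_ em hom σ (Vec.map (inverseᵃ σ ∙_) a) a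
      push {a = []}    = []
      push {a = _ ∷ _} = ∙-inverseʳ σ ∷ push
      back : ∀ {g h} → SameGerm l _ g h → SameGerm l _ (pull g) (pull h)
      back = sameGerm↦ (inverseᵃ σ) l (inverse-↦ σ e) (≋-refl , ≋-refl) (≋-refl , ≋-refl)
      forth : ∀ {g h} → SameGerm l _ (pull g) (pull h) → SameGerm l _ g h
      forth = sameGerm↦ σ l e (push , push) (push , push)

  _≋ᵍ_ : Vec Carrier 3 × Vec Carrier 3 → Vec Carrier 3 × Vec Carrier 3 → Set
  (β₁ , β₂) ≋ᵍ (β₁′ , β₂′) = β₁ ≋ β₁′ × β₂ ≋ β₂′

  sameGerm-resp : ∀ {n} l {v v′ : Vec Carrier (7 + n)} {g g′ h h′} → v ≋ v′ → g ≋ᵍ g′ → h ≋ᵍ h′ → SameGerm l v g h → SameGerm l v′ g′ h′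
  sameGerm-resp l e (f , f′) (g , g′) = sameGerm↦ identityᵃ l (map-id≋ e) (map-id≋ f , map-id≋ f′) (map-id≋ g , map-id≋ g′)

  E : ∀ i → Vec Carrier (arity i) → Vec Carrier (arity i) → Set
  E (n , l) v w = parameters v ≋ parameters w × (germ v ≋ᵍ germ w ⊎ PER l (parameters v) × SameGerm l (parameters v) (germ v) (germ w))

  private
    ≋-refl : ∀ {n} {a : Vec Carrier n} → a ≋ a
    ≋-refl = Pointwise.refl ≈-refl

    ≋-sym : ∀ {n} {a b : Vec Carrier n} → a ≋ b → b ≋ a
    ≋-sym = Pointwise.sym ≈-sym

    ≋-trans : ∀ {n} {a b c : Vec Carrier n} → a ≋ b → b ≋ c → a ≋ c
    ≋-trans = Pointwise.trans ≈-trans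

    ≋ᵍ-refl : ∀ {g} → g ≋ᵍ g
    ≋ᵍ-refl = ≋-refl , ≋-refl

    ≋ᵍ-sym : ∀ {g h} → g ≋ᵍ h → h ≋ᵍ g
    ≋ᵍ-sym (e , f) = ≋-sym e , ≋-sym f

    E-sym : ∀ i {v w} → E i v w → E i w v
    E-sym _       (p , inj₁ e)         = ≋-sym p , inj₁ (≋ᵍ-sym e)
    E-sym (n , l) (p , inj₂ (per , r)) = ≋-sym p ,
      inj₂ (PER↦ identityᵃ l (map-id≋ p) per , sameGerm-resp l p ≋ᵍ-refl ≋ᵍ-refl (proj₁ per r))

    E-trans : ∀ i {u v w} → E i u v → E i v w → E i u w
    E-trans _       (p , inj₁ (e , f))   (q , inj₁ (e′ , f′))  = ≋-trans p q , inj₁ (≋-trans e e′ , ≋-trans f f′)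
    E-trans (n , l) (p , inj₁ e)         (q , inj₂ (per , r))  = ≋-trans p q ,
      inj₂ (PER↦ identityᵃ l (map-id≋ (≋-sym p)) per , sameGerm-resp l (≋-sym p) (≋ᵍ-sym e) ≋ᵍ-refl r)
    E-trans (n , l) (p , inj₂ (per , r)) (q , inj₁ e)          = ≋-trans p q , inj₂ (per , sameGerm-resp l ≋-refl ≋ᵍ-refl e r)
    E-trans (n , l) (p , inj₂ (per , r)) (q , inj₂ (_ , r′))   = ≋-trans p q ,
      inj₂ (per , proj₂ per r (sameGerm-resp l (≋-sym p) ≋ᵍ-refl ≋ᵍ-refl r′))

    abstract
      E-isEquivalence : ∀ i → IsEquivalence (E i)
      E-isEquivalence i = record { refl = ≋-refl , inj₁ ≋ᵍ-refl ; sym = E-sym i ; trans = E-trans i }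

      ≋⇒E : ∀ i {v w} → v ≋ w → E i v w
      ≋⇒E i (e₁ ∷ e₂ ∷ e₃ ∷ e₄ ∷ e₅ ∷ e₆ ∷ es) = es , inj₁ (e₁ ∷ e₂ ∷ e₃ ∷ [] , e₄ ∷ e₅ ∷ e₆ ∷ [])

      E-invariant : ∀ i σ {v w} → E i v w → E i (Vec.map (σ ∙_) v) (Vec.map (σ ∙_) w)
      E-invariant (n , l) σ {_ ∷ _ ∷ _ ∷ _ ∷ _ ∷ _ ∷ _} {_ ∷ _ ∷ _ ∷ _ ∷ _ ∷ _ ∷ _} (p , inj₁ (e , f)) =
        Pointwise.map⁺ (∙-cong σ) p , inj₁ (Pointwise.map⁺ (∙-cong σ) e , Pointwise.map⁺ (∙-cong σ) f)
      E-invariant (n , l) σ {_ ∷ _ ∷ _ ∷ _ ∷ _ ∷ _ ∷ _} {_ ∷ _ ∷ _ ∷ _ ∷ _ ∷ _ ∷ _} (p , inj₂ (per , r)) =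
        Pointwise.map⁺ (∙-cong σ) p , inj₂ (PER↦ σ l ≋-refl per , sameGerm↦ σ l ≋-refl (≋-refl , ≋-refl) (≋-refl , ≋-refl) r)

  germImaginaries : Imaginaries (monsterAmbient M δ 𝕄)
  germImaginaries = CountableImaginaries.imaginaries em hom (ℕ × ℕ)
    (record { to = pair ; cong = cong pair ; injective = pair-injective }) arity E E-isEquivalence ≋⇒E E-invariant

-- From the quadrangle to the configuration

-- As an initial segment, `A` is recovered from `F` by its length, so the tuples naming germs carry
-- no separate copy of it.
record SegmentConfiguration (em : ExcludedMiddle 0ℓ) {L : Language} {𝕄 : PregeometryStructure L}
    (hom : HomogeneousPregeometry em 𝕄) : Set where
  field
    configurationData : ConfigurationData em hom
  open ConfigurationData configurationData using (F; A)
  field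
    l      : ℕ
    A≡take : A ≡ List.take l F

module QuadrangleConfiguration (em : ExcludedMiddle 0ℓ) {L : Language} {𝕄 : PregeometryStructure L}
    (hom : HomogeneousPregeometry em 𝕄)
    {X : Ambient} (emb : PregeometryStructure.Carrier 𝕄 → Ambient.Carrier X)
    (rank3⇒independent : ∀ A a b c → Types.URank X (emb a ∷ emb b ∷ emb c ∷ []) (List.map emb A) 3 →
      Pregeometry.Ind em 𝕄 A (a ∷ b ∷ c ∷ []))
    (rank2⇒dependent : ∀ A a b c → Types.URank≤ X (emb a ∷ emb b ∷ emb c ∷ []) (List.map emb A) 2 →
      ¬ Pregeometry.Ind em 𝕄 A (a ∷ b ∷ c ∷ [])) where
  open HomogeneousPregeometry hom
  open PregeometryStructure 𝕄 hiding (Independent)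
  open Setoid setoid using () renaming (refl to ≈-refl)
  open Pregeometry em 𝕄
  open Automorphisms structure
  open Homogeneity em 𝕄 fqm galois
  open Isolation em 𝕄 fqm galois
  open Groups X using (IsStrictBoundedPartialQuadrangle)

  private
    collinear? : ∀ i j k → Dec (Collinear i j k)
    collinear? i j k = LAny.any? (λ ℓ → (i ∈? ℓ) ×-dec ((j ∈? ℓ) ×-dec (k ∈? ℓ))) lines
      where open DecMembership Finₚ._≟_ using (_∈?_)

  module _ (A : List Carrier) (a b c x y z : Carrier)
      (quadrangle : IsStrictBoundedPartialQuadrangle (List.map emb A) (Vec.map emb (a ∷ b ∷ c ∷ x ∷ y ∷ z ∷ []))) where
    open IsStrictBoundedPartialQuadrangle quadrangle
    open Lines em hom A

    private
      -- The side conditions are decidable on numerals, so their proofs are found by evaluation.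
      triple-ind : ∀ i j k {i≢j : False (i Finₚ.≟ j)} {j≢k : False (j Finₚ.≟ k)} {i≢k : False (i Finₚ.≟ k)}
                   {¬col : False (collinear? i j k)} → let pt = Vec.lookup (a ∷ b ∷ c ∷ x ∷ y ∷ z ∷ []) in
                   Ind A (pt i ∷ pt j ∷ pt k ∷ [])
      triple-ind i j k {i≢j} {j≢k} {i≢k} {¬col} = rank3⇒independent A _ _ _
        (subst₂ (λ u v → Types.URank X (u ∷ v) (List.map emb A) 3) (Vecₚ.lookup-map i emb pts)
          (cong₂ (λ u v → u ∷ v ∷ []) (Vecₚ.lookup-map j emb pts) (Vecₚ.lookup-map k emb pts))
          (nonCollinear i j k (toWitnessFalse i≢j) (toWitnessFalse j≢k) (toWitnessFalse i≢k) (toWitnessFalse ¬col)))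
        where
        pts : Vec Carrier 6
        pts = a ∷ b ∷ c ∷ x ∷ y ∷ z ∷ []

      lineˡ : ∀ {p q r} → Ind A (p ∷ q ∷ r ∷ []) → ¬ p ∈cl q ∷ A
      lineˡ (i , _) = i ∘ cl-trans (cl-here ∷ cl-selfʳ (_ ∷ _ ∷ []))

      lineʳ : ∀ {p q r} → Ind A (p ∷ q ∷ r ∷ []) → Ind A (q ∷ r ∷ [])
      lineʳ = proj₂

    quad : Quad a b c x y z
    quad = fromLines onLine
      where
      fromLines : All (λ ℓ → Types.URank X (Vec.map (Vec.lookup (Vec.map emb (a ∷ b ∷ c ∷ x ∷ y ∷ z ∷ []))) ℓ) (List.map emb A) 2) lines →
                  Quad a b c x y z
      fromLines (l₁ ∷ l₂ ∷ l₃ ∷ l₄ ∷ []) = record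
        { abc = collin (rank2⇒dependent A a b c (proj₂ l₁)) (lineʳ (triple-ind 3F 1F 2F)) (lineˡ (triple-ind 0F 2F 3F)) (lineˡ (triple-ind 0F 1F 3F))
        ; axy = collin (rank2⇒dependent A a x y (proj₂ l₂)) (lineʳ (triple-ind 1F 3F 4F)) (lineˡ (triple-ind 0F 4F 1F)) (lineˡ (triple-ind 0F 3F 1F))
        ; byz = collin (rank2⇒dependent A b y z (proj₂ l₃)) (lineʳ (triple-ind 0F 4F 5F)) (lineˡ (triple-ind 1F 5F 0F)) (lineˡ (triple-ind 1F 4F 0F))
        ; cxz = collin (rank2⇒dependent A c x z (proj₂ l₄)) (lineʳ (triple-ind 0F 3F 5F)) (lineˡ (triple-ind 2F 5F 0F)) (lineˡ (triple-ind 2F 3F 0F))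
        ; bay = triple-ind 1F 0F 4F
        ; acx = triple-ind 0F 2F 3F
        ; bcz = triple-ind 1F 2F 5F
        ; cax = triple-ind 2F 0F 3F
        }

    -- Naming generic u and v turns the points x, y, z into tuples which are interdefinable.
    configuration : SegmentConfiguration em hom
    configuration = first′ (moveGeneric (c∉byz quad) G₁)
      where
      G₁ : List Carrier
      G₁ = a ∷ b ∷ c ∷ x ∷ y ∷ z ∷ A
      first′ : Σ[ τ ∈ Aut ] Fixes τ (b ∷ y ∷ z ∷ A) × ¬ τ ∙ c ∈cl G₁ → SegmentConfiguration em hom
      first′ (τ , eb ∷ ey ∷ ez ∷ τA , u∉) = second′ (moveGeneric (a∉byz quad) (u ∷ p₀ ∷ r₀ ∷ G₁))
        where
        u p₀ r₀ : Carrier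
        u = τ ∙ c
        p₀ = τ ∙ a
        r₀ = τ ∙ x
        quad-u : Quad p₀ b u r₀ y z
        quad-u = quad-aut τ τA ≈-refl eb ≈-refl ≈-refl ey ez quad
        second′ : Σ[ κ ∈ Aut ] Fixes κ (b ∷ y ∷ z ∷ A) × ¬ κ ∙ a ∈cl u ∷ p₀ ∷ r₀ ∷ G₁ → SegmentConfiguration em hom
        second′ (κ , fb ∷ fy ∷ fz ∷ κA , v∉) = third′ (isolating bz-ind E⊆)
          where
          v q₀ s₀ : Carrier
          v = κ ∙ a
          q₀ = κ ∙ c
          s₀ = κ ∙ x
          quad-v : Quad v b q₀ s₀ y z
          quad-v = quad-aut κ κA ≈-refl fb ≈-refl ≈-refl fy fz quad
          B₀ : List Carrier
          B₀ = v ∷ u ∷ A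
          D : List Carrier
          D = b ∷ z ∷ []
          -- `u` was chosen outside the closure of the six points, and `v` outside that of these and
          -- `u`; so naming them keeps `b` and `z` independent.
          bz-ind : Ind B₀ D
          bz-ind = ind-extend D (ind-extend D (lineʳ (triple-ind 0F 1F 5F))
              (u∉ ∘ cl-trans (cl-there cl-here ∷ cl-there (cl-there (cl-there (cl-there (cl-there cl-here)))) ∷ cl-selfʳ (a ∷ b ∷ c ∷ x ∷ y ∷ z ∷ []))))
            (v∉ ∘ cl-trans (cl-++ʳ (u ∷ p₀ ∷ r₀ ∷ a ∷ []) cl-here ∷ cl-++ʳ (u ∷ p₀ ∷ r₀ ∷ a ∷ b ∷ c ∷ x ∷ y ∷ []) cl-here ∷ cl-here ∷
              cl-selfʳ (u ∷ p₀ ∷ r₀ ∷ a ∷ b ∷ c ∷ x ∷ y ∷ z ∷ [])))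
          E : List Carrier
          E = p₀ ∷ q₀ ∷ r₀ ∷ y ∷ s₀ ∷ []
          E⊆ : All (_∈cl D ++ B₀) E
          E⊆ = first cC A⊆ (Quad.abc quad-u) b∈ u∈ ∷ third cC A⊆ (Quad.abc quad-v) v∈ b∈ ∷
               second cC A⊆ (Quad.cxz quad-u) u∈ z∈ ∷ y∈ ∷ second cC A⊆ (Quad.axy quad-v) v∈ y∈ ∷ []
            where
            cC : Closed (_∈cl D ++ B₀)
            cC = clList-closed (D ++ B₀)
            A⊆ : All (_∈cl D ++ B₀) A
            A⊆ = cl-selfʳ (b ∷ z ∷ v ∷ u ∷ [])
            b∈ : b ∈cl D ++ B₀
            b∈ = cl-here
            z∈ : z ∈cl D ++ B₀
            z∈ = cl-there cl-here
            v∈ : v ∈cl D ++ B₀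
            v∈ = cl-there (cl-there cl-here)
            u∈ : u ∈cl D ++ B₀
            u∈ = cl-there (cl-there (cl-there cl-here))
            y∈ : y ∈cl D ++ B₀
            y∈ = second cC A⊆ (Quad.byz quad) b∈ z∈
          third′ : Σ[ F ∈ List Carrier ] Ind (F ++ B₀) D × Isolates (F ++ B₀) D E → SegmentConfiguration em hom
          third′ (F₁ , i , isol) = record
            { configurationData = record
                { F        = F
                ; A        = A
                ; A⊆F      = LAll.tabulate ∈-++⁺ˡ
                ; u∈F      = ∈-++⁺ʳ A (∈-++⁺ʳ F₁ (there (here refl)))
                ; v∈F      = ∈-++⁺ʳ A (∈-++⁺ʳ F₁ (here refl))
                ; quad-u   = quad-u
                ; quad-v   = quad-v
                ; bz-ind   = ind-base (LAllₚ.++⁺ (LAll.map (cl-++ʳ F₁ ∘ cl-there ∘ cl-there) (cl-self A)) (cl-self (F₁ ++ B₀))) i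
                ; isolates = isolates-mono (LAll.tabulateₛ setoid (LAnyₚ.++⁺ʳ A)) isol
                }
            ; l      = length A
            ; A≡take = sym (take-++ A (F₁ ++ B₀))
            }
            where
            F : List Carrier
            F = A ++ F₁ ++ B₀
            take-++ : (xs ys : List Carrier) → List.take (length xs) (xs ++ ys) ≡ xs
            take-++ []       ys = refl
            take-++ (x ∷ xs) ys = cong (x ∷_) (take-++ xs ys)

-- The group of germs inside the imaginaries

module _ {X : Ambient} (ℰ : Imaginaries X) (ℰ′ : Imaginaries (Imaginaries.eq ℰ)) where
  open Types
  open Groups

  GroupOfRankOne : Set₁
  GroupOfRankOne = Σ[ A ∈ List (Ambient.Carrier X) ] Σ[ 𝔾 ∈ GroupIn (Imaginaries.eq ℰ′) ]
    (let B = List.map (Imaginaries.ι ℰ′ ∘ Imaginaries.ι ℰ) A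
         G = GroupIn.G 𝔾
     in
     IsDefinableGroup (Imaginaries.eq ℰ′) 𝔾 B ×
     (Σ[ g ∈ Ambient.Carrier (Imaginaries.eq ℰ′) ] Generic (Imaginaries.eq ℰ′) g G B) ×
     (∀ g → Generic (Imaginaries.eq ℰ′) g G B → URank (Imaginaries.eq ℰ′) (g ∷ []) B 1))

-- Names of germs among the imaginaries

module GermNaming (em : ExcludedMiddle 0ℓ) {L : Language} {M 𝕄 : PregeometryStructure L} {δ : Set}
    (hom : HomogeneousPregeometry em 𝕄) (cfg : ConfigurationData em hom) where
  open HomogeneousPregeometry hom
  open ConfigurationData cfg hiding (u; v)
  open PregeometryStructure 𝕄 hiding (Independent)
  open Setoid setoid using () renaming (refl to ≈-refl)
  open Automorphisms structure
  open Correspond em hom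
  open Germs em hom F A o
  open GermWords em hom cfg

  base′ : List Carrier
  base′ = Vec.toList o ++ F

  mapᵍ : Automorphism structure → Germ → Germ
  mapᵍ σ (β₁ , β₂) = Vec.map (σ ∙_) β₁ , Vec.map (σ ∙_) β₂

  record GermNames (ℰ : Imaginaries (monsterAmbient M δ 𝕄)) : Set₁ where
    open Imaginaries ℰ using (J; arityᴶ; Eᴶ)
    field
      index          : J
      name           : Germ → Vec Carrier (arityᴶ index)
      name-cong      : ∀ {g h} → (g ∷ []) ≃ (h ∷ []) → Eᴶ index (name g) (name h)
      name-injective : ∀ {g h} → Valid g → Eᴶ index (name g) (name h) → (g ∷ []) ≃ (h ∷ [])
      name-resp      : ∀ {β₁ β₂ β₁′ β₂′} → β₁ ≋ β₁′ → β₂ ≋ β₂′ → Eᴶ index (name (β₁ , β₂)) (name (β₁′ , β₂′))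
      name-act       : ∀ σ → Fixes σ base′ → ∀ g → Eᴶ index (Vec.map (σ ∙_) (name g)) (name (mapᵍ σ g))
      name-all       : ∀ {C : Pred Carrier 0ℓ} {β₁ β₂} → All C (Vec.toList β₁) → All C (Vec.toList β₂) → All C base′ →
                       All C (Vec.toList (name (β₁ , β₂)))

  module _ (l : ℕ) (A≡take : A ≡ List.take l F) where
    open GermImaginaries em {M = M} {𝕄} {δ} hom

    private
      n : ℕ
      n = length F

      F≡ : Vec.toList (Vec.fromList F) ≡ F
      F≡ = Vecₚ.toList∘fromList F

      A≡ : List.take l (Vec.toList (Vec.fromList F)) ≡ A
      A≡ = trans (cong (List.take l) F≡) (sym A≡take)

      par : Vec Carrier (7 + n)
      par = o Vec.++ Vec.fromList F

      cls : Germ → Vec Carrier (13 + n)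
      cls (b₁ ∷ p₁ ∷ q₁ ∷ [] , b₂ ∷ p₂ ∷ q₂ ∷ []) = b₁ ∷ p₁ ∷ q₁ ∷ b₂ ∷ p₂ ∷ q₂ ∷ par

      toSame : ∀ {g h} → (g ∷ []) ≃ (h ∷ []) → SameGerm l par g h
      toSame {g} {h} = Equivalence.from sameGerm⇔ ∘ subst₂ (λ F A → Germs._≃_ em hom F A o (g ∷ []) (h ∷ [])) (sym F≡) (sym A≡)

      fromSame : ∀ {g h} → SameGerm l par g h → (g ∷ []) ≃ (h ∷ [])
      fromSame {g} {h} = subst₂ (λ F A → Germs._≃_ em hom F A o (g ∷ []) (h ∷ [])) F≡ A≡ ∘ Equivalence.to sameGerm⇔

      ≋-refl : ∀ {n} {a : Vec Carrier n} → a ≋ a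
      ≋-refl = Pointwise.refl ≈-refl

      cls-cong : ∀ {g h} → (g ∷ []) ≃ (h ∷ []) → E (n , l) (cls g) (cls h)
      cls-cong {_ ∷ _ ∷ _ ∷ [] , _ ∷ _ ∷ _ ∷ []} {_ ∷ _ ∷ _ ∷ [] , _ ∷ _ ∷ _ ∷ []} e =
        ≋-refl , inj₂ (((λ r → toSame (≃-sym (fromSame r))) , λ r s → toSame (≃-trans (fromSame r) (fromSame s))) , toSame e)

      cls-injective : ∀ {g h} → Valid g → E (n , l) (cls g) (cls h) → (g ∷ []) ≃ (h ∷ [])
      cls-injective {_ ∷ _ ∷ _ ∷ [] , _ ∷ _ ∷ _ ∷ []} {_ ∷ _ ∷ _ ∷ [] , _ ∷ _ ∷ _ ∷ []} V (_ , inj₁ e) =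
        fromSame (sameGerm-resp l ≋-refl (≋-refl , ≋-refl) e (toSame (≃-refl (V ∷ []))))
      cls-injective {_ ∷ _ ∷ _ ∷ [] , _ ∷ _ ∷ _ ∷ []} {_ ∷ _ ∷ _ ∷ [] , _ ∷ _ ∷ _ ∷ []} V (_ , inj₂ (_ , r)) = fromSame r

      cls-resp : ∀ {β₁ β₂ β₁′ β₂′} → β₁ ≋ β₁′ → β₂ ≋ β₂′ → E (n , l) (cls (β₁ , β₂)) (cls (β₁′ , β₂′))
      cls-resp {_ ∷ _ ∷ _ ∷ []} {_ ∷ _ ∷ _ ∷ []} {_ ∷ _ ∷ _ ∷ []} {_ ∷ _ ∷ _ ∷ []} e f = ≋-refl , inj₁ (e , f)

      fixes-par : ∀ σ → Fixes σ base′ → Vec.map (σ ∙_) par ≋ par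
      fixes-par σ fix = subst (_≋ par) (sym (Vecₚ.map-++ (σ ∙_) o (Vec.fromList F)))
        (Pointwise.++⁺ (fixes⇒↦ σ (LAllₚ.++⁻ˡ (Vec.toList o) fix)) (fixedF (LAllₚ.++⁻ʳ (Vec.toList o) fix)))
        where
        fixedF : ∀ {F} → Fixes σ F → Vec.map (σ ∙_) (Vec.fromList F) ≋ Vec.fromList F
        fixedF []       = []
        fixedF (e ∷ es) = e ∷ fixedF es

      cls-act : ∀ σ → Fixes σ base′ → ∀ g → E (n , l) (Vec.map (σ ∙_) (cls g)) (cls (mapᵍ σ g))
      cls-act σ fix (_ ∷ _ ∷ _ ∷ [] , _ ∷ _ ∷ _ ∷ []) = fixes-par σ fix , inj₁ (≋-refl , ≋-refl)

      cls-all : ∀ {C : Pred Carrier 0ℓ} {β₁ β₂} → All C (Vec.toList β₁) → All C (Vec.toList β₂) → All C base′ →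
                All C (Vec.toList (cls (β₁ , β₂)))
      cls-all {C} {_ ∷ _ ∷ _ ∷ []} {_ ∷ _ ∷ _ ∷ []} (b₁ ∷ p₁ ∷ q₁ ∷ []) (b₂ ∷ p₂ ∷ q₂ ∷ []) s =
        b₁ ∷ p₁ ∷ q₁ ∷ b₂ ∷ p₂ ∷ q₂ ∷ subst (λ F → All C (Vec.toList o ++ F)) (sym F≡) s

    germNames : GermNames (GermImaginaries.germImaginaries em {M = M} {𝕄} {δ} hom)
    germNames = record
      { index          = n , l
      ; name           = cls
      ; name-cong      = cls-cong
      ; name-injective = cls-injective
      ; name-resp      = cls-resp
      ; name-act       = cls-act
      ; name-all       = cls-all
      }

-- Definability and rank of the group of germs

module GermGroupDefinable (em : ExcludedMiddle 0ℓ) {L : Language} {M 𝕄 : PregeometryStructure L} {δ : Set}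
    (hom : HomogeneousPregeometry em 𝕄)
    (mod-closed : ∀ {P} → IsModel M 𝕄 P → PregeometryStructure.Closed 𝕄 P)
    (mod-inf : ∀ {P} → IsModel M 𝕄 P → Pregeometry.InfDim em 𝕄 P)
    (cfg : ConfigurationData em hom) (ℰ : Imaginaries (monsterAmbient M δ 𝕄)) (names : GermNaming.GermNames em hom cfg ℰ) where
  open HomogeneousPregeometry hom
  open MonsterAbove em {M = M} {𝕄} {δ} mod-closed
  open ConfigurationData cfg hiding (u; v)
  open PregeometryStructure 𝕄 hiding (Independent)
  open Setoid setoid using () renaming (refl to ≈-refl; sym to ≈-sym; trans to ≈-trans)
  open Pregeometry em 𝕄
  open Automorphisms structure
  open Homogeneity em 𝕄 fqm galois
  open Correspond em hom
  open Germs em hom F A o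
  open Configuration em hom cfg
  open GermWords em hom cfg
  open GermGroup em hom cfg
  open GermNaming em {M = M} {𝕄} {δ} hom cfg
  open GermNames names

  X : Ambient
  X = Imaginaries.eq (noImaginaries {Imaginaries.eq ℰ})

  above : Above structure (IsModel M 𝕄) X
  above = above-eq em noImaginaries (above-eq em ℰ aboveMonster)

  open Above above
  open Rank em hom mod-closed mod-inf above
  open Groups X
  private
    module X = Setoid (Ambient.setoid X)
    module AutX = Automorphisms (Ambient.structure X)

  u : Germ → X.Carrier
  u g = nothing , (just index , name g) ∷ []

  private
    class² : ∀ {v w} → Imaginaries.Eᴶ ℰ index v w → (nothing , (just index , v) ∷ []) X.≈ (nothing , (just index , w) ∷ [])
    class² e = Imaginaries.class (Imaginaries.class e ∷ [])

  u-cong : ∀ {g h} → (g ∷ []) ≃ (h ∷ []) → u g X.≈ u h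
  u-cong e = class² (name-cong e)

  u-injective : ∀ {g h} → Valid g → u g X.≈ u h → (g ∷ []) ≃ (h ∷ [])
  u-injective V (Imaginaries.class (Imaginaries.class e ∷ [])) = name-injective V e

  private
    mul : ∀ {g h} → Valid g → Valid h → Germ
    mul V W = proj₁ (multiply V W)

    mul-≃ : ∀ {g h} (V : Valid g) (W : Valid h) → (g ∷ h ∷ []) ≃ (mul V W ∷ [])
    mul-≃ V W = proj₂ (multiply V W)

    mul-valid : ∀ {g h} (V : Valid g) (W : Valid h) → Valid (mul V W)
    mul-valid V W = LAll.head (validʳ (mul-≃ V W))

    self : ∀ {g} → Valid g → (g ∷ []) ≃ (g ∷ [])
    self V = ≃-refl (V ∷ [])

    mul-cong : ∀ {g g′ h h′} (V : Valid g) (V′ : Valid g′) (W : Valid h) (W′ : Valid h′) →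
               (g ∷ []) ≃ (g′ ∷ []) → (h ∷ []) ≃ (h′ ∷ []) → (mul V W ∷ []) ≃ (mul V′ W′ ∷ [])
    mul-cong V V′ W W′ e f = ≃-trans (≃-sym (mul-≃ V W)) (≃-trans (≃-++ e f) (mul-≃ V′ W′))

    ε₀ : Germ
    ε₀ = (b₀ ∷ p₀ ∷ q₀ ∷ []) , (b₀ ∷ p₀ ∷ q₀ ∷ [])

    ε₀-valid : Valid ε₀
    ε₀-valid = P₀ , P₀

    GermOf : X.Carrier → Set
    GermOf x = Σ[ g ∈ Germ ] Valid g × x X.≈ u g

  -- An element carries a germ representing it, on which the operations act; `u-injective` makes
  -- them independent of this choice.
  germGroup : GroupIn
  germGroup = record
    { G        = GermOf
    ; respects = λ e (g , V , f) → g , V , X.trans (X.sym e) f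
    ; _∙_      = λ (x , g , V , e) (y , h , W , f) → u (mul V W) , mul V W , mul-valid V W , X.refl
    ; ε        = u ε₀ , ε₀ , ε₀-valid , X.refl
    ; _⁻¹      = λ (x , g , V , e) → u (inverse g) , inverse g , swap V , X.refl
    ; isGroup  = record
      { isMonoid = record
        { isSemigroup = record
          { isMagma = record
            { isEquivalence = Setoid.isEquivalence (subsetoid (Ambient.setoid X) GermOf)
            ; ∙-cong        = λ {(x , g , V , e)} {(x′ , g′ , V′ , e′)} {(y , h , W , f)} {(y′ , h′ , W′ , f′)} p q →
                u-cong (mul-cong V V′ W W′ (same V e e′ p) (same W f f′ q))
            }
          ; assoc = λ (x , g , V , _) (y , h , W , _) (z , k , U , _) → u-cong
              (≃-trans (≃-sym (mul-≃ (mul-valid V W) U)) (≃-trans (≃-++ (≃-sym (mul-≃ V W)) (self U))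
                (≃-trans (≃-++ (self V) (mul-≃ W U)) (mul-≃ V (mul-valid W U)))))
          }
        ; identity = (λ (x , g , V , e) → X.trans (u-cong (≃-trans (≃-sym (mul-≃ ε₀-valid V)) (≃-++ (unit P₀) (self V)))) (X.sym e)) ,
                     (λ (x , g , V , e) → X.trans (u-cong (≃-trans (≃-sym (mul-≃ V ε₀-valid)) (≃-++ (self V) (unit P₀)))) (X.sym e))
        }
      ; inverse = (λ (x , g , V , e) → u-cong (≃-trans (≃-sym (mul-≃ (swap V) V)) (≃-trans (inverseˡ V) (≃-sym (unit P₀))))) ,
                  (λ (x , g , V , e) → u-cong (≃-trans (≃-sym (mul-≃ V (swap V))) (≃-trans (inverseʳ V) (≃-sym (unit P₀)))))
      ; ⁻¹-cong = λ {(x , g , V , e)} {(x′ , g′ , V′ , e′)} p → u-cong (inverse-cong (same V e e′ p))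
      }
    }
    where
    same : ∀ {x x′ g g′} → Valid g → x X.≈ u g → x′ X.≈ u g′ → x X.≈ x′ → (g ∷ []) ≃ (g′ ∷ [])
    same V e e′ p = u-injective V (X.trans (X.sym e) (X.trans p e′))

  act-u : ∀ σ → Fixes σ base′ → ∀ g → σ · u g X.≈ u (mapᵍ σ g)
  act-u σ fix g = class² (name-act σ fix g)

  private
    fixesF : ∀ σ → Fixes σ base′ → Fixes σ F
    fixesF σ = LAllₚ.++⁻ʳ (Vec.toList o)

    mapᵍ-valid : ∀ σ {g} → Fixes σ F → Valid g → Valid (mapᵍ σ g)
    mapᵍ-valid σ fix (p , q) = Moving.P↦ σ fix (image σ _) p , Moving.P↦ σ fix (image σ _) q

    mapᵍ-≃ : ∀ σ (fix : Fixes σ F) {g h k} → (g ∷ h ∷ []) ≃ (k ∷ []) → (mapᵍ σ g ∷ mapᵍ σ h ∷ []) ≃ (mapᵍ σ k ∷ [])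
    mapᵍ-≃ σ fix = Moving.≃↦ σ fix
      ((image σ _ , image σ _) Listᴾ.∷ (image σ _ , image σ _) Listᴾ.∷ Listᴾ.[]) ((image σ _ , image σ _) Listᴾ.∷ Listᴾ.[])

    restrict-fixes-base : ∀ f → Types.Fixes X (Ambient.⟪_⟫ X (List.map emb base′)) f → Fixes (restrict f) base′
    restrict-fixes-base f fix = LAll.map (restrict-fixes f) (LAllₚ.map⁻ (LAll.tabulateₛ (Ambient.setoid X) fix))

    fixes⁻¹ : ∀ {B} f → Types.Fixes X B f → Types.Fixes X B (AutX.inverseᵃ f)
    fixes⁻¹ f fix p = AutX.∙-inverse f (fix p)

    move-u : ∀ f → Types.Fixes X (Ambient.⟪_⟫ X (List.map emb base′)) f → ∀ {x g} → x X.≈ u g →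
             Isomorphism.to f x X.≈ u (mapᵍ (restrict f) g)
    move-u f fix {x} {g} e = X.trans (Isomorphism.cong f e) (X.trans (X.sym (act-restrict f (u g)))
      (act-u (restrict f) (restrict-fixes-base f fix) g))

    underlying⇒ : ∀ f → Types.Fixes X (Ambient.⟪_⟫ X (List.map emb base′)) f → ∀ {x} → GermOf x → GermOf (Isomorphism.to f x)
    underlying⇒ f fix (g , V , e) = mapᵍ (restrict f) g , mapᵍ-valid (restrict f) (fixesF (restrict f) (restrict-fixes-base f fix)) V , move-u f fix e

    open GroupIn germGroup using (operation)

    operation⇒ : ∀ f → Types.Fixes X (Ambient.⟪_⟫ X (List.map emb base′)) f → ∀ {x y z} →
                 operation (x ∷ y ∷ z ∷ []) → operation (Isomorphism.to f x ∷ Isomorphism.to f y ∷ Isomorphism.to f z ∷ [])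
    operation⇒ f fix ((g , V , e) , (h , W , e′) , q) = underlying⇒ f fix (g , V , e) , underlying⇒ f fix (h , W , e′) ,
      X.trans (u-cong (≃-trans (≃-sym (mul-≃ (valid V) (valid W))) (mapᵍ-≃ (restrict f) fixF (mul-≃ V W))))
        (X.trans (X.sym (move-u f fix X.refl)) (Isomorphism.cong f q))
      where
      fixF : Fixes (restrict f) F
      fixF = fixesF (restrict f) (restrict-fixes-base f fix)
      valid : ∀ {g} → Valid g → Valid (mapᵍ (restrict f) g)
      valid = mapᵍ-valid (restrict f) fixF

    operation-resp : ∀ {x y z x′ y′ z′} → x X.≈ x′ → y X.≈ y′ → z X.≈ z′ → operation (x ∷ y ∷ z ∷ []) → operation (x′ ∷ y′ ∷ z′ ∷ [])
    operation-resp p q r ((g , V , e) , (h , W , f) , s) = (g , V , X.trans (X.sym p) e) , (h , W , X.trans (X.sym q) f) , X.trans s r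

  -- Names of germs contain `o` and `F`. An automorphism fixing these acts on names through its
  -- restriction to `𝕄`, which preserves equality and composition of germs.
  definable : IsDefinableGroup germGroup (List.map emb base′)
  definable =
    (λ { f fix (x ∷ []) → mk⇔ (underlying⇒ f fix)
       (λ p → GroupIn.respects germGroup (AutX.∙-inverseˡ f) (underlying⇒ (AutX.inverseᵃ f) (fixes⁻¹ f fix) p)) }) ,
    (λ { f fix (x ∷ y ∷ z ∷ []) → mk⇔ (operation⇒ f fix)
       (λ p → operation-resp (AutX.∙-inverseˡ f) (AutX.∙-inverseˡ f) (AutX.∙-inverseˡ f)
         (operation⇒ (AutX.inverseᵃ f) (fixes⁻¹ f fix) p)) })

  private
    β₀ : Vec Carrier 3
    β₀ = b₀ ∷ p₀ ∷ q₀ ∷ []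

    supp*-all : ∀ {C : Pred Carrier 0ℓ} {n} (v : Vec Carrier n) → All C (Vec.toList v) → All C (AboveVectors.supp* aboveMonster v)
    supp*-all []      []       = []
    supp*-all (x ∷ v) (p ∷ ps) = p ∷ supp*-all v ps

    supp-u : ∀ {C : Pred Carrier 0ℓ} {β₁ β₂} → All C (Vec.toList β₁) → All C (Vec.toList β₂) → All C base′ → All C (supp (u (β₁ , β₂)))
    supp-u {C} {β₁} {β₂} s₁ s₂ s = LAllₚ.++⁺ (supp*-all (name (β₁ , β₂)) (name-all s₁ s₂ s)) []

    u-resp : ∀ {β₁ β₂ β₁′ β₂′} → β₁ ≋ β₁′ → β₂ ≋ β₂′ → u (β₁ , β₂) X.≈ u (β₁′ , β₂′)
    u-resp e f = class² (name-resp e f)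

    B′ : List X.Carrier
    B′ = List.map emb base′

  open Types X using (U≥; URank; URank≤; Model)

  -- A model containing the base contains a conjugate `β₃` of `β₀` generic over `β₁` and `β₂`.
  -- Written as (`w` , `β₃`), the germ is determined by elements algebraic over the model and `w₀`,
  -- so dimension bounds its rank by one.
  germ-rank≤1 : ∀ {x} → GroupIn.G germGroup x → URank≤ (x ∷ []) B′ 1
  germ-rank≤1 {x} ((β₁ , β₂) , (P₁ , P₂) , e) 𝒫 (sub , _) B⊆ m U = inModel (submodel⇒ sub)
    where
    inModel : Σ[ 𝒜 ∈ Pred Carrier 0ℓ ] IsModel M 𝕄 𝒜 × 𝒫 ≐ Points 𝒜 → m ≤ 1
    inModel (𝒜 , mod , P≐) = pick (mod-inf mod (Vec.head β₁ ∷ Vec.head β₂ ∷ F))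
      where
      base⊆ : All 𝒜 base′
      base⊆ = LAll.map (λ p → emb-points (closed-respects (mod-closed mod)) (proj₁ P≐ p)) (LAllₚ.map⁻ B⊆)
      pick : Σ[ c ∈ Carrier ] 𝒜 c × ¬ c ∈cl Vec.head β₁ ∷ Vec.head β₂ ∷ F → m ≤ 1
      pick (c , c∈ , c∉) = moved (move F (P⇒∉F P₀) (c∉ ∘ cl-there ∘ cl-there))
        where
        moved : Σ[ σ ∈ Aut ] Fixes σ F × σ ∙ b₀ ≈ c → m ≤ 1
        moved (σ , σF , q) = represented (represent P₁ P₂ P₃ (c∉ ∘ cl-resp q))
          where
          β₃ : Vec Carrier 3
          β₃ = Vec.map (σ ∙_) β₀
          P₃ : P β₃
          P₃ = Moving.P↦ σ σF (image σ β₀) P₀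
          represented : Σ[ w ∈ _ ] P w × ((w , β₃) ∷ []) ≃ ((β₁ , β₂) ∷ []) → m ≤ 1
          represented (w@(w₀ ∷ _ ∷ _ ∷ []) , Pw , r) = U≤dimension m {u = x ∷ []} {E = support} determined mod P≐ {w₀ ∷ []} support⊆ U
            where
            support : List Carrier
            support = Vec.toList w ++ Vec.toList β₃ ++ base′
            x≈ : x X.≈ u (w , β₃)
            x≈ = X.trans e (X.sym (u-cong r))
            determined : DeterminedBy (x ∷ []) support
            determined τ fix = X.trans (act-cong τ x≈) (X.trans (act-u τ (LAllₚ.++⁻ʳ (Vec.toList β₃) (LAllₚ.++⁻ʳ (Vec.toList w) fix)) (w , β₃))
              (X.trans (u-resp (fixes⇒↦ τ (LAllₚ.++⁻ˡ (Vec.toList w) fix))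
                (fixes⇒↦ τ (LAllₚ.++⁻ˡ (Vec.toList β₃) (LAllₚ.++⁻ʳ (Vec.toList w) fix)))) (X.sym x≈))) ∷ []
            C : Pred Carrier 0ℓ
            C = cl (𝒜 ∪ ⟪ w₀ ∷ [] ⟫)
            base⊆C : All C base′
            base⊆C = LAll.map (extensive _ ∘ inj₁) base⊆
            support⊆ : All C support
            support⊆ = LAllₚ.++⁺ (P⇒ Pw (idempotent _) (LAllₚ.++⁻ʳ (Vec.toList o) base⊆C) (extensive _ (inj₂ (here ≈-refl))))
              (LAllₚ.++⁺ (P⇒ P₃ (idempotent _) (LAllₚ.++⁻ʳ (Vec.toList o) base⊆C)
                (extensive _ (inj₁ (closed-respects (mod-closed mod) (≈-sym q) c∈)))) base⊆C)

  module Ranked (toModel : ∀ {𝒜} → CountableModels.CountableModel em 𝕄 fqm 𝒜 → Model (Points 𝒜)) where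

    private
      module Witness (β₂ : Vec Carrier 3) (P₂ : P β₂) (b₂∉ : ¬ Vec.head β₂ ∈cl base′) where
        b₂ : Carrier
        b₂ = Vec.head β₂
        open CountableModels em 𝕄 fqm using (module Generated)
        open Generated {λ _ → ⊤} (λ _ → tt) inf (b₂ ∷ base′)

        ℬ : Pred Carrier 0ℓ
        ℬ = H (b₂ ∷ base′)

        base⊆ℬ : All ℬ base′
        base⊆ℬ = LAll.tail (base⊆H (b₂ ∷ base′))

        F⊆ℬ : All ℬ F
        F⊆ℬ = LAllₚ.++⁻ʳ (Vec.toList o) base⊆ℬ

        g₀ : Germ
        g₀ = β₀ , β₂

        inℬ : Points ℬ (u g₀)
        inℬ = u g₀ , X.refl , supp-u (P⇒ P₀ (H-closed _) F⊆ℬ (LAll.head base⊆ℬ))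
          (P⇒ P₂ (H-closed _) F⊆ℬ (LAll.head (base⊆H (b₂ ∷ base′)))) base⊆ℬ

        Moves : List Carrier → Set
        Moves G = Σ[ τ ∈ Automorphism structure ] Fixes τ G × Points ℬ (τ · u g₀) × ¬ τ · u g₀ X.≈ u g₀

        -- Moving `b₂` over the base to an element outside the closure of `b₂` and the base changes
        -- the germ: otherwise `canonical` would make the new element algebraic over `b₂` and the
        -- base.
        moves : ∀ G → All (H base′) G → Moves G
        moves G G⊆ = pick (H-inf (b₂ ∷ base′) (b₂ ∷ base′ ++ G))
          where
          b₂∉G : ¬ b₂ ∈cl base′ ++ G
          b₂∉G = proj₁ (H-indOver {base′} (b₂ ∷ []) (cl-self (b₂ ∷ base′)) (b₂∉ , _) (base′ ++ G) (LAllₚ.++⁺ (base⊆H base′) G⊆))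
          pick : Σ[ m ∈ Carrier ] ℬ m × ¬ m ∈cl b₂ ∷ base′ ++ G → Moves G
          pick (m , m∈ , m∉) = moved (move (base′ ++ G) b₂∉G (m∉ ∘ cl-there))
            where
            moved : Σ[ τ ∈ Aut ] Fixes τ (base′ ++ G) × τ ∙ b₂ ≈ m → Moves G
            moved (τ , fix , q) = τ , LAllₚ.++⁻ʳ base′ fix ,
                (u (mapᵍ τ g₀) , τu , supp-u (P⇒ Pτ₀ (H-closed _) F⊆ℬ (closed-respects (H-closed _) (≈-sym τb₀) (LAll.head base⊆ℬ)))
                  (P⇒ Pτ₂ (H-closed _) F⊆ℬ (closed-respects (H-closed _) (≈-sym τb₂) m∈)) base⊆ℬ) ,
                λ r → m∉ (cl-resp τb₂ (cl-trans sub (canonical (≃-sym (u-injective (Pτ₀ , Pτ₂) (X.trans (X.sym τu) r))))))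
              where
              fixB : Fixes τ base′
              fixB = LAllₚ.++⁻ˡ base′ fix
              Pτ₀ : P (Vec.map (τ ∙_) β₀)
              Pτ₀ = Moving.P↦ τ (fixesF τ fixB) (image τ β₀) P₀
              Pτ₂ : P (Vec.map (τ ∙_) β₂)
              Pτ₂ = Moving.P↦ τ (fixesF τ fixB) (image τ β₂) P₂
              τu : τ · u g₀ X.≈ u (mapᵍ τ g₀)
              τu = act-u τ fixB g₀
              τb₀ : τ ∙ b₀ ≈ b₀
              τb₀ = LAll.head fixB
              τb₂ : Vec.head (Vec.map (τ ∙_) β₂) ≈ m
              τb₂ = ≈-trans (≈-sym (head-↦ τ (image τ β₂))) q
              base⊆cl : All (_∈cl b₂ ∷ base′ ++ G) base′
              base⊆cl = LAll.map (cl-there ∘ cl-++ˡ) (cl-self base′)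
              sub : All (_∈cl b₂ ∷ base′ ++ G) (b₀ ∷ b₂ ∷ τ ∙ b₀ ∷ F)
              sub = LAll.head base⊆cl ∷ cl-here ∷ cl-resp (≈-sym τb₀) (LAll.head base⊆cl) ∷ LAllₚ.++⁻ʳ (Vec.toList o) base⊆cl

        𝒜-model : Model (Points (H base′))
        𝒜-model = toModel (H-model base′)

        base⊆𝒜 : All (Points (H base′)) B′
        base⊆𝒜 = embs∈ (base⊆H base′)

        rank≥1 : U≥ 1 (u g₀ ∷ []) (Points (H base′))
        rank≥1 = Points ℬ , toModel (H-model (b₂ ∷ base′)) , (λ (y , e , y∈) → y , e , LAll.map (H-mono base⊆ℬ) y∈) ,
          ¬nsIndependent (id , id) (u g₀ ∷ []) zero inℬ moves , _

        inGroup : GroupIn.G germGroup (u g₀)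
        inGroup = g₀ , (P₀ , P₂) , X.refl

        rank1 : URank (u g₀ ∷ []) B′ 1
        rank1 = (Points (H base′) , 𝒜-model , base⊆𝒜 , rank≥1 , germ-rank≤1 inGroup (Points (H base′)) 𝒜-model base⊆𝒜) , germ-rank≤1 inGroup

        generic : Generic (u g₀) (GroupIn.G germGroup) B′
        generic = 1 , inGroup , rank1 , germ-rank≤1

        -- Maximality compares the rank of `g` with that of `g₀`, which is at least one.
        generic⇒rank1 : ∀ g → Generic g (GroupIn.G germGroup) B′ → URank (g ∷ []) B′ 1
        generic⇒rank1 g (n , g∈ , r@((𝒫 , mod , B⊆ , U , _) , _) , max) =
          subst (URank (g ∷ []) B′) (ℕₚ.≤-antisym (germ-rank≤1 g∈ 𝒫 mod B⊆ n U) (max inGroup (Points (H base′)) 𝒜-model base⊆𝒜 1 rank≥1)) r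

    conclusion : (Σ[ g ∈ X.Carrier ] Generic g (GroupIn.G germGroup) B′) ×
                 (∀ g → Generic g (GroupIn.G germGroup) B′ → URank (g ∷ []) B′ 1)
    conclusion = go (generic-β (Vec.toList o))
      where
      go : Σ[ β ∈ _ ] P β × ¬ Vec.head β ∈cl base′ → _
      go (β₂ , P₂ , b₂∉) = (u (β₀ , β₂) , Witness.generic β₂ P₂ b₂∉) , Witness.generic⇒rank1 β₂ P₂ b₂∉

    groupOfRankOne : GroupOfRankOne ℰ noImaginaries
    groupOfRankOne = base′ , germGroup , definable , conclusion

module QuadrangleGroup (em : ExcludedMiddle 0ℓ) {L : Language} {M 𝕄 : PregeometryStructure L} {δ : Set}
    (hom : HomogeneousPregeometry em 𝕄)
    (mod-closed : ∀ {P} → IsModel M 𝕄 P → PregeometryStructure.Closed 𝕄 P)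
    (mod-inf : ∀ {P} → IsModel M 𝕄 P → Pregeometry.InfDim em 𝕄 P)
    (countable⇒model : ∀ {X} (above : Above (PregeometryStructure.structure 𝕄) (IsModel M 𝕄) X) → Ambient.δ X ≡ δ →
      ∀ {𝒜} → CountableModels.CountableModel em 𝕄 (HomogeneousPregeometry.fqm hom) 𝒜 → Types.Model X (Above.Points above 𝒜))
    (rank3⇒independent : ∀ {X} (above : Above (PregeometryStructure.structure 𝕄) (IsModel M 𝕄) X) → Ambient.δ X ≡ δ →
      ∀ A a b c → Types.URank X (Above.emb above a ∷ Above.emb above b ∷ Above.emb above c ∷ []) (List.map (Above.emb above) A) 3 → Pregeometry.Ind em 𝕄 A (a ∷ b ∷ c ∷ []))
    (rank2⇒dependent : ∀ {X} (above : Above (PregeometryStructure.structure 𝕄) (IsModel M 𝕄) X) → Ambient.δ X ≡ δ →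
      ∀ A a b c → Types.URank≤ X (Above.emb above a ∷ Above.emb above b ∷ Above.emb above c ∷ []) (List.map (Above.emb above) A) 2 → ¬ Pregeometry.Ind em 𝕄 A (a ∷ b ∷ c ∷ []))
    (ℰ : Imaginaries (monsterAmbient M δ 𝕄))
    (names : ∀ cfg l → ConfigurationData.A cfg ≡ List.take l (ConfigurationData.F cfg) →
      GermNaming.GermNames em {M = M} {𝕄} {δ} hom cfg ℰ) where
  open MonsterAbove em {M = M} {𝕄} {δ} mod-closed using (aboveMonster)

  quadrangleGroup : ∀ A a b c x y z → let ι = Imaginaries.ι ℰ in
    Groups.IsStrictBoundedPartialQuadrangle (Imaginaries.eq ℰ) (List.map ι A) (ι a ∷ ι b ∷ ι c ∷ ι x ∷ ι y ∷ ι z ∷ []) →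
    GroupOfRankOne ℰ noImaginaries
  quadrangleGroup A a b c x y z quadrangle = fromConfiguration (configuration A a b c x y z quadrangle)
    where
    aboveᵉ : Above (PregeometryStructure.structure 𝕄) (IsModel M 𝕄) (Imaginaries.eq ℰ)
    aboveᵉ = above-eq em ℰ aboveMonster

    open QuadrangleConfiguration em hom {Imaginaries.eq ℰ} (Imaginaries.ι ℰ)
      (rank3⇒independent aboveᵉ refl) (rank2⇒dependent aboveᵉ refl) using (configuration)

    fromConfiguration : SegmentConfiguration em hom → GroupOfRankOne ℰ noImaginaries
    fromConfiguration record { configurationData = cfg ; l = l ; A≡take = A≡take } =
      GermGroupDefinable.Ranked.groupOfRankOne em {M = M} {𝕄} {δ} hom mod-closed mod-inf cfg ℰ (names cfg l A≡take)
        (countable⇒model {GermGroupDefinable.X em {M = M} {𝕄} {δ} hom mod-closed mod-inf cfg ℰ (names cfg l A≡take)}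
          (GermGroupDefinable.above em {M = M} {𝕄} {δ} hom mod-closed mod-inf cfg ℰ (names cfg l A≡take)) refl)

open import Data.List.Base using (map)

theorem3p10 :
  (∀ {ℓ} → ExcludedMiddle ℓ) →
  (∀ {a ℓ} → ExtensionalChoice a ℓ) →
  (L : Language) → CountableLanguage L →
  (M : PregeometryStructure L) → IsQuasiminimal M →
  Σ[ δ₀ ∈ Set ] (∀ (δ : Set) → (δ₀ ↣ δ) →
    ∀ (𝕄 : PregeometryStructure L) → IsMonster M δ 𝕄 →
    Σ[ ℰ ∈ Imaginaries (monsterAmbient M δ 𝕄) ]
    Σ[ ℰ′ ∈ Imaginaries (Imaginaries.eq ℰ) ]
      (let open PregeometryStructure 𝕄 using (Carrier)
           𝕄ᵉ  = Imaginaries.eq ℰ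
           𝕄ᵉᵉ = Imaginaries.eq ℰ′
           ι   = Imaginaries.ι ℰ
           ι′  = Imaginaries.ι ℰ′
           open Types
           open Groups
       in
       (A : List Carrier) (a b c x y z : Carrier) →
       let p = ι a ∷ ι b ∷ ι c ∷ ι x ∷ ι y ∷ ι z ∷ []
           B = map ι A
       in
       IsStrictBoundedPartialQuadrangle 𝕄ᵉ B p →
       Stationary 𝕄ᵉ p (Ambient.⟪_⟫ 𝕄ᵉ B) →
       Σ[ A′ ∈ List Carrier ] Σ[ 𝔾 ∈ GroupIn 𝕄ᵉᵉ ]
         (let B′ = map (ι′ ∘ ι) A′
              G  = GroupIn.G 𝔾
          in
          IsDefinableGroup 𝕄ᵉᵉ 𝔾 B′ ×
          (Σ[ g ∈ Ambient.Carrier 𝕄ᵉᵉ ] Generic 𝕄ᵉᵉ g G B′) ×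
          (∀ g → Generic 𝕄ᵉᵉ g G B′ → URank 𝕄ᵉᵉ (g ∷ []) B′ 1))))
theorem3p10 em ac L _ M qm = bigSet (PregeometryStructure.Carrier M) , λ δ large 𝕄 monster →
  let hom = MonsterRank.homogeneousPregeometry em ac M qm large 𝕄 monster
      ℰ = GermImaginaries.germImaginaries em {M = M} {𝕄} {δ} hom
  in
  ℰ , noImaginaries , λ A a b c x y z quadrangle _ →
    QuadrangleGroup.quadrangleGroup em {M = M} {𝕄} {δ} hom
      (MonsterRank.model-closed em ac M qm large 𝕄 monster) (MonsterRank.model-inf em ac M qm large 𝕄 monster)
      (MonsterRank.Over.countable⇒model em ac M qm large 𝕄 monster)
      (MonsterRank.Over.rank3⇒independent em ac M qm large 𝕄 monster)
      (MonsterRank.Over.rank2⇒dependent em ac M qm large 𝕄 monster)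
      ℰ (GermNaming.germNames em {M = M} {𝕄} {δ} hom) A a b c x y z quadrangle
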